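{- Let $G$ be the $xy$-sum of connected graphs $G_1,G_2\in\mathcal G_{xy}^\circ$. The subgraph $G_1$ is $\widehat g$-tight in $G$ if and only if the following hold: (i) if $\eta(G_1,G_2)=0$, then $G_1\in\mathcal C^\circ(\widehat g^+)$; (ii) if $\eta(G_1,G_2)=1$, then $G_1\in\mathcal C^\circ(\widehat g^+)\cup\mathcal H^w(\widehat g)$; (iii) if $\eta(G_1,G_2)=2$, then $G_1\in\mathcal C^\circ(\widehat g^+)\cup\mathcal C^\circ(\widehat g)\cup\mathcal S$; (iv) if $\eta(G_1,G_2)=3$, then $G_1\in\mathcal C^\circ(\widehat g)\cup\mathcal H^w(\widehat g^+)$; (v) if $\eta(G_1,G_2)=4$, then $G_1\in\mathcal C^\circ(\widehat g)$.
   Context: All graphs are finite and simple; after contracting an edge, parallel edges are replaced by single edges. The Euler genus $\widehat g(G)$ is the minimum Euler genus of a surface into which $G$ embeds. $\mathcal G_{xy}$ is the class of simple graphs with two distinguished vertices $x,y$ (terminals); $\mathcal G_{xy}^\circ$ the subclass with $x,y$ non-adjacent. The set $\mathcal M(G)$ of minor-operations consists of deletion of any edge and contraction of any edge other than $xy$ (contracting an edge incident with a terminal yields a terminal); $\mu G$ is the result. For a subgraph $H$ of $G$, $\mathcal M(H)\subseteq\mathcal M(G)$ are the minor-operations on edges of $H$. $G^+$ is $G$ with edge $xy$ added, $\widehat g^+(G)=\widehat g(G^+)$, $\theta(G)=\widehat g^+(G)-\widehat g(G)$. For $G_1,G_2\in\mathcal G_{xy}$ with $V(G_1)\cap V(G_2)=\{x,y\}$,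 their $xy$-sum has vertex set $V(G_1)\cup V(G_2)$, edge set $E(G_1)\cup E(G_2)$ and terminals $x,y$; $\eta(G_1,G_2)=\theta(G_1)+\theta(G_2)$. For a parameter $\mathcal P$ and $k\ge1$, $\Delta_k(\mathcal P)=\{\mu\in\mathcal M(G):\mathcal P(\mu G)\le\mathcal P(G)-k\}$. $G$ is $\mathcal P$-critical if $\mathcal M(G)=\Delta_1(\mathcal P)$; $\mathcal C^\circ(\mathcal P)$ is the class of $\mathcal P$-critical graphs in $\mathcal G_{xy}^\circ$. A subgraph $H$ of $G$ is $\mathcal P$-tight if $\mathcal P(\mu G)<\mathcal P(G)$ for every $\mu\in\mathcal M(H)$. A cascade is $G\in\mathcal G_{xy}^\circ$ with $\mathcal M(G)=\Delta_1(\widehat g)\cup\Delta_1(\widehat g^+)$, $G\notin\mathcal C^\circ(\widehat g)$, $G\notin\mathcal C^\circ(\widehat g^+)$; $\mathcal S$ is the class of cascades. $\mathcal H^w(\widehat g)$ (weak $\widehat g$-hoppers) is the class of $G\in\mathcal G_{xy}^\circ$ with $G\notin\mathcal C^\circ(\widehat g^+)$ and $\mathcal M(G)=\Delta_1(\widehat g^+)\cup\Delta_2(\widehat g)$; $\mathcal H^w(\widehat g^+)$ (weak $\widehat g^+$-hoppers) is the class of $G\in\mathcal G_{xy}^\circ$ with $G\notin\mathcal C^\circ(\widehat g)$ and $\mathcal M(G)=\Delta_1(\widehat g)\cup\Delta_2(\widehat g^+)$. -}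

module Defs where

open import Data.Nat using (ℕ; zero; suc; _+_; _*_; _∸_; _⊓_; _<_; _≤_; _<ᵇ_; _≤ᵇ_)
open import Data.Nat.DivMod using (_/_)
open import Data.Fin using (Fin; toℕ; zero; suc; punchOut)
open import Data.Fin.Properties using (_≟_)
open import Data.Bool using (Bool; true; false; _∧_; _∨_; not; if_then_else_)
open import Data.Bool.ListAction using (all; any)
open import Data.List using (List; []; _∷_; map; concatMap; allFin; upTo; filterᵇ; length; foldr; cartesianProduct)
open import Data.Product using (Σ; ∃; _×_; _,_; proj₁; proj₂)
open import Data.Sum using (_⊎_)
open import Relation.Nullary using (¬_)
open import Relation.Nullary.Decidable using (⌊_⌋)
open import Relation.Binary.PropositionalEquality using (_≡_; _≢_; sym)

eqF : ∀ {n} → Fin n → Fin n → Bool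
eqF u v = ⌊ u ≟ v ⌋

allF : ∀ {n} → (Fin n → Bool) → Bool
allF {n} p = all p (allFin n)

anyF : ∀ {n} → (Fin n → Bool) → Bool
anyF {n} p = any p (allFin n)

countF : ∀ {n} → (Fin n → Bool) → ℕ
countF {n} p = length (filterᵇ p (allFin n))

iter : ∀ {A : Set} → ℕ → (A → A) → A → A
iter zero    f a = a
iter (suc k) f a = f (iter k f a)

allFuns : ∀ {B : Set} (k : ℕ) → List B → List (Fin k → B)
allFuns zero    bs = (λ ()) ∷ []
allFuns (suc k) bs =
  concatMap (λ b → map (λ f → cons b f) (allFuns k bs)) bs
  where
    cons : _ → (Fin k → _) → Fin (suc k) → _
    cons b f zero    = b
    cons b f (suc i) = f i

-- Euler genus of a (simple) graph on vertex set Fin n, given by a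
-- symmetric irreflexive Boolean adjacency function, computed as the
-- minimum over all generalized embedding schemes (rotation system +
-- edge signature) of  2c - V + E - F  (Mohar–Thomassen), where c is the
-- number of connected components and F is the number of faces
-- (isolated vertices contribute one face each).

Adj : ℕ → Set
Adj n = Fin n → Fin n → Bool

module Genus {n : ℕ} (adj : Adj n) where

  reach : ℕ → Fin n → Fin n → Bool
  reach zero    u w = eqF u w
  reach (suc k) u w = reach k u w ∨ anyF (λ z → reach k u z ∧ adj z w)

  -- number of connected components (vertices minimal in their component)
  components : ℕ
  components = countF (λ v → allF (λ w → not (reach n v w) ∨ (toℕ v ≤ᵇ toℕ w)))

  edges : ℕ
  edges = length (filterᵇ (λ p → (toℕ (proj₁ p) <ᵇ toℕ (proj₂ p)) ∧ adj (proj₁ p) (proj₂ p))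
                          (cartesianProduct (allFin n) (allFin n)))

  isolated : ℕ
  isolated = countF (λ v → allF (λ w → not (adj v w)))

  -- ρ v is a cyclic permutation of the neighbourhood N(v)
  validRot : (Fin n → Fin n → Fin n) → Bool
  validRot ρ = allF λ v → allF λ u → not (adj v u) ∨
    (adj v (ρ v u) ∧ allF (λ w → not (adj v w) ∨ any (λ k → eqF (iter k (ρ v) u) w) (upTo n)))

  module Scheme (ρ : Fin n → Fin n → Fin n) (λs : Fin n → Fin n → Bool) where

    ρinv : Fin n → Fin n → Fin n
    ρinv v w = foldr (λ u acc → if adj v u ∧ eqF (ρ v u) w then u else acc) w (allFin n)

    -- signature of the edge uv (true = twisted / negative)
    sig : Fin n → Fin n → Bool
    sig u v = if toℕ u <ᵇ toℕ v then λs u v else λs v u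

    State : Set
    State = Fin n × Fin n × Bool

    -- face-tracing permutation on (dart, local orientation)
    φ : State → State
    φ (u , v , s) = let s' = if sig u v then not s else s in
                    (v , (if s' then ρ v u else ρinv v u) , s')

    key : State → ℕ
    key (u , v , s) = (toℕ u * n + toℕ v) * 2 + (if s then 1 else 0)

    states : List State
    states = concatMap (λ u → concatMap (λ v → (u , v , true) ∷ (u , v , false) ∷ []) (allFin n)) (allFin n)

    isRep : State → Bool
    isRep st@(u , v , s) = adj u v ∧ all (λ k → key st ≤ᵇ key (iter k φ st)) (upTo (suc (2 * n * n)))

    orbits : ℕ
    orbits = length (filterᵇ isRep states)

    faces : ℕ
    faces = orbits / 2 + isolated

    eulerGenus : ℕ
    eulerGenus = (2 * components + edges) ∸ (n + faces)

  genus : ℕ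
  genus = foldr (λ ρ acc → foldr (λ λs acc' → if validRot ρ then Scheme.eulerGenus ρ λs ⊓ acc' else acc')
                                  acc (allFuns n (allFuns n (true ∷ false ∷ []))))
                (2 * components + edges)
                (allFuns n (allFuns n (allFin n)))

record TGraph (n : ℕ) : Set where
  field
    adj : Adj n
    x   : Fin n
    y   : Fin n

open TGraph public

InGxy : ∀ {n} → TGraph n → Set
InGxy G = (∀ u v → adj G u v ≡ adj G v u) × (∀ v → adj G v v ≡ false) × (x G ≢ y G)

InGxy° : ∀ {n} → TGraph n → Set
InGxy° G = InGxy G × adj G (x G) (y G) ≡ false

data Reach {n} (G : TGraph n) (u : Fin n) : Fin n → Set where
  here : Reach G u u
  step : ∀ {v w} → Reach G u v → adj G v w ≡ true → Reach G u w

Connected : ∀ {n} → TGraph n → Set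
Connected {n} G = ∀ (u w : Fin n) → Reach G u w

plus : ∀ {n} → TGraph n → TGraph n
plus G = record
  { adj = λ a b → adj G a b ∨ (eqF a (x G) ∧ eqF b (y G)) ∨ (eqF a (y G) ∧ eqF b (x G))
  ; x = x G ; y = y G }

ĝ : ∀ {n} → TGraph n → ℕ
ĝ G = Genus.genus (adj G)

ĝ⁺ : ∀ {n} → TGraph n → ℕ
ĝ⁺ G = ĝ (plus G)

-- θ(G) = ĝ⁺(G) - ĝ(G)  (always ≥ 0, so truncated subtraction is exact)
θ : ∀ {n} → TGraph n → ℕ
θ G = ĝ⁺ G ∸ ĝ G

η : ∀ {n₁ n₂} → TGraph n₁ → TGraph n₂ → ℕ
η G₁ G₂ = θ G₁ + θ G₂

deleteEdge : ∀ {n} → TGraph n → Fin n → Fin n → TGraph n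
deleteEdge G u v = record
  { adj = λ a b → adj G a b ∧ not ((eqF a u ∧ eqF b v) ∨ (eqF a v ∧ eqF b u))
  ; x = x G ; y = y G }

-- contract the edge uv, the vertex v being merged into u (v removed);
-- parallel edges are merged (adjacency is Boolean), vertices renumbered.
contractEdge : ∀ {n} → TGraph n → (u v : Fin n) → u ≢ v → Σ ℕ TGraph
contractEdge {zero}  G () v _
contractEdge {suc m} G u v u≢v = m , record
  { adj = λ a b → not (eqF a b) ∧ anyF (λ a' → anyF (λ b' → eqF (f a') a ∧ eqF (f b') b ∧ adj G a' b'))
  ; x = f (x G) ; y = f (y G) }
  where
    f : Fin (suc m) → Fin m
    f w with w ≟ v
    ... | Relation.Nullary.yes _ = punchOut {i = v} {j = u} (λ e → u≢v (sym e))
    ... | Relation.Nullary.no w≢v = punchOut {i = v} {j = w} (λ e → w≢v (sym e))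

-- 𝓜(G): deletion of any edge uv; contraction of an edge uv other than xy,
-- oriented so that the removed endpoint v is not a terminal (so the merged
-- vertex is a terminal whenever the edge is incident with one).
data MinorOp {n} (G : TGraph n) : Set where
  del : (u v : Fin n) → adj G u v ≡ true → MinorOp G
  con : (u v : Fin n) → adj G u v ≡ true → u ≢ v → v ≢ x G → v ≢ y G → MinorOp G

apply : ∀ {n} {G : TGraph n} → MinorOp G → Σ ℕ TGraph
apply {n} {G} (del u v _) = n , deleteEdge G u v
apply {G = G} (con u v _ u≢v _ _) = contractEdge G u v u≢v

opEdge : ∀ {n} {G : TGraph n} → MinorOp G → Fin n × Fin n
opEdge (del u v _) = u , v
opEdge (con u v _ _ _ _) = u , v

Param : Set
Param = ∀ {k} → TGraph k → ℕ

InΔ : ℕ → Param → ∀ {n} {G : TGraph n} → MinorOp G → Set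
InΔ k P {G = G} μ = P (proj₂ (apply μ)) + k ≤ P G

Critical : Param → ∀ {n} → TGraph n → Set
Critical P G = ∀ (μ : MinorOp G) → InΔ 1 P μ

C° : Param → ∀ {n} → TGraph n → Set
C° P G = InGxy° G × Critical P G

Cascade : ∀ {n} → TGraph n → Set
Cascade G = InGxy° G × (∀ (μ : MinorOp G) → InΔ 1 ĝ μ ⊎ InΔ 1 ĝ⁺ μ)
            × ¬ C° ĝ G × ¬ C° ĝ⁺ G

Hw-ĝ : ∀ {n} → TGraph n → Set
Hw-ĝ G = InGxy° G × ¬ C° ĝ⁺ G × (∀ (μ : MinorOp G) → InΔ 1 ĝ⁺ μ ⊎ InΔ 2 ĝ μ)

Hw-ĝ⁺ : ∀ {n} → TGraph n → Set
Hw-ĝ⁺ G = InGxy° G × ¬ C° ĝ G × (∀ (μ : MinorOp G) → InΔ 1 ĝ μ ⊎ InΔ 2 ĝ⁺ μ)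

record IsXYSum {n n₁ n₂} (G : TGraph n) (G₁ : TGraph n₁) (G₂ : TGraph n₂)
               (ι₁ : Fin n₁ → Fin n) (ι₂ : Fin n₂ → Fin n) : Set where
  field
    inj₁ : ∀ a b → ι₁ a ≡ ι₁ b → a ≡ b
    inj₂ : ∀ a b → ι₂ a ≡ ι₂ b → a ≡ b
    x₁ : ι₁ (x G₁) ≡ x G
    y₁ : ι₁ (y G₁) ≡ y G
    x₂ : ι₂ (x G₂) ≡ x G
    y₂ : ι₂ (y G₂) ≡ y G
    meet : ∀ a b → ι₁ a ≡ ι₂ b → (a ≡ x G₁ × b ≡ x G₂) ⊎ (a ≡ y G₁ × b ≡ y G₂)
    cover : ∀ w → (∃ λ a → ι₁ a ≡ w) ⊎ (∃ λ b → ι₂ b ≡ w)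
    edges→ : ∀ u w → adj G u w ≡ true →
      (∃ λ a → ∃ λ b → ι₁ a ≡ u × ι₁ b ≡ w × adj G₁ a b ≡ true)
      ⊎ (∃ λ a → ∃ λ b → ι₂ a ≡ u × ι₂ b ≡ w × adj G₂ a b ≡ true)
    edges₁ : ∀ a b → adj G₁ a b ≡ true → adj G (ι₁ a) (ι₁ b) ≡ true
    edges₂ : ∀ a b → adj G₂ a b ≡ true → adj G (ι₂ a) (ι₂ b) ≡ true

OnSubgraph : ∀ {n n₁} {G : TGraph n} (G₁ : TGraph n₁) (ι : Fin n₁ → Fin n) → MinorOp G → Set
OnSubgraph G₁ ι μ = ∃ λ a → ∃ λ b → ι a ≡ proj₁ (opEdge μ) × ι b ≡ proj₂ (opEdge μ) × adj G₁ a b ≡ true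

Tight : Param → ∀ {n n₁} (G : TGraph n) (G₁ : TGraph n₁) (ι : Fin n₁ → Fin n) → Set
Tight P G G₁ ι = ∀ (μ : MinorOp G) → OnSubgraph G₁ ι μ → P (proj₂ (apply μ)) < P G

{-# OPTIONS --safe #-}

-- An embedding of a graph is encoded on the flags of its edges: the sides of the edges give one perfect
-- matching m, the crossings at the ends of the edges another one α, and the corners a third one β.
-- Faces are the components of β ∪ m and vertices those of β ∪ α.  Dropping the requirement that the
-- corners at a vertex form a single cycle does not change the genus: the Euler genus of a connected graph is
-- 2 + |E| − 2|V| − max_β (c(β ∪ m) − c(β ∪ α)), where β ranges over all matchings that respect the vertices.
-- Switching two pairs of β changes either count by at most one, and such switches give
--   ĝ(G) = min (ĝ⁺(G₁) + ĝ⁺(G₂), ĝ(G₁) + ĝ(G₂) + 2)   for an xy-sum G of connected graphs G₁ and G₂,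
--   ĝ ≤ ĝ⁺ ≤ ĝ + 2, and that contracting a bridge lowers neither ĝ nor ĝ⁺.
-- If no edge of G₁ is a bridge, every minor-operation on G₁ leaves an xy-sum of connected graphs, and the theorem
-- is arithmetic of the minimum above.  If there is a bridge, its contraction refutes both sides.
module Submission where

open import Data.Bool using (Bool; true; false; if_then_else_; _xor_; not; _∧_; _∨_) renaming (T to IsTrue)
open import Data.Bool.ListAction using (all; any)
import Data.Bool.Properties as Bool
open import Data.Bool.Properties using (∧-identityʳ)
open import Data.Empty using (⊥; ⊥-elim)
open import Data.Fin using (Fin; toℕ; combine; zero; suc; punchOut; punchIn)
import Data.Fin.Properties as Fin
open import Data.List using (List; []; _∷_; _++_; map; length; concatMap; allFin; upTo; filterᵇ; foldr; cartesianProduct)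
open import Data.List.Membership.Propositional using (_∈_; _∉_)
open import Data.List.Membership.Propositional.Properties using (∈-++⁺ˡ; ∈-++⁺ʳ; ∈-++⁻; ∈-map⁻; ∈-map⁺; ∈-∃++; ∈-allFin; ∈-cartesianProduct⁺; ∈-upTo⁺)
import Data.List.Membership.Propositional.Properties.WithK as WithK
open import Data.List.Properties using (++-assoc; length-++; length-map; map-++; map-id; map-∘)
open import Data.List.Relation.Binary.BagAndSetEquality using (∼bag⇒↭)
open import Data.List.Relation.Binary.Permutation.Propositional using (_↭_; prep; swap; ↭-refl; ↭-sym; ↭-trans; ↭-reflexive) renaming (refl to reflP; trans to transP)
open import Data.List.Relation.Binary.Permutation.Propositional.Properties using (Any-resp-↭; ∈-resp-↭; ↭-length; All-resp-↭; shift; shifts; ++-comm; ++⁺ˡ; ++⁺ʳ; ++⁺; drop-∷; map⁺)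
open import Data.List.Relation.Unary.All as All using (All; []; _∷_)
open import Data.List.Relation.Unary.AllPairs using ([]; _∷_)
open import Data.List.Relation.Unary.Any using (Any; here; there; any?)
open import Data.List.Relation.Unary.Unique.Propositional using (Unique)
import Data.List.Relation.Unary.Unique.Propositional.Properties as Uniq
open import Data.Nat using (ℕ; zero; suc; _+_; _*_; _≤_; _<_; z≤n; s≤s; s≤s⁻¹; _∸_; _%_; _/_; _<ᵇ_; _≤ᵇ_; _⊓_; _≤?_)
open import Data.Nat.DivMod using (m≡m%n+[m/n]*n; m%n<n; m*n/n≡m)
open import Data.Nat.Properties using (≤-refl; ≤-trans; ≤-antisym; ≤-reflexive; +-mono-≤; +-suc; +-comm; +-assoc; n≤1+n; suc-injective; m≤n+m; m≤m+n; +-monoˡ-≤; +-monoʳ-≤; +-cancelʳ-≤; +-identityʳ; m∸n+n≡m; <⇒≤; m<n⇒0<n∸m; m∸n≤m; <-≤-trans; m≤n*m; <ᵇ⇒<; <⇒<ᵇ; ≤ᵇ⇒≤; ≤⇒≤ᵇ; <-cmp; <-asym; <-irrefl; ≰⇒>; m⊓n≤m; m⊓n≤n; ⊓-sel; m≤n+m∸n; *-cancelˡ-≡; m+[n∸m]≡n; m+1+n≰m; m≤n+o⇒m∸n≤o)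
open import Data.Nat.Tactic.RingSolver using (solve-∀)
open import Data.Product using (Σ; ∃; _×_; _,_; proj₁; proj₂)
open import Data.Product.Properties using (≡-dec)
open import Data.Sum using (_⊎_; inj₁; inj₂)
open import Data.Unit using (⊤; tt)
import Data.Unit.Properties as Unit
open import Function using (_∘_; id; case_of_)
open import Function.Bundles using (mk⇔; _⇔_)
open import Relation.Binary using (DecidableEquality; Decidable; tri<; tri≈; tri>)
open import Relation.Binary.PropositionalEquality using (_≡_; _≢_; refl; sym; trans; cong; cong₂; subst; subst₂)
open import Relation.Nullary using (¬_; Dec; yes; no; does; ¬?)
open import Relation.Nullary.Decidable using (_⊎-dec_; _×-dec_; _→-dec_; map′)

-- Let `D` be the maximum of `M - A` over all valid corner matchings, strict or not. It is easier to
-- handle than the genus: deleting or adding an edge changes it by at most one, disjoint unions add,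
-- and the systems in between may be disconnected or have parallel edges. It is translated back into
-- the genus only for connected graphs. The upper bounds for an xy-sum are constructions; the lower
-- bound is the hard half. In a matching of the sum, corners with one flag on each side are switched
-- away while this is free. If some remain, parity forces the face paths between them to run from
-- `x` to `y` in either summand, and the two sides of a new edge `xy` close these paths up at the
-- right price. Two complications shape the rest. Contracting an edge of `G₁` can make `x` and `y`
-- adjacent, so the sum formula excludes the edge `xy` only from `G₂`, and the new edge may be
-- parallel to an old one. And once `xy` is added a bridge of `G₁` may lie on a cycle, so for `ĝ⁺`
-- its contraction needs a distinction by the sides of `x` and `y`.

-- Connectivity along a list of edges

module _ {X : Set} where

  -- Recursion on the edges in place of paths makes connectivity decidable at once, and turns the
  -- effect of one further edge, the only change that is ever counted, into a matter of definition.
  Conn : List (X × X) → X → X → Set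
  Conn []             p q = p ≡ q
  Conn ((u , v) ∷ es) p q = Conn es p q ⊎ (Conn es p u × Conn es v q) ⊎ (Conn es p v × Conn es u q)

  Conn-refl : ∀ es {p} → Conn es p p
  Conn-refl []       = refl
  Conn-refl (e ∷ es) = inj₁ (Conn-refl es)

  Conn-sym : ∀ es {p q} → Conn es p q → Conn es q p
  Conn-sym []       pq                      = sym pq
  Conn-sym (e ∷ es) (inj₁ pq)               = inj₁ (Conn-sym es pq)
  Conn-sym (e ∷ es) (inj₂ (inj₁ (pu , vq))) = inj₂ (inj₂ (Conn-sym es vq , Conn-sym es pu))
  Conn-sym (e ∷ es) (inj₂ (inj₂ (pv , uq))) = inj₂ (inj₁ (Conn-sym es uq , Conn-sym es pv))

  Conn-trans : ∀ es {p q r} → Conn es p q → Conn es q r → Conn es p r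
  Conn-trans [] = trans
  Conn-trans (e ∷ es) = go
    where
    t = Conn-trans es
    go : ∀ {p q r} → Conn (e ∷ es) p q → Conn (e ∷ es) q r → Conn (e ∷ es) p r
    go (inj₁ a) (inj₁ b) = inj₁ (t a b)
    go (inj₁ a) (inj₂ (inj₁ (b , c))) = inj₂ (inj₁ (t a b , c))
    go (inj₁ a) (inj₂ (inj₂ (b , c))) = inj₂ (inj₂ (t a b , c))
    go (inj₂ (inj₁ (a , b))) (inj₁ c) = inj₂ (inj₁ (a , t b c))
    go (inj₂ (inj₁ (a , b))) (inj₂ (inj₁ (c , d))) = inj₂ (inj₁ (a , d))
    go (inj₂ (inj₁ (a , b))) (inj₂ (inj₂ (c , d))) = inj₁ (t a d)
    go (inj₂ (inj₂ (a , b))) (inj₁ c) = inj₂ (inj₂ (a , t b c))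
    go (inj₂ (inj₂ (a , b))) (inj₂ (inj₁ (c , d))) = inj₁ (t a d)
    go (inj₂ (inj₂ (a , b))) (inj₂ (inj₂ (c , d))) = inj₂ (inj₂ (a , d))

  Conn-∈ : ∀ es {p q} → (p , q) ∈ es → Conn es p q
  Conn-∈ (e ∷ es) (here refl) = inj₂ (inj₁ (Conn-refl es , Conn-refl es))
  Conn-∈ (e ∷ es) (there i)   = inj₁ (Conn-∈ es i)

  record Equiv (S : X → X → Set) : Set where
    field
      rfl : ∀ {p} → S p p
      sm  : ∀ {p q} → S p q → S q p
      tr  : ∀ {p q r} → S p q → S q r → S p r

  Conn-Equiv : ∀ es → Equiv (Conn es)
  Conn-Equiv es = record { rfl = Conn-refl es ; sm = Conn-sym es ; tr = Conn-trans es }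

  -- `Conn es` is the least equivalence relation containing `es`. This replaces induction along
  -- paths: the invariant of a path is put into `S`.
  Conn-least : ∀ {S} → Equiv S → ∀ es → (∀ {u v} → (u , v) ∈ es → S u v) → ∀ {p q} → Conn es p q → S p q
  Conn-least E []       h refl = Equiv.rfl E
  Conn-least E (e ∷ es) h (inj₁ pq) = Conn-least E es (h ∘ there) pq
  Conn-least E (e ∷ es) h (inj₂ (inj₁ (pu , vq))) =
    Equiv.tr E (Conn-least E es (h ∘ there) pu) (Equiv.tr E (h (here refl)) (Conn-least E es (h ∘ there) vq))
  Conn-least E (e ∷ es) h (inj₂ (inj₂ (pv , uq))) =
    Equiv.tr E (Conn-least E es (h ∘ there) pv) (Equiv.tr E (Equiv.sm E (h (here refl))) (Conn-least E es (h ∘ there) uq))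

  Conn-mono : ∀ es es' → (∀ {u v} → (u , v) ∈ es → Conn es' u v) → ∀ {p q} → Conn es p q → Conn es' p q
  Conn-mono es es' = Conn-least (Conn-Equiv es') es

  Conn-respects : ∀ {V : Set} (χ : X → V) es → (∀ {u v} → (u , v) ∈ es → χ u ≡ χ v) → ∀ {p q} → Conn es p q → χ p ≡ χ q
  Conn-respects χ = Conn-least (record { rfl = refl ; sm = sym ; tr = trans })

-- Counting the classes of a relation on a list

bit : ∀ {A : Set} → Dec A → ℕ
bit d = if does d then 1 else 0

bitN : ∀ {A : Set} → Dec A → ℕ
bitN d = if does d then 0 else 1

bitN-anti : ∀ {A B : Set} (a : Dec A) (b : Dec B) → (A → B) → bitN b ≤ bitN a
bitN-anti (yes a) (yes b) f = ≤-refl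
bitN-anti (yes a) (no ¬b) f = ⊥-elim (¬b (f a))
bitN-anti (no ¬a) (yes b) f = z≤n
bitN-anti (no ¬a) (no ¬b) f = ≤-refl

bitN-cong : ∀ {A B : Set} (a : Dec A) (b : Dec B) → (A → B) → (B → A) → bitN a ≡ bitN b
bitN-cong a b f g = ≤-antisym (bitN-anti b a g) (bitN-anti a b f)

bit-yes : ∀ {A : Set} (a : Dec A) → A → bit a ≡ 1
bit-yes (yes _) _ = refl
bit-yes (no ¬a) a = ⊥-elim (¬a a)

bitN-yes : ∀ {A : Set} (a : Dec A) → A → bitN a ≡ 0
bitN-yes (yes _) _ = refl
bitN-yes (no ¬a) a = ⊥-elim (¬a a)

bitN-no : ∀ {A : Set} (a : Dec A) → ¬ A → bitN a ≡ 1
bitN-no (yes a) ¬a = ⊥-elim (¬a a)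
bitN-no (no _) _ = refl

bit≤1 : ∀ {A : Set} (a : Dec A) → bit a ≤ 1
bit≤1 (yes _) = s≤s z≤n
bit≤1 (no _)  = z≤n

Any-map∈ : ∀ {X : Set} {P Q : X → Set} {l} → (∀ {z} → z ∈ l → P z → Q z) → Any P l → Any Q l
Any-map∈ f (here p)  = here (f (here refl) p)
Any-map∈ f (there i) = there (Any-map∈ (f ∘ there) i)

-- An entry counts when no later entry is related to it, so an equivalence class is counted once, at
-- its last member.
classes : ∀ {X : Set} {R : X → X → Set} → Decidable R → List X → ℕ
classes R? []       = 0
classes R? (p ∷ ps) = bitN (any? (R? p) ps) + classes R? ps

module _ {X : Set} where

  classes-mono : ∀ {R R' : X → X → Set} (R? : Decidable R) (R'? : Decidable R') l →
    (∀ {p q} → p ∈ l → q ∈ l → R p q → R' p q) → classes R'? l ≤ classes R? l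
  classes-mono R? R'? []       h = z≤n
  classes-mono R? R'? (p ∷ ps) h =
    +-mono-≤ (bitN-anti (any? (R? p) ps) (any? (R'? p) ps) (Any-map∈ (λ z∈ → h (here refl) (there z∈))))
             (classes-mono R? R'? ps (λ a b → h (there a) (there b)))

  classes-cong : ∀ {R R' : X → X → Set} (R? : Decidable R) (R'? : Decidable R') l →
    (∀ {p q} → p ∈ l → q ∈ l → R p q → R' p q) → (∀ {p q} → p ∈ l → q ∈ l → R' p q → R p q) → classes R? l ≡ classes R'? l
  classes-cong R? R'? l f g = ≤-antisym (classes-mono R'? R? l g) (classes-mono R? R'? l f)

  module _ {R : X → X → Set} (R? : Decidable R) (E : Equiv R) where
    open Equiv E

    -- Only the swap uses that `R` is an equivalence: if two neighbouring entries are related, the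
    -- earlier one never counts, and the swap hands the role of the later one over.
    classes-↭ : ∀ {l l'} → l ↭ l' → classes R? l ≡ classes R? l'
    classes-↭ reflP = refl
    classes-↭ {p ∷ l} {p ∷ l'} (prep p π) =
      cong₂ _+_ (bitN-cong (any? (R? p) l) (any? (R? p) l') (Any-resp-↭ π) (Any-resp-↭ (↭-sym π))) (classes-↭ π)
    classes-↭ {p ∷ q ∷ l} {q ∷ p ∷ l'} (swap p q π) =
      trans (lem (any? (R? p) (q ∷ l)) (any? (R? q) l) (any? (R? q) (p ∷ l)) (any? (R? p) l) f₁ f₂ f₃ f₄)
      (cong₂ _+_ (bitN-cong (any? (R? q) (p ∷ l)) (any? (R? q) (p ∷ l')) (Any-resp-↭ (prep p π)) (Any-resp-↭ (prep p (↭-sym π))))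
       (cong₂ _+_ (bitN-cong (any? (R? p) l) (any? (R? p) l') (Any-resp-↭ π) (Any-resp-↭ (↭-sym π))) (classes-↭ π)))
      where
      tail-or : ∀ {a b} → Any (R a) (b ∷ l) → R a b ⊎ Any (R a) l
      tail-or (here r) = inj₁ r
      tail-or (there i) = inj₂ i
      mv : ∀ {a b} → R a b → Any (R a) l → Any (R b) l
      mv ab = Any-map∈ (λ _ → tr (sm ab))
      f₁ : Any (R p) l → Any (R p) (q ∷ l)
      f₁ = there
      f₂ : Any (R q) l → Any (R q) (p ∷ l)
      f₂ = there
      f₃ : Any (R p) (q ∷ l) → (Any (R q) (p ∷ l) × (Any (R q) l → Any (R p) l)) ⊎ Any (R p) l
      f₃ a with tail-or a
      ... | inj₁ r = inj₁ (here (sm r) , mv (sm r))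
      ... | inj₂ i = inj₂ i
      f₄ : Any (R q) (p ∷ l) → (Any (R p) (q ∷ l) × (Any (R p) l → Any (R q) l)) ⊎ Any (R q) l
      f₄ a with tail-or a
      ... | inj₁ r = inj₁ (here (sm r) , mv (sm r))
      ... | inj₂ i = inj₂ i
      lem : ∀ {A B C D : Set} (a : Dec A) (b : Dec B) (c : Dec C) (d : Dec D) →
        (D → A) → (B → C) → (A → (C × (B → D)) ⊎ D) → (C → (A × (D → B)) ⊎ B) →
        ∀ {k} → bitN a + (bitN b + k) ≡ bitN c + (bitN d + k)
      lem (yes a) (yes b) (yes c) (yes d) g₁ g₂ g₃ g₄ = refl
      lem (yes a) (yes b) (yes c) (no ¬d) g₁ g₂ g₃ g₄ with g₃ a
      ... | inj₁ (_ , h) = ⊥-elim (¬d (h b))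
      ... | inj₂ d = ⊥-elim (¬d d)
      lem (yes a) (yes b) (no ¬c) _ g₁ g₂ g₃ g₄ = ⊥-elim (¬c (g₂ b))
      lem (yes a) (no ¬b) (yes c) (yes d) g₁ g₂ g₃ g₄ with g₄ c
      ... | inj₁ (_ , h) = ⊥-elim (¬b (h d))
      ... | inj₂ b = ⊥-elim (¬b b)
      lem (yes a) (no ¬b) (yes c) (no ¬d) g₁ g₂ g₃ g₄ = refl
      lem (yes a) (no ¬b) (no ¬c) (yes d) g₁ g₂ g₃ g₄ = refl
      lem (yes a) (no ¬b) (no ¬c) (no ¬d) g₁ g₂ g₃ g₄ with g₃ a
      ... | inj₁ (c , _) = ⊥-elim (¬c c)
      ... | inj₂ d = ⊥-elim (¬d d)
      lem (no ¬a) b c (yes d) g₁ g₂ g₃ g₄ = ⊥-elim (¬a (g₁ d))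
      lem (no ¬a) (yes b) (yes c) (no ¬d) g₁ g₂ g₃ g₄ = refl
      lem (no ¬a) (yes b) (no ¬c) (no ¬d) g₁ g₂ g₃ g₄ = ⊥-elim (¬c (g₂ b))
      lem (no ¬a) (no ¬b) (yes c) (no ¬d) g₁ g₂ g₃ g₄ with g₄ c
      ... | inj₁ (a , _) = ⊥-elim (¬a a)
      ... | inj₂ b = ⊥-elim (¬b b)
      lem (no ¬a) (no ¬b) (no ¬c) (no ¬d) g₁ g₂ g₃ g₄ = refl
    classes-↭ (transP π π') = trans (classes-↭ π) (classes-↭ π')

    module _ {R' : X → X → Set} (R'? : Decidable R') (u v : X)
             (to : ∀ {p q} → R' p q → R p q ⊎ (R p u × R v q) ⊎ (R p v × R u q))
             (from : ∀ {p q} → R p q ⊎ (R p u × R v q) ⊎ (R p v × R u q) → R' p q)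
             (¬uv : ¬ R u v) where

      -- The list notices the merging of the classes of `u` and `v` only if it meets both. The `bit`
      -- records this, so that the induction can pass to tails that miss one of them.
      classes-edge : ∀ l → classes R? l ≡ bit (any? (R? u) l ×-dec any? (R? v) l) + classes R'? l
      classes-edge [] = refl
      classes-edge (p ∷ ps) with R? u p | R? v p
      ... | yes up | yes vp = ⊥-elim (¬uv (tr up (sm vp)))
      ... | yes up | no ¬vp = trans
        (cong₂ _+_ (bitN-cong (any? (R? p) ps) (any? (R? u) ps) (Any-map∈ (λ _ → tr up)) (Any-map∈ (λ _ → tr (sm up)))) (classes-edge ps))
        (trans (lem (any? (R? u) ps) (any? (R? v) ps))
        (cong (bit (any? (R? v) ps) +_)
        (cong (_+ classes R'? ps) (bitN-cong (any? (R? u) ps ⊎-dec any? (R? v) ps) (any? (R'? p) ps)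
          (λ { (inj₁ a) → Any-map∈ (λ _ r → from (inj₁ (tr (sm up) r))) a
             ; (inj₂ a) → Any-map∈ (λ _ r → from (inj₂ (inj₁ (sm up , r)))) a })
          (λ a → dist a)))))
        where
        dist : ∀ {l} → Any (R' p) l → Any (R u) l ⊎ Any (R v) l
        dist (here r) with to r
        ... | inj₁ s = inj₁ (here (tr up s))
        ... | inj₂ (inj₁ (_ , s)) = inj₂ (here s)
        ... | inj₂ (inj₂ (_ , s)) = inj₁ (here s)
        dist (there a) with dist a
        ... | inj₁ b = inj₁ (there b)
        ... | inj₂ b = inj₂ (there b)
        lem : ∀ {A B : Set} (a : Dec A) (b : Dec B) {k} → bitN a + (bit (a ×-dec b) + k) ≡ bit b + (bitN (a ⊎-dec b) + k)
        lem (yes _) (yes _) = refl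
        lem (yes _) (no _)  = refl
        lem (no _)  (yes _) = refl
        lem (no _)  (no _)  = refl
      ... | no ¬up | yes vp = trans
        (cong₂ _+_ (bitN-cong (any? (R? p) ps) (any? (R? v) ps) (Any-map∈ (λ _ → tr vp)) (Any-map∈ (λ _ → tr (sm vp)))) (classes-edge ps))
        (trans (lem (any? (R? u) ps) (any? (R? v) ps))
        (cong₂ _+_ (cong (λ b → if b then 1 else 0) (sym (∧-identityʳ (does (any? (R? u) ps)))))
        (cong (_+ classes R'? ps) (bitN-cong (any? (R? u) ps ⊎-dec any? (R? v) ps) (any? (R'? p) ps)
          (λ { (inj₁ a) → Any-map∈ (λ _ r → from (inj₂ (inj₂ (sm vp , r)))) a
             ; (inj₂ a) → Any-map∈ (λ _ r → from (inj₁ (tr (sm vp) r))) a })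
          (λ a → dist a)))))
        where
        dist : ∀ {l} → Any (R' p) l → Any (R u) l ⊎ Any (R v) l
        dist (here r) with to r
        ... | inj₁ s = inj₂ (here (tr vp s))
        ... | inj₂ (inj₁ (_ , s)) = inj₂ (here s)
        ... | inj₂ (inj₂ (_ , s)) = inj₁ (here s)
        dist (there a) with dist a
        ... | inj₁ b = inj₁ (there b)
        ... | inj₂ b = inj₂ (there b)
        lem : ∀ {A B : Set} (a : Dec A) (b : Dec B) {k} → bitN b + (bit (a ×-dec b) + k) ≡ bit a + (bitN (a ⊎-dec b) + k)
        lem (yes _) (yes _) = refl
        lem (yes _) (no _)  = refl
        lem (no _)  (yes _) = refl
        lem (no _)  (no _)  = refl
      ... | no ¬up | no ¬vp = trans
        (cong₂ _+_ (bitN-cong (any? (R? p) ps) (any? (R'? p) ps) (Any-map∈ (λ _ r → from (inj₁ r)))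
            (Any-map∈ (λ _ r' → un (to r')))) (classes-edge ps))
        (comm (bitN (any? (R'? p) ps)) (bit (any? (R? u) ps ×-dec any? (R? v) ps)))
        where
        un : ∀ {z} → R p z ⊎ (R p u × R v z) ⊎ (R p v × R u z) → R p z
        un (inj₁ r) = r
        un (inj₂ (inj₁ (r , _))) = ⊥-elim (¬up (sm r))
        un (inj₂ (inj₂ (r , _))) = ⊥-elim (¬vp (sm r))
        comm : ∀ a b {k} → a + (b + k) ≡ b + (a + k)
        comm a b {k} = trans (sym (+-assoc a b k)) (trans (cong (_+ k) (+-comm a b)) (+-assoc b a k))

-- Matchings, parity and path ends

module _ {X : Set} where

  -- A perfect matching of the points in `Φ` is a list `a` with `flat a ↭ Φ`; if `Φ` is `Unique`,
  -- each point then lies in exactly one pair.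
  flat : List (X × X) → List X
  flat []             = []
  flat ((p , q) ∷ es) = p ∷ q ∷ flat es

  flat-++ : ∀ es fs → flat (es ++ fs) ≡ flat es ++ flat fs
  flat-++ []             fs = refl
  flat-++ ((p , q) ∷ es) fs = cong (λ l → p ∷ q ∷ l) (flat-++ es fs)

  flat-∈ˡ : ∀ {es u v} → (u , v) ∈ es → u ∈ flat es
  flat-∈ˡ (here refl) = here refl
  flat-∈ˡ (there i)   = there (there (flat-∈ˡ i))

  flat-∈ʳ : ∀ {es u v} → (u , v) ∈ es → v ∈ flat es
  flat-∈ʳ (here refl) = there (here refl)
  flat-∈ʳ (there i)   = there (there (flat-∈ʳ i))

  par : (X → Bool) → List X → Bool
  par f []       = false
  par f (p ∷ ps) = f p xor par f ps

  par-↭ : ∀ f {l l'} → l ↭ l' → par f l ≡ par f l'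
  par-↭ f reflP        = refl
  par-↭ f (prep x π)   = cong (f x xor_) (par-↭ f π)
  par-↭ f (swap x y π) = trans (lem (f x) (f y) _) (cong (λ b → f y xor (f x xor b)) (par-↭ f π))
    where
    lem : ∀ a b c → a xor (b xor c) ≡ b xor (a xor c)
    lem false b c = refl
    lem true false c = refl
    lem true true c = refl
  par-↭ f (transP π π') = trans (par-↭ f π) (par-↭ f π')

  par-++ : ∀ f l l' → par f (l ++ l') ≡ par f l xor par f l'
  par-++ f []       l' = refl
  par-++ f (p ∷ ps) l' = trans (cong (f p xor_) (par-++ f ps l')) (sym (assoc (f p) (par f ps) (par f l')))
    where
    assoc : ∀ a b c → (a xor b) xor c ≡ a xor (b xor c)
    assoc false b c = refl
    assoc true false c = refl
    assoc true true false = refl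
    assoc true true true = refl

  Closed : (X → Bool) → List (X × X) → Set
  Closed f es = ∀ {u v} → (u , v) ∈ es → f u ≡ f v

  par-flat : ∀ f es → Closed f es → par f (flat es) ≡ false
  par-flat f []             h = refl
  par-flat f ((p , q) ∷ es) h rewrite par-flat f es (h ∘ there) | h (here refl) = lem (f q)
    where
    lem : ∀ b → b xor (b xor false) ≡ false
    lem false = refl
    lem true = refl

  -- Handshaking: `a` shows that `f` holds at an even number of points of `Φ`, `β` that it does so
  -- at an even number of points outside `O`. Every existence claim about the other end of a path
  -- rests on this.
  par-open : ∀ f a β O {Φ} → flat a ↭ Φ → O ++ flat β ↭ Φ → Closed f a → Closed f β → par f O ≡ false
  par-open f a β O pa pβ ca cβ = xor-false (trans (sym (par-++ f O (flat β))) (trans (par-↭ f (↭-trans pβ (↭-sym pa))) (par-flat f a ca)))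
    where
    xor-false : par f O xor par f (flat β) ≡ false → par f O ≡ false
    xor-false e rewrite par-flat f β cβ = trans (sym (lem (par f O))) e
      where
      lem : ∀ b → b xor false ≡ b
      lem false = refl
      lem true = refl

  Conn-∉ : ∀ es {p q} → p ∉ flat es → Conn es p q → p ≡ q
  Conn-∉ []       h pq = pq
  Conn-∉ (e ∷ es) h (inj₁ pq) = Conn-∉ es (λ i → h (there (there i))) pq
  Conn-∉ (e ∷ es) h (inj₂ (inj₁ (pu , _))) = ⊥-elim (h (here (Conn-∉ es (λ i → h (there (there i))) pu)))
  Conn-∉ (e ∷ es) h (inj₂ (inj₂ (pv , _))) = ⊥-elim (h (there (here (Conn-∉ es (λ i → h (there (there i))) pv))))

  Unique-resp-↭ : ∀ {l l' : List X} → l ↭ l' → Unique l → Unique l'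
  Unique-resp-↭ reflP u = u
  Unique-resp-↭ (prep x π) (h ∷ u) = All-resp-↭ π h ∷ Unique-resp-↭ π u
  Unique-resp-↭ (swap x y π) ((x≢y ∷ hx) ∷ hy ∷ u) =
    ((x≢y ∘ sym) ∷ All-resp-↭ π hy) ∷ All-resp-↭ π hx ∷ Unique-resp-↭ π u
  Unique-resp-↭ (transP π π') u = Unique-resp-↭ π' (Unique-resp-↭ π u)

  unique-head : ∀ {p : X} {l} → Unique (p ∷ l) → p ∉ l
  unique-head (h ∷ _) i = All.lookup h i refl

  unique-tail : ∀ {p : X} {l} → Unique (p ∷ l) → Unique l
  unique-tail (_ ∷ u) = u

  matching-pairs : ∀ a → Unique (flat a) → ∀ {p q r} → p ≢ q → p ≢ r → q ≢ r → Conn a p q → Conn a p r → ⊥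
  matching-pairs [] u p≢q p≢r q≢r refl pr = p≢q refl
  matching-pairs ((x , y) ∷ a) u {p} {q} {r} p≢q p≢r q≢r = go
    where
    y∉ : y ∉ flat a
    y∉ = unique-head (unique-tail u)
    x∉ : x ∉ flat a
    x∉ i = unique-head u (there i)
    x≢y : x ≢ y
    x≢y refl = unique-head u (here refl)
    to : ∀ {z w} → w ∉ flat a → Conn a z w → w ≡ z
    to w∉ c = Conn-∉ a w∉ (Conn-sym a c)
    go : Conn ((x , y) ∷ a) p q → Conn ((x , y) ∷ a) p r → ⊥
    go (inj₁ pq) (inj₁ pr) = matching-pairs a (unique-tail (unique-tail u)) p≢q p≢r q≢r pq pr
    go (inj₁ pq) (inj₂ (inj₁ (px , _))) with refl ← to x∉ px = p≢q (Conn-∉ a x∉ pq)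
    go (inj₁ pq) (inj₂ (inj₂ (py , _))) with refl ← to y∉ py = p≢q (Conn-∉ a y∉ pq)
    go (inj₂ (inj₁ (px , _))) (inj₁ pr) with refl ← to x∉ px = p≢r (Conn-∉ a x∉ pr)
    go (inj₂ (inj₂ (py , _))) (inj₁ pr) with refl ← to y∉ py = p≢r (Conn-∉ a y∉ pr)
    go (inj₂ (inj₁ (_ , yq))) (inj₂ (inj₁ (_ , yr))) = q≢r (trans (sym (Conn-∉ a y∉ yq)) (Conn-∉ a y∉ yr))
    go (inj₂ (inj₁ (px , _))) (inj₂ (inj₂ (py , _))) = x≢y (trans (to x∉ px) (sym (to y∉ py)))
    go (inj₂ (inj₂ (py , _))) (inj₂ (inj₁ (px , _))) = x≢y (trans (to x∉ px) (sym (to y∉ py)))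
    go (inj₂ (inj₂ (_ , xq))) (inj₂ (inj₂ (_ , xr))) = q≢r (trans (sym (Conn-∉ a x∉ xq)) (Conn-∉ a x∉ xr))

  -- A component of the union of a perfect matching a and a partial matching β is a path or a
  -- cycle, so it contains at most two points missed by β.
  path-ends : ∀ a β → Unique (flat a) → Unique (flat β) → ∀ {p q r} → p ∉ flat β → q ∉ flat β → r ∉ flat β →
    p ≢ q → p ≢ r → q ≢ r → Conn (β ++ a) p q → Conn (β ++ a) p r → ⊥
  path-ends a [] ua uβ _ _ _ = matching-pairs a ua
  path-ends a ((x , y) ∷ β) ua uβ {p} {q} {r} p∉ q∉ r∉ p≢q p≢r q≢r = go
    where
    W = β ++ a
    s = Conn-sym W
    y∉ : y ∉ flat β
    y∉ = unique-head (unique-tail uβ)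
    x∉ : x ∉ flat β
    x∉ i = unique-head uβ (there i)
    x≢y : x ≢ y
    x≢y refl = unique-head uβ (here refl)
    y≢x : y ≢ x
    y≢x = x≢y ∘ sym
    out : ∀ {z} → z ∉ x ∷ y ∷ flat β → z ∉ flat β
    out h = h ∘ there ∘ there
    ≢x : ∀ {z} → z ∉ x ∷ y ∷ flat β → z ≢ x
    ≢x h = h ∘ here
    ≢y : ∀ {z} → z ∉ x ∷ y ∷ flat β → z ≢ y
    ≢y h = h ∘ there ∘ here
    IH : ∀ {p q r} → p ∉ flat β → q ∉ flat β → r ∉ flat β → p ≢ q → p ≢ r → q ≢ r → Conn W p q → Conn W p r → ⊥
    IH = path-ends a β ua (unique-tail (unique-tail uβ))
    p' = out p∉
    q' = out q∉
    r' = out r∉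
    go : Conn ((x , y) ∷ W) p q → Conn ((x , y) ∷ W) p r → ⊥
    go (inj₁ pq) (inj₁ pr) = IH p' q' r' p≢q p≢r q≢r pq pr
    go (inj₁ pq) (inj₂ (inj₁ (px , _))) = IH p' q' x∉ p≢q (≢x p∉) (≢x q∉) pq px
    go (inj₁ pq) (inj₂ (inj₂ (py , _))) = IH p' q' y∉ p≢q (≢y p∉) (≢y q∉) pq py
    go (inj₂ (inj₁ (px , _))) (inj₁ pr) = IH p' r' x∉ p≢r (≢x p∉) (≢x r∉) pr px
    go (inj₂ (inj₂ (py , _))) (inj₁ pr) = IH p' r' y∉ p≢r (≢y p∉) (≢y r∉) pr py
    go (inj₂ (inj₁ (_ , yq))) (inj₂ (inj₁ (_ , yr))) = IH y∉ q' r' (≢y q∉ ∘ sym) (≢y r∉ ∘ sym) q≢r yq yr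
    go (inj₂ (inj₁ (px , _))) (inj₂ (inj₂ (py , _))) = IH p' x∉ y∉ (≢x p∉) (≢y p∉) x≢y px py
    go (inj₂ (inj₂ (py , _))) (inj₂ (inj₁ (px , _))) = IH p' x∉ y∉ (≢x p∉) (≢y p∉) x≢y px py
    go (inj₂ (inj₂ (_ , xq))) (inj₂ (inj₂ (_ , xr))) = IH x∉ q' r' (≢x q∉ ∘ sym) (≢x r∉ ∘ sym) q≢r xq xr

  InE : List (X × X) → X → X → Set
  InE es u v = (u , v) ∈ es ⊎ (v , u) ∈ es

  InE-sym : ∀ {es u v} → InE es u v → InE es v u
  InE-sym (inj₁ i) = inj₂ i
  InE-sym (inj₂ i) = inj₁ i

  InE-there : ∀ {e es u v} → InE es u v → InE (e ∷ es) u v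
  InE-there (inj₁ i) = inj₁ (there i)
  InE-there (inj₂ i) = inj₂ (there i)

  Conn-InE : ∀ es {u v} → InE es u v → Conn es u v
  Conn-InE es (inj₁ i) = Conn-∈ es i
  Conn-InE es (inj₂ i) = Conn-sym es (Conn-∈ es i)

  InE-∈ : ∀ {es u v} → InE es u v → u ∈ flat es
  InE-∈ (inj₁ i) = flat-∈ˡ i
  InE-∈ (inj₂ i) = flat-∈ʳ i

  infix 4 _≅_
  -- Equality of lists of unordered pairs, up to order and orientation. The field `perm` keeps the
  -- multiplicities, which `to` and `from` cannot see.
  record _≅_ (β γ : List (X × X)) : Set where
    field
      perm : flat β ↭ flat γ
      to   : ∀ {u v} → (u , v) ∈ β → InE γ u v
      from : ∀ {u v} → (u , v) ∈ γ → InE β u v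
  open _≅_ public

  ≅-refl : ∀ {β} → β ≅ β
  ≅-refl = record { perm = ↭-refl ; to = inj₁ ; from = inj₁ }

  ≅-sym : ∀ {β γ} → β ≅ γ → γ ≅ β
  ≅-sym h = record { perm = ↭-sym (perm h) ; to = from h ; from = to h }

  InE-≅ : ∀ {β γ} → β ≅ γ → ∀ {u v} → InE β u v → InE γ u v
  InE-≅ h (inj₁ i) = to h i
  InE-≅ h (inj₂ i) = InE-sym (to h i)

  ≅-trans : ∀ {β γ δ} → β ≅ γ → γ ≅ δ → β ≅ δ
  ≅-trans g h = record { perm = ↭-trans (perm g) (perm h) ; to = InE-≅ h ∘ to g ; from = InE-≅ (≅-sym g) ∘ from h }

  ≅-cons : ∀ e {β γ} → β ≅ γ → e ∷ β ≅ e ∷ γ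
  ≅-cons (p , q) h = record
    { perm = prep p (prep q (perm h))
    ; to   = λ { (here refl) → inj₁ (here refl) ; (there i) → InE-there (to h i) }
    ; from = λ { (here refl) → inj₁ (here refl) ; (there i) → InE-there (from h i) } }

  ≅-exch : ∀ e f {β} → e ∷ f ∷ β ≅ f ∷ e ∷ β
  ≅-exch e f = record { perm = pm e f ; to = mv ; from = mv }
    where
    pm : ∀ e f {β} → flat (e ∷ f ∷ β) ↭ flat (f ∷ e ∷ β)
    pm (p , q) (r , s) = ↭-trans (prep p (swap q r ↭-refl))
      (↭-trans (swap p r (swap q s ↭-refl)) (prep r (swap p s ↭-refl)))
    mv : ∀ {e f β u v} → (u , v) ∈ e ∷ f ∷ β → InE (f ∷ e ∷ β) u v
    mv (here refl) = inj₁ (there (here refl))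
    mv (there (here refl)) = inj₁ (here refl)
    mv (there (there i)) = inj₁ (there (there i))

  ≅-flip : ∀ p q {β} → (p , q) ∷ β ≅ (q , p) ∷ β
  ≅-flip p q = record { perm = swap p q ↭-refl ; to = mv ; from = mv }
    where
    mv : ∀ {p q β u v} → (u , v) ∈ (p , q) ∷ β → InE ((q , p) ∷ β) u v
    mv (here refl) = inj₂ (here refl)
    mv (there i) = inj₁ (there i)

  ↭⇒≅ : ∀ {β γ} → β ↭ γ → β ≅ γ
  ↭⇒≅ reflP = ≅-refl
  ↭⇒≅ (prep x π) = ≅-cons x (↭⇒≅ π)
  ↭⇒≅ (swap x y π) = ≅-trans (≅-exch x y) (≅-cons y (≅-cons x (↭⇒≅ π)))
  ↭⇒≅ (transP π π') = ≅-trans (↭⇒≅ π) (↭⇒≅ π')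

  ≅-++ˡ : ∀ δ {β γ} → β ≅ γ → δ ++ β ≅ δ ++ γ
  ≅-++ˡ []      h = h
  ≅-++ˡ (e ∷ δ) h = ≅-cons e (≅-++ˡ δ h)

  ≅-++ : ∀ {β γ β' γ'} → β ≅ γ → β' ≅ γ' → β ++ β' ≅ γ ++ γ'
  ≅-++ {β} {γ} {β'} {γ'} h h' = ≅-trans (≅-++ˡ β h')
    (≅-trans (↭⇒≅ (++-comm β γ')) (≅-trans (≅-++ˡ γ' h) (↭⇒≅ (++-comm γ' γ))))

  extract : ∀ β {p} → p ∈ flat β → ∃ λ a → ∃ λ β' → β ≅ (p , a) ∷ β'
  extract ((x , y) ∷ β) (here refl) = y , β , ≅-refl
  extract ((x , y) ∷ β) (there (here refl)) = x , β , ≅-flip x y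
  extract ((x , y) ∷ β) (there (there i)) with extract β i
  ... | a , β' , h = a , (x , y) ∷ β' , ≅-trans (≅-cons (x , y) h) (≅-exch (x , y) (_ , a))

  -- Every switch starts from this alternative: the wanted pair is already there, or the two points
  -- have partners `a` and `b` that can be exchanged.
  extract₂ : ∀ β {p r} → p ≢ r → p ∈ flat β → r ∈ flat β →
    (∃ λ β' → β ≅ (p , r) ∷ β') ⊎ (∃ λ a → ∃ λ b → ∃ λ β' → β ≅ (p , a) ∷ (r , b) ∷ β')
  extract₂ β {p} {r} p≢r i j with extract β i
  ... | a , β' , h with ∈-resp-↭ (perm h) j
  ... | here r≡p = ⊥-elim (p≢r (sym r≡p))
  ... | there (here refl) = inj₁ (β' , h)
  ... | there (there k) with extract β' k
  ... | b , β'' , h' = inj₂ (a , b , β'' , ≅-trans h (≅-cons (p , a) h'))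

  Conn-≅ : ∀ {β γ} → β ≅ γ → ∀ {p q} → Conn β p q → Conn γ p q
  Conn-≅ {β} {γ} h = Conn-mono β γ (Conn-InE γ ∘ to h)

  Conn-⊆ : ∀ {es es' : List (X × X)} → (∀ {u v} → (u , v) ∈ es → (u , v) ∈ es') → ∀ {p q} → Conn es p q → Conn es' p q
  Conn-⊆ {es} {es'} h = Conn-mono es es' (Conn-∈ es' ∘ h)

  Conn-++ˡ : ∀ {es es'} → ∀ {p q} → Conn es p q → Conn (es ++ es') p q
  Conn-++ˡ {es} {es'} = Conn-⊆ {es} {es ++ es'} ∈-++⁺ˡ

  Conn-++ʳ : ∀ es {es'} → ∀ {p q} → Conn es' p q → Conn (es ++ es') p q
  Conn-++ʳ es {es'} = Conn-⊆ {es'} {es ++ es'} (∈-++⁺ʳ es)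

-- Component counts and the switching of two pairs

module Count {X : Set} (_≟_ : DecidableEquality X) where

  conn? : ∀ es → Decidable (Conn {X} es)
  conn? []             p q = p ≟ q
  conn? ((u , v) ∷ es) p q = conn? es p q ⊎-dec ((conn? es p u ×-dec conn? es v q) ⊎-dec (conn? es p v ×-dec conn? es u q))

  opaque
    c : List (X × X) → List X → ℕ
    c es Φ = classes (conn? es) Φ

    c-mono : ∀ {es es'} Φ → (∀ {p q} → Conn es p q → Conn es' p q) → c es' Φ ≤ c es Φ
    c-mono {es} {es'} Φ h = classes-mono (conn? es) (conn? es') Φ (λ _ _ → h)

  c-≅ : ∀ {es es'} Φ → es ≅ es' → c es Φ ≡ c es' Φ
  c-≅ {es} {es'} Φ h = ≤-antisym (c-mono {es'} {es} Φ (Conn-≅ (≅-sym h))) (c-mono {es} {es'} Φ (Conn-≅ h))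

  opaque
    unfolding c

    c-↭ : ∀ es {Φ Φ'} → Φ ↭ Φ' → c es Φ ≡ c es Φ'
    c-↭ es = classes-↭ (conn? es) (Conn-Equiv es)

  c-∷-≤ : ∀ e es Φ → c (e ∷ es) Φ ≤ c es Φ
  c-∷-≤ e es Φ = c-mono {es} {e ∷ es} Φ inj₁

  c-∷-conn : ∀ {u v} es Φ → Conn es u v → c ((u , v) ∷ es) Φ ≡ c es Φ
  c-∷-conn {u} {v} es Φ uv = ≤-antisym (c-∷-≤ (u , v) es Φ) (c-mono {(u , v) ∷ es} {es} Φ
    (Conn-mono ((u , v) ∷ es) es λ { (here refl) → uv ; (there i) → Conn-∈ es i }))

  private opaque
    unfolding c

    edge : ∀ {u v} es Φ → ¬ Conn es u v → c es Φ ≡ bit (any? (conn? es u) Φ ×-dec any? (conn? es v) Φ) + c ((u , v) ∷ es) Φ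
    edge {u} {v} es Φ ¬uv = classes-edge (conn? es) (Conn-Equiv es) (conn? ((u , v) ∷ es)) u v id id ¬uv Φ

  c-∷-new : ∀ {u v} es {Φ} → u ∈ Φ → v ∈ Φ → ¬ Conn es u v → c es Φ ≡ suc (c ((u , v) ∷ es) Φ)
  c-∷-new {u} {v} es {Φ} u∈ v∈ ¬uv = trans (edge es Φ ¬uv) (cong (_+ c ((u , v) ∷ es) Φ)
    (bit-yes (any? (conn? es u) Φ ×-dec any? (conn? es v) Φ) (at u∈ , at v∈)))
    where
    at : ∀ {z l} → z ∈ l → Any (Conn es z) l
    at (here refl) = here (Conn-refl es)
    at (there i) = there (at i)

  c-∷-≥ : ∀ e es Φ → c es Φ ≤ suc (c (e ∷ es) Φ)
  c-∷-≥ (u , v) es Φ with conn? es u v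
  ... | yes uv = ≤-trans (≤-reflexive (sym (c-∷-conn es Φ uv))) (n≤1+n _)
  ... | no ¬uv = ≤-trans (≤-reflexive (edge es Φ ¬uv)) (+-monoˡ-≤ _ (bit≤1 (any? (conn? es u) Φ ×-dec any? (conn? es v) Φ)))

  comp : List (X × X) → X → X → Bool
  comp es p z = does (conn? es p z)

  comp-true : ∀ es {p z} → Conn es p z → comp es p z ≡ true
  comp-true es {p} {z} h with conn? es p z
  ... | yes _ = refl
  ... | no ¬h = ⊥-elim (¬h h)

  comp-false : ∀ es {p z} → ¬ Conn es p z → comp es p z ≡ false
  comp-false es {p} {z} ¬h with conn? es p z
  ... | yes h = ⊥-elim (¬h h)
  ... | no _ = refl

  comp-conn : ∀ es {p z} → comp es p z ≡ true → Conn es p z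
  comp-conn es {p} {z} e with conn? es p z
  ... | yes h = h
  comp-conn es {p} {z} () | no _

  comp-closed : ∀ es {p u v} → Conn es u v → comp es p u ≡ comp es p v
  comp-closed es {p} {u} {v} uv with conn? es p u
  ... | yes pu = sym (comp-true es (Conn-trans es pu uv))
  ... | no ¬pu = sym (comp-false es (λ pv → ¬pu (Conn-trans es pv (Conn-sym es uv))))

  par-comp : ∀ {Φ} a β O → flat a ↭ Φ → O ++ flat β ↭ Φ → ∀ p → par (comp (β ++ a) p) O ≡ false
  par-comp a β O pa pβ p = par-open (comp (β ++ a) p) a β O pa pβ
    (λ i → comp-closed (β ++ a) (Conn-∈ (β ++ a) (∈-++⁺ʳ β i)))
    (λ i → comp-closed (β ++ a) (Conn-∈ (β ++ a) (∈-++⁺ˡ i)))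

  -- The component of `p` contains an even number of the points missed by `β`, and `q` is the only
  -- other one.
  cycle : ∀ {Φ} a β {p q} → flat a ↭ Φ → p ∷ q ∷ flat β ↭ Φ → Conn (β ++ a) p q
  cycle a β {p} {q} pa pβ = comp-conn (β ++ a) (lem (par-comp a β (p ∷ q ∷ []) pa pβ p))
    where
    lem : comp (β ++ a) p p xor (comp (β ++ a) p q xor false) ≡ false → comp (β ++ a) p q ≡ true
    lem e rewrite comp-true (β ++ a) (Conn-refl (β ++ a) {p}) with comp (β ++ a) p q
    ... | true = refl

  -- Of the four loose ends, the component of `r` contains both or neither of `p` and `q`; evenness
  -- then leaves `s` for it.
  four : ∀ {Φ} a β {p q r s} → flat a ↭ Φ → p ∷ q ∷ r ∷ s ∷ flat β ↭ Φ → Conn (β ++ a) p q → Conn (β ++ a) r s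
  four a β {p} {q} {r} {s} pa pβ pq = comp-conn (β ++ a) (lem (par-comp a β (p ∷ q ∷ r ∷ s ∷ []) pa pβ r))
    where
    lem : comp (β ++ a) r p xor (comp (β ++ a) r q xor (comp (β ++ a) r r xor (comp (β ++ a) r s xor false))) ≡ false → comp (β ++ a) r s ≡ true
    lem e rewrite comp-true (β ++ a) (Conn-refl (β ++ a) {r}) | comp-closed (β ++ a) {r} pq with comp (β ++ a) r q | comp (β ++ a) r s
    ... | true  | true = refl
    ... | false | true = refl

  module _ {Φ : List X} (uΦ : Unique Φ) (a : List (X × X)) (pa : flat a ↭ Φ) where

    module _ (β : List (X × X)) {p q r s : X} (pβ : p ∷ q ∷ r ∷ s ∷ flat β ↭ Φ) where
      private
        W = β ++ a
        u4 : Unique (p ∷ q ∷ r ∷ s ∷ flat β)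
        u4 = Unique-resp-↭ (↭-sym pβ) uΦ
        pβ' : p ∷ r ∷ q ∷ s ∷ flat β ↭ Φ
        pβ' = ↭-trans (prep p (swap r q ↭-refl)) pβ
        old new : List (X × X)
        old = (p , q) ∷ (r , s) ∷ W
        new = (p , r) ∷ (q , s) ∷ W

        old≡ : c old Φ ≡ c ((r , s) ∷ W) Φ
        old≡ = c-∷-conn ((r , s) ∷ W) Φ (cycle a ((r , s) ∷ β) pa pβ)

        new≡ : c new Φ ≡ c ((q , s) ∷ W) Φ
        new≡ = c-∷-conn ((q , s) ∷ W) Φ (cycle a ((q , s) ∷ β) pa pβ')

      -- In either matching the pair that is added last joins the two ends of one path and merges
      -- nothing. So both counts are `c W Φ` or one less.
      break-≤ : c new Φ ≤ suc (c old Φ)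
      break-≤ = ≤-trans (≤-trans (≤-reflexive new≡) (c-∷-≤ (q , s) W Φ))
                (≤-trans (c-∷-≥ (r , s) W Φ) (s≤s (≤-reflexive (sym old≡))))

      -- Taking the two pairs out opens two different cycles into a path from `p` to `q` and one
      -- from `r` to `s`; the new pairs join these paths into one cycle.
      break-merge : ¬ Conn old p r → c old Φ ≡ suc (c new Φ)
      break-merge ¬pr = trans old≡ (trans (c-∷-conn W Φ rs) (trans (c-∷-new W q∈ s∈ ¬qs) (cong suc (sym new≡))))
        where
        ¬prW : ¬ Conn W p r
        ¬prW h = ¬pr (inj₁ (inj₁ h))
        ¬psW : ¬ Conn W p s
        ¬psW h = ¬pr (inj₁ (inj₂ (inj₂ (h , Conn-refl W))))
        pq : Conn W p q
        pq = comp-conn W (lem (par-comp a β (p ∷ q ∷ r ∷ s ∷ []) pa pβ p))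
          where
          lem : comp W p p xor (comp W p q xor (comp W p r xor (comp W p s xor false))) ≡ false → comp W p q ≡ true
          lem e rewrite comp-true W (Conn-refl W {p}) | comp-false W ¬prW | comp-false W ¬psW with comp W p q
          ... | true = refl
        rs : Conn W r s
        rs = four a β pa pβ pq
        ¬qs : ¬ Conn W q s
        ¬qs h = ¬psW (Conn-trans W pq h)
        q∈ : q ∈ Φ
        q∈ = ∈-resp-↭ pβ (there (here refl))
        s∈ : s ∈ Φ
        s∈ = ∈-resp-↭ pβ (there (there (there (here refl))))

      -- The hypothesis speaks of `W`, without the two pairs. It would not suffice that `p` and `r`
      -- lie on one cycle of `old`: if the path of `W` from `p` ended in `s`, the switch would leave
      -- a single cycle.
      break-split : Conn W p r → c new Φ ≡ suc (c old Φ)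
      break-split pr = trans (trans new≡ (c-∷-conn W Φ qs)) (trans (c-∷-new W r∈ s∈ ¬rs) (cong suc (sym old≡)))
        where
        qs : Conn W q s
        qs = four a β pa pβ' pr
        r∈ : r ∈ Φ
        r∈ = ∈-resp-↭ pβ (there (there (here refl)))
        s∈ : s ∈ Φ
        s∈ = ∈-resp-↭ pβ (there (there (there (here refl))))
        uβ : Unique (flat β)
        uβ = unique-tail (unique-tail (unique-tail (unique-tail u4)))
        ¬rs : ¬ Conn W r s
        ¬rs rs = path-ends a β (Unique-resp-↭ (↭-sym pa) uΦ) uβ {r} {p} {s}
          (λ i → unique-head (unique-tail (unique-tail u4)) (there i))
          (λ i → unique-head u4 (there (there (there i))))
          (unique-head (unique-tail (unique-tail (unique-tail u4))))
          (λ { refl → unique-head u4 (there (here refl)) })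
          (λ { refl → unique-head (unique-tail (unique-tail u4)) (here refl) })
          (λ { refl → unique-head u4 (there (there (here refl))) })
          (Conn-sym W pr) rs

-- Linear inequalities are obtained as a sum `L ≤ R` of hypotheses from which a common summand `k`
-- is cancelled; the two identities that remain are for the ring solver.
lin : ∀ {a b L R} k → L ≤ R → a + k ≡ L → R ≡ b + k → a ≤ b
lin {a} {b} k h e e' = +-cancelʳ-≤ k a b (≤-trans (≤-reflexive e) (≤-trans h (≤-reflexive e')))

-- Disjoint unions

interchange : ∀ {A : Set} (a b c d : List A) → (a ++ b) ++ (c ++ d) ↭ (a ++ c) ++ (b ++ d)
interchange a b c d = ↭-trans (↭-reflexive (++-assoc a b (c ++ d)))
  (↭-trans (++⁺ˡ a (shifts b c)) (↭-reflexive (sym (++-assoc a c (b ++ d)))))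

classes-++ : ∀ {X : Set} {R : X → X → Set} (R? : Decidable R) l l' → (∀ {p q} → p ∈ l → q ∈ l' → ¬ R p q) →
  classes R? (l ++ l') ≡ classes R? l + classes R? l'
classes-++ R? []      l' h = refl
classes-++ {R = R} R? (p ∷ l) l' h = trans (cong₂ _+_ (bitN-cong (any? (R? p) (l ++ l')) (any? (R? p) l) left anyˡ)
    (classes-++ R? l l' (h ∘ there))) (sym (+-assoc _ (classes R? l) (classes R? l')))
  where
  anyˡ : ∀ {l} → Any (R p) l → Any (R p) (l ++ l')
  anyˡ (here r) = here r
  anyˡ (there i) = there (anyˡ i)
  right : ∀ {l''} → (∀ {q} → q ∈ l'' → q ∈ l') → Any (R p) l'' → ⊥
  right s (here r) = h (here refl) (s (here refl)) r
  right s (there i) = right (s ∘ there) i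
  left : ∀ {l} → Any (R p) (l ++ l') → Any (R p) l
  left {[]} i = ⊥-elim (right id i)
  left {_ ∷ l} (here r) = here r
  left {_ ∷ l} (there i) = there (left i)

module Union {X : Set} (_≟_ : DecidableEquality X) where
  open Count _≟_ public

  _∈?_ : ∀ (z : X) l → Dec (z ∈ l)
  z ∈? l = any? (z ≟_) l

  module _ (es₁ es₂ : List (X × X)) {Φ₁ Φ₂ : List X}
           (s₁ : ∀ {z} → z ∈ flat es₁ → z ∈ Φ₁) (s₂ : ∀ {z} → z ∈ flat es₂ → z ∈ Φ₂)
           (dj : ∀ {z} → z ∈ Φ₁ → z ∈ Φ₂ → ⊥) where

    -- Where a chain passes from one list to the other, the meeting point is missed by one of them,
    -- so that part of the chain is trivial.
    Conn-union : ∀ {p q} → Conn (es₁ ++ es₂) p q → Conn es₁ p q ⊎ Conn es₂ p q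
    Conn-union = Conn-least (record
      { rfl = inj₁ (Conn-refl es₁)
      ; sm  = λ { (inj₁ h) → inj₁ (Conn-sym es₁ h) ; (inj₂ h) → inj₂ (Conn-sym es₂ h) }
      ; tr  = tr }) (es₁ ++ es₂) (λ i → ed (∈-++⁻ es₁ i))
      where
      ed : ∀ {u v} → (u , v) ∈ es₁ ⊎ (u , v) ∈ es₂ → Conn es₁ u v ⊎ Conn es₂ u v
      ed (inj₁ i) = inj₁ (Conn-∈ es₁ i)
      ed (inj₂ i) = inj₂ (Conn-∈ es₂ i)
      tr : ∀ {p q r} → Conn es₁ p q ⊎ Conn es₂ p q → Conn es₁ q r ⊎ Conn es₂ q r → Conn es₁ p r ⊎ Conn es₂ p r
      tr (inj₁ a) (inj₁ b) = inj₁ (Conn-trans es₁ a b)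
      tr (inj₂ a) (inj₂ b) = inj₂ (Conn-trans es₂ a b)
      tr {p} {q} (inj₁ a) (inj₂ b) with q ∈? flat es₁
      ... | no q∉ with refl ← Conn-∉ es₁ q∉ (Conn-sym es₁ a) = inj₂ b
      ... | yes q∈ with refl ← Conn-∉ es₂ (λ i → dj (s₁ q∈) (s₂ i)) b = inj₁ a
      tr {p} {q} (inj₂ a) (inj₁ b) with q ∈? flat es₁
      ... | no q∉ with refl ← Conn-∉ es₁ q∉ b = inj₂ a
      ... | yes q∈ with refl ← Conn-∉ es₂ (λ i → dj (s₁ q∈) (s₂ i)) (Conn-sym es₂ a) = inj₁ b

    Conn-unionˡ : ∀ {p q} → p ∈ Φ₁ → Conn (es₁ ++ es₂) p q → Conn es₁ p q
    Conn-unionˡ p∈ h with Conn-union h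
    ... | inj₁ a = a
    ... | inj₂ b with refl ← Conn-∉ es₂ (λ i → dj p∈ (s₂ i)) b = Conn-refl es₁

    Conn-unionʳ : ∀ {p q} → p ∈ Φ₂ → Conn (es₁ ++ es₂) p q → Conn es₂ p q
    Conn-unionʳ p∈ h with Conn-union h
    ... | inj₁ a with refl ← Conn-∉ es₁ (λ i → dj (s₁ i) p∈) a = Conn-refl es₂
    ... | inj₂ b = b

    Conn-cross : ∀ {p q} → p ∈ Φ₁ → q ∈ Φ₂ → ¬ Conn (es₁ ++ es₂) p q
    Conn-cross p∈ q∈ h with refl ← Conn-∉ es₁ (λ i → dj (s₁ i) q∈) (Conn-sym es₁ (Conn-unionˡ p∈ h)) = dj p∈ q∈

    opaque
      unfolding c

      c-union : c (es₁ ++ es₂) (Φ₁ ++ Φ₂) ≡ c es₁ Φ₁ + c es₂ Φ₂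
      c-union = trans (classes-++ (conn? (es₁ ++ es₂)) Φ₁ Φ₂ Conn-cross)
        (cong₂ _+_
          (classes-cong (conn? (es₁ ++ es₂)) (conn? es₁) Φ₁ (λ p∈ _ → Conn-unionˡ p∈) (λ _ _ → Conn-++ˡ {es = es₁}))
          (classes-cong (conn? (es₁ ++ es₂)) (conn? es₂) Φ₂ (λ p∈ _ → Conn-unionʳ p∈) (λ _ _ → Conn-++ʳ es₁)))

  opaque
    unfolding c

    c-[] : ∀ {Φ} → Unique Φ → c [] Φ ≡ length Φ
    c-[] {[]} u = refl
    c-[] {p ∷ Φ} u = cong₂ _+_ (bitN-no (any? (p ≟_) Φ) (unique-head u)) (c-[] (unique-tail u))

    c-pos : ∀ es {Φ z} → z ∈ Φ → 1 ≤ c es Φ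
    c-pos es {p ∷ []} _ = ≤-refl
    c-pos es {p ∷ r ∷ Φ} _ = ≤-trans (c-pos es {r ∷ Φ} (here refl)) (m≤n+m (c es (r ∷ Φ)) (bitN (any? (conn? es p) (r ∷ Φ))))

-- Flag systems

record Sys (X : Set) : Set where
  constructor sys
  field
    Φ   : List X
    m α : List (X × X)
open Sys public

infixr 5 _⊕_
_⊕_ : ∀ {X} → Sys X → Sys X → Sys X
S ⊕ T = sys (Φ S ++ Φ T) (m S ++ m T) (α S ++ α T)

-- The four flags of an edge: p, p′ at one end and q, q′ at the other; p, q lie on one side of the edge.
record Quad (X : Set) : Set where
  constructor quad
  field
    p p′ q q′ : X

edgeSys : ∀ {X} → Quad X → Sys X
edgeSys (quad p p′ q q′) = sys (p ∷ p′ ∷ q ∷ q′ ∷ []) ((p , q) ∷ (p′ , q′) ∷ []) ((p , p′) ∷ (q , q′) ∷ [])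

infixr 5 _◂_
_◂_ : ∀ {X} → Quad X → Sys X → Sys X
e ◂ S = edgeSys e ⊕ S

-- Corner matchings of a flag system

module Emb {X V : Set} (_≟_ : DecidableEquality X) (_≟V_ : DecidableEquality V) (χ : X → V) where
  open Union _≟_ public

  Resp : List (X × X) → Set
  Resp es = ∀ {u v} → (u , v) ∈ es → χ u ≡ χ v

  record WF (S : Sys X) : Set where
    field
      uniq : Unique (Φ S)
      pm   : flat (m S) ↭ Φ S
      pα   : flat (α S) ↭ Φ S
      rα   : Resp (α S)
  open WF public

  record Valid (S : Sys X) (β : List (X × X)) : Set where
    field
      pβ : flat β ↭ Φ S
      rβ : Resp β
  open Valid public

  M A : Sys X → List (X × X) → ℕ
  M S β = c (β ++ m S) (Φ S)
  A S β = c (β ++ α S) (Φ S)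

  -- The maximum D(S) of M − A over all valid matchings is at least i − j.
  Ach : Sys X → ℕ → ℕ → Set
  Ach S i j = ∃ λ β → Valid S β × A S β + i ≤ M S β + j

  Resp-InE : ∀ {es} → Resp es → ∀ {u v} → InE es u v → χ u ≡ χ v
  Resp-InE r (inj₁ i) = r i
  Resp-InE r (inj₂ i) = sym (r i)

  Resp-++ : ∀ {es fs} → Resp es → Resp fs → Resp (es ++ fs)
  Resp-++ {es} r s i with ∈-++⁻ es i
  ... | inj₁ j = r j
  ... | inj₂ j = s j

  Valid-≅ : ∀ {S β γ} → β ≅ γ → Valid S β → Valid S γ
  Valid-≅ h v = record { pβ = ↭-trans (↭-sym (perm h)) (pβ v) ; rβ = Resp-InE (rβ v) ∘ from h }

  M-≅ : ∀ S {β γ} → β ≅ γ → M S β ≡ M S γ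
  M-≅ S h = c-≅ (Φ S) (≅-++ h ≅-refl)

  A-≅ : ∀ S {β γ} → β ≅ γ → A S β ≡ A S γ
  A-≅ S h = c-≅ (Φ S) (≅-++ h ≅-refl)

  Disj : Sys X → Sys X → Set
  Disj S T = ∀ {z} → z ∈ Φ S → z ∈ Φ T → ⊥

  WF-⊕ : ∀ {S T} → WF S → WF T → Disj S T → WF (S ⊕ T)
  WF-⊕ {S} {T} w v d = record
    { uniq = Uniq.++⁺ (uniq w) (uniq v) (λ (i , j) → d i j)
    ; pm = ↭-trans (↭-reflexive (flat-++ (m S) (m T))) (++⁺ (pm w) (pm v))
    ; pα = ↭-trans (↭-reflexive (flat-++ (α S) (α T))) (++⁺ (pα w) (pα v))
    ; rα = Resp-++ {α S} (rα w) (rα v) }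

  private
    sub : ∀ {β a : List (X × X)} {Φ : List X} → flat β ↭ Φ → flat a ↭ Φ → ∀ {z} → z ∈ flat (β ++ a) → z ∈ Φ
    sub {β} {a} pβ pa i with ∈-++⁻ (flat β) (subst (_ ∈_) (flat-++ β a) i)
    ... | inj₁ j = ∈-resp-↭ pβ j
    ... | inj₂ j = ∈-resp-↭ pa j

  module _ {S T : Sys X} (w : WF S) (v : WF T) (d : Disj S T) where

    Valid-⊕ : ∀ {β γ} → Valid S β → Valid T γ → Valid (S ⊕ T) (β ++ γ)
    Valid-⊕ {β} {γ} b g = record
      { pβ = ↭-trans (↭-reflexive (flat-++ β γ)) (++⁺ (pβ b) (pβ g)) ; rβ = Resp-++ {β} (rβ b) (rβ g) }

    M-⊕ : ∀ {β γ} → Valid S β → Valid T γ → M (S ⊕ T) (β ++ γ) ≡ M S β + M T γ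
    M-⊕ {β} {γ} b g = trans (c-≅ (Φ (S ⊕ T)) (↭⇒≅ (interchange β γ (m S) (m T))))
      (c-union (β ++ m S) (γ ++ m T) (sub {β} (pβ b) (pm w)) (sub {γ} (pβ g) (pm v)) d)

    A-⊕ : ∀ {β γ} → Valid S β → Valid T γ → A (S ⊕ T) (β ++ γ) ≡ A S β + A T γ
    A-⊕ {β} {γ} b g = trans (c-≅ (Φ (S ⊕ T)) (↭⇒≅ (interchange β γ (α S) (α T))))
      (c-union (β ++ α S) (γ ++ α T) (sub {β} (pβ b) (pα w)) (sub {γ} (pβ g) (pα v)) d)

    Conn-⊕-cross : ∀ {β γ} → Valid S β → Valid T γ → ∀ {p q} → p ∈ Φ S → q ∈ Φ T →
      ¬ Conn ((β ++ γ) ++ m (S ⊕ T)) p q × ¬ Conn ((β ++ γ) ++ α (S ⊕ T)) p q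
    Conn-⊕-cross {β} {γ} b g p∈ q∈ =
      Conn-cross (β ++ m S) (γ ++ m T) (sub {β} (pβ b) (pm w)) (sub {γ} (pβ g) (pm v)) d p∈ q∈
        ∘ Conn-≅ (↭⇒≅ (interchange β γ (m S) (m T))) ,
      Conn-cross (β ++ α S) (γ ++ α T) (sub {β} (pβ b) (pα w)) (sub {γ} (pβ g) (pα v)) d p∈ q∈
        ∘ Conn-≅ (↭⇒≅ (interchange β γ (α S) (α T)))

    Ach-⊕ : ∀ {i j i' j'} → Ach S i j → Ach T i' j' → Ach (S ⊕ T) (i + i') (j + j')
    Ach-⊕ {i} {j} {i'} {j'} (β , b , h) (γ , g , h') = β ++ γ , Valid-⊕ b g ,
      subst₂ _≤_ (trans (eq (A S β) i (A T γ) i') (cong (_+ (i + i')) (sym (A-⊕ b g))))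
                 (trans (eq (M S β) j (M T γ) j') (cong (_+ (j + j')) (sym (M-⊕ b g))))
                 (+-mono-≤ h h')
      where
      eq : ∀ a b c d → a + b + (c + d) ≡ a + c + (b + d)
      eq = solve-∀

  module _ {S : Sys X} (w : WF S) where

    break-valid : ∀ {p a r b β} → Valid S ((p , a) ∷ (r , b) ∷ β) → χ p ≡ χ r → Valid S ((p , r) ∷ (a , b) ∷ β)
    break-valid {p} {a} {r} {b} v e = record
      { pβ = ↭-trans (prep p (swap r a ↭-refl)) (pβ v)
      ; rβ = λ { (here refl) → e
               ; (there (here refl)) → trans (sym (rβ v (here refl))) (trans e (rβ v (there (here refl))))
               ; (there (there i)) → rβ v (there (there i)) } }

    break-A : ∀ {p a r b β} → Valid S ((p , a) ∷ (r , b) ∷ β) → A S ((p , r) ∷ (a , b) ∷ β) ≤ suc (A S ((p , a) ∷ (r , b) ∷ β))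
    break-A {β = β} v = break-≤ (uniq w) (α S) (pα w) β (pβ v)

    break-M : ∀ {p a r b β} → Valid S ((p , a) ∷ (r , b) ∷ β) → M S ((p , a) ∷ (r , b) ∷ β) ≤ suc (M S ((p , r) ∷ (a , b) ∷ β))
    break-M {p} {a} {r} {b} {β} v = break-≤ (uniq w) (m S) (pm w) β (↭-trans (prep p (swap r a ↭-refl)) (pβ v))

    -- These are the embeddings in the usual sense: the corners at each vertex form one cycle, its
    -- rotation.
    Strict : List (X × X) → Set
    Strict β = ∀ p q → p ∈ Φ S → q ∈ Φ S → χ p ≡ χ q → Conn (β ++ α S) p q

    -- Two corner cycles at the same vertex are merged by a switch that lowers `A` by exactly one
    -- and `M` by at most one, so `M - A` does not fall. As `A` decreases, it bounds the number of
    -- switches.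
    strictify : ∀ fuel β → Valid S β → A S β ≤ fuel →
      ∃ λ β' → Valid S β' × A S β' + M S β ≤ A S β + M S β' × Strict β'
    strictify fuel β v f with any? (λ p → any? (λ r → (χ p ≟V χ r) ×-dec ¬? (conn? (β ++ α S) p r)) (Φ S)) (Φ S)
    ... | no none = β , v , ≤-refl , str
      where
      str : Strict β
      str p q p∈ q∈ e with conn? (β ++ α S) p q
      ... | yes h = h
      ... | no ¬h = ⊥-elim (none (any∈ p∈ (any∈ q∈ (e , ¬h))))
        where
        any∈ : ∀ {P : X → Set} {z l} → z ∈ l → P z → Any P l
        any∈ (here refl) h = here h
        any∈ (there i) h = there (any∈ i h)
    ... | yes some = go (find some)
      where
      Goal = ∃ λ β' → Valid S β' × A S β' + M S β ≤ A S β + M S β' × Strict β'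
      find : ∀ {P : X → Set} {l} → Any P l → ∃ λ z → z ∈ l × P z
      find (here h) = _ , here refl , h
      find (there i) with find i
      ... | z , z∈ , h = z , there z∈ , h
      go : (∃ λ p → p ∈ Φ S × Any (λ r → χ p ≡ χ r × ¬ Conn (β ++ α S) p r) (Φ S)) → Goal
      go (p , p∈ , i) with find i
      ... | r , r∈ , e , ¬pr with extract₂ β (λ { refl → ¬pr (Conn-refl (β ++ α S)) }) (∈-resp-↭ (↭-sym (pβ v)) p∈) (∈-resp-↭ (↭-sym (pβ v)) r∈)
      ... | inj₁ (β' , h) = ⊥-elim (¬pr (Conn-++ˡ {es = β} (Conn-InE β (from h (here refl)))))
      ... | inj₂ (a , b , β' , h) = step fuel f
        where
        old new : List (X × X)
        old = (p , a) ∷ (r , b) ∷ β'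
        new = (p , r) ∷ (a , b) ∷ β'
        vo : Valid S old
        vo = Valid-≅ h v
        eA : A S β ≡ suc (A S new)
        eA = trans (A-≅ S h) (break-merge (uniq w) (α S) (pα w) β' (pβ vo)
               (¬pr ∘ Conn-≅ (≅-++ (≅-sym h) ≅-refl)))
        eM : M S β ≤ suc (M S new)
        eM = ≤-trans (≤-reflexive (M-≅ S h)) (break-M vo)
        step : ∀ fuel → A S β ≤ fuel → Goal
        step zero f = ⊥-elim (λ0 (subst (_≤ 0) eA f))
          where
          λ0 : ∀ {k} → ¬ suc k ≤ 0
          λ0 ()
        step (suc fuel) f with strictify fuel new (break-valid vo e) (s≤s⁻¹ (subst (_≤ suc fuel) eA f))
        ... | β'' , v'' , le , st = β'' , v'' ,
          lin (M S new) (+-mono-≤ le eM) (eq₁ (A S β'') (M S β) (M S new))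
            (trans (eq₂ (A S new) (M S β'') (M S new)) (cong (λ k → k + M S β'' + M S new) (sym eA))) , st
          where
          eq₁ : ∀ a b c → a + b + c ≡ a + c + b
          eq₁ = solve-∀
          eq₂ : ∀ a b c → a + b + suc c ≡ suc a + b + c
          eq₂ = solve-∀

-- Deleting, gluing and joining edges

delete-arith : ∀ a b A⁺ M⁺ A₁ M₁ i j → 2 + a + M₁ ≤ A₁ + (1 + b) → A₁ ≤ suc A⁺ → M⁺ ≤ suc M₁ → A⁺ + i ≤ M⁺ + j → a + i ≤ b + suc j
delete-arith a b A⁺ M⁺ A₁ M₁ i j h₂ hA hM h =
  lin (2 + M⁺ + M₁ + A₁ + A⁺) (+-mono-≤ (+-mono-≤ h₂ hA) (+-mono-≤ hM h)) (eq₁ a i M⁺ M₁ A₁ A⁺) (eq₂ b j M⁺ M₁ A₁ A⁺)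
  where
  eq₁ : ∀ a i M⁺ M₁ A₁ A⁺ → a + i + (2 + M⁺ + M₁ + A₁ + A⁺) ≡ 2 + a + M₁ + A₁ + (M⁺ + (A⁺ + i))
  eq₁ = solve-∀
  eq₂ : ∀ b j M⁺ M₁ A₁ A⁺ → A₁ + (1 + b) + suc A⁺ + (suc M₁ + (M⁺ + j)) ≡ b + suc j + (2 + M⁺ + M₁ + A₁ + A⁺)
  eq₂ = solve-∀

bridge-arith : ∀ a b A⁺ M⁺ A₁ M₁ i j → 2 + a + M₁ ≤ A₁ + (1 + b) → A₁ + M⁺ ≤ A⁺ + M₁ → A⁺ + i ≤ M⁺ + j → a + suc i ≤ b + j
bridge-arith a b A⁺ M⁺ A₁ M₁ i j h₂ hs h =
  lin (1 + M⁺ + M₁ + A₁ + A⁺) (+-mono-≤ (+-mono-≤ h₂ hs) h) (eq₁ a i M⁺ M₁ A₁ A⁺) (eq₂ b j M⁺ M₁ A₁ A⁺)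
  where
  eq₁ : ∀ a i M⁺ M₁ A₁ A⁺ → a + suc i + (1 + M⁺ + M₁ + A₁ + A⁺) ≡ 2 + a + M₁ + (A₁ + M⁺) + (A⁺ + i)
  eq₁ = solve-∀
  eq₂ : ∀ b j M⁺ M₁ A₁ A⁺ → A₁ + (1 + b) + (A⁺ + M₁) + (M⁺ + j) ≡ b + j + (1 + M⁺ + M₁ + A₁ + A⁺)
  eq₂ = solve-∀

module Surgery {X V : Set} (_≟_ : DecidableEquality X) (_≟V_ : DecidableEquality V) (χ : X → V) where
  open Emb _≟_ _≟V_ χ public

  shift₂ : ∀ (δ : List (X × X)) e f γ → δ ++ e ∷ f ∷ γ ≅ e ∷ f ∷ (δ ++ γ)
  shift₂ δ e f γ = ↭⇒≅ (↭-trans (shift e δ (f ∷ γ)) (prep e (shift f δ γ)))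

  module _ {S : Sys X} (w : WF S) where

    -- `δ` holds pairs placed earlier, which have to survive. In general making the pair `(p , r)`
    -- may cost two, one in `A` and one in `M`. The last component is the free case: if `p` and `r`
    -- are joined by a face path that uses neither of their corners, the switch splits a face and so
    -- pays for the loss in `A`.
    isolate : ∀ δ β {p r} → Valid S (δ ++ β) → p ≢ r → p ∈ flat β → r ∈ flat β → χ p ≡ χ r →
      ∃ λ β' → Valid S (δ ++ (p , r) ∷ β')
        × A S (δ ++ (p , r) ∷ β') ≤ suc (A S (δ ++ β)) × M S (δ ++ β) ≤ suc (M S (δ ++ (p , r) ∷ β'))
        × ((∀ a b γ → δ ++ β ≅ (p , a) ∷ (r , b) ∷ (δ ++ γ) → Conn ((δ ++ γ) ++ m S) p r) →
            A S (δ ++ (p , r) ∷ β') + M S (δ ++ β) ≤ A S (δ ++ β) + M S (δ ++ (p , r) ∷ β'))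
    isolate δ β {p} {r} v p≢r p∈ r∈ e with extract₂ β p≢r p∈ r∈
    ... | inj₁ (β' , h) = β' , Valid-≅ h' v , ≤-trans (≤-reflexive (sym eA)) (n≤1+n _) , ≤-trans (≤-reflexive eM) (n≤1+n _) ,
          λ _ → ≤-reflexive (cong₂ _+_ (sym eA) eM)
      where
      h' : δ ++ β ≅ δ ++ (p , r) ∷ β'
      h' = ≅-++ˡ δ h
      eA = A-≅ S h'
      eM = M-≅ S h'
    ... | inj₂ (a , b , γ , h) = (a , b) ∷ γ , Valid-≅ (≅-sym n) (break-valid w vo e) ,
          ≤-trans (≤-reflexive (A-≅ S n)) (≤-trans (break-A w vo) (s≤s (≤-reflexive (sym (A-≅ S o))))) ,
          ≤-trans (≤-reflexive (M-≅ S o)) (≤-trans (break-M w vo) (s≤s (≤-reflexive (sym (M-≅ S n))))) ,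
          sp
      where
      old new : List (X × X)
      old = (p , a) ∷ (r , b) ∷ (δ ++ γ)
      new = (p , r) ∷ (a , b) ∷ (δ ++ γ)
      o : δ ++ β ≅ old
      o = ≅-trans (≅-++ˡ δ h) (shift₂ δ (p , a) (r , b) γ)
      n : δ ++ (p , r) ∷ (a , b) ∷ γ ≅ new
      n = shift₂ δ (p , r) (a , b) γ
      vo : Valid S old
      vo = Valid-≅ o v
      sp : (∀ a b γ → δ ++ β ≅ (p , a) ∷ (r , b) ∷ (δ ++ γ) → Conn ((δ ++ γ) ++ m S) p r) → _
      sp H = subst₂ _≤_ (cong₂ _+_ (sym (A-≅ S n)) (sym (M-≅ S o))) (cong₂ _+_ (sym (A-≅ S o)) (sym (M-≅ S n)))
        (≤-trans (+-monoˡ-≤ (M S old) (break-A w vo)) (≤-reflexive (trans (sym (+-suc (A S old) (M S old)))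
          (cong (A S old +_) (sym (break-split (uniq w) (m S) (pm w) (δ ++ γ) (pβ vo) (H a b γ o)))))))

  record EdgeOK (e : Quad X) : Set where
    open Quad e
    field
      uq : Unique (p ∷ p′ ∷ q ∷ q′ ∷ [])
      χp : χ p ≡ χ p′
      χq : χ q ≡ χ q′
  open EdgeOK public

  module _ {e : Quad X} (ok : EdgeOK e) where
    open Quad e
    private
      p≢p′ : p ≢ p′
      p≢p′ refl = unique-head (uq ok) (here refl)
      p≢q : p ≢ q
      p≢q refl = unique-head (uq ok) (there (here refl))
      p≢q′ : p ≢ q′
      p≢q′ refl = unique-head (uq ok) (there (there (here refl)))
      p′≢q : p′ ≢ q
      p′≢q refl = unique-head (unique-tail (uq ok)) (here refl)
      p′≢q′ : p′ ≢ q′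
      p′≢q′ refl = unique-head (unique-tail (uq ok)) (there (here refl))
      q≢q′ : q ≢ q′
      q≢q′ refl = unique-head (unique-tail (unique-tail (uq ok))) (here refl)
      ∈p : p ∈ Φ (edgeSys e)
      ∈p = here refl
      ∈p′ : p′ ∈ Φ (edgeSys e)
      ∈p′ = there (here refl)
      ∈q : q ∈ Φ (edgeSys e)
      ∈q = there (there (here refl))
      ∈q′ : q′ ∈ Φ (edgeSys e)
      ∈q′ = there (there (there (here refl)))

    WF-edge : WF (edgeSys e)
    WF-edge = record { uniq = uq ok ; pm = prep p (swap q p′ ↭-refl) ; pα = ↭-refl
                     ; rα = λ { (here refl) → χp ok ; (there (here refl)) → χq ok } }

    Valid-edge : Valid (edgeSys e) (α (edgeSys e))
    Valid-edge = record { pβ = ↭-refl ; rβ = rα WF-edge }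

    c-α-edge : c (α (edgeSys e)) (Φ (edgeSys e)) ≡ 2
    c-α-edge = suc-injective (trans (sym (c-∷-new ((q , q′) ∷ []) ∈p ∈p′ λ h → p≢p′ (Conn-∉ ((q , q′) ∷ []) (λ { (here e) → p≢q e ; (there (here e)) → p≢q′ e }) h)))
           (suc-injective (trans (sym (c-∷-new [] ∈q ∈q′ q≢q′)) (c-[] (uq ok)))))
    c-m-edge : c (m (edgeSys e)) (Φ (edgeSys e)) ≡ 2
    c-m-edge = suc-injective (trans (sym (c-∷-new ((p′ , q′) ∷ []) ∈p ∈q λ h → p≢q (Conn-∉ ((p′ , q′) ∷ []) (λ { (here e) → p≢p′ e ; (there (here e)) → p≢q′ e }) h)))
           (suc-injective (trans (sym (c-∷-new [] ∈p′ ∈q′ p′≢q′)) (c-[] (uq ok)))))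

    A-edge : A (edgeSys e) (α (edgeSys e)) ≡ 2
    A-edge = trans (c-∷-conn ((q , q′) ∷ αs) Φs (inj₁ (Conn-∈ αs (here refl))))
             (trans (c-∷-conn αs Φs (Conn-∈ αs (there (here refl)))) c-α-edge)
      where
      αs = α (edgeSys e)
      Φs = Φ (edgeSys e)

    M-edge : M (edgeSys e) (α (edgeSys e)) ≡ 1
    M-edge = trans (c-∷-conn ((q , q′) ∷ ms) Φs (Conn-trans ((q , q′) ∷ ms) (Conn-∈ ((q , q′) ∷ ms) (there (here refl)))
                      (Conn-trans ((q , q′) ∷ ms) (Conn-∈ ((q , q′) ∷ ms) (here refl)) (Conn-sym ((q , q′) ∷ ms) (Conn-∈ ((q , q′) ∷ ms) (there (there (here refl))))))))
             (suc-injective (trans (sym (c-∷-new ms ∈q ∈q′ ¬qq′)) c-m-edge))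
      where
      ms = m (edgeSys e)
      Φs = Φ (edgeSys e)
      ¬qq′ : ¬ Conn ms q q′
      ¬qq′ = matching-pairs ms (Unique-resp-↭ (↭-sym (pm WF-edge)) (uq ok)) (p≢q ∘ sym) q≢q′ p≢q′ (Conn-sym ms (Conn-∈ ms (here refl)))

    -- With the sides themselves as corners both ends fall into one corner cycle: the edge becomes a
    -- loop in the sphere, with two faces. This is of use only where the vertices are ignored.
    AM-edge : A (edgeSys e) (m (edgeSys e)) ≡ 1 × M (edgeSys e) (m (edgeSys e)) ≡ 2
    AM-edge = trans (c-≅ Φs (↭⇒≅ (++-comm ms αs))) M-edge ,
      trans (c-∷-conn ((p′ , q′) ∷ ms) Φs (inj₁ (Conn-∈ ms (here refl))))
             (trans (c-∷-conn ms Φs (Conn-∈ ms (there (here refl)))) c-m-edge)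
      where
      αs = α (edgeSys e)
      ms = m (edgeSys e)
      Φs = Φ (edgeSys e)

    -- An edge drawn in the sphere has one face and two vertices.
    Ach-edge : Ach (edgeSys e) 0 1
    Ach-edge = α (edgeSys e) , Valid-edge , ≤-reflexive (trans (cong (_+ 0) A-edge) (cong (_+ 1) (sym M-edge)))

    module _ {S : Sys X} (w : WF S) (d : Disj (edgeSys e) S) where

      WF-◂ : WF (e ◂ S)
      WF-◂ = WF-⊕ WF-edge w d

      private
        pull : ∀ {β} → Valid (e ◂ S) ((p , p′) ∷ (q , q′) ∷ β) → Valid S β
        pull v = record { pβ = drop-∷ (drop-∷ (drop-∷ (drop-∷ (pβ v)))) ; rβ = λ i → rβ v (there (there i)) }

        M-pull : ∀ {β} (v : Valid (e ◂ S) ((p , p′) ∷ (q , q′) ∷ β)) → M (e ◂ S) ((p , p′) ∷ (q , q′) ∷ β) ≡ 1 + M S β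
        M-pull {β} v = trans (M-⊕ WF-edge w d Valid-edge (pull v)) (cong (_+ M S β) M-edge)

        A-pull : ∀ {β} (v : Valid (e ◂ S) ((p , p′) ∷ (q , q′) ∷ β)) → A (e ◂ S) ((p , p′) ∷ (q , q′) ∷ β) ≡ 2 + A S β
        A-pull {β} v = trans (A-⊕ WF-edge w d Valid-edge (pull v)) (cong (_+ A S β) A-edge)

        rest : ∀ {β} → Valid (e ◂ S) ((p , p′) ∷ β) → q ∈ flat β × q′ ∈ flat β
        rest {β} v = r q (there (there (here refl))) (p≢q ∘ sym) (p′≢q ∘ sym) ,
                 r q′ (there (there (there (here refl)))) (p≢q′ ∘ sym) (p′≢q′ ∘ sym)
          where
          r : ∀ z → z ∈ Φ (e ◂ S) → z ≢ p → z ≢ p′ → z ∈ flat β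
          r z z∈ z≢p z≢p′ with ∈-resp-↭ (↭-sym (pβ v)) z∈
          ... | here h = ⊥-elim (z≢p h)
          ... | there (here h) = ⊥-elim (z≢p′ h)
          ... | there (there i) = i

        -- Once `p` and `p′` form a corner, the walk `q`, `p`, `p′`, `q′` avoids the corners of `q`
        -- and `q′`, so pairing these two is the free case of `isolate`. The edge is then a
        -- component of its own, with two corner cycles and one face; hence the constants 2 and 1.
        second : ∀ {β} → Valid (e ◂ S) ((p , p′) ∷ β) →
          ∃ λ β' → Valid S β' × 2 + A S β' + M (e ◂ S) ((p , p′) ∷ β) ≤ A (e ◂ S) ((p , p′) ∷ β) + (1 + M S β')
        second {β} v with isolate WF-◂ ((p , p′) ∷ []) β v q≢q′ (proj₁ (rest v)) (proj₂ (rest v)) (χq ok)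
        ... | β' , v' , _ , _ , sp = β' , pull v' , subst₂ _≤_ (cong (_+ _) (A-pull v')) (cong (_ +_) (M-pull v'))
              (sp λ a b γ _ → Conn-trans (K γ) (Conn-sym (K γ) (Conn-∈ (K γ) (∈-++⁺ʳ ((p , p′) ∷ γ) (here refl))))
                 (Conn-trans (K γ) (Conn-∈ (K γ) (here refl)) (Conn-∈ (K γ) (∈-++⁺ʳ ((p , p′) ∷ γ) (there (here refl))))))
          where
          K : List (X × X) → List (X × X)
          K γ = ((p , p′) ∷ γ) ++ m (e ◂ S)

        inside : ∀ {β} → Valid (e ◂ S) β → p ∈ flat β × p′ ∈ flat β
        inside v = ∈-resp-↭ (↭-sym (pβ v)) (here refl) , ∈-resp-↭ (↭-sym (pβ v)) (there (here refl))

      -- Pairing `p` with `p′` costs at most two and pairing `q` with `q′` nothing; removing the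
      -- isolated edge, with its one face and two corner cycles, wins one back.
      delete : ∀ {i j} → Ach (e ◂ S) i j → Ach S i (suc j)
      delete {i} {j} (β , v , h) =
        case isolate WF-◂ [] β v p≢p′ (proj₁ (inside v)) (proj₂ (inside v)) (χp ok) of λ { (β₁ , v₁ , hA , hM , _) →
        case second v₁ of λ { (β₂ , v₂ , h₂) →
          β₂ , v₂ , delete-arith (A S β₂) (M S β₂) (A (e ◂ S) β) (M (e ◂ S) β) _ _ i j h₂ hA hM h } }

      -- The sides of an edge whose ends are separated by the remaining edges lie on one face.
      delete-bridge : (f : V → Bool) → f (χ p) ≢ f (χ q) → (∀ {u v} → (u , v) ∈ m S → f (χ u) ≡ f (χ v)) →
        ∀ {i j} → Ach (e ◂ S) i j → Ach S (suc i) j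
      delete-bridge f f≢ fm {i} {j} (β , v , h) =
        case isolate WF-◂ [] β v p≢p′ (proj₁ (inside v)) (proj₂ (inside v)) (χp ok) of λ { (β₁ , v₁ , _ , _ , sp) →
        case second v₁ of λ { (β₂ , v₂ , h₂) →
          β₂ , v₂ , bridge-arith (A S β₂) (M S β₂) (A (e ◂ S) β) (M (e ◂ S) β) _ _ i j h₂ (sp conn) h } }
        where
        conn : ∀ a b γ → β ≅ (p , a) ∷ (p′ , b) ∷ γ → Conn (γ ++ m (e ◂ S)) p p′
        conn a b γ o = Conn-trans K (Conn-∈ K (∈-++⁺ʳ γ (here refl))) (Conn-trans K
            (Conn-⊆ {es = W} {es' = K} incl (comp-conn W gq′)) (Conn-sym K (Conn-∈ K (∈-++⁺ʳ γ (there (here refl))))))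
          where
          K W : List (X × X)
          K = γ ++ m (e ◂ S)
          W = γ ++ m S
          incl : ∀ {u v} → (u , v) ∈ W → (u , v) ∈ K
          incl i with ∈-++⁻ γ i
          ... | inj₁ j = ∈-++⁺ˡ j
          ... | inj₂ j = ∈-++⁺ʳ γ (there (there j))
          vo : Valid (e ◂ S) ((p , a) ∷ (p′ , b) ∷ γ)
          vo = Valid-≅ o v
          g : X → Bool
          g = comp W q
          g-false : ∀ {z} → f (χ z) ≡ f (χ p) → g z ≡ false
          g-false {z} e = comp-false W (λ h → f≢ (trans (sym e) (sym (Conn-respects (f ∘ χ) W rW h))))
            where
            rW : ∀ {u v} → (u , v) ∈ W → f (χ u) ≡ f (χ v)
            rW i with ∈-++⁻ γ i
            ... | inj₁ j = cong f (rβ vo (there (there j)))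
            ... | inj₂ j = fm j
          cl : ∀ {u v} → (u , v) ∈ W → g u ≡ g v
          cl i = comp-closed W (Conn-∈ W i)
          pp′ = χp ok
          -- The component of `q` is counted modulo two, once along the sides and once along the
          -- corners. The flags `p`, `p′`, `a` and `b` lie at the other end of the edge, hence
          -- outside it, so `q` can only be balanced by `q′`.
          gq′ : g q′ ≡ true
          gq′ = lem (trans (par-↭ g (prep p (prep p′ (prep q (prep q′ (pm w))))))
                     (sym (par-↭ g (pβ vo))))
            where
            lem : par g (p ∷ p′ ∷ q ∷ q′ ∷ flat (m S)) ≡ par g (p ∷ a ∷ p′ ∷ b ∷ flat γ) → g q′ ≡ true
            lem h rewrite par-flat g (m S) (λ i → cl (∈-++⁺ʳ γ i)) | par-flat g γ (λ i → cl (∈-++⁺ˡ i))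
              | g-false {p} refl | g-false {p′} (cong f (sym pp′)) | g-false {a} (cong f (sym (rβ vo (here refl))))
              | g-false {b} (cong f (sym (trans pp′ (rβ vo (there (here refl))))))
              | comp-true W (Conn-refl W {q}) with comp W q q′
            ... | true = refl

  Ach-≤ : ∀ {S i j i' j'} → i' + j ≤ i + j' → Ach S i j → Ach S i' j'
  Ach-≤ {S} {i} {j} {i'} {j'} h (β , v , k) = β , v , lin (i + j) (+-mono-≤ k h) (eq₁ (A S β) i j i') (eq₂ (M S β) i j j')
    where
    eq₁ : ∀ a i j i' → a + i' + (i + j) ≡ a + i + (i' + j)
    eq₁ = solve-∀
    eq₂ : ∀ b i j j' → b + j + (i + j') ≡ b + j' + (i + j)
    eq₂ = solve-∀

  infix 4 _≃_
  record _≃_ (S T : Sys X) : Set where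
    field
      Φ≃ : Φ S ↭ Φ T
      m≃ : m S ≅ m T
      α≃ : α S ≅ α T
  open _≃_ public

  Ach-≃ : ∀ {S T} → S ≃ T → ∀ {i j} → Ach S i j → Ach T i j
  Ach-≃ {S} {T} h (β , v , k) = β , record { pβ = ↭-trans (pβ v) (Φ≃ h) ; rβ = rβ v } ,
    subst₂ _≤_ (cong (_+ _) (eq (α≃ h))) (cong (_+ _) (eq (m≃ h))) k
    where
    eq : ∀ {a b} → a ≅ b → c (β ++ a) (Φ S) ≡ c (β ++ b) (Φ T)
    eq {a} {b} g = trans (c-≅ (Φ S) (≅-++ˡ β g)) (c-↭ (β ++ b) (Φ≃ h))

  ≃-comm : ∀ S T → S ⊕ T ≃ T ⊕ S
  ≃-comm S T = record { Φ≃ = ++-comm (Φ S) (Φ T) ; m≃ = ↭⇒≅ (++-comm (m S) (m T)) ; α≃ = ↭⇒≅ (++-comm (α S) (α T)) }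

  module _ {S : Sys X} (w : WF S) where

    -- Two simultaneous vertex amalgamations, along p ~ r and then along the other ends q ~ s of
    -- their edges, keep the number of faces: the first merges two faces and the second splits them.
    glue : ∀ {β p r q s} → Valid S β → χ p ≡ χ r → χ q ≡ χ s → χ q ≢ χ p → InE (m S) p q → InE (m S) r s →
      ¬ Conn (β ++ α S) p r → ¬ Conn (β ++ m S) p r → ¬ Conn (β ++ α S) q s →
      ∃ λ β' → Valid S β' × A S β ≡ 2 + A S β' × M S β ≡ M S β'
    glue {β} {p} {r} {q} {s} v epr eqs q≁p pq rs ¬αpr ¬mpr ¬αqs = go₁ (extract₂ β p≢r (∈β (∈Φ pq)) (∈β (∈Φ rs)))
      where
      Goal = ∃ λ β' → Valid S β' × A S β ≡ 2 + A S β' × M S β ≡ M S β'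
      ∈Φ : ∀ {u z} → InE (m S) u z → u ∈ Φ S
      ∈Φ i = ∈-resp-↭ (pm w) (InE-∈ i)
      ∈β : ∀ {u} → u ∈ Φ S → u ∈ flat β
      ∈β = ∈-resp-↭ (↭-sym (pβ v))
      p≢r : p ≢ r
      p≢r refl = ¬αpr (Conn-refl (β ++ α S))
      q≢s : q ≢ s
      q≢s refl = ¬αqs (Conn-refl (β ++ α S))
      go₁ : _ → Goal
      go₁ (inj₁ (β' , h)) = ⊥-elim (¬αpr (Conn-++ˡ {es = β} (Conn-InE β (from h (here refl)))))
      go₁ (inj₂ (a , b , β₀ , h)) = go₂ (extract₂ ((a , b) ∷ β₀) q≢s (in₁ (∈Φ (InE-sym pq)) (λ { refl → q≁p refl }) (λ { refl → q≁p (sym epr) }))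
                                            (in₁ (∈Φ (InE-sym rs)) (λ { refl → q≁p eqs }) (λ { refl → q≁p (trans eqs (sym epr)) })))
        where
        old₁ new₁ : List (X × X)
        old₁ = (p , a) ∷ (r , b) ∷ β₀
        new₁ = (p , r) ∷ (a , b) ∷ β₀
        vo : Valid S old₁
        vo = Valid-≅ h v
        v₁ : Valid S new₁
        v₁ = break-valid w vo epr
        A₁ : A S β ≡ suc (A S new₁)
        A₁ = trans (A-≅ S h) (break-merge (uniq w) (α S) (pα w) β₀ (pβ vo) (¬αpr ∘ Conn-≅ (≅-++ (≅-sym h) ≅-refl)))
        M₁ : M S β ≡ suc (M S new₁)
        M₁ = trans (M-≅ S h) (break-merge (uniq w) (m S) (pm w) β₀ (pβ vo) (¬mpr ∘ Conn-≅ (≅-++ (≅-sym h) ≅-refl)))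
        in₁ : ∀ {z} → z ∈ Φ S → z ≢ p → z ≢ r → z ∈ flat ((a , b) ∷ β₀)
        in₁ z∈ z≢p z≢r with ∈-resp-↭ (↭-sym (pβ v₁)) z∈
        ... | here e = ⊥-elim (z≢p e)
        ... | there (here e) = ⊥-elim (z≢r e)
        ... | there (there i) = i
        -- outside the vertex of p the corner components are unchanged
        R : X → X → Set
        R z z' = Conn (β ++ α S) z z' ⊎ (χ z ≡ χ p × χ z' ≡ χ p)
        χβ : ∀ {z z'} → Conn (β ++ α S) z z' → χ z ≡ χ z'
        χβ = Conn-respects χ (β ++ α S) (Resp-++ {β} (rβ v) (rα w))
        trR : ∀ {x y z} → R x y → R y z → R x z
        trR (inj₁ a) (inj₁ b) = inj₁ (Conn-trans (β ++ α S) a b)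
        trR (inj₁ a) (inj₂ (b , c)) = inj₂ (trans (χβ a) b , c)
        trR (inj₂ (a , b)) (inj₁ c) = inj₂ (a , trans (sym (χβ c)) b)
        trR (inj₂ (a , b)) (inj₂ (c , d)) = inj₂ (a , d)
        smR : ∀ {x y} → R x y → R y x
        smR (inj₁ a) = inj₁ (Conn-sym (β ++ α S) a)
        smR (inj₂ (a , b)) = inj₂ (b , a)
        edR : ∀ {x y} → (x , y) ∈ new₁ ++ α S → R x y
        edR (here refl) = inj₂ (refl , sym epr)
        edR (there (here refl)) = inj₂ (sym (rβ vo (here refl)) , trans (sym (rβ vo (there (here refl)))) (sym epr))
        edR (there (there i)) with ∈-++⁻ β₀ i
        ... | inj₁ j = inj₁ (Conn-++ˡ {es = β} (Conn-InE β (from h (there (there j)))))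
        ... | inj₂ j = inj₁ (Conn-∈ (β ++ α S) (∈-++⁺ʳ β j))
        ¬qs : ¬ Conn (new₁ ++ α S) q s
        ¬qs k with Conn-least (record { rfl = inj₁ (Conn-refl (β ++ α S)) ; sm = smR ; tr = trR }) (new₁ ++ α S) edR k
        ... | inj₁ k' = ¬αqs k'
        ... | inj₂ (e , _) = q≁p e
        go₂ : _ → Goal
        go₂ (inj₁ (γ , g)) = ⊥-elim (¬qs (Conn-++ˡ {es = new₁} {es' = α S} (inj₁ (Conn-InE ((a , b) ∷ β₀) (from g (here refl))))))
        go₂ (inj₂ (x , y , γ , g)) = new₂ , break-valid w v₂ eqs ,
            trans A₁ (cong suc (trans (A-≅ S o) (break-merge (uniq w) (α S) (pα w) δ (pβ v₂) (¬qs ∘ Conn-≅ (≅-++ (≅-sym o) ≅-refl))))) ,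
            trans M₁ (trans (cong suc (M-≅ S o)) (sym (break-split (uniq w) (m S) (pm w) δ (pβ v₂) qs)))
          where
          δ old₂ new₂ : List (X × X)
          δ = (p , r) ∷ γ
          old₂ = (q , x) ∷ (s , y) ∷ δ
          new₂ = (q , s) ∷ (x , y) ∷ δ
          o : new₁ ≅ old₂
          o = ≅-trans (≅-cons (p , r) g) (shift₂ ((p , r) ∷ []) (q , x) (s , y) γ)
          v₂ : Valid S old₂
          v₂ = Valid-≅ o v₁
          K = δ ++ m S
          -- The pair `(p , r)` made by the first switch links the sides `p q` and `r s`, which puts
          -- `q` and `s` on one face path; this is why the second switch splits.
          qs : Conn K q s
          qs = Conn-trans K (Conn-++ʳ δ (Conn-InE (m S) (InE-sym pq)))
                 (Conn-trans K (Conn-∈ K (here refl)) (Conn-++ʳ δ (Conn-InE (m S) rs)))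

  module _ {e e' : Quad X} {S T : Sys X} (ok : EdgeOK e) (ok' : EdgeOK e') (w : WF (e ◂ S)) (w' : WF (e' ◂ T)) (d : Disj (e ◂ S) (e' ◂ T))
           (ep : χ (Quad.p e) ≡ χ (Quad.p e')) (eq : χ (Quad.q e) ≡ χ (Quad.q e')) (p≁q : χ (Quad.q e) ≢ χ (Quad.p e)) where
    open Quad e
    open Quad e' renaming (p to r; q to s; p′ to r′; q′ to s′)

    -- Gluing at both ends of the two edges lowers `A` by two, once at each end, and leaves `M` as
    -- it is. This is where the gain of two comes from.
    parallel : ∀ {i j i' j'} → Ach (e ◂ S) i j → Ach (e' ◂ T) i' j' → Ach ((e ◂ S) ⊕ (e' ◂ T)) (2 + (i + i')) (j + j')
    parallel {i} {j} {i'} {j'} (β , v , h) (γ , g , k)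
      with glue (WF-⊕ w w' d) {p = p} {r} {q} {s} (Valid-⊕ w w' d v g) ep eq p≁q (inj₁ (here refl)) (inj₁ (∈-++⁺ʳ (m (e ◂ S)) (here refl)))
             (proj₂ (Conn-⊕-cross w w' d v g (here refl) (here refl)))
             (proj₁ (Conn-⊕-cross w w' d v g (here refl) (here refl)))
             (proj₂ (Conn-⊕-cross w w' d v g (there (there (here refl))) (there (there (here refl)))))
    ... | β' , v' , eA , eM = β' , v' , subst₂ _≤_ (trans (cong (_+ (i + i')) eA) (sq (A ST β') (i + i'))) (cong (_+ (j + j')) eM)
          (proj₂ (proj₂ (Ach-⊕ w w' d {i} {j} {i'} {j'} (β , v , h) (γ , g , k))))
      where
      ST = (e ◂ S) ⊕ (e' ◂ T)
      sq : ∀ a b → 2 + a + b ≡ a + (2 + b)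
      sq = solve-∀

    -- The gain of two in `parallel` pays for the deletion of the two edges, at most one each. The
    -- inequality ĝ(G) ≤ ĝ⁺(G₁) + ĝ⁺(G₂) rests on this.
    join : WF S → WF T → ∀ {i j i' j'} → Ach (e ◂ S) i j → Ach (e' ◂ T) i' j' → Ach (S ⊕ T) (i + i') (j + j')
    join wS wT {i} {j} {i'} {j'} x y = Ach-≤ {i = 2 + (i + i')} {j = 2 + (j + j')} (≤-reflexive (sq (i + i') (j + j')))
        (Ach-≃ (≃-comm T S) (delete ok' (WF-⊕ wT wS (λ a b → dST b a)) dE'
          (Ach-≃ (≃-comm S (e' ◂ T)) (delete ok (WF-⊕ wS w' dS) dE (parallel x y)))))
      where
      sq : ∀ a b → a + (2 + b) ≡ 2 + (a + b)
      sq = solve-∀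
      inS : ∀ {z} → z ∈ Φ S → z ∈ Φ (e ◂ S)
      inS = ∈-++⁺ʳ (Φ (edgeSys e))
      inT : ∀ {z} → z ∈ Φ T → z ∈ Φ (e' ◂ T)
      inT = ∈-++⁺ʳ (Φ (edgeSys e'))
      dST : Disj S T
      dST a b = d (inS a) (inT b)
      dS : Disj S (e' ◂ T)
      dS a b = d (inS a) b
      dis : ∀ {x : Quad X} {l} → Unique (Φ (edgeSys x) ++ l) → ∀ {z} → z ∈ Φ (edgeSys x) → z ∈ l → ⊥
      dis (u ∷ _) (here refl) k = All.lookup u (there (there (there k))) refl
      dis (_ ∷ u ∷ _) (there (here refl)) k = All.lookup u (there (there k)) refl
      dis (_ ∷ _ ∷ u ∷ _) (there (there (here refl))) k = All.lookup u (there k) refl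
      dis (_ ∷ _ ∷ _ ∷ u ∷ _) (there (there (there (here refl)))) k = All.lookup u k refl
      dE : Disj (edgeSys e) (S ⊕ (e' ◂ T))
      dE a b with ∈-++⁻ (Φ S) b
      ... | inj₁ b' = dis {e} (uniq w) a b'
      ... | inj₂ b' = d (∈-++⁺ˡ a) b'
      dE' : Disj (edgeSys e') (T ⊕ S)
      dE' a b with ∈-++⁻ (Φ T) b
      ... | inj₁ b' = dis {e'} (uniq w') a b'
      ... | inj₂ b' = dS b' (∈-++⁺ˡ a)

-- Pairing up loose ends

unique-set-↭ : ∀ {X : Set} {l l' : List X} → Unique l → Unique l' → (∀ {z} → z ∈ l → z ∈ l') → (∀ {z} → z ∈ l' → z ∈ l) → l ↭ l'
unique-set-↭ u u' f g = ∼bag⇒↭ (WithK.unique∧set⇒bag u u' (mk⇔ f g))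

∈-↭ : ∀ {X : Set} {z : X} {l} → z ∈ l → ∃ λ l' → l ↭ z ∷ l'
∈-↭ i with ∈-∃++ i
... | ys , zs , refl = ys ++ zs , shift _ ys zs

unique-++ˡ : ∀ {X : Set} (l : List X) {l'} → Unique (l ++ l') → Unique l
unique-++ˡ []      u = []
unique-++ˡ (x ∷ l) (h ∷ u) = All.tabulate (λ i → All.lookup h (∈-++⁺ˡ i)) ∷ unique-++ˡ l u

unique-++ʳ : ∀ {X : Set} (l : List X) {l'} → Unique (l ++ l') → Unique l'
unique-++ʳ []      u = u
unique-++ʳ (x ∷ l) (h ∷ u) = unique-++ʳ l u

unique-disj : ∀ {X : Set} (l : List X) {l'} → Unique (l ++ l') → ∀ {z} → z ∈ l → z ∈ l' → ⊥
unique-disj (x ∷ l) (h ∷ u) (here refl) j = All.lookup h (∈-++⁺ʳ l j) refl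
unique-disj (x ∷ l) (h ∷ u) (there i)   j = unique-disj l u i j

xor-⊥ : ∀ {a b} → a ≡ true → b ≡ false → a xor b ≡ false → ⊥
xor-⊥ refl refl ()

xor-true : ∀ {a b c} → a ≡ true → b ≡ false → a xor (b xor c) ≡ false → c ≡ true
xor-true {c = true} refl refl _ = refl

module _ {X : Set} where

  par-all-false : ∀ (f : X → Bool) l → (∀ {z} → z ∈ l → f z ≡ false) → par f l ≡ false
  par-all-false f []      h = refl
  par-all-false f (z ∷ l) h rewrite h (here refl) = par-all-false f l (h ∘ there)

  par-true : ∀ (f : X → Bool) l → par f l ≡ true → ∃ λ z → z ∈ l × f z ≡ true
  par-true f (z ∷ l) e with f z in eq
  ... | true  = z , here refl , eq
  ... | false with par-true f l e
  ... | z' , i , e' = z' , there i , e'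

  dbl : ℕ → ℕ
  dbl zero    = zero
  dbl (suc k) = suc (suc (dbl k))

  dbl-+ : ∀ k → dbl k ≡ k + k
  dbl-+ zero    = refl
  dbl-+ (suc k) = cong suc (trans (cong suc (dbl-+ k)) (sym (+-suc k k)))

  par-even : ∀ (f : X → Bool) l → (∀ {z} → z ∈ l → f z ≡ true) → par f l ≡ false → ∃ λ k → length l ≡ dbl k
  par-even f []          h e = 0 , refl
  par-even f (z ∷ [])    h e rewrite h (here refl) with () ← e
  par-even f (z ∷ y ∷ l) h e rewrite h (here refl) | h (there (here refl)) with par f l in eq
  ... | false with par-even f l (h ∘ there ∘ there) eq
  ... | k , k≡ = suc k , cong (2 +_) k≡

  flat-maps : ∀ (μ : List (X × X)) → flat μ ↭ map proj₁ μ ++ map proj₂ μ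
  flat-maps []            = ↭-refl
  flat-maps ((a , b) ∷ μ) = prep a (↭-trans (prep b (flat-maps μ)) (↭-sym (shift b (map proj₁ μ) (map proj₂ μ))))

  search : ∀ {P : X → X → Set} → Decidable P → ∀ l → (∃ λ e → ∃ λ f → ∃ λ l' → l ↭ e ∷ f ∷ l' × P e f) ⊎
    (∀ {e f} → e ∈ l → f ∈ l → e ≢ f → P e f → P f e → ⊥)
  search P? [] = inj₂ λ ()
  search {P} P? (e ∷ l) with any? (P? e) l
  ... | yes i = let (f , f∈ , h) = find i ; (l' , π) = ∈-↭ f∈ in inj₁ (e , f , l' , prep e π , h)
    where
    find : ∀ {l} → Any (P e) l → ∃ λ z → z ∈ l × P e z
    find (here h) = _ , here refl , h
    find (there i) with find i
    ... | z , z∈ , h = z , there z∈ , h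
  ... | no ¬i with search P? l
  ... | inj₁ (x , y , l' , π , h) = inj₁ (x , y , e ∷ l' , ↭-trans (prep e π) (↭-trans (swap e x ↭-refl) (prep x (swap e y ↭-refl))) , h)
  ... | inj₂ none = inj₂ go
    where
    any∈ : ∀ {P : X → Set} {z l} → z ∈ l → P z → Any P l
    any∈ (here refl) h = here h
    any∈ (there i) h = there (any∈ i h)
    go : ∀ {x y} → x ∈ e ∷ l → y ∈ e ∷ l → x ≢ y → P x y → P y x → ⊥
    go (here refl) (here refl) n _ _ = n refl
    go (here refl) (there j) n h _ = ¬i (any∈ j h)
    go (there i) (here refl) n _ h = ¬i (any∈ i h)
    go (there i) (there j) n h h' = none i j n h h'

module Pairing {X V : Set} (_≟_ : DecidableEquality X) (_≟V_ : DecidableEquality V) (χ : X → V) where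
  open Surgery _≟_ _≟V_ χ public

  module _ {S : Sys X} (w : WF S) where

    -- A component of `K` contains an even number of the loose flags, but at most one of `ν` and at
    -- most one of `ω`; so it contains one of each or none.
    partners : ∀ K → (∀ {u v} → (u , v) ∈ m S → Conn K u v) → ∀ ν ω es → (∀ {u v} → (u , v) ∈ es → Conn K u v) →
      (ν ++ ω) ++ flat es ↭ Φ S →
      (∀ {a b} → a ∈ ν → b ∈ ν → a ≢ b → ¬ Conn K a b) → (∀ {a b} → a ∈ ω → b ∈ ω → a ≢ b → ¬ Conn K a b) →
      ∃ λ I → (∀ {a b} → (a , b) ∈ I → Conn K a b) × map proj₁ I ↭ ν × map proj₂ I ↭ ω
    partners K mK [] [] es eK π sν sω = [] , (λ ()) , ↭-refl , ↭-refl
    partners K mK [] (d ∷ ω) es eK π sν sω = ⊥-elim (contra (par-open f (m S) es (d ∷ ω) (pm w) π (λ i → comp-closed K (mK i)) (λ i → comp-closed K (eK i))))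
      where
      f = comp K d
      u = Unique-resp-↭ (↭-sym π) (uniq w)
      contra : f d xor par f ω ≡ false → ⊥
      contra = xor-⊥ (comp-true K (Conn-refl K {d}))
        (par-all-false f ω (λ {z} i → comp-false K (sω (here refl) (there i) λ { refl → unique-head u (∈-++⁺ˡ i) })))
    partners K mK (a ∷ ν) ω es eK π sν sω =
      case par-true f ω (lem (par-open f (m S) es (a ∷ ν ++ ω) (pm w) π (λ i → comp-closed K (mK i)) (λ i → comp-closed K (eK i)))) of λ { (d , d∈ , e) →
      case ∈-↭ d∈ of λ { (ω' , ρ) →
      case partners K mK ν ω' ((a , d) ∷ es)
            (λ { (here refl) → comp-conn K e ; (there i) → eK i })
            (↭-trans (rearr a d ν ω' es) (↭-trans (++⁺ʳ (flat es) (prep a (++⁺ˡ ν (↭-sym ρ)))) π))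
            (λ i j → sν (there i) (there j)) (λ i j → sω (∈-resp-↭ (↭-sym ρ) (there i)) (∈-resp-↭ (↭-sym ρ) (there j))) of λ { (I , cI , π₁ , π₂) →
      (a , d) ∷ I , (λ { (here refl) → comp-conn K e ; (there i) → cI i }) , prep a π₁ , ↭-trans (prep d π₂) (↭-sym ρ) } } }
      where
      f = comp K a
      u = Unique-resp-↭ (↭-sym π) (uniq w)
      lem : f a xor par f (ν ++ ω) ≡ false → par f ω ≡ true
      lem e = xor-true (comp-true K (Conn-refl K {a}))
        (par-all-false f ν (λ {z} i → comp-false K (sν (here refl) (there i) λ { refl → unique-head u (∈-++⁺ˡ (∈-++⁺ˡ i)) })))
        (trans (cong (f a xor_) (sym (par-++ f ν ω))) e)
      rearr : ∀ a d ν ω' es → (ν ++ ω') ++ a ∷ d ∷ flat es ↭ (a ∷ ν ++ d ∷ ω') ++ flat es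
      rearr a d ν ω' es = ↭-trans (shift a (ν ++ ω') (d ∷ flat es)) (prep a (↭-trans (shift d (ν ++ ω') (flat es))
        (↭-sym (++⁺ʳ (flat es) (shift d ν ω')))))

    -- Each entry `(a , b)` of `I` is a face path with loose ends at `x` and `y`. Two such paths are
    -- closed up by the corners `(a , a')` and `(b , b')`: `M` falls by at most one, since the
    -- second corner only closes a cycle, while `A` falls by two if both corners join different
    -- corner paths. There are `suc k` such steps, and all but the last can be made to lower `A` by
    -- two.
    pairing : ∀ {x y} → x ≢ y → ∀ k β I → length I ≡ dbl {X} (suc k) → flat I ++ flat β ↭ Φ S → Resp β →
      (∀ {a b} → (a , b) ∈ I → χ a ≡ x × χ b ≡ y × Conn (β ++ m S) a b) →
      ∃ λ β' → Valid S β' × c (β ++ m S) (Φ S) ≤ suc k + M S β' × A S β' + dbl {X} k ≤ c (β ++ α S) (Φ S)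
    -- Only two paths are left, so there is no choice and `A` may stay as it is; hence `dbl k`
    -- rather than `dbl (suc k)` in the statement.
    pairing x≢y zero β ((a , b) ∷ (a' , b') ∷ []) _ π r H = (b , b') ∷ (a , a') ∷ β ,
        record { pβ = ↭-trans (↭-trans (prep b (swap b' a ↭-refl)) (↭-trans (swap b a ↭-refl) (prep a (prep b (swap b' a' ↭-refl))))) π
               ; rβ = λ { (here refl) → trans (proj₁ (proj₂ h₁)) (sym (proj₁ (proj₂ h₂)))
                        ; (there (here refl)) → trans (proj₁ h₁) (sym (proj₁ h₂)) ; (there (there i)) → r i } } ,
        ≤-trans (c-∷-≥ (a , a') K (Φ S)) (s≤s (≤-reflexive (sym (c-∷-conn ((a , a') ∷ K) (Φ S)
          (inj₂ (inj₁ (Conn-sym K (proj₂ (proj₂ h₁)) , proj₂ (proj₂ h₂)))))))) ,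
        ≤-trans (≤-reflexive (+-identityʳ _)) (≤-trans (c-∷-≤ (b , b') ((a , a') ∷ β ++ α S) (Φ S)) (c-∷-≤ (a , a') (β ++ α S) (Φ S)))
      where
      K = β ++ m S
      h₁ = H (here refl)
      h₂ = H (there (here refl))
    pairing {x} {y} x≢y (suc k) β (i@(a , b) ∷ j₁ ∷ j₂ ∷ j₃ ∷ I) len π r H = finish pick
      where
      K = β ++ m S
      Kα = β ++ α S
      Good : X × X → Set
      Good (a' , b') = ¬ Conn Kα a a' × ¬ Conn Kα b b'
      full = i ∷ j₁ ∷ j₂ ∷ j₃ ∷ I
      uf : Unique (flat full ++ flat β)
      uf = Unique-resp-↭ (↭-sym π) (uniq w)
      out : ∀ {z} → z ∈ flat full → z ∉ flat β
      out = unique-disj (flat full) uf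
      noPath : ∀ {p q r} → p ∈ flat full → q ∈ flat full → r ∈ flat full → p ≢ q → p ≢ r → q ≢ r → Conn Kα p q → Conn Kα p r → ⊥
      noPath p q r = path-ends (α S) β (Unique-resp-↭ (↭-sym (pα w)) (uniq w)) (unique-++ʳ (flat full) uf) (out p) (out q) (out r)
      ≢s : ∀ {z z' : X} l → Unique ((z ∷ l) ++ flat β) → z' ∈ l → z ≢ z'
      ≢s l u i refl = unique-head u (∈-++⁺ˡ i)
      bad : ∀ j → Dec (Conn Kα a (proj₁ j) ⊎ Conn Kα b (proj₂ j))
      bad (a' , b') = conn? Kα a a' ⊎-dec conn? Kα b b'
      good : ∀ {j} → ¬ (Conn Kα a (proj₁ j) ⊎ Conn Kα b (proj₂ j)) → Good j
      good n = (n ∘ inj₁) , (n ∘ inj₂)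
      a≢ : ∀ {z} → z ∈ b ∷ flat (j₁ ∷ j₂ ∷ j₃ ∷ I) → a ≢ z
      a≢ = ≢s _ uf
      b≢ : ∀ {z} → z ∈ flat (j₁ ∷ j₂ ∷ j₃ ∷ I) → b ≢ z
      b≢ = ≢s _ (unique-tail uf)
      L₂′ = flat (j₃ ∷ I)
      L₂ = proj₂ j₂ ∷ L₂′
      L₁′ = flat (j₂ ∷ j₃ ∷ I)
      L₁ = proj₂ j₁ ∷ L₁′
      u₁ = unique-tail (unique-tail uf)
      u₂ = unique-tail (unique-tail u₁)
      twice-a : ∀ {z z'} → z ∈ flat (j₁ ∷ j₂ ∷ j₃ ∷ I) → z' ∈ flat (j₁ ∷ j₂ ∷ j₃ ∷ I) → z ≢ z' → Conn Kα a z → Conn Kα a z' → ⊥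
      twice-a p q n = noPath (here refl) (there (there p)) (there (there q)) (a≢ (there p)) (a≢ (there q)) n
      twice-b : ∀ {z z'} → z ∈ flat (j₁ ∷ j₂ ∷ j₃ ∷ I) → z' ∈ flat (j₁ ∷ j₂ ∷ j₃ ∷ I) → z ≢ z' → Conn Kα b z → Conn Kα b z' → ⊥
      twice-b p q n = noPath (there (here refl)) (there (there p)) (there (there q)) (b≢ p) (b≢ q) n
      -- A corner path starting in `a` has only one other end, and likewise for `b`. So at most two
      -- of the three candidates are spoilt.
      pick : ∃ λ j → ∃ λ I' → full ↭ i ∷ j ∷ I' × Good j
      pick with bad j₁ | bad j₂ | bad j₃
      ... | no n | _ | _ = j₁ , j₂ ∷ j₃ ∷ I , ↭-refl , good n
      ... | yes _ | no n | _ = j₂ , j₁ ∷ j₃ ∷ I , prep i (swap j₁ j₂ ↭-refl) , good n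
      ... | yes _ | yes _ | no n = j₃ , j₁ ∷ j₂ ∷ I , prep i (↭-trans (prep j₁ (swap j₂ j₃ ↭-refl)) (swap j₁ j₃ ↭-refl)) , good n
      ... | yes (inj₁ p) | yes (inj₁ q) | yes _ = ⊥-elim (twice-a (here refl) (there (there (here refl))) (≢s L₁ u₁ (there (here refl))) p q)
      ... | yes (inj₁ p) | yes (inj₂ q) | yes (inj₁ s) = ⊥-elim (twice-a (here refl) (there (there (there (there (here refl))))) (≢s L₁ u₁ (there (there (there (here refl))))) p s)
      ... | yes (inj₁ p) | yes (inj₂ q) | yes (inj₂ s) = ⊥-elim (twice-b (there (there (there (here refl)))) (there (there (there (there (there (here refl)))))) (≢s L₂′ (unique-tail u₂) (there (here refl))) q s)
      ... | yes (inj₂ p) | yes (inj₂ q) | yes _ = ⊥-elim (twice-b (there (here refl)) (there (there (there (here refl)))) (≢s L₁′ (unique-tail u₁) (there (here refl))) p q)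
      ... | yes (inj₂ p) | yes (inj₁ q) | yes (inj₁ s) = ⊥-elim (twice-a (there (there (here refl))) (there (there (there (there (here refl))))) (≢s L₂ u₂ (there (here refl))) q s)
      ... | yes (inj₂ p) | yes (inj₁ q) | yes (inj₂ s) = ⊥-elim (twice-b (there (here refl)) (there (there (there (there (there (here refl)))))) (≢s L₁′ (unique-tail u₁) (there (there (there (here refl))))) p s)
      χα : ∀ {z z'} → Conn Kα z z' → χ z ≡ χ z'
      χα = Conn-respects χ Kα (Resp-++ {β} r (rα w))
      finish : (∃ λ j → ∃ λ I' → full ↭ i ∷ j ∷ I' × Good j) → _
      finish ((a' , b') , I' , ρ , ¬aa' , ¬bb') =
        case pairing x≢y k β' I' (suc-injective (suc-injective (trans (sym (↭-length ρ)) len))) π' r' H' of λ { (β'' , v , hM , hA) →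
          β'' , v , ≤-trans cM (s≤s hM) , ≤-trans (≤-reflexive (trans (+-suc _ _) (cong suc (+-suc _ _)))) (≤-trans (s≤s (s≤s hA)) (≤-reflexive (sym cA))) }
        where
        β' = (b , b') ∷ (a , a') ∷ β
        h₁ = H (here refl)
        h₂ = H (∈-resp-↭ (↭-sym ρ) (there (here refl)))
        r' : Resp β'
        r' (here refl) = trans (proj₁ (proj₂ h₁)) (sym (proj₁ (proj₂ h₂)))
        r' (there (here refl)) = trans (proj₁ h₁) (sym (proj₁ h₂))
        r' (there (there i)) = r i
        π₀ : a ∷ b ∷ a' ∷ b' ∷ flat I' ++ flat β ↭ Φ S
        π₀ = ↭-trans (++⁺ʳ (flat β) (↭-sym (perm (↭⇒≅ ρ)))) π
        π' : flat I' ++ flat β' ↭ Φ S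
        π' = ↭-trans (shifts (flat I') (b ∷ b' ∷ a ∷ a' ∷ [])) (↭-trans
          (↭-trans (prep b (swap b' a ↭-refl)) (↭-trans (swap b a ↭-refl) (prep a (prep b (swap b' a' ↭-refl))))) π₀)
        H' : ∀ {z z'} → (z , z') ∈ I' → χ z ≡ x × χ z' ≡ y × Conn (β' ++ m S) z z'
        H' i with H (∈-resp-↭ (↭-sym ρ) (there (there i)))
        ... | e , e' , h = e , e' , inj₁ (inj₁ h)
        in∈ : ∀ {z} → z ∈ a ∷ b ∷ a' ∷ b' ∷ [] → z ∈ Φ S
        in∈ i = ∈-resp-↭ π₀ (∈-++⁺ˡ {xs = a ∷ b ∷ a' ∷ b' ∷ flat I'} (∈-++⁺ˡ i))
        cA : c Kα (Φ S) ≡ suc (suc (c (β' ++ α S) (Φ S)))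
        cA = trans (c-∷-new Kα (in∈ (here refl)) (in∈ (there (there (here refl)))) ¬aa')
             (cong suc (c-∷-new ((a , a') ∷ Kα) (in∈ (there (here refl))) (in∈ (there (there (there (here refl))))) ¬bb″))
          where
          ¬bb″ : ¬ Conn ((a , a') ∷ Kα) b b'
          ¬bb″ (inj₁ h) = ¬bb' h
          ¬bb″ (inj₂ (inj₁ (h , _))) = x≢y (trans (sym (proj₁ h₁)) (trans (sym (χα h)) (proj₁ (proj₂ h₁))))
          ¬bb″ (inj₂ (inj₂ (h , _))) = x≢y (trans (sym (proj₁ h₂)) (trans (sym (χα h)) (proj₁ (proj₂ h₁))))
        cM : c K (Φ S) ≤ suc (c (β' ++ m S) (Φ S))
        cM = ≤-trans (c-∷-≥ (a , a') K (Φ S)) (s≤s (≤-reflexive (sym (c-∷-conn ((a , a') ∷ K) (Φ S)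
          (inj₂ (inj₁ (Conn-sym K (proj₂ (proj₂ h₁)) , proj₂ (proj₂ h₂))))))))

    -- The face path from `a` ends in a flag of `ω` and therefore not in `b`: each pair of `ν`
    -- merges two components. Pairs already added leave the paths of the others intact.
    merge-all : ∀ ν ω β → flat ν ++ (flat ω ++ flat β) ↭ Φ S → (∀ {a b} → (a , b) ∈ ν → ∃ λ d → d ∈ flat ω × Conn (β ++ m S) a d) →
      c (ν ++ (β ++ m S)) (Φ S) + length ν ≤ c (β ++ m S) (Φ S)
    merge-all [] ω β π H = ≤-reflexive (+-identityʳ _)
    merge-all ((a , b) ∷ ν) ω β π H =
      ≤-trans (≤-reflexive (trans (+-suc _ _) (cong (λ z → suc (z + length ν)) (c-≅ (Φ S) (↭⇒≅ (↭-sym (shift (a , b) ν K)))))))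
        (≤-trans (s≤s (merge-all ν ω ((a , b) ∷ β) π' H')) (≤-reflexive (sym (c-∷-new K a∈ b∈ ¬ab))))
      where
      K = β ++ m S
      u : Unique (a ∷ b ∷ flat ν ++ (flat ω ++ flat β))
      u = Unique-resp-↭ (↭-sym π) (uniq w)
      π' : flat ν ++ (flat ω ++ a ∷ b ∷ flat β) ↭ Φ S
      π' = ↭-trans (++⁺ˡ (flat ν) (shifts (flat ω) (a ∷ b ∷ []))) (↭-trans (shifts (flat ν) (a ∷ b ∷ [])) π)
      H' : ∀ {z z'} → (z , z') ∈ ν → ∃ λ d → d ∈ flat ω × Conn ((a , b) ∷ K) z d
      H' i with H (there i)
      ... | d , d∈ , h = d , d∈ , inj₁ h
      a∈ : a ∈ Φ S
      a∈ = ∈-resp-↭ π (here refl)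
      b∈ : b ∈ Φ S
      b∈ = ∈-resp-↭ π (there (here refl))
      toβ : ∀ {z} → z ∈ flat β → z ∈ flat ν ++ (flat ω ++ flat β)
      toβ i = ∈-++⁺ʳ (flat ν) (∈-++⁺ʳ (flat ω) i)
      toω : ∀ {z} → z ∈ flat ω → z ∈ flat ν ++ (flat ω ++ flat β)
      toω i = ∈-++⁺ʳ (flat ν) (∈-++⁺ˡ i)
      ¬ab : ¬ Conn K a b
      ¬ab ab with H (here refl)
      ... | d , d∈ , ad = path-ends (m S) β (Unique-resp-↭ (↭-sym (pm w)) (uniq w))
          (unique-++ʳ (flat ω) (unique-++ʳ (flat ν) (unique-tail (unique-tail u))))
          (λ i → unique-head u (there (toβ i))) (λ i → unique-head (unique-tail u) (toβ i))
          (unique-disj (flat ω) (unique-++ʳ (flat ν) (unique-tail (unique-tail u))) d∈)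
          (λ { refl → unique-head u (here refl) }) (λ { refl → unique-head u (there (toω d∈)) })
          (λ { refl → unique-head (unique-tail u) (toω d∈) }) ab ad

  c-++-≥ : ∀ ν K Φ → c K Φ ≤ c (ν ++ K) Φ + length ν
  c-++-≥ []      K Φ = ≤-reflexive (sym (+-identityʳ _))
  c-++-≥ (e ∷ ν) K Φ = ≤-trans (c-++-≥ ν K Φ) (≤-trans (+-monoˡ-≤ (length ν) (c-∷-≥ e (ν ++ K) Φ)) (≤-reflexive (sym (+-suc _ _))))

  -- The pair that closes a cycle does not lower the count, which saves one.
  c-cycle-≥ : ∀ {a b} ν K Φ → Conn (ν ++ K) a b → suc (c K Φ) ≤ c ((a , b) ∷ ν ++ K) Φ + length ((a , b) ∷ ν)
  c-cycle-≥ {a} {b} ν K Φ h = ≤-trans (s≤s (c-++-≥ ν K Φ)) (≤-reflexive (trans (sym (+-suc _ _)) (cong (_+ suc (length ν)) (sym (c-∷-conn (ν ++ K) Φ h)))))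

-- Splitting along two vertices

-- There are `n = 2k` mixed pairs at each of the two common vertices. `Kᵢ` and `Lᵢ` count the face
-- and corner components of a summand whose flags in mixed pairs are left loose, `bᵢ` and `aᵢ` those
-- after closing up with the new edge; `b` and `a` belong to the sum.
terminal-arith : ∀ k {n a b K₁ K₂ L₁ L₂ a₁ b₁ a₂ b₂} → n ≡ k + k → b + n ≤ K₁ + K₂ → 2 + (L₁ + L₂) ≤ a + n + n →
  2 + K₁ ≤ suc k + b₁ → a₁ + n ≤ 2 + L₁ → 2 + K₂ ≤ suc k + b₂ → a₂ + n ≤ 2 + L₂ → b + (a₁ + a₂) ≤ a + (b₁ + b₂)
terminal-arith k {_} {a} {b} {K₁} {K₂} {L₁} {L₂} {a₁} {b₁} {a₂} {b₂} refl h₁ h₂ h₃ h₄ h₅ h₆ =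
  lin (6 + K₁ + K₂ + L₁ + L₂ + (k + k) + (k + k) + (k + k)) (+-mono-≤ h₁ (+-mono-≤ h₂ (+-mono-≤ (+-mono-≤ h₃ h₄) (+-mono-≤ h₅ h₆))))
    (eq₁ k b K₁ K₂ L₁ L₂ a₁ a₂) (eq₂ k a K₁ K₂ L₁ L₂ b₁ b₂)
  where
  eq₁ : ∀ k b K₁ K₂ L₁ L₂ a₁ a₂ → b + (a₁ + a₂) + (6 + K₁ + K₂ + L₁ + L₂ + (k + k) + (k + k) + (k + k)) ≡
    b + (k + k) + (2 + (L₁ + L₂) + (2 + K₁ + (a₁ + (k + k)) + (2 + K₂ + (a₂ + (k + k)))))
  eq₁ = solve-∀
  eq₂ : ∀ k a K₁ K₂ L₁ L₂ b₁ b₂ → K₁ + K₂ + (a + (k + k) + (k + k) + (suc k + b₁ + (2 + L₁) + (suc k + b₂ + (2 + L₂)))) ≡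
    a + (b₁ + b₂) + (6 + K₁ + K₂ + L₁ + L₂ + (k + k) + (k + k) + (k + k))
  eq₂ = solve-∀

weaken-arith : ∀ {a b a' b' I J} → a' + b ≤ a + b' → b' + J ≤ a' + I → b + J ≤ a + I
weaken-arith {a} {b} {a'} {b'} {I} {J} h k = lin (a' + b') (+-mono-≤ h k) (eq₁ b J a' b') (eq₂ a b' a' I)
  where
  eq₁ : ∀ b J a' b' → b + J + (a' + b') ≡ a' + b + (b' + J)
  eq₁ = solve-∀
  eq₂ : ∀ a b' a' I → a + b' + (a' + I) ≡ a + I + (a' + b')
  eq₂ = solve-∀

xor-mid : ∀ {a b c} → a ≡ true → c ≡ false → a xor (b xor c) ≡ false → b ≡ true
xor-mid {b = true} refl refl _ = refl

module Split {X V : Set} (_≟_ : DecidableEquality X) (_≟V_ : DecidableEquality V) (χ : X → V) where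
  open Pairing _≟_ _≟V_ χ public

  module _ {e : Quad X} (ok : EdgeOK e) {x y : V} (x≢y : x ≢ y) (ex : χ (Quad.p e) ≡ x) (ey : χ (Quad.q e) ≡ y) where
    open Quad e

    -- The two sides of `e` are two further paths from `x` to `y`, so that `pairing` applies to
    -- `2(k + 1)` of them. The summands 2 are the components of the bare edge: its two sides in one
    -- count, its two ends in the other.
    side : ∀ {S} (w : WF S) (d : Disj (edgeSys e) S) k β ν ω I → Resp β → (ν ++ ω) ++ flat β ↭ Φ S →
      (∀ {a} → a ∈ ν → χ a ≡ x) → (∀ {a} → a ∈ ω → χ a ≡ y) → length ν ≡ dbl {X} k →
      (∀ {a b} → (a , b) ∈ I → Conn (β ++ m S) a b) → map proj₁ I ↭ ν → map proj₂ I ↭ ω →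
      ∃ λ β' → Valid (e ◂ S) β' × 2 + c (β ++ m S) (Φ S) ≤ suc k + M (e ◂ S) β' × A (e ◂ S) β' + dbl {X} k ≤ 2 + c (β ++ α S) (Φ S)
    side {S} w d k β ν ω I r π hν hω len cI π₁ π₂ =
      case pairing (WF-◂ ok w d) x≢y k β ((p , q) ∷ (p′ , q′) ∷ I)
            (cong (2 +_) (trans (sym (length-map proj₁ I)) (trans (↭-length π₁) len))) π' r H of λ { (β' , v , hM , hA) →
         β' , v , ≤-trans (≤-reflexive (sym (count (m S) (m (edgeSys e)) (prep p (swap q p′ ↭-refl)) (pm w) (c-m-edge ok)))) hM ,
         ≤-trans hA (≤-reflexive (count (α S) (α (edgeSys e)) ↭-refl (pα w) (c-α-edge ok))) }
      where
      π' : p ∷ q ∷ p′ ∷ q′ ∷ (flat I ++ flat β) ↭ Φ (e ◂ S)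
      π' = prep p (swap q p′ (prep q′ (↭-trans (++⁺ʳ (flat β) (↭-trans (flat-maps I) (++⁺ π₁ π₂))) π)))
      K = β ++ m (e ◂ S)
      mS⊆ : ∀ {u v} → (u , v) ∈ β ++ m S → (u , v) ∈ K
      mS⊆ i with ∈-++⁻ β i
      ... | inj₁ j = ∈-++⁺ˡ j
      ... | inj₂ j = ∈-++⁺ʳ β (there (there j))
      H : ∀ {a b} → (a , b) ∈ (p , q) ∷ (p′ , q′) ∷ I → χ a ≡ x × χ b ≡ y × Conn K a b
      H (here refl) = ex , ey , Conn-∈ K (∈-++⁺ʳ β (here refl))
      H (there (here refl)) = trans (sym (χp ok)) ex , trans (sym (χq ok)) ey , Conn-∈ K (∈-++⁺ʳ β (there (here refl)))
      H (there (there i)) = hν (∈-resp-↭ π₁ (∈-map⁺ proj₁ i)) , hω (∈-resp-↭ π₂ (∈-map⁺ proj₂ i)) ,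
        Conn-⊆ {es = β ++ m S} {es' = K} mS⊆ (cI i)
      β⊆ : ∀ {z} → z ∈ flat β → z ∈ Φ S
      β⊆ i = ∈-resp-↭ π (∈-++⁺ʳ (ν ++ ω) i)
      count : ∀ a ae → flat ae ↭ Φ (edgeSys e) → flat a ↭ Φ S → c ae (Φ (edgeSys e)) ≡ 2 →
        c (β ++ (ae ++ a)) (Φ (e ◂ S)) ≡ 2 + c (β ++ a) (Φ S)
      count a ae pe pa e2 = trans (c-≅ (Φ (e ◂ S)) (↭⇒≅ (shifts β ae)))
        (trans (c-union ae (β ++ a) (∈-resp-↭ pe) into d) (cong (_+ c (β ++ a) (Φ S)) e2))
        where
        into : ∀ {z} → z ∈ flat (β ++ a) → z ∈ Φ S
        into i with ∈-++⁻ (flat β) (subst (_ ∈_) (flat-++ β a) i)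
        ... | inj₁ j = β⊆ j
        ... | inj₂ j = ∈-resp-↭ pa j

  record Glued (S T : Sys X) (x y : V) (e : Quad X) : Set where
    field
      wS : WF S
      wT : WF T
      d : Disj S T
      x≢y : x ≢ y
      shared : ∀ {z z'} → z ∈ Φ S → z' ∈ Φ T → χ z ≡ χ z' → χ z ≡ x ⊎ χ z ≡ y
      ok : EdgeOK e
      dS : Disj (edgeSys e) S
      dT : Disj (edgeSys e) T
      ex : χ (Quad.p e) ≡ x
      ey : χ (Quad.q e) ≡ y

  module _ {S T : Sys X} {x y : V} {e : Quad X} (σ : Glued S T x y e) where
    open Glued σ

    -- D(S ⊕ T) is at least the M − A = b − a at hand; these say that it is at most D(S) + D(T),
    -- respectively D(e ◂ S) + D(e ◂ T).
    Res₁ Res₂ Res : ℕ → ℕ → Set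
    Res₁ a b = ∃ λ i → ∃ λ j → ∃ λ i' → ∃ λ j' → Ach S i j × Ach T i' j' × b + (j + j') ≤ a + (i + i')
    Res₂ a b = (∃ λ z → ∃ λ z' → z ∈ Φ S × z' ∈ Φ T × χ z ≡ y × χ z' ≡ y) ×
      (∃ λ i → ∃ λ j → ∃ λ i' → ∃ λ j' → Ach (e ◂ S) i j × Ach (e ◂ T) i' j' × b + (j + j') ≤ a + (i + i'))
    Res a b = Res₁ a b ⊎ Res₂ a b

    private
      ST = S ⊕ T
      wST : WF ST
      wST = WF-⊕ wS wT d

      weaken : ∀ {a b a' b'} → a' + b ≤ a + b' → Res a' b' → Res a b
      weaken {a} {b} {a'} h (inj₁ (i , j , i' , j' , p , q , k)) = inj₁ (i , j , i' , j' , p , q , weaken-arith {a} {b} {a'} h k)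
      weaken {a} {b} {a'} h (inj₂ (z , i , j , i' , j' , p , q , k)) = inj₂ (z , i , j , i' , j' , p , q , weaken-arith {a} {b} {a'} h k)

      -- A corner matching of the sum, sorted into pairs inside `S`, pairs inside `T` and mixed
      -- pairs, the latter oriented from `S` to `T`.
      record St (β₁ β₂ μ : List (X × X)) : Set where
        field
          p₁ : map proj₁ μ ++ flat β₁ ↭ Φ S
          p₂ : map proj₂ μ ++ flat β₂ ↭ Φ T
          r₁ : Resp β₁
          r₂ : Resp β₂
          rμ : Resp μ
      open St

      full : List (X × X) → List (X × X) → List (X × X) → List (X × X)
      full β₁ β₂ μ = μ ++ (β₁ ++ β₂)

      full-↭ : ∀ {β₁ β₂ μ} → St β₁ β₂ μ → flat (full β₁ β₂ μ) ↭ Φ ST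
      full-↭ {β₁} {β₂} {μ} s = ↭-trans (↭-reflexive (trans (flat-++ μ (β₁ ++ β₂)) (cong (flat μ ++_) (flat-++ β₁ β₂))))
        (↭-trans (++⁺ʳ (flat β₁ ++ flat β₂) (flat-maps μ))
        (↭-trans (interchange (map proj₁ μ) (map proj₂ μ) (flat β₁) (flat β₂)) (++⁺ (p₁ s) (p₂ s))))

      St-valid : ∀ {β₁ β₂ μ} → St β₁ β₂ μ → Valid ST (full β₁ β₂ μ)
      St-valid {β₁} {β₂} {μ} s = record { pβ = full-↭ s ; rβ = Resp-++ {μ} (rμ s) (Resp-++ {β₁} (r₁ s) (r₂ s)) }

      St-↭ : ∀ {β₁ β₂ μ μ'} → μ ↭ μ' → St β₁ β₂ μ → St β₁ β₂ μ'
      St-↭ {β₁} {β₂} π s = record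
        { p₁ = ↭-trans (++⁺ʳ (flat β₁) (map⁺ proj₁ (↭-sym π))) (p₁ s)
        ; p₂ = ↭-trans (++⁺ʳ (flat β₂) (map⁺ proj₂ (↭-sym π))) (p₂ s)
        ; r₁ = r₁ s ; r₂ = r₂ s ; rμ = λ i → rμ s (∈-resp-↭ (↭-sym π) i) }

      Sep : List (X × X) → List (X × X) → List (X × X) → Set
      Sep β₁ β₂ μ = ∀ {f g} → f ∈ μ → g ∈ μ → f ≢ g → χ (proj₁ f) ≡ χ (proj₁ g) →
        ¬ Conn (β₁ ++ m S) (proj₁ f) (proj₁ g) × ¬ Conn (β₂ ++ m T) (proj₂ f) (proj₂ g)

      -- No free switch is left, so by `partners` the face paths between mixed pairs run from `x` to
      -- `y` within either summand. With `n = 2k` mixed pairs at each vertex, `M` is at most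
      -- `K₁ + K₂ - n`, since each pair of `ν` merges two face paths, and `A` is at least
      -- `L₁ + L₂ + 2 - 2n`, since at each of the two vertices one pair closes a corner cycle. With
      -- `e` added, `side` reaches `Kᵢ - Lᵢ + k - 1` in each summand, and these two add up to the
      -- resulting bound for `M - A`.
      terminal : ∀ {β₁ β₂} ν ω → St β₁ β₂ (ν ++ ω) → (∀ {f} → f ∈ ν → χ (proj₁ f) ≡ x) → (∀ {f} → f ∈ ω → χ (proj₁ f) ≡ y) →
        Sep β₁ β₂ (ν ++ ω) → ν ++ ω ≢ [] → Res₂ (A ST (full β₁ β₂ (ν ++ ω))) (M ST (full β₁ β₂ (ν ++ ω)))
      terminal {β₁} {β₂} ν ω s hν hω sep ne =
        case partners wS W₁ (λ i → Conn-∈ W₁ (∈-++⁺ʳ β₁ i)) (map proj₁ ν) (map proj₁ ω) β₁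
              (λ i → Conn-∈ W₁ (∈-++⁺ˡ i)) q₁ (sepν₁ hν (λ i → ∈-++⁺ˡ i)) (sepν₁ hω (∈-++⁺ʳ ν)) of λ { (I , cI , π₁ , π₂) →
        case partners wT W₂ (λ i → Conn-∈ W₂ (∈-++⁺ʳ β₂ i)) (map proj₂ ν) (map proj₂ ω) β₂
              (λ i → Conn-∈ W₂ (∈-++⁺ˡ i)) q₂ (sepν₂ hν (λ i → ∈-++⁺ˡ i)) (sepν₂ hω (∈-++⁺ʳ ν)) of λ { (I' , cI' , π₁' , π₂') →
        case even of λ { (k , ek) →
        case side ok x≢y ex ey wS dS k β₁ (map proj₁ ν) (map proj₁ ω) I (r₁ s) q₁ (χm hν) (χm hω) ek cI π₁ π₂ of λ { (γ , v , hM , hA) →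
        case side ok x≢y ex ey wT dT k β₂ (map proj₂ ν) (map proj₂ ω) I' (r₂ s) q₂ (χm₂ hν (λ i → ∈-++⁺ˡ i)) (χm₂ hω (∈-++⁺ʳ ν))
                                     (trans (length-map proj₂ ν) (trans (sym (length-map proj₁ ν)) ek)) cI' π₁' π₂' of λ { (γ' , v' , hM' , hA') →
           wit ν ω s hω (same I π₁ π₂) ne , M (e ◂ S) γ , A (e ◂ S) γ , M (e ◂ T) γ' , A (e ◂ T) γ' ,
           (γ , v , ≤-reflexive (+-comm (A (e ◂ S) γ) _)) , (γ' , v' , ≤-reflexive (+-comm (A (e ◂ T) γ') _)) ,
           terminal-arith k {K₁ = c W₁ (Φ S)} {c W₂ (Φ T)} {c (β₁ ++ α S) (Φ S)} {c (β₂ ++ α T) (Φ T)} (dbl-+ {X} k)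
             (≤-trans (+-mono-≤ Mle (≤-reflexive (sym (ek' ek))))
               (≤-trans (merge-all wST ν ω (β₁ ++ β₂) πm (λ {a} i → par₁ I cI π₁ π₂ (∈-map⁺ proj₁ i))) (≤-reflexive (union (m S) (m T) (pm wS) (pm wT)))))
             (≤-trans (s≤s (s≤s (≤-reflexive (sym (union (α S) (α T) (pα wS) (pα wT))))))
               (subst₂ (λ l l' → 2 + c ((β₁ ++ β₂) ++ α ST) (Φ ST) ≤ A ST (full β₁ β₂ (ν ++ ω)) + l + l') (ek' ek) (trans (sym (same I π₁ π₂)) (ek' ek)) (Ale ν ω s hν hω (same I π₁ π₂) ne)))
             hM hA hM' hA' } } } } }
        where
        same : ∀ I → map proj₁ I ↭ map proj₁ ν → map proj₂ I ↭ map proj₁ ω → length ν ≡ length ω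
        same I π₁ π₂ = trans (sym (length-map proj₁ ν)) (trans (sym (↭-length π₁)) (trans (length-map proj₁ I)
          (trans (sym (length-map proj₂ I)) (trans (↭-length π₂) (length-map proj₁ ω)))))
        ek' : ∀ {k} → length (map proj₁ ν) ≡ k → length ν ≡ k
        ek' = trans (sym (length-map proj₁ ν))
        W₁ W₂ : List (X × X)
        W₁ = β₁ ++ m S
        W₂ = β₂ ++ m T
        q₁ : (map proj₁ ν ++ map proj₁ ω) ++ flat β₁ ↭ Φ S
        q₁ = subst (λ l → l ++ flat β₁ ↭ Φ S) (map-++ proj₁ ν ω) (p₁ s)
        q₂ : (map proj₂ ν ++ map proj₂ ω) ++ flat β₂ ↭ Φ T
        q₂ = subst (λ l → l ++ flat β₂ ↭ Φ T) (map-++ proj₂ ν ω) (p₂ s)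
        χm : ∀ {l : List (X × X)} {z} → (∀ {f} → f ∈ l → χ (proj₁ f) ≡ z) → ∀ {a} → a ∈ map proj₁ l → χ a ≡ z
        χm h i with ∈-map⁻ proj₁ i
        ... | f , f∈ , refl = h f∈
        χm₂ : ∀ {l : List (X × X)} {z} → (∀ {f} → f ∈ l → χ (proj₁ f) ≡ z) → (∀ {f} → f ∈ l → f ∈ ν ++ ω) → ∀ {a} → a ∈ map proj₂ l → χ a ≡ z
        χm₂ h sub i with ∈-map⁻ proj₂ i
        ... | f , f∈ , refl = trans (sym (rμ s (sub f∈))) (h f∈)
        sepν₁ : ∀ {l : List (X × X)} {z} → (∀ {f} → f ∈ l → χ (proj₁ f) ≡ z) → (∀ {f} → f ∈ l → f ∈ ν ++ ω) →
          ∀ {a b} → a ∈ map proj₁ l → b ∈ map proj₁ l → a ≢ b → ¬ Conn W₁ a b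
        sepν₁ h sub i j n with ∈-map⁻ proj₁ i | ∈-map⁻ proj₁ j
        ... | f , f∈ , refl | g , g∈ , refl = proj₁ (sep (sub f∈) (sub g∈) (n ∘ cong proj₁) (trans (h f∈) (sym (h g∈))))
        sepν₂ : ∀ {l : List (X × X)} {z} → (∀ {f} → f ∈ l → χ (proj₁ f) ≡ z) → (∀ {f} → f ∈ l → f ∈ ν ++ ω) →
          ∀ {a b} → a ∈ map proj₂ l → b ∈ map proj₂ l → a ≢ b → ¬ Conn W₂ a b
        sepν₂ h sub i j n with ∈-map⁻ proj₂ i | ∈-map⁻ proj₂ j
        ... | f , f∈ , refl | g , g∈ , refl = proj₂ (sep (sub f∈) (sub g∈) (n ∘ cong proj₂) (trans (h f∈) (sym (h g∈))))
        -- Crossings and corners keep the vertex, so handshaking applies to the flags of `S` at `x`: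
        -- an even number of them is loose.
        even : ∃ λ k → length (map proj₁ ν) ≡ dbl {X} k
        even = par-even isx (map proj₁ ν) (λ i → isx-true (χm hν i))
          (xor-l (par-all-false isx (map proj₁ ω) (λ i → isx-false (λ h → x≢y (trans (sym h) (χm hω i)))))
            (trans (sym (par-++ isx (map proj₁ ν) (map proj₁ ω)))
              (par-open isx (α S) β₁ (map proj₁ ν ++ map proj₁ ω) (pα wS) q₁ (λ i → cong (λ z → does (z ≟V x)) (rα wS i)) (λ i → cong (λ z → does (z ≟V x)) (r₁ s i)))))
          where
          isx : X → Bool
          isx z = does (χ z ≟V x)
          isx-true : ∀ {z} → χ z ≡ x → isx z ≡ true
          isx-true {z} h with χ z ≟V x
          ... | yes _ = refl
          ... | no n = ⊥-elim (n h)
          isx-false : ∀ {z} → χ z ≢ x → isx z ≡ false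
          isx-false {z} h with χ z ≟V x
          ... | yes e = ⊥-elim (h e)
          ... | no n = refl
          xor-l : ∀ {a b} → b ≡ false → a xor b ≡ false → a ≡ false
          xor-l {false} refl _ = refl
        union : ∀ a b → flat a ↭ Φ S → flat b ↭ Φ T → c ((β₁ ++ β₂) ++ (a ++ b)) (Φ ST) ≡ c (β₁ ++ a) (Φ S) + c (β₂ ++ b) (Φ T)
        union a b pa pb = trans (c-≅ (Φ ST) (↭⇒≅ (interchange β₁ β₂ a b)))
          (c-union (β₁ ++ a) (β₂ ++ b) (into β₁ a (λ i → ∈-resp-↭ (p₁ s) (∈-++⁺ʳ (map proj₁ (ν ++ ω)) i)) (∈-resp-↭ pa))
            (into β₂ b (λ i → ∈-resp-↭ (p₂ s) (∈-++⁺ʳ (map proj₂ (ν ++ ω)) i)) (∈-resp-↭ pb)) d)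
          where
          into : ∀ {Φ} β a → (∀ {z} → z ∈ flat β → z ∈ Φ) → (∀ {z} → z ∈ flat a → z ∈ Φ) → ∀ {z} → z ∈ flat (β ++ a) → z ∈ Φ
          into β a f g i with ∈-++⁻ (flat β) (subst (_ ∈_) (flat-++ β a) i)
          ... | inj₁ j = f j
          ... | inj₂ j = g j
        πm : flat ν ++ (flat ω ++ flat (β₁ ++ β₂)) ↭ Φ ST
        πm = ↭-trans (↭-reflexive (sym (trans (flat-++ (ν ++ ω) (β₁ ++ β₂)) (trans (cong (_++ flat (β₁ ++ β₂)) (flat-++ ν ω)) (++-assoc (flat ν) (flat ω) _))))) (full-↭ s)
        Mle : M ST (full β₁ β₂ (ν ++ ω)) ≤ c (ν ++ ((β₁ ++ β₂) ++ m ST)) (Φ ST)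
        Mle = c-mono {ν ++ ((β₁ ++ β₂) ++ m ST)} {full β₁ β₂ (ν ++ ω) ++ m ST} (Φ ST)
          (Conn-⊆ {es = ν ++ ((β₁ ++ β₂) ++ m ST)} {es' = full β₁ β₂ (ν ++ ω) ++ m ST} sub)
          where
          sub : ∀ {u v} → (u , v) ∈ ν ++ ((β₁ ++ β₂) ++ m ST) → (u , v) ∈ ((ν ++ ω) ++ (β₁ ++ β₂)) ++ m ST
          sub i with ∈-++⁻ ν i
          ... | inj₁ j = ∈-++⁺ˡ (∈-++⁺ˡ (∈-++⁺ˡ j))
          ... | inj₂ j with ∈-++⁻ (β₁ ++ β₂) j
          ... | inj₁ k = ∈-++⁺ˡ (∈-++⁺ʳ (ν ++ ω) k)
          ... | inj₂ k = ∈-++⁺ʳ ((ν ++ ω) ++ (β₁ ++ β₂)) k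
        par₁ : ∀ I → (∀ {a b} → (a , b) ∈ I → Conn W₁ a b) → map proj₁ I ↭ map proj₁ ν → map proj₂ I ↭ map proj₁ ω →
          ∀ {a} → a ∈ map proj₁ ν → ∃ λ z → z ∈ flat ω × Conn ((β₁ ++ β₂) ++ m ST) a z
        par₁ I cI π₁ π₂ a∈ with ∈-map⁻ proj₁ (∈-resp-↭ (↭-sym π₁) a∈)
        ... | (a , z) , i , refl with ∈-map⁻ proj₁ (∈-resp-↭ π₂ (∈-map⁺ proj₂ i))
        ... | (z' , _) , j , refl = z , flat-∈ˡ j , Conn-⊆ {es = W₁} {es' = (β₁ ++ β₂) ++ m ST} sub (cI i)
          where
          sub : ∀ {u v} → (u , v) ∈ W₁ → (u , v) ∈ (β₁ ++ β₂) ++ m ST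
          sub i with ∈-++⁻ β₁ i
          ... | inj₁ j = ∈-++⁺ˡ (∈-++⁺ˡ j)
          ... | inj₂ j = ∈-++⁺ʳ (β₁ ++ β₂) (∈-++⁺ˡ j)
        -- Flags at `y` in both summands are kept as evidence: they refute this outcome when the
        -- summands have only `x` in common.
        wit : ∀ ν ω → St β₁ β₂ (ν ++ ω) → (∀ {f} → f ∈ ω → χ (proj₁ f) ≡ y) → length ν ≡ length ω → ν ++ ω ≢ [] →
          ∃ λ z → ∃ λ z' → z ∈ Φ S × z' ∈ Φ T × χ z ≡ y × χ z' ≡ y
        wit [] [] s hω ℓ ne = ⊥-elim (ne refl)
        wit (f ∷ ν) ((a , b) ∷ ω) s hω ℓ ne = a , b , ∈-resp-↭ (p₁ s) (∈-++⁺ˡ (∈-map⁺ proj₁ {x = a , b} at)) ,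
            ∈-resp-↭ (p₂ s) (∈-++⁺ˡ (∈-map⁺ proj₂ {x = a , b} at)) , hω (here refl) , trans (sym (rμ s at)) (hω (here refl))
          where
          at : (a , b) ∈ f ∷ ν ++ (a , b) ∷ ω
          at = ∈-++⁺ʳ (f ∷ ν) (here refl)
        -- Each mixed pair lowers the corner count by at most one, but the pair closing up the
        -- corners at `x` and the one doing so at `y` do not lower it; this accounts for the 2.
        Ale : ∀ ν ω → St β₁ β₂ (ν ++ ω) → (∀ {f} → f ∈ ν → χ (proj₁ f) ≡ x) → (∀ {f} → f ∈ ω → χ (proj₁ f) ≡ y) → length ν ≡ length ω → ν ++ ω ≢ [] →
          2 + c ((β₁ ++ β₂) ++ α ST) (Φ ST) ≤ A ST (full β₁ β₂ (ν ++ ω)) + length ν + length ω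
        Ale [] [] s hν hω ℓ ne = ⊥-elim (ne refl)
        Ale ((a , b) ∷ ν) ((a' , b') ∷ ω) s hν hω ℓ ne = ≤-trans (s≤s (c-cycle-≥ ω K (Φ ST) yconn))
            (≤-trans (+-monoˡ-≤ (length ω₊) (c-cycle-≥ ν (ω₊ ++ K) (Φ ST) xconn))
              (≤-reflexive (cong (λ l → c l (Φ ST) + length ν₊ + length ω₊) assoc₁)))
          where
          B = β₁ ++ β₂
          K = B ++ α ST
          ν₊ ω₊ : List (X × X)
          ν₊ = (a , b) ∷ ν
          ω₊ = (a' , b') ∷ ω
          assoc₁ : ν₊ ++ (ω₊ ++ K) ≡ ((ν₊ ++ ω₊) ++ B) ++ α ST
          assoc₁ = trans (cong (ν₊ ++_) (sym (++-assoc ω₊ B (α ST)))) (trans (sym (++-assoc ν₊ (ω₊ ++ B) (α ST))) (cong (_++ α ST) (sym (++-assoc ν₊ ω₊ B))))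
          xconn : Conn (ν ++ (ω₊ ++ K)) a b
          xconn = subst (λ l → Conn l a b) (trans (cong (_++ α ST) (++-assoc ν ω₊ B)) (trans (++-assoc ν (ω₊ ++ B) (α ST)) (cong (ν ++_) (++-assoc ω₊ B (α ST)))))
                    (cycle (α ST) ((ν ++ ω₊) ++ B) (pα wST) (full-↭ s))
          f : X → Bool
          f = comp (ω ++ K) a'
          χK : ∀ {z z'} → Conn (ω ++ K) z z' → χ z ≡ χ z'
          χK = Conn-respects χ (ω ++ K) (Resp-++ {ω} (λ i → rμ s (∈-++⁺ʳ ν₊ (there i))) (Resp-++ {B} (Resp-++ {β₁} (r₁ s) (r₂ s)) (rα wST)))
          νfalse : ∀ {z} → z ∈ flat ν₊ → f z ≡ false
          νfalse {z} i = comp-false (ω ++ K) (λ h → x≢y (trans (sym (χν z i)) (trans (sym (χK h)) (hω (here refl)))))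
            where
            χν : ∀ z → z ∈ flat ν₊ → χ z ≡ x
            χν z i with ∈-++⁻ (map proj₁ ν₊) (∈-resp-↭ (flat-maps ν₊) i)
            ... | inj₁ j with ∈-map⁻ proj₁ j
            ... | g , g∈ , refl = hν g∈
            χν z i | inj₂ j with ∈-map⁻ proj₂ j
            ... | g , g∈ , refl = trans (sym (rμ s (∈-++⁺ˡ g∈))) (hν g∈)
          -- Apart from `a'` and `b'` all loose flags lie at `x`, and a corner path cannot change
          -- its vertex.
          yconn : Conn (ω ++ K) a' b'
          yconn = comp-conn (ω ++ K) (xor-mid (comp-true (ω ++ K) (Conn-refl (ω ++ K) {a'})) (par-all-false f (flat ν₊) νfalse)
            (par-open f (α ST) (ω ++ B) (a' ∷ b' ∷ flat ν₊) (pα wST) πy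
              (λ i → comp-closed (ω ++ K) (Conn-∈ (ω ++ K) (∈-++⁺ʳ ω (∈-++⁺ʳ B i))))
              (λ i → comp-closed (ω ++ K) (Conn-∈ (ω ++ K) (mv (∈-++⁻ ω i))))))
            where
            mv : ∀ {g} → g ∈ ω ⊎ g ∈ B → g ∈ ω ++ K
            mv (inj₁ i) = ∈-++⁺ˡ i
            mv (inj₂ i) = ∈-++⁺ʳ ω (∈-++⁺ˡ i)
            πy : a' ∷ b' ∷ (flat ν₊ ++ flat (ω ++ B)) ↭ Φ ST
            πy = ↭-trans (↭-sym (shifts (flat ν₊) (a' ∷ b' ∷ []))) (↭-trans
              (↭-reflexive (trans (sym (flat-++ ν₊ (ω₊ ++ B))) (cong flat (sym (++-assoc ν₊ ω₊ B))))) (full-↭ s))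

      split-types : ∀ (μ : List (X × X)) → (∀ {f} → f ∈ μ → χ (proj₁ f) ≡ x ⊎ χ (proj₁ f) ≡ y) →
        ∃ λ ν → ∃ λ ω → μ ↭ ν ++ ω × (∀ {f} → f ∈ ν → χ (proj₁ f) ≡ x) × (∀ {f} → f ∈ ω → χ (proj₁ f) ≡ y)
      split-types [] h = [] , [] , ↭-refl , (λ ()) , (λ ())
      split-types (f ∷ μ) h with split-types μ (h ∘ there) | h (here refl)
      ... | ν , ω , π , hν , hω | inj₁ e = f ∷ ν , ω , prep f π , (λ { (here refl) → e ; (there i) → hν i }) , hω
      ... | ν , ω , π , hν , hω | inj₂ e = ν , f ∷ ω , ↭-trans (prep f π) (↭-sym (shift f ν ω)) , hν , (λ { (here refl) → e ; (there i) → hω i })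

      -- The condition for a free switch of two mixed pairs: they sit at one vertex, and a face path
      -- inside one of the summands joins their ends there.
      P : List (X × X) → List (X × X) → X × X → X × X → Set
      P β₁ β₂ (a , b) (a' , b') = χ a ≡ χ a' × (Conn (β₁ ++ m S) a a' ⊎ Conn (β₂ ++ m T) b b')

      P? : ∀ β₁ β₂ → Decidable (P β₁ β₂)
      P? β₁ β₂ (a , b) (a' , b') = (χ a ≟V χ a') ×-dec (conn? (β₁ ++ m S) a a' ⊎-dec conn? (β₂ ++ m T) b b')

      P-sym : ∀ {β₁ β₂ f g} → P β₁ β₂ f g → P β₁ β₂ g f
      P-sym {β₁} (e , inj₁ h) = sym e , inj₁ (Conn-sym (β₁ ++ m S) h)
      P-sym {β₁} {β₂} (e , inj₂ h) = sym e , inj₂ (Conn-sym (β₂ ++ m T) h)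

      -- A free switch turns two mixed pairs into one pair inside `S` and one inside `T`; it splits
      -- a face, which pays for at most one more corner cycle. Without mixed pairs the matching is a
      -- disjoint union; with mixed pairs but no free switch `terminal` takes over.
      loop : ∀ fuel β₁ β₂ μ → St β₁ β₂ μ → length μ ≤ fuel → Res (A ST (full β₁ β₂ μ)) (M ST (full β₁ β₂ μ))
      loop fuel β₁ β₂ [] s _ = inj₁ (M S β₁ , A S β₁ , M T β₂ , A T β₂ , (β₁ , v₁ , ≤-reflexive (+-comm (A S β₁) _)) , (β₂ , v₂ , ≤-reflexive (+-comm (A T β₂) _)) ,
          ≤-reflexive (trans (cong₂ _+_ (M-⊕ wS wT d v₁ v₂) (sym (A-⊕ wS wT d v₁ v₂))) (+-comm (M S β₁ + M T β₂) (A ST (β₁ ++ β₂)))))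
        where
        v₁ : Valid S β₁
        v₁ = record { pβ = p₁ s ; rβ = r₁ s }
        v₂ : Valid T β₂
        v₂ = record { pβ = p₂ s ; rβ = r₂ s }
      loop zero β₁ β₂ (f ∷ μ) s ()
      loop (suc fuel) β₁ β₂ μ@(_ ∷ _) s le with search (P? β₁ β₂) μ
      ... | inj₁ ((a₁ , b₁) , (a₂ , b₂) , μ' , π , eχ , h) = weaken {A ST (full β₁ β₂ μ)} {M ST (full β₁ β₂ μ)} {A ST (full ((a₁ , a₂) ∷ β₁) ((b₁ , b₂) ∷ β₂) μ')} fin
              (loop fuel ((a₁ , a₂) ∷ β₁) ((b₁ , b₂) ∷ β₂) μ' s' (s≤s⁻¹ (≤-trans (≤-trans (n≤1+n _) (≤-reflexive (sym (↭-length π)))) le)))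
        where
        B = β₁ ++ β₂
        so : St β₁ β₂ ((a₁ , b₁) ∷ (a₂ , b₂) ∷ μ')
        so = St-↭ π s
        old new : List (X × X)
        old = (a₁ , b₁) ∷ (a₂ , b₂) ∷ (μ' ++ B)
        new = (a₁ , a₂) ∷ (b₁ , b₂) ∷ (μ' ++ B)
        vo : Valid ST old
        vo = St-valid so
        n : full ((a₁ , a₂) ∷ β₁) ((b₁ , b₂) ∷ β₂) μ' ≅ new
        n = ↭⇒≅ (↭-trans (++⁺ˡ μ' (prep (a₁ , a₂) (shift (b₁ , b₂) β₁ β₂))) (↭-trans (shift (a₁ , a₂) μ' _) (prep (a₁ , a₂) (shift (b₁ , b₂) μ' B))))
        o : full β₁ β₂ μ ≅ old
        o = ↭⇒≅ (++⁺ʳ B π)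
        W = (μ' ++ B) ++ m ST
        sub₁ : ∀ {u v} → (u , v) ∈ β₁ ++ m S → (u , v) ∈ W
        sub₁ i with ∈-++⁻ β₁ i
        ... | inj₁ j = ∈-++⁺ˡ (∈-++⁺ʳ μ' (∈-++⁺ˡ j))
        ... | inj₂ j = ∈-++⁺ʳ (μ' ++ B) (∈-++⁺ˡ j)
        sub₂ : ∀ {u v} → (u , v) ∈ β₂ ++ m T → (u , v) ∈ W
        sub₂ i with ∈-++⁻ β₂ i
        ... | inj₁ j = ∈-++⁺ˡ (∈-++⁺ʳ μ' (∈-++⁺ʳ β₁ j))
        ... | inj₂ j = ∈-++⁺ʳ (μ' ++ B) (∈-++⁺ʳ (m S) j)
        conn-W : Conn (β₁ ++ m S) a₁ a₂ ⊎ Conn (β₂ ++ m T) b₁ b₂ → Conn W a₁ a₂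
        conn-W (inj₁ k) = Conn-⊆ {es = β₁ ++ m S} {es' = W} sub₁ k
        -- Face paths pair up the four loose ends, so a path between the ends in `T` forces one
        -- between the ends in `S`.
        conn-W (inj₂ k) = four (m ST) (μ' ++ B) (pm wST)
              (↭-trans (↭-trans (prep b₁ (swap b₂ a₁ ↭-refl)) (↭-trans (swap b₁ a₁ ↭-refl) (prep a₁ (prep b₁ (swap b₂ a₂ ↭-refl))))) (pβ vo))
              (Conn-⊆ {es = β₂ ++ m T} {es' = W} sub₂ k)
        fin : A ST (full ((a₁ , a₂) ∷ β₁) ((b₁ , b₂) ∷ β₂) μ') + M ST (full β₁ β₂ μ) ≤ A ST (full β₁ β₂ μ) + M ST (full ((a₁ , a₂) ∷ β₁) ((b₁ , b₂) ∷ β₂) μ')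
        fin = subst₂ _≤_ (cong₂ _+_ (sym (A-≅ ST n)) (sym (M-≅ ST o))) (cong₂ _+_ (sym (A-≅ ST o)) (sym (M-≅ ST n)))
          (≤-trans (+-monoˡ-≤ (M ST old) (break-A wST vo)) (≤-reflexive (trans (sym (+-suc (A ST old) (M ST old)))
            (cong (A ST old +_) (sym (break-split (uniq wST) (m ST) (pm wST) (μ' ++ B) (pβ vo) (conn-W h)))))))
        s' : St ((a₁ , a₂) ∷ β₁) ((b₁ , b₂) ∷ β₂) μ'
        s' = record
          { p₁ = ↭-trans (shifts (map proj₁ μ') (a₁ ∷ a₂ ∷ [])) (p₁ so)
          ; p₂ = ↭-trans (shifts (map proj₂ μ') (b₁ ∷ b₂ ∷ [])) (p₂ so)
          ; r₁ = λ { (here refl) → eχ ; (there i) → r₁ s i }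
          ; r₂ = λ { (here refl) → trans (sym (rμ so (here refl))) (trans eχ (rμ so (there (here refl)))) ; (there i) → r₂ s i }
          ; rμ = λ i → rμ so (there (there i)) }
      ... | inj₂ none =
        case split-types μ types of λ { (ν , ω , π , hν , hω) →
          inj₂ (subst₂ Res₂ (sym (A-≅ ST (↭⇒≅ (++⁺ʳ (β₁ ++ β₂) π)))) (sym (M-≅ ST (↭⇒≅ (++⁺ʳ (β₁ ++ β₂) π))))
            (terminal ν ω (St-↭ π s) hν hω
              (λ i j n e → (λ h → sep (∈-resp-↭ (↭-sym π) i) (∈-resp-↭ (↭-sym π) j) n (e , inj₁ h)) ,
                           (λ h → sep (∈-resp-↭ (↭-sym π) i) (∈-resp-↭ (↭-sym π) j) n (e , inj₂ h)))
              (λ e → ne (↭-length (subst (μ ↭_) e π))))) }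
        where
        ne : length μ ≢ 0
        ne ()
        types : ∀ {f} → f ∈ μ → χ (proj₁ f) ≡ x ⊎ χ (proj₁ f) ≡ y
        types {a , b} i = shared (∈-resp-↭ (p₁ s) (∈-++⁺ˡ (∈-map⁺ proj₁ i))) (∈-resp-↭ (p₂ s) (∈-++⁺ˡ (∈-map⁺ proj₂ i))) (rμ s i)
        sep : ∀ {f g} → f ∈ μ → g ∈ μ → f ≢ g → P β₁ β₂ f g → ⊥
        sep i j n h = none i j n h (P-sym {β₁} {β₂} h)

      sort : ∀ β → (∀ {z} → z ∈ flat β → z ∈ Φ S ⊎ z ∈ Φ T) → ∃ λ β₁ → ∃ λ β₂ → ∃ λ μ → β ≅ full β₁ β₂ μ ×
        (∀ {z} → z ∈ map proj₁ μ ++ flat β₁ → z ∈ Φ S) × (∀ {z} → z ∈ map proj₂ μ ++ flat β₂ → z ∈ Φ T)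
      sort [] h = [] , [] , [] , ≅-refl , (λ ()) , (λ ())
      sort ((a , b) ∷ β) h with sort β (h ∘ there ∘ there) | h (here refl) | h (there (here refl))
      ... | β₁ , β₂ , μ , o , h₁ , h₂ | inj₁ a∈ | inj₁ b∈ = (a , b) ∷ β₁ , β₂ , μ ,
          ≅-trans (≅-cons (a , b) o) (↭⇒≅ (↭-sym (shift (a , b) μ (β₁ ++ β₂)))) , in₁ , h₂
        where
        in₁ : ∀ {z} → z ∈ map proj₁ μ ++ a ∷ b ∷ flat β₁ → z ∈ Φ S
        in₁ i with ∈-resp-↭ (shifts (map proj₁ μ) (a ∷ b ∷ [])) i
        ... | here refl = a∈
        ... | there (here refl) = b∈
        ... | there (there j) = h₁ j
      ... | β₁ , β₂ , μ , o , h₁ , h₂ | inj₂ a∈ | inj₂ b∈ = β₁ , (a , b) ∷ β₂ , μ ,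
          ≅-trans (≅-cons (a , b) o) (↭⇒≅ (↭-sym (↭-trans (++⁺ˡ μ (shift (a , b) β₁ β₂)) (shift (a , b) μ (β₁ ++ β₂))))) , h₁ , in₂
        where
        in₂ : ∀ {z} → z ∈ map proj₂ μ ++ a ∷ b ∷ flat β₂ → z ∈ Φ T
        in₂ i with ∈-resp-↭ (shifts (map proj₂ μ) (a ∷ b ∷ [])) i
        ... | here refl = a∈
        ... | there (here refl) = b∈
        ... | there (there j) = h₂ j
      ... | β₁ , β₂ , μ , o , h₁ , h₂ | inj₁ a∈ | inj₂ b∈ = β₁ , β₂ , (a , b) ∷ μ , ≅-cons (a , b) o ,
          (λ { (here refl) → a∈ ; (there i) → h₁ i }) , (λ { (here refl) → b∈ ; (there i) → h₂ i })
      ... | β₁ , β₂ , μ , o , h₁ , h₂ | inj₂ a∈ | inj₁ b∈ = β₁ , β₂ , (b , a) ∷ μ , ≅-trans (≅-cons (a , b) o) (≅-flip a b) ,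
          (λ { (here refl) → b∈ ; (there i) → h₁ i }) , (λ { (here refl) → a∈ ; (there i) → h₂ i })

    split : ∀ {β} → Valid ST β → Res (A ST β) (M ST β)
    split {β} v with sort β (λ i → ∈-++⁻ (Φ S) (∈-resp-↭ (pβ v) i))
    ... | β₁ , β₂ , μ , o , h₁ , h₂ = subst₂ Res (sym (A-≅ ST o)) (sym (M-≅ ST o)) (loop (length μ) β₁ β₂ μ s ≤-refl)
      where
      l₁ l₂ : List X
      l₁ = map proj₁ μ ++ flat β₁
      l₂ = map proj₂ μ ++ flat β₂
      vo : Valid ST (full β₁ β₂ μ)
      vo = Valid-≅ o v
      π : l₁ ++ l₂ ↭ Φ ST
      π = ↭-trans (↭-sym (↭-trans (↭-reflexive (trans (flat-++ μ (β₁ ++ β₂)) (cong (flat μ ++_) (flat-++ β₁ β₂))))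
        (↭-trans (++⁺ʳ (flat β₁ ++ flat β₂) (flat-maps μ)) (interchange (map proj₁ μ) (map proj₂ μ) (flat β₁) (flat β₂))))) (pβ vo)
      u : Unique (l₁ ++ l₂)
      u = Unique-resp-↭ (↭-sym π) (uniq wST)
      back₁ : ∀ {z} → z ∈ Φ S → z ∈ l₁
      back₁ i with ∈-++⁻ l₁ (∈-resp-↭ (↭-sym π) (∈-++⁺ˡ i))
      ... | inj₁ j = j
      ... | inj₂ j = ⊥-elim (d i (h₂ j))
      back₂ : ∀ {z} → z ∈ Φ T → z ∈ l₂
      back₂ i with ∈-++⁻ l₁ (∈-resp-↭ (↭-sym π) (∈-++⁺ʳ (Φ S) i))
      ... | inj₁ j = ⊥-elim (d (h₁ j) i)
      ... | inj₂ j = j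
      s : St β₁ β₂ μ
      s = record { p₁ = unique-set-↭ (unique-++ˡ l₁ u) (uniq wS) h₁ back₁
                 ; p₂ = unique-set-↭ (unique-++ʳ l₁ u) (uniq wT) h₂ back₂
                 ; r₁ = λ i → rβ vo (∈-++⁺ʳ μ (∈-++⁺ˡ i)) ; r₂ = λ i → rβ vo (∈-++⁺ʳ μ (∈-++⁺ʳ β₁ i)) ; rμ = λ i → rβ vo (∈-++⁺ˡ i) }

-- Relabelling of flags

InE-unique : ∀ {X : Set} {b : List (X × X)} → Unique (flat b) → ∀ {p q r} → InE b p q → InE b p r → q ≡ r
InE-unique u (inj₁ (here refl)) (inj₁ (here refl)) = refl
InE-unique u (inj₁ (here refl)) (inj₂ (here refl)) = refl
InE-unique u (inj₂ (here refl)) (inj₁ (here refl)) = refl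
InE-unique u (inj₂ (here refl)) (inj₂ (here refl)) = refl
InE-unique u (inj₁ (here refl)) (inj₁ (there j)) = ⊥-elim (unique-head u (there (flat-∈ˡ j)))
InE-unique u (inj₁ (here refl)) (inj₂ (there j)) = ⊥-elim (unique-head u (there (flat-∈ʳ j)))
InE-unique u (inj₂ (here refl)) (inj₁ (there j)) = ⊥-elim (unique-head (unique-tail u) (flat-∈ˡ j))
InE-unique u (inj₂ (here refl)) (inj₂ (there j)) = ⊥-elim (unique-head (unique-tail u) (flat-∈ʳ j))
InE-unique u (inj₁ (there j)) (inj₁ (here refl)) = ⊥-elim (unique-head u (there (flat-∈ˡ j)))
InE-unique u (inj₂ (there j)) (inj₁ (here refl)) = ⊥-elim (unique-head u (there (flat-∈ʳ j)))
InE-unique u (inj₁ (there j)) (inj₂ (here refl)) = ⊥-elim (unique-head (unique-tail u) (flat-∈ˡ j))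
InE-unique u (inj₂ (there j)) (inj₂ (here refl)) = ⊥-elim (unique-head (unique-tail u) (flat-∈ʳ j))
InE-unique u (inj₁ (there i)) (inj₁ (there j)) = InE-unique (unique-tail (unique-tail u)) (inj₁ i) (inj₁ j)
InE-unique u (inj₁ (there i)) (inj₂ (there j)) = InE-unique (unique-tail (unique-tail u)) (inj₁ i) (inj₂ j)
InE-unique u (inj₂ (there i)) (inj₁ (there j)) = InE-unique (unique-tail (unique-tail u)) (inj₂ i) (inj₁ j)
InE-unique u (inj₂ (there i)) (inj₂ (there j)) = InE-unique (unique-tail (unique-tail u)) (inj₂ i) (inj₂ j)

flat-partner : ∀ {X : Set} (a : List (X × X)) {p} → p ∈ flat a → ∃ λ r → InE a p r
flat-partner (_ ∷ a) (here refl) = _ , inj₁ (here refl)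
flat-partner (_ ∷ a) (there (here refl)) = _ , inj₂ (here refl)
flat-partner (_ ∷ a) (there (there i)) with flat-partner a i
... | r , h = r , InE-there h

-- Perfect matchings of the same points cannot be properly nested, so one inclusion is enough.
matching-≅ : ∀ {X : Set} (a b : List (X × X)) → Unique (flat b) → flat a ↭ flat b → (∀ {u v} → (u , v) ∈ a → InE b u v) → a ≅ b
matching-≅ a b u π h = record { perm = π ; to = h ; from = back }
  where
  h' : ∀ {u v} → InE a u v → InE b u v
  h' (inj₁ i) = h i
  h' (inj₂ i) = InE-sym (h i)
  back : ∀ {u v} → (u , v) ∈ b → InE a u v
  back i with flat-partner a (∈-resp-↭ (↭-sym π) (flat-∈ˡ i))
  ... | r , k with refl ← InE-unique u (inj₁ i) (h' k) = k

module _ {X X' : Set} (f : X → X') where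

  map² : List (X × X) → List (X' × X')
  map² = map (λ (u , v) → f u , f v)

  flat-map² : ∀ es → flat (map² es) ≡ map f (flat es)
  flat-map² []       = refl
  flat-map² (e ∷ es) = cong (λ l → _ ∷ _ ∷ l) (flat-map² es)

  ∈-map²⁻ : ∀ {es u v} → (u , v) ∈ map² es → ∃ λ p → ∃ λ q → (p , q) ∈ es × u ≡ f p × v ≡ f q
  ∈-map²⁻ i with ∈-map⁻ _ i
  ... | (p , q) , j , refl = p , q , j , refl , refl

  Conn-map : ∀ es {p q} → Conn es p q → Conn (map² es) (f p) (f q)
  Conn-map [] refl = refl
  Conn-map (e ∷ es) (inj₁ h) = inj₁ (Conn-map es h)
  Conn-map (e ∷ es) (inj₂ (inj₁ (h , k))) = inj₂ (inj₁ (Conn-map es h , Conn-map es k))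
  Conn-map (e ∷ es) (inj₂ (inj₂ (h , k))) = inj₂ (inj₂ (Conn-map es h , Conn-map es k))

  classes-map : ∀ {R : X → X → Set} {R' : X' → X' → Set} (R? : Decidable R) (R'? : Decidable R') l →
    (∀ {p q} → p ∈ l → q ∈ l → R p q → R' (f p) (f q)) → (∀ {p q} → p ∈ l → q ∈ l → R' (f p) (f q) → R p q) →
    classes R'? (map f l) ≡ classes R? l
  classes-map R? R'? [] h g = refl
  classes-map {R} {R'} R? R'? (p ∷ l) h g = cong₂ _+_ (bitN-cong (any? (R'? (f p)) (map f l)) (any? (R? p) l) (un l (λ i → g (here refl) (there i))) (mp l (λ i → h (here refl) (there i))))
    (classes-map R? R'? l (λ i j → h (there i) (there j)) (λ i j → g (there i) (there j)))
    where
    un : ∀ l → (∀ {q} → q ∈ l → R' (f p) (f q) → R p q) → Any (R' (f p)) (map f l) → Any (R p) l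
    un (q ∷ l) k (here r) = here (k (here refl) r)
    un (q ∷ l) k (there i) = there (un l (k ∘ there) i)
    mp : ∀ l → (∀ {q} → q ∈ l → R p q → R' (f p) (f q)) → Any (R p) l → Any (R' (f p)) (map f l)
    mp (q ∷ l) k (here r) = here (k (here refl) r)
    mp (q ∷ l) k (there i) = there (mp l (k ∘ there) i)

  module _ {Φ : List X} (inj : ∀ {p q} → p ∈ Φ → q ∈ Φ → f p ≡ f q → p ≡ q) where

    Conn-unmap : ∀ es → (∀ {z} → z ∈ flat es → z ∈ Φ) → ∀ {p q} → p ∈ Φ → q ∈ Φ → Conn (map² es) (f p) (f q) → Conn es p q
    Conn-unmap es s {p} {q} p∈ q∈ h with Conn-least {S = R} (record { rfl = inj₁ refl ; sm = smR ; tr = trR }) (map² es) edR h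
      where
      -- The first alternative covers the points outside the image of `Φ`, at which the relation is
      -- merely reflexive.
      R : X' → X' → Set
      R u v = u ≡ v ⊎ (∃ λ p → ∃ λ q → p ∈ Φ × q ∈ Φ × u ≡ f p × v ≡ f q × Conn es p q)
      smR : ∀ {u v} → R u v → R v u
      smR (inj₁ e) = inj₁ (sym e)
      smR (inj₂ (p , q , p∈ , q∈ , e , e' , h)) = inj₂ (q , p , q∈ , p∈ , e' , e , Conn-sym es h)
      trR : ∀ {u v w} → R u v → R v w → R u w
      trR (inj₁ refl) r = r
      trR (inj₂ r) (inj₁ refl) = inj₂ r
      trR (inj₂ (p , q , p∈ , q∈ , refl , refl , h)) (inj₂ (q' , r , q'∈ , r∈ , e , refl , k)) with refl ← inj q∈ q'∈ e =
        inj₂ (p , r , p∈ , r∈ , refl , refl , Conn-trans es h k)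
      edR : ∀ {u v} → (u , v) ∈ map² es → R u v
      edR i with ∈-map²⁻ i
      ... | p , q , j , refl , refl = inj₂ (p , q , s (flat-∈ˡ j) , s (flat-∈ʳ j) , refl , refl , Conn-∈ es j)
    ... | inj₁ e with refl ← inj p∈ q∈ e = Conn-refl es
    ... | inj₂ (p' , q' , p'∈ , q'∈ , e , e' , k) with refl ← inj p∈ p'∈ e | refl ← inj q∈ q'∈ e' = k

module Relabel {X X' : Set} (_≟_ : DecidableEquality X) (_≟'_ : DecidableEquality X') (f : X → X') where
  private
    module C  = Count _≟_
    module C' = Count _≟'_

  opaque
    unfolding Count.c

    c-map : ∀ es {Φ} → (∀ {p q} → p ∈ Φ → q ∈ Φ → f p ≡ f q → p ≡ q) → (∀ {z} → z ∈ flat es → z ∈ Φ) →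
      C'.c (map² f es) (map f Φ) ≡ C.c es Φ
    c-map es {Φ} inj s = classes-map f (C.conn? es) (C'.conn? (map² f es)) Φ (λ _ _ → Conn-map f es) (Conn-unmap f inj es s)

  module _ {V V' : Set} (_≟V_ : DecidableEquality V) (_≟V'_ : DecidableEquality V') (χ : X → V) (χ' : X' → V') where
    private
      module E  = Surgery _≟_ _≟V_ χ
      module E' = Surgery _≟'_ _≟V'_ χ'

    -- Vertices are compared in one direction only, so `f` may also identify vertices: with fewer of
    -- them more matchings are valid, and `D` can only grow.
    transport : ∀ {S S'} → E.WF S → E'.WF S' → (∀ {p q} → p ∈ Φ S → q ∈ Φ S → f p ≡ f q → p ≡ q) → map f (Φ S) ↭ Φ S' →
      (∀ {u v} → (u , v) ∈ m S → InE (m S') (f u) (f v)) → (∀ {u v} → (u , v) ∈ α S → InE (α S') (f u) (f v)) →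
      (∀ {u v} → u ∈ Φ S → v ∈ Φ S → χ u ≡ χ v → χ' (f u) ≡ χ' (f v)) → ∀ {i j} → E.Ach S i j → E'.Ach S' i j
    transport {S} {S'} w w' inj π hm hα hχ {i} {j} (β , v , h) = map² f β , record { pβ = πβ ; rβ = rβ' } ,
        subst₂ _≤_ (cong (_+ i) (count (α S) (α S') (E.pα w) (E'.pα w') hα)) (cong (_+ j) (count (m S) (m S') (E.pm w) (E'.pm w') hm)) h
      where
      open E'.Valid
      πβ : flat (map² f β) ↭ Φ S'
      πβ = ↭-trans (↭-reflexive (flat-map² f β)) (↭-trans (map⁺ f (E.pβ v)) π)
      rβ' : E'.Resp (map² f β)
      rβ' i with ∈-map²⁻ f i
      ... | p , q , k , refl , refl = hχ (∈-resp-↭ (E.pβ v) (flat-∈ˡ k)) (∈-resp-↭ (E.pβ v) (flat-∈ʳ k)) (E.rβ v k)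
      count : ∀ a a' → flat a ↭ Φ S → flat a' ↭ Φ S' → (∀ {u v} → (u , v) ∈ a → InE a' (f u) (f v)) →
        C.c (β ++ a) (Φ S) ≡ C'.c (map² f β ++ a') (Φ S')
      count a a' pa pa' ha = trans (sym (c-map (β ++ a) inj into))
        (trans (C'.c-↭ (map² f (β ++ a)) π) (trans (cong (λ l → C'.c l (Φ S')) (map-++ _ β a))
          (C'.c-≅ (Φ S') (≅-++ˡ (map² f β) (matching-≅ (map² f a) a' (Unique-resp-↭ (↭-sym pa') (E'.uniq w'))
            (↭-trans (↭-reflexive (flat-map² f a)) (↭-trans (map⁺ f pa) (↭-trans π (↭-sym pa')))) ha')))))
        where
        ha' : ∀ {u v} → (u , v) ∈ map² f a → InE a' u v
        ha' i with ∈-map²⁻ f i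
        ... | p , q , k , refl , refl = ha k
        into : ∀ {z} → z ∈ flat (β ++ a) → z ∈ Φ S
        into i with ∈-++⁻ (flat β) (subst (_ ∈_) (flat-++ β a) i)
        ... | inj₁ j = ∈-resp-↭ (E.pβ v) j
        ... | inj₂ j = ∈-resp-↭ pa j

-- Euler's inequality

edgesSys : ∀ {X} → List (Quad X) → Sys X
edgesSys []      = sys [] [] []
edgesSys (e ∷ Q) = e ◂ edgesSys Q

module Euler {X V : Set} (_≟_ : DecidableEquality X) (_≟V_ : DecidableEquality V) (χ : X → V) where
  open Split _≟_ _≟V_ χ public
  module CV = Union _≟V_

  ends : Quad X → V × V
  ends e = χ (Quad.p e) , χ (Quad.q e)

  WF-edges : ∀ {Q} → All EdgeOK Q → Unique (Φ (edgesSys Q)) → WF (edgesSys Q)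
  WF-edges {[]} [] u = record { uniq = u ; pm = ↭-refl ; pα = ↭-refl ; rα = λ () }
  WF-edges {e ∷ Q} (ok ∷ oks) u = WF-◂ ok (WF-edges oks (unique-++ʳ (Φ (edgeSys e)) u)) (unique-disj (Φ (edgeSys e)) u)

  m-ends : ∀ {Q} → All EdgeOK Q → ∀ {u v} → (u , v) ∈ m (edgesSys Q) → Conn (map ends Q) (χ u) (χ v)
  m-ends {e ∷ Q} (ok ∷ oks) (here refl) = Conn-∈ (map ends (e ∷ Q)) (here refl)
  m-ends {e ∷ Q} (ok ∷ oks) (there (here refl)) = subst₂ (Conn (map ends (e ∷ Q))) (χp ok) (χq ok) (Conn-∈ (map ends (e ∷ Q)) (here refl))
  m-ends {e ∷ Q} (ok ∷ oks) (there (there i)) = inj₁ (m-ends oks i)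

  -- Nonnegativity of the Euler genus, by deleting the edges one after the other. An edge with
  -- connected ends costs at most one, the contribution of that edge to `length Q`. A bridge even
  -- gains one, and its deletion raises the number of components by one, which counts twice.
  euler : ∀ Q → All EdgeOK Q → Unique (Φ (edgesSys Q)) → ∀ {vs} → Unique vs → (∀ {e} → e ∈ Q → χ (Quad.p e) ∈ vs × χ (Quad.q e) ∈ vs) →
    ∀ {i j} → Ach (edgesSys Q) i j → i + 2 * length vs ≤ j + length Q + 2 * CV.c (map ends Q) vs
  euler [] _ _ {vs} uv _ {i} {j} (β , _ , h) = subst₂ _≤_ (cong (λ l → i + 2 * l) (CV.c-[] uv)) (cong (_+ 2 * CV.c [] vs) (sym (+-identityʳ j)))
    (+-monoˡ-≤ (2 * CV.c [] vs) (lin (A (edgesSys []) β) h (+-comm i _) (+-comm (A (edgesSys []) β) j)))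
  euler (e ∷ Q) (ok ∷ oks) u {vs} uv inv {i} {j} x with CV.conn? (map ends Q) (χ (Quad.p e)) (χ (Quad.q e))
  ... | yes h = subst (λ l → i + 2 * length vs ≤ j + suc (length Q) + 2 * l) (sym (CV.c-∷-conn (map ends Q) vs h))
        (≤-trans (euler Q oks uQ uv (inv ∘ there) (delete ok (WF-edges oks uQ) (unique-disj (Φ (edgeSys e)) u) x))
          (≤-reflexive (cong (_+ 2 * CV.c (map ends Q) vs) (sym (+-suc j (length Q))))))
    where uQ = unique-++ʳ (Φ (edgeSys e)) u
  ... | no ¬h = arith (CV.c-∷-new (map ends Q) (proj₁ (inv (here refl))) (proj₂ (inv (here refl))) ¬h)
        (euler Q oks uQ uv (inv ∘ there) (delete-bridge ok (WF-edges oks uQ) (unique-disj (Φ (edgeSys e)) u)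
          (CV.comp (map ends Q) (χ (Quad.p e))) ne (λ i → CV.comp-closed (map ends Q) (m-ends oks i)) x))
    where
    uQ = unique-++ʳ (Φ (edgeSys e)) u
    ne : CV.comp (map ends Q) (χ (Quad.p e)) (χ (Quad.p e)) ≢ CV.comp (map ends Q) (χ (Quad.p e)) (χ (Quad.q e))
    ne e= with () ← trans (sym (CV.comp-true (map ends Q) (Conn-refl (map ends Q)))) (trans e= (CV.comp-false (map ends Q) ¬h))
    arith : ∀ {n l κ κ'} → κ ≡ suc κ' → suc i + n ≤ j + l + 2 * κ → i + n ≤ j + suc l + 2 * κ'
    arith {n} {l} {_} {κ'} refl k = lin 1 k (eq₁ i n) (eq₂ j l κ')
      where
      eq₁ : ∀ i n → i + n + 1 ≡ suc i + n
      eq₁ = solve-∀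
      eq₂ : ∀ j l κ' → j + l + 2 * suc κ' ≡ j + suc l + 2 * κ' + 1
      eq₂ = solve-∀

-- Replacing the end at the flags r, r′ of an edge by a path through the new edge e costs one.
module Subdivide {X V V' : Set} (_≟_ : DecidableEquality X) (_≟V_ : DecidableEquality V) (_≟V'_ : DecidableEquality V') (χ : X → V) (χ' : X → V') where
  private
    module E  = Surgery _≟_ _≟V_ χ
    module E' = Surgery _≟_ _≟V'_ χ'
    module E₀ = Surgery _≟_ Unit._≟_ (λ (_ : X) → tt)

  module _ {o o′ r r′ s s′ t t′ : X} {S : Sys X} (w : E₀.WF (quad o o′ r r′ ◂ S)) (ok : E.EdgeOK (quad s s′ t t′))
           (d : E.Disj (edgeSys (quad s s′ t t′)) (quad o o′ r r′ ◂ S)) (χr : χ r ≡ χ s) (χr′ : χ r′ ≡ χ s)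
           (hχ : ∀ {z z'} → z ∈ Φ (quad o o′ r r′ ◂ S) → z' ∈ Φ (quad o o′ r r′ ◂ S) → z ≢ r → z ≢ r′ → z' ≢ r → z' ≢ r′ → χ' z ≡ χ' z' → χ z ≡ χ z')
           (ht : ∀ {z} → z ∈ Φ (quad o o′ r r′ ◂ S) → z ≢ r → z ≢ r′ → χ' z ≡ χ' r ⊎ χ' z ≡ χ' r′ → χ z ≡ χ t) where
    private
      h e : Quad X
      h = quad o o′ r r′
      e = quad s s′ t t′

    subdivide : ∀ {i j} → E'.Ach (h ◂ S) i j → E.Ach (e ◂ h ◂ S) i (suc j)
    subdivide {i} {j} (β , v , k) = go (extract₂ β r≢r′ r∈ r′∈)
      where
      T = e ◂ h ◂ S
      ok₀ : E₀.EdgeOK e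
      ok₀ = record { uq = E.uq ok ; χp = refl ; χq = refl }
      we : E₀.WF (edgeSys e)
      we = E₀.WF-edge ok₀
      wT : E₀.WF T
      wT = E₀.WF-◂ ok₀ w d
      v₀ : E₀.Valid (h ◂ S) β
      v₀ = record { pβ = E'.pβ v ; rβ = λ _ → refl }
      -- The counts are followed with vertices ignored, so the new edge can start as a loop with one
      -- corner cycle and two faces. Joining `r` to `s` lowers both counts by one; joining `r′` to
      -- `s′` raises `A` and lowers `M` by at most one. In total only `A` can grow, by one, and only
      -- the final matching is checked against `χ`.
      ve : E₀.Valid (edgeSys e) (m (edgeSys e))
      ve = record { pβ = E₀.pm we ; rβ = λ _ → refl }
      r∈Φ : r ∈ Φ (h ◂ S)
      r∈Φ = there (there (here refl))
      r′∈Φ : r′ ∈ Φ (h ◂ S)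
      r′∈Φ = there (there (there (here refl)))
      r∈ : r ∈ flat β
      r∈ = ∈-resp-↭ (↭-sym (E'.pβ v)) r∈Φ
      r′∈ : r′ ∈ flat β
      r′∈ = ∈-resp-↭ (↭-sym (E'.pβ v)) r′∈Φ
      r≢r′ : r ≢ r′
      r≢r′ refl = unique-head (unique-tail (unique-tail (E₀.uniq w))) (here refl)
      -- the state after joining r to s
      mid : X → List (X × X) → List (X × X)
      mid a γ = (r , s) ∷ (a , t) ∷ (s′ , t′) ∷ γ
      start : X → List (X × X) → List (X × X)
      start a γ = (r , a) ∷ (s , t) ∷ (s′ , t′) ∷ γ
      module _ {a γ} (g : β ≅ (r , a) ∷ γ) where
        g' : m (edgeSys e) ++ β ≅ start a γ
        g' = ≅-trans (≅-++ˡ (m (edgeSys e)) g) (↭⇒≅ (shift (r , a) (m (edgeSys e)) γ))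
        vs : E₀.Valid T (start a γ)
        vs = E₀.Valid-≅ g' (E₀.Valid-⊕ we w d ve v₀)
        vm : E₀.Valid T (mid a γ)
        vm = E₀.break-valid wT vs refl
        As : E₀.A T (start a γ) ≡ suc (E'.A (h ◂ S) β)
        As = trans (sym (E₀.A-≅ T g')) (trans (E₀.A-⊕ we w d ve v₀) (cong (_+ E'.A (h ◂ S) β) (proj₁ (E₀.AM-edge ok₀))))
        Ms : E₀.M T (start a γ) ≡ suc (suc (E'.M (h ◂ S) β))
        Ms = trans (sym (E₀.M-≅ T g')) (trans (E₀.M-⊕ we w d ve v₀) (cong (_+ E'.M (h ◂ S) β) (proj₂ (E₀.AM-edge ok₀))))
        cross = E₀.Conn-⊕-cross we w d ve v₀ {s} {r} (here refl) r∈Φ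
        Am : E'.A (h ◂ S) β ≡ E₀.A T (mid a γ)
        Am = suc-injective (trans (sym As) (E₀.break-merge (E₀.uniq wT) (α T) (E₀.pα wT) ((s′ , t′) ∷ γ) (E₀.pβ vs)
          (λ c → proj₂ cross (Conn-sym ((m (edgeSys e) ++ β) ++ α T) (Conn-≅ (≅-++ (≅-sym g') ≅-refl) c)))))
        Mm : suc (E'.M (h ◂ S) β) ≡ E₀.M T (mid a γ)
        Mm = suc-injective (trans (sym Ms) (E₀.break-merge (E₀.uniq wT) (m T) (E₀.pm wT) ((s′ , t′) ∷ γ) (E₀.pβ vs)
          (λ c → proj₁ cross (Conn-sym ((m (edgeSys e) ++ β) ++ m T) (Conn-≅ (≅-++ (≅-sym g') ≅-refl) c)))))
        finish : ∀ a' γ' → mid a γ ≅ (r′ , a') ∷ (s′ , t′) ∷ γ' → E.Resp ((r′ , s′) ∷ (a' , t′) ∷ γ') → E.Ach T i (suc j)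
        finish a' γ' o' rs = (r′ , s′) ∷ (a' , t′) ∷ γ' , record { pβ = E₀.pβ (E₀.break-valid wT vn refl) ; rβ = rs } ,
          arith (E₀.A T new) (E₀.M T new) (≤-trans (E₀.break-A wT vn) (s≤s (≤-reflexive (trans (sym (E₀.A-≅ T o')) (sym Am)))))
            (≤-trans (≤-reflexive (trans Mm (E₀.M-≅ T o'))) (E₀.break-M wT vn))
          where
          new = (r′ , s′) ∷ (a' , t′) ∷ γ'
          vn : E₀.Valid T ((r′ , a') ∷ (s′ , t′) ∷ γ')
          vn = E₀.Valid-≅ o' vm
          arith : ∀ x y → x ≤ suc (E'.A (h ◂ S) β) → suc (E'.M (h ◂ S) β) ≤ suc y → x + i ≤ y + suc j
          arith x y p q = ≤-trans (+-monoˡ-≤ i p) (≤-trans (s≤s k) (≤-trans (+-monoˡ-≤ j q) (≤-reflexive (sym (+-suc y j)))))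
      ≢r : ∀ {l z} → Unique (r ∷ l) → z ∈ l → z ≢ r
      ≢r u i refl = unique-head u i
      go : _ → E.Ach T i (suc j)
      go (inj₁ (γ , g)) = finish g t ((r , s) ∷ γ)
          (≅-trans (≅-exch (r , s) (r′ , t)) (≅-cons (r′ , t) (≅-exch (r , s) (s′ , t′)))) rs
        where
        u : Unique (r ∷ r′ ∷ flat γ)
        u = Unique-resp-↭ (↭-sym (↭-trans (↭-sym (perm g)) (E'.pβ v))) (E₀.uniq w)
        in∈ : ∀ {z} → z ∈ flat γ → z ∈ Φ (h ◂ S)
        in∈ i = ∈-resp-↭ (E'.pβ v) (∈-resp-↭ (↭-sym (perm g)) (there (there i)))
        rs : E.Resp ((r′ , s′) ∷ (t , t′) ∷ (r , s) ∷ γ)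
        rs (here refl) = trans χr′ (E.χp ok)
        rs (there (here refl)) = E.χq ok
        rs (there (there (here refl))) = χr
        rs (there (there (there i))) = hχ (in∈ (flat-∈ˡ i)) (in∈ (flat-∈ʳ i))
          (≢r u (there (flat-∈ˡ i))) (λ { refl → unique-head (unique-tail u) (flat-∈ˡ i) })
          (≢r u (there (flat-∈ʳ i))) (λ { refl → unique-head (unique-tail u) (flat-∈ʳ i) })
          (E'.Resp-InE (E'.rβ v) (from g (there i)))
      go (inj₂ (a , a' , γ , g)) = finish g a' ((r , s) ∷ (a , t) ∷ γ) o' rs
        where
        o' : (r , s) ∷ (a , t) ∷ (s′ , t′) ∷ (r′ , a') ∷ γ ≅ (r′ , a') ∷ (s′ , t′) ∷ (r , s) ∷ (a , t) ∷ γ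
        o' = ↭⇒≅ (↭-trans (shifts ((r , s) ∷ (a , t) ∷ []) ((s′ , t′) ∷ (r′ , a') ∷ [])) (swap _ _ ↭-refl))
        u : Unique (r ∷ a ∷ r′ ∷ a' ∷ flat γ)
        u = Unique-resp-↭ (↭-sym (↭-trans (↭-sym (perm g)) (E'.pβ v))) (E₀.uniq w)
        in∈ : ∀ {z} → z ∈ r ∷ a ∷ r′ ∷ a' ∷ flat γ → z ∈ Φ (h ◂ S)
        in∈ i = ∈-resp-↭ (E'.pβ v) (∈-resp-↭ (↭-sym (perm g)) i)
        ≢r′ : ∀ {z} → z ∈ a' ∷ flat γ → z ≢ r′
        ≢r′ i refl = unique-head (unique-tail (unique-tail u)) i
        pr : ∀ {z z'} → (z , z') ∈ (r , a) ∷ (r′ , a') ∷ γ → χ' z ≡ χ' z'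
        pr i = E'.Resp-InE (E'.rβ v) (from g i)
        rs : E.Resp ((r′ , s′) ∷ (a' , t′) ∷ (r , s) ∷ (a , t) ∷ γ)
        rs (here refl) = trans χr′ (E.χp ok)
        rs (there (here refl)) = trans (ht (in∈ (there (there (there (here refl))))) (≢r u (there (there (here refl)))) (≢r′ (here refl)) (inj₂ (sym (pr (there (here refl)))))) (E.χq ok)
        rs (there (there (here refl))) = χr
        rs (there (there (there (here refl)))) = ht (in∈ (there (here refl))) (≢r u (here refl)) (λ { refl → unique-head (unique-tail u) (here refl) }) (inj₁ (sym (pr (here refl))))
        rs (there (there (there (there i)))) = hχ (in∈ (there (there (there (there (flat-∈ˡ i)))))) (in∈ (there (there (there (there (flat-∈ʳ i))))))
          (≢r u (there (there (there (flat-∈ˡ i))))) (≢r′ (there (flat-∈ˡ i))) (≢r u (there (there (there (flat-∈ʳ i))))) (≢r′ (there (flat-∈ʳ i)))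
          (pr (there (there i)))

open import Defs

-- Graphs and their embedding schemes

module _ {X : Set} {R : X → X → Set} (R? : Decidable R) where

  classes-absorb : ∀ k l → (∀ {z} → z ∈ k → Any (R z) l) → classes R? (k ++ l) ≡ classes R? l
  classes-absorb []      l h = refl
  classes-absorb (p ∷ k) l h = cong₂ _+_ (bitN-yes (any? (R? p) (k ++ l)) (right k (h (here refl)))) (classes-absorb k l (h ∘ there))
    where
    right : ∀ {P : X → Set} k → Any P l → Any P (k ++ l)
    right []      i = i
    right (_ ∷ k) i = there (right k i)

  classes-++-≥ : ∀ k l → classes R? l ≤ classes R? (k ++ l)
  classes-++-≥ []      l = ≤-refl
  classes-++-≥ (p ∷ k) l = ≤-trans (classes-++-≥ k l) (m≤n+m _ (bitN (any? (R? p) (k ++ l))))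

  classes-≤-length : ∀ l → classes R? l ≤ length l
  classes-≤-length []      = z≤n
  classes-≤-length (p ∷ l) = +-mono-≤ (bitN≤1 (any? (R? p) l)) (classes-≤-length l)
    where
    bitN≤1 : ∀ {A : Set} (a : Dec A) → bitN a ≤ 1
    bitN≤1 (yes _) = z≤n
    bitN≤1 (no _)  = ≤-refl

  classes-discrete : ∀ {l} → Unique l → (∀ {z w} → z ∈ l → w ∈ l → R z w → z ≡ w) → classes R? l ≡ length l
  classes-discrete {[]}    u h = refl
  classes-discrete {p ∷ l} u h = cong₂ _+_ (bitN-no (any? (R? p) l) (λ i → no-rel i id))
      (classes-discrete (unique-tail u) (λ i j → h (there i) (there j)))
    where
    no-rel : ∀ {k} → Any (R p) k → (∀ {z} → z ∈ k → z ∈ l) → ⊥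
    no-rel (here r) s with refl ← h (here refl) (there (s (here refl))) r = unique-head u (s (here refl))
    no-rel (there i) s = no-rel i (s ∘ there)

  classes-reps : Equiv R → ∀ {Φ reps} → (∀ {z} → z ∈ reps → z ∈ Φ) → (∀ {z} → z ∈ Φ → Any (R z) reps) →
    Unique reps → (∀ {z w} → z ∈ reps → w ∈ reps → R z w → z ≡ w) → classes R? Φ ≡ length reps
  classes-reps E {Φ} {reps} sub rep u h = trans (sym (classes-absorb reps Φ (λ i → at (sub i))))
      (trans (classes-↭ R? E (++-comm reps Φ)) (trans (classes-absorb Φ reps rep) (classes-discrete u h)))
    where
    at : ∀ {z l} → z ∈ l → Any (R z) l
    at (here refl) = here (Equiv.rfl E)
    at (there i) = there (at i)

module _ {X V : Set} (_≟V_ : DecidableEquality V) (χ : X → V) {R : X → X → Set} (R? : Decidable R) {Φ : List X} {vs : List V} where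
  private
    χ≡? : Decidable (λ p q → χ p ≡ χ q)
    χ≡? p q = χ p ≟V χ q

    E≡ : Equiv {V} _≡_
    E≡ = record { rfl = refl ; sm = sym ; tr = trans }

    at : ∀ {z : V} {l} → z ∈ l → Any (z ≡_) l
    at = id

    mapped : classes _≟V_ (map χ Φ) ≡ classes χ≡? Φ
    mapped = classes-map χ χ≡? _≟V_ Φ (λ _ _ → id) (λ _ _ → id)

  classes-≤-vertices : (∀ {p} → p ∈ Φ → χ p ∈ vs) → (∀ {p q} → p ∈ Φ → q ∈ Φ → χ p ≡ χ q → R p q) → classes R? Φ ≤ length vs
  classes-≤-vertices sub h = ≤-trans (classes-mono χ≡? R? Φ h) (≤-trans (≤-reflexive (sym mapped))
    (≤-trans (classes-++-≥ _≟V_ vs (map χ Φ)) (≤-trans (≤-reflexive (trans (classes-↭ _≟V_ E≡ (++-comm vs (map χ Φ)))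
      (classes-absorb _≟V_ (map χ Φ) vs sub'))) (classes-≤-length _≟V_ vs))))
    where
    sub' : ∀ {z} → z ∈ map χ Φ → Any (z ≡_) vs
    sub' i with ∈-map⁻ χ i
    ... | p , p∈ , refl = sub p∈

  classes-≥-vertices : Unique vs → (∀ {v} → v ∈ vs → ∃ λ p → p ∈ Φ × χ p ≡ v) → (∀ {p q} → R p q → χ p ≡ χ q) → length vs ≤ classes R? Φ
  classes-≥-vertices u onto h = ≤-trans (≤-reflexive (sym (classes-discrete _≟V_ u (λ _ _ → id))))
    (≤-trans (classes-++-≥ _≟V_ (map χ Φ) vs) (≤-trans (≤-reflexive (trans (classes-↭ _≟V_ E≡ (++-comm (map χ Φ) vs))
      (trans (classes-absorb _≟V_ vs (map χ Φ) onto') mapped))) (classes-mono R? χ≡? Φ (λ _ _ → h))))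
    where
    onto' : ∀ {z} → z ∈ vs → Any (z ≡_) (map χ Φ)
    onto' i with onto i
    ... | p , p∈ , refl = ∈-map⁺ χ p∈

-- A fixed-point-free symmetry τ of R pairs up the classes of R.
classes-halve : ∀ {X : Set} {R R' : X → X → Set} (R? : Decidable R) (R'? : Decidable R') (τ : X → X) ms →
  (∀ {p q} → (p , q) ∈ ms → q ≡ τ p × p ≡ τ q) → (∀ {p q} → (p , q) ∈ ms → R' p q) → (∀ {z w} → R z w → R' z w) →
  (∀ {z w} → z ∈ flat ms → w ∈ flat ms → R' z w → R z w ⊎ R z (τ w)) → (∀ {z} → z ∈ flat ms → ¬ R z (τ z)) →
  (∀ {z w} → z ∈ flat ms → w ∈ flat ms → R z w → R (τ z) (τ w)) → classes R? (flat ms) ≡ 2 * classes R'? (flat ms)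
classes-halve R? R'? τ [] _ _ _ _ _ _ = refl
classes-halve {X} {R} {R'} R? R'? τ ((p , q) ∷ ms) hτ h₁ h₂ h₃ h₄ h₅ = trans
    (cong₂ _+_ (bitN-cong (any? (R? p) (q ∷ l)) (any? (R? q) l) pq qp) (cong (bitN (any? (R? q) l) +_)
      (classes-halve R? R'? τ ms (hτ ∘ there) (h₁ ∘ there) h₂ (λ i j → h₃ (↑ i) (↑ j)) (λ i → h₄ (↑ i)) (λ i j → h₅ (↑ i) (↑ j)))))
    (trans (eq (bitN (any? (R? q) l)) (classes R'? l))
      (cong (2 *_) (cong₂ _+_ (sym (bitN-yes (any? (R'? p) (q ∷ l)) (here (h₁ (here refl)))))
        (cong (_+ classes R'? l) (bitN-cong (any? (R? q) l) (any? (R'? q) l) (Any-map∈ (λ _ → h₂)) q'q)))))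
  where
  l = flat ms
  ↑ : ∀ {z} → z ∈ l → z ∈ p ∷ q ∷ l
  ↑ = there ∘ there
  eq : ∀ b k → b + (b + 2 * k) ≡ 2 * (0 + (b + k))
  eq = solve-∀
  q≡ : q ≡ τ p
  q≡ = proj₁ (hτ (here refl))
  p≡ : p ≡ τ q
  p≡ = proj₂ (hτ (here refl))
  τ∈ : ∀ {ms z} → (∀ {p q} → (p , q) ∈ ms → q ≡ τ p × p ≡ τ q) → z ∈ flat ms → τ z ∈ flat ms
  τ∈ {(a , b) ∷ ms} h (here refl) = there (here (sym (proj₁ (h (here refl)))))
  τ∈ {(a , b) ∷ ms} h (there (here refl)) = here (sym (proj₂ (h (here refl))))
  τ∈ {(a , b) ∷ ms} h (there (there i)) = there (there (τ∈ (h ∘ there) i))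
  any∈ : ∀ {P : X → Set} {z l} → z ∈ l → P z → Any P l
  any∈ (here refl) h = here h
  any∈ (there i) h = there (any∈ i h)
  find : ∀ {P : X → Set} {l} → Any P l → ∃ λ z → z ∈ l × P z
  find (here h) = _ , here refl , h
  find (there i) with find i
  ... | z , z∈ , h = z , there z∈ , h
  pq : Any (R p) (q ∷ l) → Any (R q) l
  pq (here r) = ⊥-elim (h₄ (here refl) (subst (R p) q≡ r))
  pq (there i) with find i
  ... | w , w∈ , r = any∈ (τ∈ (hτ ∘ there) w∈) (subst (λ z → R z (τ w)) (sym q≡) (h₅ (here refl) (↑ w∈) r))
  qp : Any (R q) l → Any (R p) (q ∷ l)
  qp i with find i
  ... | w , w∈ , r = there (any∈ (τ∈ (hτ ∘ there) w∈) (subst (λ z → R z (τ w)) (sym p≡) (h₅ (there (here refl)) (↑ w∈) r)))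
  q'q : Any (R' q) l → Any (R q) l
  q'q i with find i
  ... | w , w∈ , r with h₃ (there (here refl)) (↑ w∈) r
  ... | inj₁ s = any∈ w∈ s
  ... | inj₂ s = any∈ (τ∈ (hτ ∘ there) w∈) s

-- Orbits of an injection on a finite set

iter-+ : ∀ {A : Set} (f : A → A) a b z → iter (a + b) f z ≡ iter a f (iter b f z)
iter-+ f zero    b z = refl
iter-+ f (suc a) b z = cong f (iter-+ f a b z)

module Orbit {A : Set} {N : ℕ} (enc : A → Fin N) (enc-inj : ∀ {a b} → enc a ≡ enc b → a ≡ b)
             (f : A → A) (P : A → Set) (Pf : ∀ {z} → P z → P (f z)) (f-inj : ∀ {z w} → P z → P w → f z ≡ f w → z ≡ w) where

  P-iter : ∀ k {z} → P z → P (iter k f z)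
  P-iter zero    h = h
  P-iter (suc k) h = Pf (P-iter k h)

  iter-inj : ∀ k {z w} → P z → P w → iter k f z ≡ iter k f w → z ≡ w
  iter-inj zero    _ _ e = e
  iter-inj (suc k) a b e = iter-inj k a b (f-inj (P-iter k a) (P-iter k b) e)

  -- Among `N + 1` iterates two agree, and injectivity moves the repetition back to the start.
  period : ∀ {z} → P z → ∃ λ p → suc p ≤ N × iter (suc p) f z ≡ z
  period {z} h with Fin.pigeonhole {N} {suc N} ≤-refl (λ i → enc (iter (toℕ i) f z))
  ... | i , j , i<j , e = go (toℕ j ∸ toℕ i) refl
    where
    i≤j = <⇒≤ i<j
    eq : iter (toℕ j ∸ toℕ i) f z ≡ z
    eq = sym (iter-inj (toℕ i) h (P-iter (toℕ j ∸ toℕ i) h)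
      (trans (enc-inj e) (trans (cong (λ k → iter k f z) (trans (sym (m∸n+n≡m i≤j)) (+-comm (toℕ j ∸ toℕ i) (toℕ i)))) (iter-+ f (toℕ i) _ z))))
    go : ∀ d → toℕ j ∸ toℕ i ≡ d → ∃ λ p → suc p ≤ N × iter (suc p) f z ≡ z
    go zero d≡ with () ← subst (0 <_) d≡ (m<n⇒0<n∸m i<j)
    go (suc p) d≡ = p , ≤-trans (≤-reflexive (sym d≡)) (≤-trans (m∸n≤m (toℕ j) (toℕ i)) (s≤s⁻¹ (Fin.toℕ<n j))) , trans (cong (λ k → iter k f z) (sym d≡)) eq

  iter-* : ∀ p {z} → iter p f z ≡ z → ∀ k → iter (k * p) f z ≡ z
  iter-* p e zero    = refl
  iter-* p {z} e (suc k) = trans (iter-+ f p (k * p) z) (trans (cong (iter p f) (iter-* p e k)) e)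

  bounded : ∀ {z} → P z → ∀ k → ∃ λ k' → k' < N × iter k' f z ≡ iter k f z
  bounded {z} h k with period h
  ... | p , p≤ , e = k % suc p , <-≤-trans (m%n<n k (suc p)) p≤ , sym (trans (cong (λ l → iter l f z) (m≡m%n+[m/n]*n k (suc p)))
          (trans (iter-+ f (k % suc p) (k / suc p * suc p) z) (cong (iter (k % suc p) f) (iter-* (suc p) e (k / suc p)))))

  back : ∀ {z} → P z → ∀ k → ∃ λ k' → iter k' f (iter k f z) ≡ z
  back {z} h k with period h
  ... | p , p≤ , e = suc p * k ∸ k , trans (sym (iter-+ f (suc p * k ∸ k) k z))
          (trans (cong (λ l → iter l f z) (trans (m∸n+n≡m (m≤n*m k (suc p))) (*-comm' (suc p) k))) (iter-* (suc p) e k))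
    where
    *-comm' : ∀ a b → a * b ≡ b * a
    *-comm' = solve-∀

-- The flags of a simple graph

module Flags {V : Set} (_≟V_ : DecidableEquality V) where

  -- `(u , v , s)` is the flag at the end `u` of the edge `uv`, on its side `s`. The type is that of
  -- the states of face tracing; `swapF` runs along a side of the edge and `flipF` crosses the edge.
  Fl : Set
  Fl = V × V × Bool

  _≟F_ : DecidableEquality Fl
  _≟F_ = ≡-dec _≟V_ (≡-dec _≟V_ Bool._≟_)

  swapF flipF : Fl → Fl
  swapF (u , v , s) = v , u , s
  flipF (u , v , s) = u , v , not s

  qd : V × V → Quad Fl
  qd (u , v) = quad (u , v , false) (u , v , true) (v , u , false) (v , u , true)

  graphSys : List (V × V) → Sys Fl
  graphSys L = edgesSys (map qd L)

  record Simple (L : List (V × V)) : Set where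
    field
      uL    : Unique L
      noRev : ∀ {u v} → (u , v) ∈ L → (v , u) ∈ L → ⊥
  open Simple public

  Simple-tail : ∀ {e L} → Simple (e ∷ L) → Simple L
  Simple-tail s = record { uL = unique-tail (uL s) ; noRev = λ i j → noRev s (there i) (there j) }

  Φ-∈ˡ : ∀ {L u v} s → (u , v) ∈ L → (u , v , s) ∈ Φ (graphSys L)
  Φ-∈ˡ false (here refl) = here refl
  Φ-∈ˡ true  (here refl) = there (here refl)
  Φ-∈ˡ s (there i) = there (there (there (there (Φ-∈ˡ s i))))

  Φ-∈ʳ : ∀ {L u v} s → (u , v) ∈ L → (v , u , s) ∈ Φ (graphSys L)
  Φ-∈ʳ false (here refl) = there (there (here refl))
  Φ-∈ʳ true  (here refl) = there (there (there (here refl)))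
  Φ-∈ʳ s (there i) = there (there (there (there (Φ-∈ʳ s i))))

  Φ-∈⁻ : ∀ L {u v s} → (u , v , s) ∈ Φ (graphSys L) → InE L u v
  Φ-∈⁻ (_ ∷ L) (here refl) = inj₁ (here refl)
  Φ-∈⁻ (_ ∷ L) (there (here refl)) = inj₁ (here refl)
  Φ-∈⁻ (_ ∷ L) (there (there (here refl))) = inj₂ (here refl)
  Φ-∈⁻ (_ ∷ L) (there (there (there (here refl)))) = inj₂ (here refl)
  Φ-∈⁻ (_ ∷ L) (there (there (there (there i)))) = InE-there (Φ-∈⁻ L i)

  Φ-∈⁺ : ∀ {L u v} s → InE L u v → (u , v , s) ∈ Φ (graphSys L)
  Φ-∈⁺ s (inj₁ i) = Φ-∈ˡ s i
  Φ-∈⁺ s (inj₂ i) = Φ-∈ʳ s i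

  quad-unique : ∀ {u v} → u ≢ v → Unique (Φ (edgeSys (qd (u , v))))
  quad-unique n = ((λ ()) ∷ (λ { refl → n refl }) ∷ (λ ()) ∷ []) ∷ ((λ ()) ∷ (λ { refl → n refl }) ∷ []) ∷ ((λ ()) ∷ []) ∷ [] ∷ []

  Simple-≢ : ∀ {L} → Simple L → ∀ {u v} → (u , v) ∈ L → u ≢ v
  Simple-≢ s i refl = noRev s i i

  Φ-unique : ∀ {L} → Simple L → Unique (Φ (graphSys L))
  Φ-unique {[]} s = []
  Φ-unique {(u , v) ∷ L} s = Uniq.++⁺ (quad-unique (Simple-≢ s (here refl))) (Φ-unique (Simple-tail s)) λ (i , j) → dis i (Φ-∈⁻ L j)
    where
    out : InE L u v → ⊥
    out (inj₁ j) = unique-head (uL s) j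
    out (inj₂ j) = noRev s (here refl) (there j)
    dis : ∀ {a b t} → (a , b , t) ∈ Φ (edgeSys (qd (u , v))) → InE L a b → ⊥
    dis (here refl) j = out j
    dis (there (here refl)) j = out j
    dis (there (there (here refl))) j = out (InE-sym j)
    dis (there (there (there (here refl)))) j = out (InE-sym j)

  m-∈⁻ : ∀ L {a b} → (a , b) ∈ m (graphSys L) → b ≡ swapF a
  m-∈⁻ (_ ∷ L) (here refl) = refl
  m-∈⁻ (_ ∷ L) (there (here refl)) = refl
  m-∈⁻ (_ ∷ L) (there (there i)) = m-∈⁻ L i

  α-∈⁻ : ∀ L {a b} → (a , b) ∈ α (graphSys L) → b ≡ flipF a
  α-∈⁻ (_ ∷ L) (here refl) = refl
  α-∈⁻ (_ ∷ L) (there (here refl)) = refl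
  α-∈⁻ (_ ∷ L) (there (there i)) = α-∈⁻ L i

  m-∈⁺ : ∀ L {a} → a ∈ Φ (graphSys L) → InE (m (graphSys L)) a (swapF a)
  m-∈⁺ (_ ∷ L) (here refl) = inj₁ (here refl)
  m-∈⁺ (_ ∷ L) (there (here refl)) = inj₁ (there (here refl))
  m-∈⁺ (_ ∷ L) (there (there (here refl))) = inj₂ (here refl)
  m-∈⁺ (_ ∷ L) (there (there (there (here refl)))) = inj₂ (there (here refl))
  m-∈⁺ (_ ∷ L) (there (there (there (there i)))) = InE-there (InE-there (m-∈⁺ L i))

  α-∈⁺ : ∀ L {a} → a ∈ Φ (graphSys L) → InE (α (graphSys L)) a (flipF a)
  α-∈⁺ (_ ∷ L) (here refl) = inj₁ (here refl)
  α-∈⁺ (_ ∷ L) (there (here refl)) = inj₂ (here refl)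
  α-∈⁺ (_ ∷ L) (there (there (here refl))) = inj₁ (there (here refl))
  α-∈⁺ (_ ∷ L) (there (there (there (here refl)))) = inj₂ (there (here refl))
  α-∈⁺ (_ ∷ L) (there (there (there (there i)))) = InE-there (InE-there (α-∈⁺ L i))

  module _ {V' : Set} (_≟V'_ : DecidableEquality V') (g : V → V') where
    edges-OK : ∀ {L} → Simple L → All (Euler.EdgeOK _≟F_ _≟V'_ (g ∘ proj₁)) (map qd L)
    edges-OK {[]} s = []
    edges-OK {_ ∷ L} s = record { uq = quad-unique (Simple-≢ s (here refl)) ; χp = refl ; χq = refl } ∷ edges-OK (Simple-tail s)

    WF-graph : ∀ {L} → Simple L → Euler.WF _≟F_ _≟V'_ (g ∘ proj₁) (graphSys L)
    WF-graph s = Euler.WF-edges _≟F_ _≟V'_ (g ∘ proj₁) (edges-OK s) (Φ-unique s)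

-- Boolean tests and their meaning

∧-true : ∀ {a b} → a ∧ b ≡ true → a ≡ true × b ≡ true
∧-true {true} {true} refl = refl , refl

∧-intro : ∀ {a b} → a ≡ true → b ≡ true → a ∧ b ≡ true
∧-intro refl refl = refl

not-∨ : ∀ {a b} → a ≡ true → not a ∨ b ≡ true → b ≡ true
not-∨ refl e = e

imp-∨ : ∀ {a b} → (a ≡ true → b ≡ true) → not a ∨ b ≡ true
imp-∨ {false} h = refl
imp-∨ {true}  h = h refl

true≢false : true ≢ false
true≢false ()

T⁻ : ∀ {b} → IsTrue b → b ≡ true
T⁻ {true} _ = refl

T⁺ : ∀ {b} → b ≡ true → IsTrue b
T⁺ refl = tt

<ᵇ⁻ : ∀ {a b} → (a <ᵇ b) ≡ true → a < b
<ᵇ⁻ {a} {b} e = <ᵇ⇒< a b (T⁺ e)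

<ᵇ⁺ : ∀ {a b} → a < b → (a <ᵇ b) ≡ true
<ᵇ⁺ h = T⁻ (<⇒<ᵇ h)

<ᵇ-false : ∀ {a b} → ¬ a < b → (a <ᵇ b) ≡ false
<ᵇ-false {a} {b} h with a <ᵇ b in e
... | true  = ⊥-elim (h (<ᵇ⁻ e))
... | false = refl

≤ᵇ⁻ : ∀ {a b} → (a ≤ᵇ b) ≡ true → a ≤ b
≤ᵇ⁻ {a} {b} e = ≤ᵇ⇒≤ a b (T⁺ e)

≤ᵇ⁺ : ∀ {a b} → a ≤ b → (a ≤ᵇ b) ≡ true
≤ᵇ⁺ h = T⁻ (≤⇒≤ᵇ h)

eqF⁻ : ∀ {n} {u v : Fin n} → eqF u v ≡ true → u ≡ v
eqF⁻ {_} {u} {v} e with u Fin.≟ v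
... | yes h = h

eqF⁺ : ∀ {n} {u v : Fin n} → u ≡ v → eqF u v ≡ true
eqF⁺ {_} {u} {v} e with u Fin.≟ v
... | yes h = refl
... | no ¬h = ⊥-elim (¬h e)

eqF-refl : ∀ {n} (u : Fin n) → eqF u u ≡ true
eqF-refl u = eqF⁺ refl

module _ {A : Set} (p : A → Bool) where

  all⁻ : ∀ {l} → all p l ≡ true → ∀ {z} → z ∈ l → p z ≡ true
  all⁻ {x ∷ l} h (here refl) = proj₁ (∧-true h)
  all⁻ {x ∷ l} h (there i) = all⁻ (proj₂ (∧-true {p x} h)) i

  all⁺ : ∀ {l} → (∀ {z} → z ∈ l → p z ≡ true) → all p l ≡ true
  all⁺ {[]} h = refl
  all⁺ {x ∷ l} h = ∧-intro (h (here refl)) (all⁺ (h ∘ there))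

  all-false : ∀ {l} → all p l ≡ false → ∃ λ z → z ∈ l × p z ≡ false
  all-false {x ∷ l} h with p x in e
  ... | false = x , here refl , e
  ... | true with all-false {l} h
  ... | z , i , e' = z , there i , e'

  any⁻ : ∀ {l} → any p l ≡ true → ∃ λ z → z ∈ l × p z ≡ true
  any⁻ {x ∷ l} h with p x in e
  ... | true = x , here refl , e
  ... | false with any⁻ {l} h
  ... | z , i , e' = z , there i , e'

  any⁺ : ∀ {l z} → z ∈ l → p z ≡ true → any p l ≡ true
  any⁺ (here refl) e rewrite e = refl
  any⁺ {x ∷ l} (there i) e with p x
  ... | true = refl
  ... | false = any⁺ i e

  ∈-filterᵇ⁻ : ∀ {l z} → z ∈ filterᵇ p l → z ∈ l × p z ≡ true
  ∈-filterᵇ⁻ {x ∷ l} i with p x in e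
  ∈-filterᵇ⁻ {x ∷ l} (here refl) | true = here refl , e
  ∈-filterᵇ⁻ {x ∷ l} (there i) | true with ∈-filterᵇ⁻ i
  ... | j , e' = there j , e'
  ∈-filterᵇ⁻ {x ∷ l} i | false with ∈-filterᵇ⁻ i
  ... | j , e' = there j , e'

  ∈-filterᵇ⁺ : ∀ {l z} → z ∈ l → p z ≡ true → z ∈ filterᵇ p l
  ∈-filterᵇ⁺ {x ∷ l} (here refl) e rewrite e = here refl
  ∈-filterᵇ⁺ {x ∷ l} (there i) e with p x
  ... | true = there (∈-filterᵇ⁺ i e)
  ... | false = ∈-filterᵇ⁺ i e

  filterᵇ-unique : ∀ {l} → Unique l → Unique (filterᵇ p l)
  filterᵇ-unique {[]} u = []
  filterᵇ-unique {x ∷ l} u with p x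
  ... | true = All.tabulate (λ i e → unique-head u (subst (_∈ l) (sym e) (proj₁ (∈-filterᵇ⁻ i)))) ∷ filterᵇ-unique (unique-tail u)
  ... | false = filterᵇ-unique (unique-tail u)

concatMap-∈⁺ : ∀ {A B : Set} (f : A → List B) {l x z} → x ∈ l → z ∈ f x → z ∈ concatMap f l
concatMap-∈⁺ f (here refl) i = ∈-++⁺ˡ i
concatMap-∈⁺ f {y ∷ l} (there j) i = ∈-++⁺ʳ (f y) (concatMap-∈⁺ f j i)

concatMap-∈⁻ : ∀ {A B : Set} (f : A → List B) l {z} → z ∈ concatMap f l → ∃ λ x → x ∈ l × z ∈ f x
concatMap-∈⁻ f (y ∷ l) i with ∈-++⁻ (f y) i
... | inj₁ j = y , here refl , j
... | inj₂ j with concatMap-∈⁻ f l j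
... | x , k , h = x , there k , h

concatMap-unique : ∀ {A B : Set} (f : A → List B) (key : B → A) → (∀ {x z} → z ∈ f x → key z ≡ x) → (∀ x → Unique (f x)) →
  ∀ {l} → Unique l → Unique (concatMap f l)
concatMap-unique f key hk uf {[]} u = []
concatMap-unique f key hk uf {x ∷ l} u = Uniq.++⁺ (uf x) (concatMap-unique f key hk uf (unique-tail u)) dis
  where
  dis : ∀ {z} → z ∈ f x × z ∈ concatMap f l → ⊥
  dis (i , j) with concatMap-∈⁻ f l j
  ... | y , k , h = unique-head u (subst (_∈ l) (trans (sym (hk h)) (hk i)) k)

iter-suc : ∀ {A : Set} (f : A → A) k z → iter (suc k) f z ≡ iter k f (f z)
iter-suc f zero    z = refl
iter-suc f (suc k) z = cong f (iter-suc f k z)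

-- Face tracing in an embedding scheme

module GraphSys {n : ℕ} (adj : Adj n) (sm : ∀ u v → adj u v ≡ adj v u) (ir : ∀ v → adj v v ≡ false) where
  open Flags {Fin n} Fin._≟_ public

  -- Written exactly like the list counted by `edges`, so that its length is this number by
  -- definition.
  edgeL : List (Fin n × Fin n)
  edgeL = filterᵇ (λ p → (toℕ (proj₁ p) <ᵇ toℕ (proj₂ p)) ∧ adj (proj₁ p) (proj₂ p)) (cartesianProduct (allFin n) (allFin n))

  GS : Sys Fl
  GS = graphSys edgeL

  ∈-edgeL⁻ : ∀ {u v} → (u , v) ∈ edgeL → toℕ u < toℕ v × adj u v ≡ true
  ∈-edgeL⁻ {u} {v} i with ∧-true {toℕ u <ᵇ toℕ v} (proj₂ (∈-filterᵇ⁻ _ {cartesianProduct (allFin n) (allFin n)} i))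
  ... | a , b = <ᵇ⁻ a , b

  ∈-edgeL⁺ : ∀ {u v} → toℕ u < toℕ v → adj u v ≡ true → (u , v) ∈ edgeL
  ∈-edgeL⁺ {u} {v} h e = ∈-filterᵇ⁺ _ (∈-cartesianProduct⁺ (∈-allFin u) (∈-allFin v)) (∧-intro (<ᵇ⁺ h) e)

  edgeL-simple : Simple edgeL
  edgeL-simple = record
    { uL = filterᵇ-unique _ (Uniq.cartesianProduct⁺ (Uniq.allFin⁺ n) (Uniq.allFin⁺ n))
    ; noRev = λ i j → <-asym (proj₁ (∈-edgeL⁻ i)) (proj₁ (∈-edgeL⁻ j)) }

  Adjacent : Fl → Set
  Adjacent (u , v , _) = adj u v ≡ true

  Φ-adj : ∀ {z} → z ∈ Φ GS → Adjacent z
  Φ-adj {u , v , s} i with Φ-∈⁻ edgeL i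
  ... | inj₁ j = proj₂ (∈-edgeL⁻ j)
  ... | inj₂ j = trans (sm u v) (proj₂ (∈-edgeL⁻ j))

  adj-InE : ∀ {u v} → adj u v ≡ true → InE edgeL u v
  adj-InE {u} {v} e with <-cmp (toℕ u) (toℕ v)
  ... | tri< h _ _ = inj₁ (∈-edgeL⁺ h e)
  ... | tri> _ _ h = inj₂ (∈-edgeL⁺ h (trans (sm v u) e))
  ... | tri≈ _ h _ with refl ← Fin.toℕ-injective h = ⊥-elim (true≢false (trans (sym e) (ir u)))

  adj-Φ : ∀ {z} → Adjacent z → z ∈ Φ GS
  adj-Φ {u , v , s} e = Φ-∈⁺ s (adj-InE e)

  adj-≢ : ∀ {u v} → adj u v ≡ true → u ≢ v
  adj-≢ {u} e refl = true≢false (trans (sym e) (ir u))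

  record RotOK (ρ : Fin n → Fin n → Fin n) : Set where
    field
      ρ-adj   : ∀ {v u} → adj v u ≡ true → adj v (ρ v u) ≡ true
      ρ-trans : ∀ {v u w} → adj v u ≡ true → adj v w ≡ true → ∃ λ k → iter k (ρ v) u ≡ w

  validRot⁻ : ∀ {ρ} → Genus.validRot adj ρ ≡ true → RotOK ρ
  validRot⁻ {ρ} h = record { ρ-adj = λ e → proj₁ (at e) ; ρ-trans = λ {v} {u} {w} e e' → tr v u w e' (proj₂ (at e)) }
    where
    at : ∀ {v u} → adj v u ≡ true → adj v (ρ v u) ≡ true × allF (λ w → not (adj v w) ∨ any (λ k → eqF (iter k (ρ v) u) w) (upTo n)) ≡ true
    at {v} {u} e = ∧-true {adj v (ρ v u)} (not-∨ e (all⁻ _ (all⁻ _ h (∈-allFin v)) (∈-allFin u)))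
    tr : ∀ v u w → adj v w ≡ true → allF (λ w → not (adj v w) ∨ any (λ k → eqF (iter k (ρ v) u) w) (upTo n)) ≡ true → ∃ λ k → iter k (ρ v) u ≡ w
    tr v u w e' h with any⁻ _ {upTo n} (not-∨ e' (all⁻ _ h (∈-allFin w)))
    ... | k , _ , e = k , eqF⁻ e

  module Rotation {ρ : Fin n → Fin n → Fin n} (ok : RotOK ρ) (λs : Fin n → Fin n → Bool) where
    open RotOK ok
    open Genus adj using (module Scheme)
    open Scheme ρ λs

    ρ-iter : ∀ {v u} k → adj v u ≡ true → adj v (iter k (ρ v) u) ≡ true
    ρ-iter zero    e = e
    ρ-iter (suc k) e = ρ-adj (ρ-iter k e)

    -- Transitivity alone suffices: all neighbours lie on the orbit of `d`, which returns after
    -- `suc k` steps, so `iter k f` undoes `f`.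
    ρ-inj : ∀ {v a b} → adj v a ≡ true → adj v b ≡ true → ρ v a ≡ ρ v b → a ≡ b
    ρ-inj {v} {a} {b} ea eb e = trans (sym (cyc a ea)) (trans (iter-suc f k a) (trans (cong (iter k f) e) (trans (sym (iter-suc f k b)) (cyc b eb))))
      where
      f = ρ v
      d = ρ v a
      ed = ρ-adj ea
      k = proj₁ (ρ-trans ed ea)
      period : iter (suc k) f d ≡ d
      period = cong f (proj₂ (ρ-trans ed ea))
      cyc : ∀ z → adj v z ≡ true → iter (suc k) f z ≡ z
      cyc z ez with ρ-trans ed ez
      ... | j , refl = trans (sym (iter-+ f (suc k) j d)) (trans (cong (λ l → iter l f d) (+-comm (suc k) j)) (trans (iter-+ f j (suc k) d) (cong (iter j f) period)))

    ρinv-ρ : ∀ {v u} → adj v u ≡ true → ρinv v (ρ v u) ≡ u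
    ρinv-ρ {v} {u} e = go (allFin n) (∈-allFin u)
      where
      w = ρ v u
      go : ∀ l → u ∈ l → foldr (λ u' acc → if adj v u' ∧ eqF (ρ v u') w then u' else acc) w l ≡ u
      go (u' ∷ l) i with adj v u' ∧ eqF (ρ v u') w in t
      ... | true with ∧-true {adj v u'} t
      ... | e' , t' = ρ-inj e' e (eqF⁻ t')
      go (u' ∷ l) (here refl) | false = ⊥-elim (true≢false (trans (sym (∧-intro e (eqF-refl (ρ v u)))) t))
      go (u' ∷ l) (there i) | false = go l i

    ρ-surj : ∀ {v w} → adj v w ≡ true → ∃ λ u → adj v u ≡ true × ρ v u ≡ w
    ρ-surj {v} {w} e with ρ-trans (ρ-adj e) e
    ... | k , h = iter k (ρ v) w , ρ-iter k e , trans (iter-suc (ρ v) k w) h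

    ρinv-adj : ∀ {v w} → adj v w ≡ true → adj v (ρinv v w) ≡ true
    ρinv-adj {v} e with ρ-surj e
    ... | u , eu , refl = trans (cong (adj v) (ρinv-ρ eu)) eu

    ρ-ρinv : ∀ {v w} → adj v w ≡ true → ρ v (ρinv v w) ≡ w
    ρ-ρinv {v} e with ρ-surj e
    ... | u , eu , refl = cong (ρ v) (ρinv-ρ eu)

    sig-sym : ∀ u v → sig u v ≡ sig v u
    sig-sym u v with <-cmp (toℕ u) (toℕ v)
    ... | tri< h _ h' rewrite <ᵇ⁺ h | <ᵇ-false h' = refl
    ... | tri> h _ h' rewrite <ᵇ⁺ h' | <ᵇ-false h = refl
    ... | tri≈ _ h _ with refl ← Fin.toℕ-injective h = refl

    twist : Bool → Bool → Bool
    twist b s = if b then not s else s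

    twist-invol : ∀ b s → not (twist b (not (twist b s))) ≡ s
    twist-invol false s = Bool.not-involutive s
    twist-invol true  s = trans (cong not (cong not (Bool.not-involutive s))) (Bool.not-involutive s)

    -- The face-tracing permutation is a product of two involutions: `τ₀` runs along a side to the
    -- other end of the edge, `τ₁` turns around a corner. This makes the faces the components of a
    -- union of two matchings.
    τ₀ τ₁ : Fl → Fl
    τ₀ (u , v , s) = v , u , not (twist (sig u v) s)
    τ₁ (u , v , false) = u , ρ u v , true
    τ₁ (u , v , true)  = u , ρinv u v , false

    φ-τ : ∀ z → φ z ≡ τ₁ (τ₀ z)
    φ-τ (u , v , s) with if sig u v then not s else s
    ... | true  = refl
    ... | false = refl

    τ₀-invol : ∀ z → τ₀ (τ₀ z) ≡ z
    τ₀-invol (u , v , s) = cong (λ t → u , v , t) (trans (cong (λ b → not (twist b (not (twist (sig u v) s)))) (sig-sym v u)) (twist-invol (sig u v) s))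

    τ₀-adj : ∀ {z} → Adjacent z → Adjacent (τ₀ z)
    τ₀-adj {u , v , s} e = trans (sm v u) e

    τ₁-adj : ∀ {z} → Adjacent z → Adjacent (τ₁ z)
    τ₁-adj {u , v , false} = ρ-adj
    τ₁-adj {u , v , true}  = ρinv-adj

    τ₁-invol : ∀ {z} → Adjacent z → τ₁ (τ₁ z) ≡ z
    τ₁-invol {u , v , false} e = cong (λ w → u , w , false) (ρinv-ρ e)
    τ₁-invol {u , v , true}  e = cong (λ w → u , w , true) (ρ-ρinv e)

    φ-adj : ∀ {z} → Adjacent z → Adjacent (φ z)
    φ-adj {z} e = subst Adjacent (sym (φ-τ z)) (τ₁-adj {τ₀ z} (τ₀-adj {z} e))

    φ-inj : ∀ {z w} → Adjacent z → Adjacent w → φ z ≡ φ w → z ≡ w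
    φ-inj {z} {w} ez ew e = trans (sym (τ₀-invol z)) (trans (cong τ₀ (trans (sym (τ₁-invol {τ₀ z} (τ₀-adj {z} ez)))
      (trans (cong τ₁ (trans (sym (φ-τ z)) (trans e (φ-τ w)))) (τ₁-invol {τ₀ w} (τ₀-adj {w} ew))))) (τ₀-invol w))

    φ-τ₀-φ : ∀ {z} → Adjacent z → φ (τ₀ (φ z)) ≡ τ₀ z
    φ-τ₀-φ {z} e = trans (φ-τ (τ₀ (φ z))) (trans (cong τ₁ (trans (τ₀-invol (φ z)) (φ-τ z))) (τ₁-invol {τ₀ z} (τ₀-adj {z} e)))

    bitF : Bool → Fin 2
    bitF false = zero
    bitF true  = suc zero

    enc : Fl → Fin (2 * n * n)
    enc (u , v , s) = combine (combine (bitF s) u) v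

    enc-inj : ∀ {z w} → enc z ≡ enc w → z ≡ w
    enc-inj {u , v , s} {u' , v' , s'} e with Fin.combine-injective {2 * n} (combine (bitF s) u) v (combine (bitF s') u') v' e
    ... | e₁ , refl with Fin.combine-injective {2} (bitF s) u (bitF s') u' e₁
    enc-inj {u , v , false} {u' , v' , false} e | e₁ , refl | _ , refl = refl
    enc-inj {u , v , true}  {u' , v' , true}  e | e₁ , refl | _ , refl = refl
    enc-inj {u , v , false} {u' , v' , true}  e | e₁ , refl | () , refl
    enc-inj {u , v , true}  {u' , v' , false} e | e₁ , refl | () , refl

    open Orbit enc enc-inj φ Adjacent (λ {z} → φ-adj {z}) (λ {z} {w} → φ-inj {z} {w})

    Kφ : List (Fl × Fl)
    Kφ = map (λ z → z , φ z) (Φ GS)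

    Kφ-∈⁻ : ∀ {z w} → (z , w) ∈ Kφ → Adjacent z × w ≡ φ z
    Kφ-∈⁻ i with ∈-map⁻ _ i
    ... | z , j , refl = Φ-adj j , refl

    Kφ-step : ∀ {z} → Adjacent z → Conn Kφ z (φ z)
    Kφ-step {z} e = Conn-∈ Kφ (∈-map⁺ _ (adj-Φ {z} e))

    Kφ-iter : ∀ k {z} → Adjacent z → Conn Kφ z (iter k φ z)
    Kφ-iter zero e = Conn-refl Kφ
    Kφ-iter (suc k) {z} e = Conn-trans Kφ (Kφ-iter k e) (Kφ-step {iter k φ z} (P-iter k {z} e))

    Kφ-orbit : ∀ {z w} → Adjacent z → Conn Kφ z w → ∃ λ k → iter k φ z ≡ w
    Kφ-orbit {z} {w} e h with Conn-least {S = R} (record { rfl = inj₁ refl ; sm = smR ; tr = trR }) Kφ edR h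
      where
      R : Fl → Fl → Set
      R z w = z ≡ w ⊎ (Adjacent z × ∃ λ k → iter k φ z ≡ w)
      smR : ∀ {z w} → R z w → R w z
      smR (inj₁ e) = inj₁ (sym e)
      smR {z} (inj₂ (e , k , refl)) = inj₂ (P-iter k {z} e , back {z} e k)
      trR : ∀ {x y z} → R x y → R y z → R x z
      trR (inj₁ refl) r = r
      trR (inj₂ r) (inj₁ refl) = inj₂ r
      trR {x} (inj₂ (e , k , refl)) (inj₂ (_ , l , refl)) = inj₂ (e , l + k , iter-+ φ l k x)
      edR : ∀ {z w} → (z , w) ∈ Kφ → R z w
      edR i with Kφ-∈⁻ i
      ... | e , refl = inj₂ (e , 1 , refl)
    ... | inj₁ refl = 0 , refl
    ... | inj₂ (_ , r) = r

    key-inj : ∀ {z w} → key z ≡ key w → z ≡ w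
    key-inj {u , v , s} {u' , v' , s'} e with bits (toℕ u * n + toℕ v) (toℕ u' * n + toℕ v') s s' e
      where
      bits : ∀ a b s s' → a * 2 + (if s then 1 else 0) ≡ b * 2 + (if s' then 1 else 0) → a ≡ b × s ≡ s'
      bits zero zero false false e = refl , refl
      bits zero zero true true e = refl , refl
      bits zero (suc b) false false ()
      bits zero (suc b) true true ()
      bits (suc a) zero s true ()
      bits (suc a) zero s false ()
      bits (suc a) (suc b) s s' e with bits a b s s' (suc-injective (suc-injective e))
      ... | refl , e' = refl , e'
    ... | e₁ , refl with Fin.combine-injective u v u' v' (Fin.toℕ-injective (trans (Fin.toℕ-combine u v) (trans (cong (_+ toℕ v) (*-comm' n (toℕ u)))
            (trans e₁ (sym (trans (Fin.toℕ-combine u' v') (cong (_+ toℕ v') (*-comm' n (toℕ u')))))))))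
      where
      *-comm' : ∀ a b → a * b ≡ b * a
      *-comm' = solve-∀
    ... | refl , refl = refl


    reps : List Fl
    reps = filterᵇ isRep states

    private
      row : Fin n → List Fl
      row u = concatMap (λ v → (u , v , true) ∷ (u , v , false) ∷ []) (allFin n)

      states-∈ : ∀ z → z ∈ states
      states-∈ (u , v , s) = concatMap-∈⁺ row (∈-allFin u) (concatMap-∈⁺ (λ v → (u , v , true) ∷ (u , v , false) ∷ []) (∈-allFin v) (at s))
        where
        at : ∀ s → (u , v , s) ∈ (u , v , true) ∷ (u , v , false) ∷ []
        at true = here refl
        at false = there (here refl)

      states-unique : Unique states
      states-unique = concatMap-unique row proj₁ row₁ (λ u → concatMap-unique _ (λ z → proj₁ (proj₂ z)) k₂ (λ v → ((λ ()) ∷ []) ∷ [] ∷ []) (Uniq.allFin⁺ n)) (Uniq.allFin⁺ n)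
        where
        k₂ : ∀ {u v z} → z ∈ (u , v , true) ∷ (u , v , false) ∷ [] → proj₁ (proj₂ z) ≡ v
        k₂ (here refl) = refl
        k₂ (there (here refl)) = refl
        row₁ : ∀ {u z} → z ∈ row u → proj₁ z ≡ u
        row₁ {u} i with concatMap-∈⁻ (λ v → (u , v , true) ∷ (u , v , false) ∷ []) (allFin n) i
        ... | v , _ , here refl = refl
        ... | v , _ , there (here refl) = refl

    rep⁻ : ∀ {z} → isRep z ≡ true → Adjacent z × (∀ {k} → k < suc (2 * n * n) → key z ≤ key (iter k φ z))
    rep⁻ {z@(u , v , s)} e with ∧-true {adj u v} e
    ... | a , b = a , λ h → ≤ᵇ⁻ (all⁻ _ b (∈-upTo⁺ h))

    rep-exists : ∀ fuel {z} → Adjacent z → key z ≤ fuel → ∃ λ k → isRep (iter k φ z) ≡ true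
    rep-exists fuel {z@(u , v , s)} e le with all (λ k → key z ≤ᵇ key (iter k φ z)) (upTo (suc (2 * n * n))) in a
    ... | true = 0 , ∧-intro e a
    ... | false with all-false _ {upTo (suc (2 * n * n))} a
    ... | k , _ , b = go fuel le
      where
      lt : key (iter k φ z) < key z
      lt = ≰⇒> (λ h → true≢false (trans (sym (≤ᵇ⁺ h)) b))
      go : ∀ fuel → key z ≤ fuel → ∃ λ k → isRep (iter k φ z) ≡ true
      go zero h with () ← ≤-trans lt h
      go (suc fuel) h with rep-exists fuel {iter k φ z} (P-iter k {z} e) (s≤s⁻¹ (≤-trans lt h))
      ... | l , r = l + k , trans (cong isRep (iter-+ φ l k z)) r

    opaque
      unfolding Count.c

      orbits≡ : orbits ≡ Count.c _≟F_ Kφ (Φ GS)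
      orbits≡ = sym (classes-reps (Count.conn? _≟F_ Kφ) (Conn-Equiv Kφ) (λ {z} i → adj-Φ {z} (proj₁ (rep⁻ (proj₂ (∈-filterᵇ⁻ isRep {states} i)))))
          rep (filterᵇ-unique isRep states-unique) same)
        where
        any∈ : ∀ {P : Fl → Set} {z l} → z ∈ l → P z → Any P l
        any∈ (here refl) h = here h
        any∈ (there i) h = there (any∈ i h)
        rep : ∀ {z} → z ∈ Φ GS → Any (Conn Kφ z) reps
        rep {z} i with rep-exists (key z) {z} (Φ-adj i) ≤-refl
        ... | k , r = any∈ {z = iter k φ z} (∈-filterᵇ⁺ isRep (states-∈ _) r) (Kφ-iter k (Φ-adj i))
        same : ∀ {z w} → z ∈ reps → w ∈ reps → Conn Kφ z w → z ≡ w
        same {z} {w} i j h = key-inj (≤-antisym (le z w i h) (le w z j (Conn-sym Kφ h)))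
          where
          le : ∀ z w → z ∈ reps → Conn Kφ z w → key z ≤ key w
          le z w i h with rep⁻ {z} (proj₂ (∈-filterᵇ⁻ isRep {states} i))
          ... | a , b with Kφ-orbit {z} a h
          -- The test for a representative looks at `2n² + 1` iterates. There are at most `2n²`
          -- flags, so it sees the whole orbit.
          ... | k , refl with bounded {z} a k
          ... | k' , k'< , e = subst (λ t → key z ≤ key t) e (b (≤-trans k'< (n≤1+n _)))

    -- `τ₀` reverses `φ`. If an orbit met its own reversal, cancelling one step at either end would
    -- lead down to `k = 0`, where an edge would have equal ends, or to `k = 1`, where the two sides
    -- differ.
    no-self : ∀ k {z} → Adjacent z → iter k φ z ≢ τ₀ z
    no-self zero {u , v , s} e h = adj-≢ e (cong proj₁ h)
    no-self (suc zero) {u , v , s} e h = Bool.not-¬ refl (cong (λ z → proj₂ (proj₂ z)) h)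
    no-self (suc (suc k)) {z} e h = no-self k {φ z} (φ-adj {z} e)
      (φ-inj {iter k φ (φ z)} {τ₀ (φ z)} (P-iter k {φ z} (φ-adj {z} e)) (τ₀-adj {φ z} (φ-adj {z} e))
        (trans (cong φ (sym (iter-suc φ k z))) (trans h (sym (φ-τ₀-φ {z} e)))))

    module _ (ms bs : List (Fl × Fl)) (pms : flat ms ↭ Φ GS) (pbs : flat bs ↭ Φ GS)
             (hm : ∀ {p q} → (p , q) ∈ ms → q ≡ τ₀ p) (hb : ∀ {p q} → (p , q) ∈ bs → q ≡ τ₁ p) where
      private
        R' = Conn (bs ++ ms)
        R = Conn Kφ

        ms-adj : ∀ {z} → z ∈ flat ms → Adjacent z
        ms-adj i = Φ-adj (∈-resp-↭ pms i)

        ms-step : ∀ {z} → Adjacent z → R' z (τ₀ z)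
        ms-step {z} e with flat-partner ms (∈-resp-↭ (↭-sym pms) (adj-Φ {z} e))
        ... | r , inj₁ i = Conn-++ʳ bs (Conn-∈ ms (subst (λ r → (z , r) ∈ ms) (hm i) i))
        ... | r , inj₂ i = Conn-++ʳ bs (Conn-sym ms (Conn-∈ ms (subst (λ r → (r , z) ∈ ms) (trans (sym (τ₀-invol r)) (cong τ₀ (sym (hm i)))) i)))

        bs-step : ∀ {z} → Adjacent z → R' z (τ₁ z)
        bs-step {z} e with flat-partner bs (∈-resp-↭ (↭-sym pbs) (adj-Φ {z} e))
        ... | r , inj₁ i = Conn-++ˡ {es = bs} (Conn-∈ bs (subst (λ r → (z , r) ∈ bs) (hb i) i))
        ... | r , inj₂ i = Conn-++ˡ {es = bs} (Conn-sym bs (Conn-∈ bs (subst (λ r → (r , z) ∈ bs)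
              (trans (sym (τ₁-invol {r} (Φ-adj (∈-resp-↭ pbs (flat-∈ˡ i))))) (cong τ₁ (sym (hb i)))) i)))

        R⊆R' : ∀ {z w} → R z w → R' z w
        R⊆R' = Conn-mono Kφ (bs ++ ms) ed
          where
          ed : ∀ {z w} → (z , w) ∈ Kφ → R' z w
          ed {z} i with Kφ-∈⁻ i
          ... | e , refl = Conn-trans (bs ++ ms) (ms-step {z} e) (subst (R' (τ₀ z)) (sym (φ-τ z)) (bs-step {τ₀ z} (τ₀-adj {z} e)))

        R-τ : ∀ {z w} → R z w → R (τ₀ z) (τ₀ w)
        R-τ = Conn-least {S = λ z w → R (τ₀ z) (τ₀ w)} (record { rfl = Conn-refl Kφ ; sm = Conn-sym Kφ ; tr = Conn-trans Kφ }) Kφ ed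
          where
          ed : ∀ {z w} → (z , w) ∈ Kφ → R (τ₀ z) (τ₀ w)
          ed {z} i with Kφ-∈⁻ i
          ... | e , refl = Conn-sym Kφ (subst (R (τ₀ (φ z))) (φ-τ₀-φ {z} e) (Kφ-step {τ₀ (φ z)} (τ₀-adj {φ z} (φ-adj {z} e))))

        Q : Fl → Fl → Set
        Q z w = R z w ⊎ R z (τ₀ w)

        R'⊆Q : ∀ {z w} → R' z w → Q z w
        R'⊆Q = Conn-least {S = Q} (record { rfl = inj₁ (Conn-refl Kφ) ; sm = smQ ; tr = trQ }) (bs ++ ms) (λ i → ed (∈-++⁻ bs i))
          where
          smQ : ∀ {z w} → Q z w → Q w z
          smQ (inj₁ h) = inj₁ (Conn-sym Kφ h)
          smQ {z} {w} (inj₂ h) = inj₂ (Conn-sym Kφ (subst (R (τ₀ z)) (τ₀-invol w) (R-τ h)))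
          trQ : ∀ {x y z} → Q x y → Q y z → Q x z
          trQ (inj₁ a) (inj₁ b) = inj₁ (Conn-trans Kφ a b)
          trQ (inj₁ a) (inj₂ b) = inj₂ (Conn-trans Kφ a b)
          trQ (inj₂ a) (inj₁ b) = inj₂ (Conn-trans Kφ a (R-τ b))
          trQ {z = z} (inj₂ a) (inj₂ b) = inj₁ (Conn-trans Kφ a (subst (R _) (τ₀-invol z) (R-τ b)))
          ed : ∀ {z w} → (z , w) ∈ bs ⊎ (z , w) ∈ ms → Q z w
          ed {z} {w} (inj₂ i) = inj₂ (subst (R z) (trans (sym (τ₀-invol z)) (cong τ₀ (sym (hm i)))) (Conn-refl Kφ))
          ed {z} {w} (inj₁ i) with refl ← hb i = inj₂ (Conn-sym Kφ (subst (R (τ₀ (τ₁ z))) back' (Kφ-step {τ₀ (τ₁ z)} (τ₀-adj {τ₁ z} (τ₁-adj {z} e)))))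
            where
            e : Adjacent z
            e = Φ-adj (∈-resp-↭ pbs (flat-∈ˡ i))
            back' : φ (τ₀ (τ₁ z)) ≡ z
            back' = trans (φ-τ (τ₀ (τ₁ z))) (trans (cong τ₁ (τ₀-invol (τ₁ z))) (τ₁-invol {z} e))

      opaque
        unfolding Count.c orbits≡

        -- Each face is traced once in either direction. The two orbits are exchanged by `τ₀`, and
        -- they differ by `no-self`.
        orbits-c : orbits ≡ 2 * Count.c _≟F_ (bs ++ ms) (Φ GS)
        orbits-c = trans orbits≡ (trans (sym (Count.c-↭ _≟F_ Kφ pms)) (trans
          (classes-halve (Count.conn? _≟F_ Kφ) (Count.conn? _≟F_ (bs ++ ms)) τ₀ ms
            (λ {p} {q} i → hm i , trans (sym (τ₀-invol p)) (cong τ₀ (sym (hm i))))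
            (λ i → Conn-++ʳ bs (Conn-∈ ms i)) R⊆R' (λ _ _ → R'⊆Q)
            (λ {z} i h → let (k , e) = Kφ-orbit {z} (ms-adj i) h in no-self k {z} (ms-adj i) e) (λ _ _ → R-τ))
          (cong (2 *_) (Count.c-↭ _≟F_ (bs ++ ms) pms))))

-- Two-colourings along unions of matchings

module _ {X : Set} (_≟_ : DecidableEquality X) where
  open Count _≟_

  Conn-matching : ∀ (a : List (X × X)) → Unique (flat a) → ∀ {p q} → Conn a p q → p ≡ q ⊎ InE a p q
  Conn-matching [] u e = inj₁ e
  Conn-matching ((x , y) ∷ a) u {p} {q} = go
    where
    y∉ : y ∉ flat a
    y∉ = unique-head (unique-tail u)
    x∉ : x ∉ flat a
    x∉ i = unique-head u (there i)
    go : Conn ((x , y) ∷ a) p q → p ≡ q ⊎ InE ((x , y) ∷ a) p q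
    go (inj₁ h) with Conn-matching a (unique-tail (unique-tail u)) h
    ... | inj₁ e = inj₁ e
    ... | inj₂ i = inj₂ (InE-there i)
    go (inj₂ (inj₁ (h , k))) with refl ← Conn-∉ a x∉ (Conn-sym a h) | refl ← Conn-∉ a y∉ k = inj₂ (inj₁ (here refl))
    go (inj₂ (inj₂ (h , k))) with refl ← Conn-∉ a y∉ (Conn-sym a h) | refl ← Conn-∉ a x∉ k = inj₂ (inj₂ (here refl))

  Proper : (X → Bool) → List (X × X) → Set
  Proper o es = ∀ {p q} → (p , q) ∈ es → o q ≡ not (o p)

  -- The cycles of a ∪ β are even; a path with unmatched ends has odd length, hence ends of different colours.
  colouring : ∀ a β → Unique (flat a) → Unique (flat β) → ∀ o₀ → Proper o₀ a →
    ∃ λ o → Proper o a × Proper o β × (∀ {p q} → p ∉ flat β → q ∉ flat β → p ≢ q → Conn (β ++ a) p q → o q ≡ not (o p))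
  colouring a [] ua uβ o₀ h = o₀ , h , (λ ()) , λ {p} {q} _ _ n k → base n (Conn-matching a ua k)
    where
    base : ∀ {p q} → p ≢ q → p ≡ q ⊎ InE a p q → o₀ q ≡ not (o₀ p)
    base n (inj₁ e) = ⊥-elim (n e)
    base n (inj₂ (inj₁ i)) = h i
    base n (inj₂ (inj₂ i)) = sym (trans (cong not (h i)) (Bool.not-involutive _))
  colouring a ((r , s) ∷ β) ua uβ o₀ h₀ with colouring a β ua (unique-tail (unique-tail uβ)) o₀ h₀
  ... | o , ha , hβ , hc = pick (conn? W r s)
    where
    W = β ++ a
    Goal = ∃ λ o → Proper o a × Proper o ((r , s) ∷ β) × (∀ {p q} → p ∉ r ∷ s ∷ flat β → q ∉ r ∷ s ∷ flat β → p ≢ q → Conn ((r , s) ∷ W) p q → o q ≡ not (o p))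
    r∉ : r ∉ flat β
    r∉ i = unique-head uβ (there i)
    s∉ : s ∉ flat β
    s∉ = unique-head (unique-tail uβ)
    r≢s : r ≢ s
    r≢s refl = unique-head uβ (here refl)
    out : ∀ {z} → z ∉ r ∷ s ∷ flat β → z ∉ flat β
    out n = n ∘ there ∘ there
    pick : Dec (Conn W r s) → Goal
    pick (yes rs) = o , ha , (λ { (here refl) → hc r∉ s∉ r≢s rs ; (there i) → hβ i }) ,
      λ p∉ q∉ n k → hc (out p∉) (out q∉) n (Conn-mono ((r , s) ∷ W) W (λ { (here refl) → rs ; (there i) → Conn-∈ W i }) k)
    pick (no ¬rs) = o' , (λ i → on-W ha i (Conn-++ʳ β (Conn-∈ a i))) ,
        (λ { (here refl) → trans o's (cong not (sym o'r)) ; (there i) → on-W hβ i (Conn-++ˡ {es = β} (Conn-∈ β i)) }) , inv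
      where
      -- True exactly when `r` and `s` have the same colour; in that case the component of `s` is
      -- recoloured.
      t = not (o r xor o s)
      o' : X → Bool
      o' z = if comp W s z then o z xor t else o z
      fix : ∀ {z} → comp W s z ≡ false → o' z ≡ o z
      fix e rewrite e = refl
      flp : ∀ {z} → comp W s z ≡ true → o' z ≡ o z xor t
      flp e rewrite e = refl
      not-xor : ∀ x y → not x xor y ≡ not (x xor y)
      not-xor false false = refl
      not-xor false true = refl
      not-xor true y = sym (Bool.not-involutive y)
      same : ∀ {z w} → comp W s z ≡ comp W s w → o w ≡ not (o z) → o' w ≡ not (o' z)
      same {z} {w} e k with comp W s w
      ... | true  rewrite e = trans (cong (_xor t) k) (not-xor (o z) t)
      ... | false rewrite e = k
      on-W : ∀ {es} → Proper o es → ∀ {z w} → (z , w) ∈ es → Conn W z w → o' w ≡ not (o' z)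
      on-W h i k = same (comp-closed W k) (h i)
      o'r : o' r ≡ o r
      o'r = fix (comp-false W (¬rs ∘ Conn-sym W))
      flip-s : ∀ x y → y xor not (x xor y) ≡ not x
      flip-s false false = refl
      flip-s false true = refl
      flip-s true false = refl
      flip-s true true = refl
      o's : o' s ≡ not (o r)
      o's = trans (flp (comp-true W (Conn-refl W))) (flip-s (o r) (o s))
      inv : ∀ {p q} → p ∉ r ∷ s ∷ flat β → q ∉ r ∷ s ∷ flat β → p ≢ q → Conn ((r , s) ∷ W) p q → o' q ≡ not (o' p)
      inv p∉ q∉ n (inj₁ k) = same (comp-closed W k) (hc (out p∉) (out q∉) n k)
      inv {p} {q} p∉ q∉ n (inj₂ (inj₁ (pr , sq))) = trans (flp (comp-true W sq)) (trans (cong (_xor t) (hc s∉ (out q∉) (λ { refl → q∉ (there (here refl)) }) sq))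
        (trans (not-xor (o s) t) (trans (cong not (flip-s (o r) (o s))) (trans (Bool.not-involutive (o r))
          (trans (hc (out p∉) r∉ (λ { refl → p∉ (here refl) }) pr) (cong not (sym (fix (comp-false W λ sp → ¬rs (Conn-sym W (Conn-trans W sp pr))))))))) ))
      inv {p} {q} p∉ q∉ n (inj₂ (inj₂ (ps , rq))) = trans (fix (comp-false W λ sq → ¬rs (Conn-trans W rq (Conn-sym W sq))))
        (trans (hc r∉ (out q∉) (λ { refl → q∉ (here refl) }) rq) (cong not (sym (trans (flp (comp-true W (Conn-sym W ps)))
          (trans (cong (_xor t) (hc s∉ (out p∉) (λ { refl → p∉ (there (here refl)) }) (Conn-sym W ps)))
          (trans (not-xor (o s) t) (trans (cong not (flip-s (o r) (o s))) (Bool.not-involutive (o r)))))))))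

-- Enumerated functions, reachability and the minimum in `genus`

-- The enumeration contains a given function only up to pointwise agreement. The relation `R`
-- permits a second use one level up, for functions of two arguments.
allFuns-∈ : ∀ {B C : Set} (R : B → C → Set) (bs : List B) k (f : Fin k → C) → (∀ i → ∃ λ b → b ∈ bs × R b (f i)) →
  ∃ λ g → g ∈ allFuns k bs × (∀ i → R (g i) (f i))
allFuns-∈ R bs zero    f h = _ , here refl , λ ()
allFuns-∈ R bs (suc k) f h with h zero | allFuns-∈ R bs k (f ∘ suc) (h ∘ suc)
... | b , b∈ , r | g , g∈ , rs = _ , concatMap-∈⁺ _ b∈ (∈-map⁺ _ g∈) , λ { zero → r ; (suc i) → rs i }

filterᵇ-grow : ∀ {A : Set} (p q : A → Bool) l → (∀ {z} → p z ≡ true → q z ≡ true) → length (filterᵇ p l) ≤ length (filterᵇ q l)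
filterᵇ-grow p q [] h = z≤n
filterᵇ-grow p q (x ∷ l) h with p x in e | q x in e'
... | true  | true  = s≤s (filterᵇ-grow p q l h)
... | true  | false = ⊥-elim (true≢false (trans (sym (h e)) e'))
... | false | true  = ≤-trans (filterᵇ-grow p q l h) (n≤1+n _)
... | false | false = filterᵇ-grow p q l h

filterᵇ-grow-strict : ∀ {A : Set} (p q : A → Bool) l → (∀ {z} → p z ≡ true → q z ≡ true) →
  ∀ {z} → z ∈ l → p z ≡ false → q z ≡ true → length (filterᵇ p l) < length (filterᵇ q l)
filterᵇ-grow-strict p q (x ∷ l) h (here refl) e e' rewrite e | e' = s≤s (filterᵇ-grow p q l h)
filterᵇ-grow-strict p q (x ∷ l) h (there i) e e' with p x in ex | q x in ex'
... | true  | true  = s≤s (filterᵇ-grow-strict p q l h i e e')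
... | true  | false = ⊥-elim (true≢false (trans (sym (h ex)) ex'))
... | false | true  = ≤-trans (filterᵇ-grow-strict p q l h i e e') (n≤1+n _)
... | false | false = filterᵇ-grow-strict p q l h i e e'

filterᵇ-length : ∀ {A : Set} (p : A → Bool) l → length (filterᵇ p l) ≤ length l
filterᵇ-length p [] = z≤n
filterᵇ-length p (x ∷ l) with p x
... | true  = s≤s (filterᵇ-length p l)
... | false = ≤-trans (filterᵇ-length p l) (n≤1+n _)

filterᵇ-none : ∀ {A : Set} (p : A → Bool) l → (∀ {z} → z ∈ l → p z ≡ false) → filterᵇ p l ≡ []
filterᵇ-none p [] h = refl
filterᵇ-none p (x ∷ l) h rewrite h (here refl) = filterᵇ-none p l (h ∘ there)

length-allFin : ∀ n → length (allFin n) ≡ n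
length-allFin n = LP.length-tabulate {n = n} id
  where import Data.List.Properties as LP

∨-trueˡ : ∀ {a b} → a ≡ true → a ∨ b ≡ true
∨-trueˡ refl = refl

∨-trueʳ : ∀ {a b} → b ≡ true → a ∨ b ≡ true
∨-trueʳ {true}  refl = refl
∨-trueʳ {false} refl = refl

∨-split : ∀ {a b} → a ∨ b ≡ true → a ≡ true ⊎ b ≡ true
∨-split {true}  e = inj₁ refl
∨-split {false} e = inj₂ e

module _ {n : ℕ} (adj : Adj n) where
  open Genus adj

  module _ (u : Fin n) where
    private
      cnt : ℕ → ℕ
      cnt k = length (filterᵇ (reach k u) (allFin n))

      Stable : ℕ → Set
      Stable k = ∀ w → reach (suc k) u w ≡ true → reach k u w ≡ true

      stable? : ∀ k → Stable k ⊎ cnt k < cnt (suc k)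
      stable? k with any? (λ w → (reach (suc k) u w Bool.≟ true) ×-dec (reach k u w Bool.≟ false)) (allFin n)
      ... | yes i = inj₂ (grow i)
        where
        find : ∀ {P : Fin n → Set} {l} → Any P l → ∃ λ z → z ∈ l × P z
        find (here h) = _ , here refl , h
        find (there i) with find i
        ... | z , z∈ , h = z , there z∈ , h
        grow : Any (λ w → reach (suc k) u w ≡ true × reach k u w ≡ false) (allFin n) → cnt k < cnt (suc k)
        grow i with find i
        ... | w , w∈ , e , e' = filterᵇ-grow-strict (reach k u) (reach (suc k) u) (allFin n) ∨-trueˡ w∈ e' e
      ... | no ¬i = inj₁ st
        where
        any∈ : ∀ {P : Fin n → Set} {z l} → z ∈ l → P z → Any P l
        any∈ (here refl) h = here h
        any∈ (there i) h = there (any∈ i h)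
        st : Stable k
        st w e = by (reach k u w) refl
          where
          by : ∀ b → reach k u w ≡ b → reach k u w ≡ true
          by true  e' = e'
          by false e' = ⊥-elim (¬i (any∈ (∈-allFin w) (e , e')))

      -- As long as no step is idle, each one reaches a new vertex. With `n` vertices this cannot
      -- last for `n` steps, so the bound in `components` is large enough.
      stable-or-big : ∀ k → (∃ λ j → j ≤ k × Stable j) ⊎ suc k ≤ cnt k
      stable-or-big zero = inj₂ (pos (∈-filterᵇ⁺ (reach 0 u) (∈-allFin u) (eqF-refl u)))
        where
        pos : ∀ {A : Set} {z : A} {l} → z ∈ l → 1 ≤ length l
        pos (here _) = s≤s z≤n
        pos (there _) = s≤s z≤n
      stable-or-big (suc k) with stable-or-big k
      ... | inj₁ (j , h , s) = inj₁ (j , ≤-trans h (n≤1+n k) , s)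
      ... | inj₂ h with stable? k
      ... | inj₁ s = inj₁ (k , n≤1+n k , s)
      ... | inj₂ h' = inj₂ (≤-trans (s≤s h) h')

      reach-mono : ∀ {j k w} → j ≤ k → reach j u w ≡ true → reach k u w ≡ true
      reach-mono {j} {k} {w} h e = subst (λ l → reach l u w ≡ true) (m∸n+n≡m h) (go (k ∸ j))
        where
        go : ∀ d → reach (d + j) u w ≡ true
        go zero = e
        go (suc d) = ∨-trueˡ (go d)

    reach-complete : ∀ {w} → Conn {Fin n} (filterᵇ (λ p → adj (proj₁ p) (proj₂ p)) (cartesianProduct (allFin n) (allFin n))) u w →
      (∀ a b → adj a b ≡ adj b a) → reach n u w ≡ true
    reach-complete {w} h sm with stable-or-big n
    ... | inj₂ big = ⊥-elim (<-irrefl refl (≤-trans big (≤-trans (filterᵇ-length (reach n u) (allFin n)) (≤-reflexive (length-allFin n)))))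
    ... | inj₁ (j , j≤ , st) = reach-mono j≤ (proj₁ (Conn-least {S = R} (record { rfl = id , id ; sm = λ (a , b) → b , a ; tr = λ (a , b) (c , d) → c ∘ a , b ∘ d })
            es ed h) (reach-mono {0} {j} z≤n (eqF-refl u)))
      where
      es : List (Fin n × Fin n)
      es = filterᵇ (λ p → adj (proj₁ p) (proj₂ p)) (cartesianProduct (allFin n) (allFin n))
      R : Fin n → Fin n → Set
      R a b = (reach j u a ≡ true → reach j u b ≡ true) × (reach j u b ≡ true → reach j u a ≡ true)
      advance : ∀ a b → adj a b ≡ true → reach j u a ≡ true → reach j u b ≡ true
      advance a b e r = st b (∨-trueʳ {reach j u b} (any⁺ _ (∈-allFin a) (∧-intro r e)))
      ed : ∀ {a b} → (a , b) ∈ es → R a b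
      ed {a} {b} i with ∈-filterᵇ⁻ _ {cartesianProduct (allFin n) (allFin n)} i
      ... | _ , e = advance a b e , advance b a (trans (sm b a) e)

  genus-≤ : ∀ {ρ λs} → ρ ∈ allFuns n (allFuns n (allFin n)) → λs ∈ allFuns n (allFuns n (true ∷ false ∷ [])) → validRot ρ ≡ true →
    genus ≤ Scheme.eulerGenus ρ λs
  genus-≤ {ρ} {λs} ρ∈ λ∈ v = outer (allFuns n (allFuns n (allFin n))) ρ∈
    where
    Λ = allFuns n (allFuns n (true ∷ false ∷ []))
    F : (Fin n → Fin n → Fin n) → (Fin n → Fin n → Bool) → ℕ → ℕ
    F ρ λs acc' = if validRot ρ then Scheme.eulerGenus ρ λs ⊓ acc' else acc'
    F≤ : ∀ ρ λs a → F ρ λs a ≤ a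
    F≤ ρ λs a with validRot ρ
    ... | true = m⊓n≤n (Scheme.eulerGenus ρ λs) a
    ... | false = ≤-refl
    inner≤ : ∀ ρ a l → foldr (F ρ) a l ≤ a
    inner≤ ρ a [] = ≤-refl
    inner≤ ρ a (x ∷ l) = ≤-trans (F≤ ρ x _) (inner≤ ρ a l)
    inner∈ : ∀ a l → λs ∈ l → foldr (F ρ) a l ≤ Scheme.eulerGenus ρ λs
    inner∈ a (x ∷ l) (here refl) rewrite v = m⊓n≤m (Scheme.eulerGenus ρ λs) _
    inner∈ a (x ∷ l) (there i) = ≤-trans (F≤ ρ x _) (inner∈ a l i)
    outer : ∀ l → ρ ∈ l → foldr (λ ρ acc → foldr (F ρ) acc Λ) (2 * components + edges) l ≤ Scheme.eulerGenus ρ λs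
    outer (x ∷ l) (here refl) = inner∈ _ Λ λ∈
    outer (x ∷ l) (there i) = ≤-trans (inner≤ x _ Λ) (outer l i)

  genus-attained : genus ≡ 2 * components + edges ⊎ (∃ λ ρ → ∃ λ λs → validRot ρ ≡ true × genus ≡ Scheme.eulerGenus ρ λs)
  genus-attained = outer (allFuns n (allFuns n (allFin n)))
    where
    Λ = allFuns n (allFuns n (true ∷ false ∷ []))
    F : (Fin n → Fin n → Fin n) → (Fin n → Fin n → Bool) → ℕ → ℕ
    F ρ λs acc' = if validRot ρ then Scheme.eulerGenus ρ λs ⊓ acc' else acc'
    Good : ℕ → Set
    Good g = g ≡ 2 * components + edges ⊎ (∃ λ ρ → ∃ λ λs → validRot ρ ≡ true × g ≡ Scheme.eulerGenus ρ λs)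
    inner : ∀ ρ l {a} → Good a → Good (foldr (F ρ) a l)
    inner ρ [] h = h
    inner ρ (λs ∷ l) {a} h with validRot ρ in v
    ... | false = inner' l
      where
      inner' : ∀ l → Good (foldr (λ _ acc' → acc') a l)
      inner' [] = h
      inner' (_ ∷ l) = inner' l
    ... | true with ⊓-sel (Scheme.eulerGenus ρ λs) (foldr (λ λs acc' → Scheme.eulerGenus ρ λs ⊓ acc') a l)
    ... | inj₁ e = inj₂ (ρ , λs , v , e)
    ... | inj₂ e = subst Good (sym e) (subst (λ b → Good (foldr (λ λs acc' → if b then Scheme.eulerGenus ρ λs ⊓ acc' else acc') a l)) v (inner ρ l h))
    outer : ∀ l → Good (foldr (λ ρ acc → foldr (F ρ) acc Λ) (2 * components + edges) l)
    outer [] = inj₁ refl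
    outer (ρ ∷ l) = inner ρ Λ (outer l)

map-unique : ∀ {A B : Set} (f : A → B) {l} → (∀ {x y} → x ∈ l → y ∈ l → f x ≡ f y → x ≡ y) → Unique l → Unique (map f l)
map-unique f {[]} h u = []
map-unique f {x ∷ l} h u = All.tabulate (λ i e → go (∈-map⁻ f i) e) ∷ map-unique f (λ i j → h (there i) (there j)) (unique-tail u)
  where
  go : ∀ {z} → (∃ λ y → y ∈ l × z ≡ f y) → f x ≢ z
  go (y , i , refl) e with refl ← h (here refl) (there i) e = unique-head u i

c-connected : ∀ {V : Set} (_≟V_ : DecidableEquality V) es (vs : List V) → (∀ u w → Conn es u w) → Count.c _≟V_ es vs ≤ 1
c-connected _≟V_ es vs h = le
  where
  opaque
    unfolding Count.c
    le : Count.c _≟V_ es vs ≤ 1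
    le = classes-≤-vertices Unit._≟_ (λ _ → tt) (Count.conn? _≟V_ es) {vs} {tt ∷ []} (λ _ → here refl) (λ _ _ _ → h _ _)

module _ {X : Set} (_≟_ : DecidableEquality X) where

  mate : List (X × X) → X → X
  mate [] z = z
  mate ((a , b) ∷ β) z with z ≟ a | z ≟ b
  ... | yes _ | _     = b
  ... | no _  | yes _ = a
  ... | no _  | no _  = mate β z

  mate-InE : ∀ β {z} → z ∈ flat β → InE β z (mate β z)
  mate-InE ((a , b) ∷ β) {z} i with z ≟ a | z ≟ b
  ... | yes refl | _ = inj₁ (here refl)
  ... | no _ | yes refl = inj₂ (here refl)
  mate-InE ((a , b) ∷ β) {z} (here e) | no n | no _ = ⊥-elim (n e)
  mate-InE ((a , b) ∷ β) {z} (there (here e)) | no _ | no n = ⊥-elim (n e)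
  mate-InE ((a , b) ∷ β) {z} (there (there i)) | no _ | no _ = InE-there (mate-InE β i)

components-connected : ∀ {n} (adj : Adj n) → Fin n → (∀ u w → Genus.reach adj n u w ≡ true) → Genus.components adj ≡ 1
components-connected {suc n} adj _ h = ↭-length (unique-set-↭ (filterᵇ-unique p (Uniq.allFin⁺ (suc n))) ([] ∷ []) to′ from′)
  where
  p : Fin (suc n) → Bool
  p v = allF (λ w → not (Genus.reach adj (suc n) v w) ∨ (toℕ v ≤ᵇ toℕ w))
  to′ : ∀ {z} → z ∈ filterᵇ p (allFin (suc n)) → z ∈ zero ∷ []
  to′ {zero} i = here refl
  to′ {suc z} i with () ← ≤ᵇ⁻ {toℕ (suc z)} {0} (not-∨ (h (suc z) zero) (all⁻ _ (proj₂ (∈-filterᵇ⁻ p {allFin (suc n)} i)) (∈-allFin {suc n} zero)))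
  from′ : ∀ {z} → z ∈ zero ∷ [] → z ∈ filterᵇ p (allFin (suc n))
  from′ (here refl) = ∈-filterᵇ⁺ p (∈-allFin {suc n} zero) (all⁺ _ {allFin (suc n)} (λ {w} _ → ∨-trueʳ {not (Genus.reach adj (suc n) zero w)} refl))

-- The genus of a connected graph in terms of corner matchings

up-arith : ∀ {E n F g A} → 2 + E ≤ n + F + g → A ≤ n → A + (2 + E) ≤ F + (g + 2 * n)
up-arith {E} {n} {F} {g} {A} h k = ≤-trans (+-mono-≤ k h) (≤-reflexive (eq n F g))
  where
  eq : ∀ n F g → n + (n + F + g) ≡ F + (g + 2 * n)
  eq = solve-∀

low-arith : ∀ {E n g A M A' M' i j} → A' + M ≤ A + M' → n ≤ A' → g + (n + M') ≤ 2 + E → A + i ≤ M + j → g + 2 * n + i ≤ 2 + E + j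
low-arith {E} {n} {g} {A} {M} {A'} {M'} {i} {j} h₁ h₂ h₃ h₄ =
  lin (A' + M + A + M') (+-mono-≤ (+-mono-≤ h₁ h₂) (+-mono-≤ h₃ h₄)) (eq₁ g n i A' M A M') (eq₂ E j A' M A M')
  where
  eq₁ : ∀ g n i A' M A M' → g + 2 * n + i + (A' + M + A + M') ≡ A' + M + n + (g + (n + M') + (A + i))
  eq₁ = solve-∀
  eq₂ : ∀ E j A' M A M' → A + M' + A' + (2 + E + (M + j)) ≡ 2 + E + j + (A' + M + A + M')
  eq₂ = solve-∀

module Char {n : ℕ} (adj : Adj n) (sm : ∀ u v → adj u v ≡ adj v u) (ir : ∀ v → adj v v ≡ false)
            (v₀ : Fin n) (nb : ∀ v → ∃ λ w → adj v w ≡ true)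
            (cn : ∀ u w → Conn (GraphSys.edgeL adj sm ir) u w) where
  open GraphSys adj sm ir public
  open Genus adj
  module E = Euler _≟F_ Fin._≟_ proj₁

  wG : E.WF GS
  wG = WF-graph Fin._≟_ id edgeL-simple

  E# : ℕ
  E# = length edgeL

  private
    components≡1 : components ≡ 1
    components≡1 = components-connected adj v₀ (λ u w → reach-complete adj u (Conn-⊆ {es = edgeL} sub (cn u w)) sm)
      where
      sub : ∀ {u v} → (u , v) ∈ edgeL → (u , v) ∈ filterᵇ (λ p → adj (proj₁ p) (proj₂ p)) (cartesianProduct (allFin n) (allFin n))
      sub {u} {v} i = ∈-filterᵇ⁺ _ (∈-cartesianProduct⁺ (∈-allFin u) (∈-allFin v)) (proj₂ (∈-edgeL⁻ i))

    isolated≡0 : isolated ≡ 0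
    isolated≡0 = cong length (filterᵇ-none (λ v → allF (λ w → not (adj v w))) (allFin n) none)
      where
      none : ∀ {v} → v ∈ allFin n → allF (λ w → not (adj v w)) ≡ false
      none {v} _ with allF (λ w → not (adj v w)) in e
      ... | false = refl
      ... | true with nb v
      ... | w , a with () ← trans (sym (all⁻ _ e (∈-allFin w))) (cong not a)

    genus-form : ∀ ρ λs {F} → Scheme.orbits ρ λs ≡ 2 * F → Scheme.eulerGenus ρ λs ≡ (2 + E#) ∸ (n + F)
    genus-form ρ λs {F} e = cong₂ _∸_ (cong (λ k → 2 * k + E#) components≡1)
      (cong (n +_) (trans (cong₂ _+_ (trans (cong (_/ 2) (trans e (*-comm' 2 F))) (m*n/n≡m F 2)) isolated≡0) (+-identityʳ F)))
      where
      *-comm' : ∀ a b → a * b ≡ b * a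
      *-comm' = solve-∀

    χ-all : ∀ {p} → p ∈ Φ GS → proj₁ p ∈ allFin n
    χ-all _ = ∈-allFin _

  opaque
    unfolding Count.c

    A-≤-n : ∀ {β} → E.Strict wG β → E.A GS β ≤ n
    A-≤-n {β} st = ≤-trans (classes-≤-vertices Fin._≟_ proj₁ (E.conn? (β ++ α GS)) {Φ GS} {allFin n} χ-all (λ i j e → st _ _ i j e)) (≤-reflexive (length-allFin n))

    n-≤-A : ∀ {β} → E.Valid GS β → n ≤ E.A GS β
    n-≤-A {β} v = ≤-trans (≤-reflexive (sym (length-allFin n))) (classes-≥-vertices Fin._≟_ proj₁ (E.conn? (β ++ α GS)) {Φ GS} {allFin n} (Uniq.allFin⁺ n)
      (λ {v} _ → (v , proj₁ (nb v) , false) , adj-Φ {v , proj₁ (nb v) , false} (proj₂ (nb v)) , refl)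
      (λ {p} {q} → Conn-respects proj₁ (β ++ α GS) (E.Resp-++ {β} (E.rβ v) (E.rα wG))))

  -- Euler's inequality for one component. It ensures that the truncated subtraction in `eulerGenus`
  -- loses nothing for a scheme read off from `β`.
  euler-strict : ∀ {β} → E.Valid GS β → E.A GS β ≤ n → n + E.M GS β ≤ 2 + E#
  euler-strict {β} v le = lin n (≤-trans (E.euler (map qd edgeL) (edges-OK Fin._≟_ id edgeL-simple) (Φ-unique edgeL-simple) (Uniq.allFin⁺ n) (λ _ → ∈-allFin _ , ∈-allFin _)
        {E.M GS β} {E.A GS β} (β , v , ≤-reflexive (+-comm (E.A GS β) (E.M GS β))))
        (+-mono-≤ (+-mono-≤ le (≤-reflexive (length-map qd edgeL))) (+-mono-≤ κ (+-mono-≤ κ (z≤n {0})))))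
      (trans (eq₁ n (E.M GS β)) (cong (λ k → E.M GS β + 2 * k) (sym (length-allFin n)))) (eq₂ n E#)
    where
    κ : Count.c Fin._≟_ (map E.ends (map qd edgeL)) (allFin n) ≤ 1
    κ = c-connected Fin._≟_ _ (allFin n) (subst (λ l → ∀ u w → Conn l u w) (sym (trans (sym (map-∘ edgeL)) (map-id edgeL))) cn)
    eq₁ : ∀ n M → n + M + n ≡ M + 2 * n
    eq₁ = solve-∀
    eq₂ : ∀ n E → n + E + (1 + (1 + 0)) ≡ 2 + E + n
    eq₂ = solve-∀

  module FromScheme {ρ : Fin n → Fin n → Fin n} (ok : RotOK ρ) (λs : Fin n → Fin n → Bool) where
    open Rotation ok λs
    open Scheme ρ λs using (sig)
    open RotOK ok

    DL : List (Fin n × Fin n)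
    DL = filterᵇ (λ p → adj (proj₁ p) (proj₂ p)) (cartesianProduct (allFin n) (allFin n))

    DL-∈⁻ : ∀ {u v} → (u , v) ∈ DL → adj u v ≡ true
    DL-∈⁻ i = proj₂ (∈-filterᵇ⁻ _ {cartesianProduct (allFin n) (allFin n)} i)

    DL-∈⁺ : ∀ {u v} → adj u v ≡ true → (u , v) ∈ DL
    DL-∈⁺ {u} {v} e = ∈-filterᵇ⁺ _ (∈-cartesianProduct⁺ (∈-allFin u) (∈-allFin v)) e

    DL-unique : Unique DL
    DL-unique = filterᵇ-unique _ (Uniq.cartesianProduct⁺ (Uniq.allFin⁺ n) (Uniq.allFin⁺ n))

    corner : Fin n × Fin n → Fl × Fl
    corner (u , v) = (u , v , false) , (u , ρ u v , true)

    βρ : List (Fl × Fl)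
    βρ = map corner DL

    βρ-↭ : flat βρ ↭ Φ GS
    βρ-↭ = ↭-trans (flat-maps βρ) (↭-trans (↭-reflexive (cong₂ _++_ (sym (map-∘ DL)) (sym (map-∘ DL))))
      (unique-set-↭ (Uniq.++⁺ (map-unique (proj₁ ∘ corner) (λ { _ _ refl → refl }) DL-unique) (map-unique (proj₂ ∘ corner) inj₂′ DL-unique) dis)
        (Φ-unique edgeL-simple) to′ from′))
      where
      inj₂′ : ∀ {x y} → x ∈ DL → y ∈ DL → proj₂ (corner x) ≡ proj₂ (corner y) → x ≡ y
      inj₂′ {u , v} {u' , v'} i j e with refl ← cong proj₁ e = cong (u ,_) (ρ-inj (DL-∈⁻ i) (DL-∈⁻ j) (cong (λ z → proj₁ (proj₂ z)) e))
      dis : ∀ {z} → z ∈ map (proj₁ ∘ corner) DL × z ∈ map (proj₂ ∘ corner) DL → ⊥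
      dis (i , j) with ∈-map⁻ (proj₁ ∘ corner) i | ∈-map⁻ (proj₂ ∘ corner) j
      ... | _ , _ , refl | _ , _ , ()
      to′ : ∀ {z} → z ∈ map (proj₁ ∘ corner) DL ++ map (proj₂ ∘ corner) DL → z ∈ Φ GS
      to′ i with ∈-++⁻ (map (proj₁ ∘ corner) DL) i
      ... | inj₁ j with ∈-map⁻ (proj₁ ∘ corner) j
      ... | (u , v) , k , refl = adj-Φ {u , v , false} (DL-∈⁻ k)
      to′ i | inj₂ j with ∈-map⁻ (proj₂ ∘ corner) j
      ... | (u , v) , k , refl = adj-Φ {u , ρ u v , true} (ρ-adj (DL-∈⁻ k))
      from′ : ∀ {z} → z ∈ Φ GS → z ∈ map (proj₁ ∘ corner) DL ++ map (proj₂ ∘ corner) DL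
      from′ {u , v , false} i = ∈-++⁺ˡ (∈-map⁺ (proj₁ ∘ corner) (DL-∈⁺ (Φ-adj i)))
      from′ {u , v , true} i with ρ-surj (Φ-adj i)
      ... | w , e , refl = ∈-++⁺ʳ (map (proj₁ ∘ corner) DL) (∈-map⁺ (proj₂ ∘ corner) (DL-∈⁺ e))

    -- moves the twists from the edges (as in the scheme) into the corners
    g : Fl → Fl
    g (u , v , s) = u , v , (if toℕ u <ᵇ toℕ v then s else not (twist (sig u v) s))

    g-invol : ∀ z → g (g z) ≡ z
    g-invol (u , v , s) = cong (λ t → u , v , t) (aux (toℕ u <ᵇ toℕ v) (sig u v))
      where
      aux : ∀ b t → (if b then (if b then s else not (twist t s)) else not (twist t (if b then s else not (twist t s)))) ≡ s
      aux true t = refl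
      aux false t = twist-invol t s

    g-inj : ∀ {z w} → g z ≡ g w → z ≡ w
    g-inj {z} {w} e = trans (sym (g-invol z)) (trans (cong g e) (g-invol w))

    g-Φ : map g (Φ GS) ↭ Φ GS
    g-Φ = unique-set-↭ (map-unique g (λ _ _ → g-inj) (Φ-unique edgeL-simple)) (Φ-unique edgeL-simple) to′ (λ {z} i → subst (_∈ map g (Φ GS)) (g-invol z) (∈-map⁺ g (adj-Φ {g z} (Φ-adj i))))
      where
      to′ : ∀ {z} → z ∈ map g (Φ GS) → z ∈ Φ GS
      to′ i with ∈-map⁻ g i
      ... | z , j , refl = adj-Φ {g z} (Φ-adj j)

    β : List (Fl × Fl)
    β = map² g βρ

    β-valid : E.Valid GS β
    β-valid = record { pβ = ↭-trans (↭-reflexive (flat-map² g βρ)) (↭-trans (map⁺ g βρ-↭) g-Φ) ; rβ = r }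
      where
      r : E.Resp β
      r i with ∈-map²⁻ g i
      ... | p , q , j , refl , refl with ∈-map⁻ corner j
      ... | _ , _ , refl = refl

    ms-τ : ∀ {p q} → (p , q) ∈ map² g (m GS) → q ≡ τ₀ p
    ms-τ i with ∈-map²⁻ g i
    ... | (u , v , s) , q , j , refl , refl with refl ← m-∈⁻ edgeL j = aux (m-order edgeL (λ k → proj₁ (∈-edgeL⁻ k)) j)
      where
      m-order : ∀ L → (∀ {u v} → (u , v) ∈ L → toℕ u < toℕ v) → ∀ {u v s q} → ((u , v , s) , q) ∈ m (graphSys L) → toℕ u < toℕ v
      m-order (_ ∷ L) h (here refl) = h (here refl)
      m-order (_ ∷ L) h (there (here refl)) = h (here refl)
      m-order (_ ∷ L) h (there (there i)) = m-order L (h ∘ there) i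
      aux : toℕ u < toℕ v → g (v , u , s) ≡ τ₀ (g (u , v , s))
      aux h rewrite <ᵇ⁺ h | <ᵇ-false (<-asym h) = refl

    M-β : 2 * E.M GS β ≡ Scheme.orbits ρ λs
    M-β = sym (trans (orbits-c (map² g (m GS)) βρ (↭-trans (↭-reflexive (flat-map² g (m GS))) (↭-trans (map⁺ g (E.pm wG)) g-Φ)) βρ-↭ ms-τ hb)
      (cong (2 *_) (trans (cong (λ l → E.c l (Φ GS)) (sym (trans (map-++ _ β (m GS)) (cong (_++ map² g (m GS)) back²))))
        (trans (sym (E.c-↭ (map² g (β ++ m GS)) g-Φ)) (Relabel.c-map _≟F_ _≟F_ g (β ++ m GS) (λ _ _ → g-inj) into)))))
      where
      hb : ∀ {p q} → (p , q) ∈ βρ → q ≡ τ₁ p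
      hb i with ∈-map⁻ corner i
      ... | _ , _ , refl = refl
      back² : map² g β ≡ βρ
      back² = go βρ
        where
        go : ∀ l → map² g (map² g l) ≡ l
        go [] = refl
        go ((a , b) ∷ l) = cong₂ _∷_ (cong₂ _,_ (g-invol a) (g-invol b)) (go l)
      into : ∀ {z} → z ∈ flat (β ++ m GS) → z ∈ Φ GS
      into i with ∈-++⁻ (flat β) (subst (_ ∈_) (flat-++ β (m GS)) i)
      ... | inj₁ j = ∈-resp-↭ (E.pβ β-valid) j
      ... | inj₂ j = ∈-resp-↭ (E.pm wG) j

    β-strict : E.Strict wG β
    β-strict (v , u , s) (_ , w , t) i j refl with ρ-trans (Φ-adj i) (Φ-adj j)
    ... | k , refl = go k t
      where
      K = β ++ α GS
      side : ∀ {a b} s t → adj a b ≡ true → Conn K (a , b , s) (a , b , t)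
      side false false _ = Conn-refl K
      side true true _ = Conn-refl K
      side {a} {b} false true e = Conn-++ʳ β (Conn-InE (α GS) (α-∈⁺ edgeL (adj-Φ {a , b , false} e)))
      side {a} {b} true false e = Conn-++ʳ β (Conn-InE (α GS) (α-∈⁺ edgeL (adj-Φ {a , b , true} e)))
      go : ∀ k t → Conn K (v , u , s) (v , iter k (ρ v) u , t)
      go zero t = side s t (Φ-adj i)
      go (suc k) t = Conn-trans K (go k (proj₂ (proj₂ (g (v , d , false))))) (Conn-trans K (Conn-++ˡ {es = β} (Conn-∈ β (∈-map⁺ _ (∈-map⁺ corner (DL-∈⁺ ex)))))
          (side (proj₂ (proj₂ (g (v , ρ v d , true)))) t (ρ-adj ex)))
        where
        d = iter k (ρ v) u
        ex = ρ-iter k (Φ-adj i)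

  -- With `charLow` this says that the genus is `2 + E# - 2n - D`. Here the corners of an optimal
  -- scheme serve as the matching.
  charUp : E.Ach GS (2 + E#) (genus + 2 * n)
  charUp with genus-attained adj
  -- If the minimum is the initial value `2 + E#`, the bound is so weak that any strict matching
  -- meets it; one is obtained from the corners `α GS`.
  ... | inj₁ e = def (E.strictify wG (E.A GS (α GS)) (α GS) (record { pβ = E.pα wG ; rβ = E.rα wG }) ≤-refl)
    where
    def : (∃ λ β' → E.Valid GS β' × E.A GS β' + E.M GS (α GS) ≤ E.A GS (α GS) + E.M GS β' × E.Strict wG β') → _
    def (β' , v , _ , st) = β' , v , up-arith {E#} {n} {E.M GS β'} {genus} {E.A GS β'} (≤-trans (≤-reflexive (trans (cong (λ k → 2 * k + E#) (sym components≡1)) (sym e))) (m≤n+m genus _)) (A-≤-n st)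
  ... | inj₂ (ρ , λs , v , e) = β , β-valid , up-arith {E#} {n} {E.M GS β} {genus} {E.A GS β} (≤-trans (m≤n+m∸n (2 + E#) (n + E.M GS β)) (≤-reflexive (cong (n + E.M GS β +_)
          (sym (trans e (genus-form ρ λs (sym M-β))))))) (A-≤-n β-strict)
    where open FromScheme (validRot⁻ v) λs

  validRot⁺ : ∀ {ρ} → (∀ {v u} → adj v u ≡ true → adj v (ρ v u) ≡ true) → (∀ {v u w} → adj v u ≡ true → adj v w ≡ true → ∃ λ k → k < n × iter k (ρ v) u ≡ w) →
    validRot ρ ≡ true
  validRot⁺ {ρ} h k = all⁺ (λ v → allF (body v)) {allFin n} λ {v} _ → all⁺ (body v) {allFin n} λ {u} _ →
      imp-∨ λ e → ∧-intro (h e) (all⁺ (transitive v u) {allFin n} λ {w} _ → imp-∨ λ e' → at v u w (k e e'))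
    where
    transitive : Fin n → Fin n → Fin n → Bool
    transitive v u w = not (adj v w) ∨ any (λ k → eqF (iter k (ρ v) u) w) (upTo n)
    body : Fin n → Fin n → Bool
    body v u = not (adj v u) ∨ (adj v (ρ v u) ∧ allF (transitive v u))
    at : ∀ v u w → (∃ λ k → k < n × iter k (ρ v) u ≡ w) → any (λ k → eqF (iter k (ρ v) u) w) (upTo n) ≡ true
    at v u w (k , k< , e) = any⁺ _ (∈-upTo⁺ k<) (eqF⁺ e)

  module ToScheme {β : List (Fl × Fl)} (v : E.Valid GS β) (st : E.Strict wG β) where
    private
      uβ : Unique (flat β)
      uβ = Unique-resp-↭ (↭-sym (E.pβ v)) (E.uniq wG)

      opaque
        -- A proper colouring of the corner cycle at a vertex is a choice of local orientation
        -- there: turning around the vertex, the two sides of each edge alternate in colour.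
        col : ∃ λ o → Proper _≟F_ o (α GS) × Proper _≟F_ o β × (∀ {p q} → p ∉ flat β → q ∉ flat β → p ≢ q → Conn (β ++ α GS) p q → o q ≡ not (o p))
        col = colouring _≟F_ (α GS) β (Unique-resp-↭ (↭-sym (E.pα wG)) (E.uniq wG)) uβ (λ z → proj₂ (proj₂ z)) (λ i → cong (λ z → proj₂ (proj₂ z)) (α-∈⁻ edgeL i))

      o : Fl → Bool
      o = proj₁ col

      o-α : ∀ {z} → z ∈ Φ GS → o (flipF z) ≡ not (o z)
      o-α i with α-∈⁺ edgeL i
      ... | inj₁ j = proj₁ (proj₂ col) j
      ... | inj₂ j = sym (trans (cong not (proj₁ (proj₂ col) j)) (Bool.not-involutive _))

      o-β : ∀ {a b} → InE β a b → o b ≡ not (o a)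
      o-β (inj₁ i) = proj₁ (proj₂ (proj₂ col)) i
      o-β (inj₂ i) = sym (trans (cong not (proj₁ (proj₂ (proj₂ col)) i)) (Bool.not-involutive _))

      β∈ : ∀ {a b} → InE β a b → a ∈ Φ GS
      β∈ i = ∈-resp-↭ (E.pβ v) (InE-∈ i)

      -- The one of the two flags at the end `v` of `vu` whose colour is `false`; the rotation
      -- leaves the edge through its corner.
      zf : Fin n → Fin n → Fl
      zf v u = v , u , o (v , u , false)

      o-zf : ∀ {v u} → adj v u ≡ true → o (zf v u) ≡ false
      o-zf {v} {u} e = aux (o (v , u , false)) refl
        where
        aux : ∀ b → o (v , u , false) ≡ b → o (v , u , b) ≡ false
        aux false e' = e'
        aux true e' = trans (o-α (adj-Φ {v , u , false} e)) (cong not e')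

      is-zf : ∀ {v u s} → adj v u ≡ true → o (v , u , s) ≡ false → (v , u , s) ≡ zf v u
      is-zf {v} {u} {false} e h = cong (λ t → v , u , t) (sym h)
      is-zf {v} {u} {true} e h = cong (λ t → v , u , t) (sym (trans (trans (sym (Bool.not-involutive _)) (cong not (sym (o-α (adj-Φ {v , u , false} e))))) (cong not h)))

    ρ₀ : Fin n → Fin n → Fin n
    ρ₀ v u = proj₁ (proj₂ (mate _≟F_ β (zf v u)))

    -- The two flags on one side of an edge look away from opposite ends. If the local orientations
    -- agree along the edge, their colours differ; equal colours mean a twist.
    λ₀ : Fin n → Fin n → Bool
    λ₀ u v = not (o (u , v , false) xor o (v , u , false))

    module _ {ρ : Fin n → Fin n → Fin n} {λs : Fin n → Fin n → Bool} (eρ : ∀ v u → ρ v u ≡ ρ₀ v u) (eλ : ∀ u v → λs u v ≡ λ₀ u v) where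
      private
        ρ-spec : ∀ {v u s b} → InE β (v , u , s) b → o (v , u , s) ≡ false → proj₁ b ≡ v × proj₁ (proj₂ b) ≡ ρ v u
        ρ-spec {v = x} {u} {s} {b} i h = sym (E.Resp-InE (E.rβ v) i) , trans (cong (λ z → proj₁ (proj₂ z)) b≡) (sym (eρ x u))
          where
          b≡ : b ≡ mate _≟F_ β (zf x u)
          b≡ = InE-unique uβ i (subst (λ z → InE β z (mate _≟F_ β (zf x u))) (sym (is-zf (Φ-adj (β∈ i)) h))
                (mate-InE _≟F_ β (∈-resp-↭ (↭-sym (E.pβ v)) (adj-Φ {zf x u} (Φ-adj (β∈ i))))))

        mate-zf : ∀ {x u} → adj x u ≡ true → InE β (zf x u) (mate _≟F_ β (zf x u))
        mate-zf {x} {u} e = mate-InE _≟F_ β (∈-resp-↭ (↭-sym (E.pβ v)) (adj-Φ {zf x u} e))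

        ρ-adj′ : ∀ {x u} → adj x u ≡ true → adj x (ρ x u) ≡ true
        ρ-adj′ {x} {u} e with ρ-spec (mate-zf e) (o-zf e) | Φ-adj (β∈ (InE-sym (mate-zf e)))
        ... | e₁ , e₂ | a = subst₂ (λ y w → adj y w ≡ true) e₁ e₂ a

        side-unique : ∀ {x u s t} → adj x u ≡ true → o (x , u , s) ≡ o (x , u , t) → s ≡ t
        side-unique {s = false} {false} e h = refl
        side-unique {s = true} {true} e h = refl
        side-unique {x} {u} {false} {true} e h = ⊥-elim (Bool.not-¬ refl (trans h (o-α (adj-Φ {x , u , false} e))))
        side-unique {x} {u} {true} {false} e h = ⊥-elim (Bool.not-¬ refl (trans h (o-α (adj-Φ {x , u , true} e))))

        ρ-inj′ : ∀ {x a b} → adj x a ≡ true → adj x b ≡ true → ρ x a ≡ ρ x b → a ≡ b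
        ρ-inj′ {x} {a} {b} ea eb e = cong (λ z → proj₁ (proj₂ z)) (InE-unique uβ (InE-sym (mate-zf ea)) (subst (λ z → InE β z (zf x b)) (sym same) (InE-sym (mate-zf eb))))
          where
          za = mate _≟F_ β (zf x a)
          zb = mate _≟F_ β (zf x b)
          sa = ρ-spec (mate-zf ea) (o-zf ea)
          sb = ρ-spec (mate-zf eb) (o-zf eb)
          oo : o za ≡ o zb
          oo = trans (o-β (mate-zf ea)) (trans (cong not (trans (o-zf ea) (sym (o-zf eb)))) (sym (o-β (mate-zf eb))))
          same : za ≡ zb
          same = go za zb (trans (proj₁ sa) (sym (proj₁ sb))) (trans (proj₂ sa) (trans e (sym (proj₂ sb)))) (Φ-adj (β∈ (InE-sym (mate-zf ea)))) oo
            where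
            go : ∀ za zb → proj₁ za ≡ proj₁ zb → proj₁ (proj₂ za) ≡ proj₁ (proj₂ zb) → Adjacent za → o za ≡ o zb → za ≡ zb
            go (d , w , s) (_ , _ , t) refl refl a h = cong (λ s → d , w , s) (side-unique a h)

        module O (x : Fin n) = Orbit {Fin n} {n} (λ u → u) (λ e → e) (ρ x) (λ u → adj x u ≡ true) (λ {u} → ρ-adj′ {x} {u}) (λ {a} {b} → ρ-inj′ {x} {a} {b})

        R : Fl → Fl → Set
        R z w = z ≡ w ⊎ (Adjacent z × proj₁ z ≡ proj₁ w × ∃ λ k → iter k (ρ (proj₁ z)) (proj₁ (proj₂ z)) ≡ proj₁ (proj₂ w))

        smR : ∀ {z w} → R z w → R w z
        smR (inj₁ e) = inj₁ (sym e)
        smR {x , u , s} {_ , w , t} (inj₂ (a , refl , k , refl)) = inj₂ (O.P-iter x k a , refl , O.back x a k)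

        trR : ∀ {z w y} → R z w → R w y → R z y
        trR (inj₁ refl) r = r
        trR (inj₂ r) (inj₁ refl) = inj₂ r
        trR {x , u , s} {_ , w , t} {y} (inj₂ (a , refl , k , refl)) (inj₂ (_ , e' , l , e)) = inj₂ (a , e' , l + k , trans (iter-+ (ρ x) l k u) e)

        edβ : ∀ {a b} → InE β a b → o a ≡ false → R a b
        edβ {x , u , s} i h with ρ-spec i h
        ... | e₁ , e₂ = inj₂ (Φ-adj (β∈ i) , sym e₁ , 1 , sym e₂)

        ed : ∀ {a b} → (a , b) ∈ β ⊎ (a , b) ∈ α GS → R a b
        ed {a} {b} (inj₁ i) with o a in h
        ... | false = edβ (inj₁ i) h
        ... | true = smR (edβ (inj₂ i) (trans (o-β (inj₁ i)) (cong not h)))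
        ed {a} {b} (inj₂ i) with refl ← α-∈⁻ edgeL i = inj₂ (Φ-adj (∈-resp-↭ (E.pα wG) (flat-∈ˡ i)) , refl , 0 , refl)

        ρ-trans′ : ∀ {x u w} → adj x u ≡ true → adj x w ≡ true → ∃ λ k → k < n × iter k (ρ x) u ≡ w
        ρ-trans′ {x} {u} {w} e e' with Conn-least {S = R} (record { rfl = inj₁ refl ; sm = smR ; tr = trR }) (β ++ α GS) (λ i → ed (∈-++⁻ β i))
                (st (x , u , false) (x , w , false) (adj-Φ {x , u , false} e) (adj-Φ {x , w , false} e') refl)
        ... | inj₁ refl = let (k , k< , h) = O.bounded x e 0 in k , k< , h
        ... | inj₂ (_ , _ , k , h) = let (k' , k< , h') = O.bounded x e k in k' , k< , trans h' h

      ρ-valid : validRot ρ ≡ true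
      ρ-valid = validRot⁺ ρ-adj′ ρ-trans′

      private
        ok : RotOK ρ
        ok = validRot⁻ ρ-valid
        open Rotation ok λs
        open Scheme ρ λs using (sig; ρinv)

        -- Calling each side by its colour turns the pairs of `m GS` into those of `τ₀` and the
        -- corners `β` into those of `τ₁`.
        g : Fl → Fl
        g z = proj₁ z , proj₁ (proj₂ z) , o z

        g-inj : ∀ {z w} → z ∈ Φ GS → w ∈ Φ GS → g z ≡ g w → z ≡ w
        g-inj {x , u , s} {x' , u' , t} i j e with refl ← cong proj₁ e | refl ← cong (λ z → proj₁ (proj₂ z)) e =
          cong (λ s → x , u , s) (side-unique (Φ-adj i) (cong (λ z → proj₂ (proj₂ z)) e))

        g-Φ : map g (Φ GS) ↭ Φ GS
        g-Φ = unique-set-↭ (map-unique g g-inj (Φ-unique edgeL-simple)) (Φ-unique edgeL-simple) to′ from′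
          where
          to′ : ∀ {z} → z ∈ map g (Φ GS) → z ∈ Φ GS
          to′ i with ∈-map⁻ g i
          ... | z , j , refl = adj-Φ {g z} (Φ-adj j)
          from′ : ∀ {z} → z ∈ Φ GS → z ∈ map g (Φ GS)
          from′ {x , u , s} i = subst (_∈ map g (Φ GS)) (cong (λ t → x , u , t) (aux s (o (x , u , false)) refl)) (∈-map⁺ g (adj-Φ {x , u , s xor o (x , u , false)} (Φ-adj i)))
            where
            aux : ∀ s b → o (x , u , false) ≡ b → o (x , u , s xor b) ≡ s
            aux false false e = e
            aux true true e = e
            aux true false e = trans (o-α (adj-Φ {x , u , false} (Φ-adj i))) (cong not e)
            aux false true e = trans (o-α (adj-Φ {x , u , false} (Φ-adj i))) (cong not e)

        sig≡ : ∀ u w → sig u w ≡ λ₀ u w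
        sig≡ u w with toℕ u <ᵇ toℕ w
        ... | true = eλ u w
        ... | false = trans (eλ w u) (cong not (xor-comm (o (w , u , false)) (o (u , w , false))))
          where
          xor-comm : ∀ a b → a xor b ≡ b xor a
          xor-comm false false = refl
          xor-comm false true = refl
          xor-comm true false = refl
          xor-comm true true = refl

        tw : ∀ a b → b ≡ not (twist (not (a xor b)) a)
        tw false false = refl
        tw false true = refl
        tw true false = refl
        tw true true = refl

        tw′ : ∀ a b → not b ≡ not (twist (not (a xor b)) (not a))
        tw′ false false = refl
        tw′ false true = refl
        tw′ true false = refl
        tw′ true true = refl

        hm : ∀ {p q} → (p , q) ∈ map² g (m GS) → q ≡ τ₀ p
        hm i with ∈-map²⁻ g i
        ... | (u , w , s) , q , j , refl , refl with refl ← m-∈⁻ edgeL j = cong (λ t → w , u , t) (trans (aux s) (cong (λ b → not (twist b (o (u , w , s)))) (sym (sig≡ u w))))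
          where
          uw : adj u w ≡ true
          uw = Φ-adj (∈-resp-↭ (E.pm wG) (flat-∈ˡ j))
          aux : ∀ s → o (w , u , s) ≡ not (twist (λ₀ u w) (o (u , w , s)))
          aux false = tw (o (u , w , false)) (o (w , u , false))
          aux true = trans (o-α (adj-Φ {w , u , false} (trans (sm w u) uw))) (trans (tw′ (o (u , w , false)) (o (w , u , false)))
            (cong (λ b → not (twist (λ₀ u w) b)) (sym (o-α (adj-Φ {u , w , false} uw)))))

        hb₁ : ∀ {a b} → InE β a b → o a ≡ false → g b ≡ τ₁ (g a)
        hb₁ {x , u , s} {b} i h with ρ-spec i h
        ... | refl , refl rewrite h = cong (λ t → x , proj₁ (proj₂ b) , t) (trans (o-β i) (cong not h))

        hb : ∀ {p q} → (p , q) ∈ map² g β → q ≡ τ₁ p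
        hb i with ∈-map²⁻ g i
        ... | a , b , j , refl , refl = by (o a) refl
          where
          by : ∀ t → o a ≡ t → g b ≡ τ₁ (g a)
          by false h = hb₁ (inj₁ j) h
          by true h = sym (trans (cong τ₁ (hb₁ (inj₂ j) (trans (o-β (inj₁ j)) (cong not h)))) (τ₁-invol {g b} (Φ-adj (β∈ (inj₂ j)))))

      scheme-orbits : Scheme.orbits ρ λs ≡ 2 * E.M GS β
      scheme-orbits = trans (orbits-c (map² g (m GS)) (map² g β) (↭-trans (↭-reflexive (flat-map² g (m GS))) (↭-trans (map⁺ g (E.pm wG)) g-Φ))
          (↭-trans (↭-reflexive (flat-map² g β)) (↭-trans (map⁺ g (E.pβ v)) g-Φ)) hm hb)
        (cong (2 *_) (trans (cong (λ l → E.c l (Φ GS)) (sym (map-++ _ β (m GS))))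
          (trans (sym (E.c-↭ (map² g (β ++ m GS)) g-Φ)) (Relabel.c-map _≟F_ _≟F_ g (β ++ m GS) g-inj into))))
        where
        into : ∀ {z} → z ∈ flat (β ++ m GS) → z ∈ Φ GS
        into i with ∈-++⁻ (flat β) (subst (_ ∈_) (flat-++ β (m GS)) i)
        ... | inj₁ j = ∈-resp-↭ (E.pβ v) j
        ... | inj₂ j = ∈-resp-↭ (E.pm wG) j

  genus-strict : ∀ {β} → E.Valid GS β → E.Strict wG β → genus + (n + E.M GS β) ≤ 2 + E#
  genus-strict {β} v st with allFuns-∈ (λ f g → ∀ i → f i ≡ g i) (allFuns n (allFin n)) n (ToScheme.ρ₀ v st) (λ x → allFuns-∈ _≡_ (allFin n) n (ToScheme.ρ₀ v st x) (λ u → _ , ∈-allFin _ , refl))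
       | allFuns-∈ (λ f g → ∀ i → f i ≡ g i) (allFuns n (true ∷ false ∷ [])) n (ToScheme.λ₀ v st) (λ x → allFuns-∈ _≡_ (true ∷ false ∷ []) n (ToScheme.λ₀ v st x) (λ u → _ , bool∈ _ , refl))
    where
    bool∈ : ∀ b → b ∈ true ∷ false ∷ []
    bool∈ true = here refl
    bool∈ false = there (here refl)
  ... | ρ , ρ∈ , eρ | λs , λ∈ , eλ = ≤-trans (+-monoˡ-≤ (n + E.M GS β) (≤-trans (genus-≤ adj ρ∈ λ∈ (ToScheme.ρ-valid v st {ρ} {λs} eρ eλ))
        (≤-reflexive (genus-form ρ λs (ToScheme.scheme-orbits v st {ρ} {λs} eρ eλ))))) (≤-reflexive (m∸n+n≡m (euler-strict v (A-≤-n st))))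

  -- An arbitrary valid matching is first made strict, which does not lower `M - A`, and then read
  -- as a scheme.
  charLow : ∀ {i j} → E.Ach GS i j → genus + 2 * n + i ≤ 2 + E# + j
  charLow (β , v , h) with E.strictify wG (E.A GS β) β v ≤-refl
  ... | β' , v' , le , st = low-arith {E#} {n} {genus} {E.A GS β} {E.M GS β} {E.A GS β'} {E.M GS β'} le (n-≤-A v') (genus-strict v' st) h

-- Relabelling backwards

module Inverse {X X' : Set} (_≟'_ : DecidableEquality X') (f : X → X') (z₀ : X) where

  inv : List X → X' → X
  inv [] z' = z₀
  inv (z ∷ l) z' with f z ≟' z'
  ... | yes _ = z
  ... | no _ = inv l z'

  inv-f : ∀ l → (∀ {p q} → p ∈ l → q ∈ l → f p ≡ f q → p ≡ q) → ∀ {z} → z ∈ l → inv l (f z) ≡ z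
  inv-f (w ∷ l) inj {z} i with f w ≟' f z
  ... | yes e = inj (here refl) i e
  inv-f (w ∷ l) inj {z} (here refl) | no n = ⊥-elim (n refl)
  inv-f (w ∷ l) inj {z} (there i) | no n = inv-f l (λ i j → inj (there i) (there j)) i

module Relabel⁻ {X X' : Set} (_≟_ : DecidableEquality X) (_≟'_ : DecidableEquality X') (f : X → X') (z₀ : X)
                {V V' : Set} (_≟V_ : DecidableEquality V) (_≟V'_ : DecidableEquality V') (χ : X → V) (χ' : X' → V') where
  private
    module E  = Surgery _≟_ _≟V_ χ
    module E' = Surgery _≟'_ _≟V'_ χ'
  open Inverse _≟'_ f z₀

  transport⁻ : ∀ {S S'} → E.WF S → E'.WF S' → (∀ {p q} → p ∈ Φ S → q ∈ Φ S → f p ≡ f q → p ≡ q) → map f (Φ S) ↭ Φ S' →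
    (∀ {u v} → (u , v) ∈ m S → InE (m S') (f u) (f v)) → (∀ {u v} → (u , v) ∈ α S → InE (α S') (f u) (f v)) →
    (∀ {u v} → u ∈ Φ S → v ∈ Φ S → χ' (f u) ≡ χ' (f v) → χ u ≡ χ v) → ∀ {i j} → E'.Ach S' i j → E.Ach S i j
  transport⁻ {S} {S'} w w' inj π hm hα hχ = Relabel.transport _≟'_ _≟_ g _≟V'_ _≟V_ χ' χ w' w inj′
      (↭-trans (map⁺ g (↭-sym π)) (↭-reflexive (trans (sym (map-∘ (Φ S))) (id-on (Φ S) id))))
      (back (m S) (m S') (E.pm w) (E'.pm w') hm) (back (α S) (α S') (E.pα w) (E'.pα w') hα) χ′
    where
    g = inv (Φ S)
    gf : ∀ {z} → z ∈ Φ S → g (f z) ≡ z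
    gf = inv-f (Φ S) inj
    pre : ∀ {z'} → z' ∈ Φ S' → ∃ λ z → z ∈ Φ S × z' ≡ f z
    pre i = ∈-map⁻ f (∈-resp-↭ (↭-sym π) i)
    inj′ : ∀ {p q} → p ∈ Φ S' → q ∈ Φ S' → g p ≡ g q → p ≡ q
    inj′ i j e with pre i | pre j
    ... | a , a∈ , refl | b , b∈ , refl = cong f (trans (sym (gf a∈)) (trans e (gf b∈)))
    id-on : ∀ l → (∀ {z} → z ∈ l → z ∈ Φ S) → map (g ∘ f) l ≡ l
    id-on [] s = refl
    id-on (z ∷ l) s = cong₂ _∷_ (gf (s (here refl))) (id-on l (s ∘ there))
    back : ∀ a a' → flat a ↭ Φ S → flat a' ↭ Φ S' → (∀ {u v} → (u , v) ∈ a → InE a' (f u) (f v)) → ∀ {u v} → (u , v) ∈ a' → InE a (g u) (g v)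
    back a a' pa pa' h i = un (from o i)
      where
      h' : ∀ {u v} → (u , v) ∈ map² f a → InE a' u v
      h' i with ∈-map²⁻ f i
      ... | p , q , k , refl , refl = h k
      o : map² f a ≅ a'
      o = matching-≅ (map² f a) a' (Unique-resp-↭ (↭-sym pa') (E'.uniq w'))
            (↭-trans (↭-reflexive (flat-map² f a)) (↭-trans (map⁺ f pa) (↭-trans π (↭-sym pa')))) h'
      un₁ : ∀ {u v} → (u , v) ∈ map² f a → (g u , g v) ∈ a
      un₁ i with ∈-map²⁻ f i
      ... | p , q , k , refl , refl = subst₂ (λ x y → (x , y) ∈ a) (sym (gf (∈-resp-↭ pa (flat-∈ˡ k)))) (sym (gf (∈-resp-↭ pa (flat-∈ʳ k)))) k
      un : ∀ {u v} → InE (map² f a) u v → InE a (g u) (g v)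
      un (inj₁ i) = inj₁ (un₁ i)
      un (inj₂ i) = inj₂ (un₁ i)
    χ′ : ∀ {u v} → u ∈ Φ S' → v ∈ Φ S' → χ' u ≡ χ' v → χ (g u) ≡ χ (g v)
    χ′ i j e with pre i | pre j
    ... | a , a∈ , refl | b , b∈ , refl = trans (cong χ (gf a∈)) (trans (hχ a∈ b∈ e) (cong χ (sym (gf b∈))))

-- Flags carry a tag, so that parallel edges can be told apart.
module Tagged {V : Set} (_≟V_ : DecidableEquality V) where

  TF : Set
  TF = ℕ × V × V × Bool

  _≟T_ : DecidableEquality TF
  _≟T_ = ≡-dec Nat._≟_ (≡-dec _≟V_ (≡-dec _≟V_ Bool._≟_))
    where import Data.Nat.Properties as Nat

  vert : TF → V
  vert (_ , u , _) = u

  edge : ℕ → V → V → Quad TF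
  edge t u v = quad (t , u , v , false) (t , u , v , true) (t , v , u , false) (t , v , u , true)

  -- A system is determined up to the order of its lists by the set `P` of its tagged, directed
  -- edges. Isomorphisms between systems built in different ways thus become statements about such
  -- predicates.
  record Pres (S : Sys TF) (P : ℕ → V → V → Set) : Set where
    field
      puniq : Unique (Φ S)
      ppm   : flat (m S) ↭ Φ S
      ppα   : flat (α S) ↭ Φ S
      in⁻   : ∀ {t u v s} → (t , u , v , s) ∈ Φ S → P t u v
      in⁺   : ∀ {t u v} s → P t u v → (t , u , v , s) ∈ Φ S
      m-mate : ∀ {t u v s b} → InE (m S) (t , u , v , s) b → b ≡ (t , v , u , s)
      α-mate : ∀ {t u v s b} → InE (α S) (t , u , v , s) b → b ≡ (t , u , v , not s)
  open Pres public

  mate-∈ : ∀ {S P} (p : Pres S P) → ∀ {t u v s} → (t , u , v , s) ∈ Φ S → InE (m S) (t , u , v , s) (t , v , u , s)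
  mate-∈ {S} p i with flat-partner (m S) (∈-resp-↭ (↭-sym (ppm p)) i)
  ... | r , j = subst (InE (m S) _) (m-mate p j) j

  flip-∈ : ∀ {S P} (p : Pres S P) → ∀ {t u v s} → (t , u , v , s) ∈ Φ S → InE (α S) (t , u , v , s) (t , u , v , not s)
  flip-∈ {S} p i with flat-partner (α S) (∈-resp-↭ (↭-sym (ppα p)) i)
  ... | r , j = subst (InE (α S) _) (α-mate p j) j

  EdgeP : ℕ → V → V → ℕ → V → V → Set
  EdgeP t x y t' u v = t' ≡ t × ((u ≡ x × v ≡ y) ⊎ (u ≡ y × v ≡ x))

  edge-unique : ∀ t {x y} → x ≢ y → Unique (Φ (edgeSys (edge t x y)))
  edge-unique t n = ((λ ()) ∷ (λ { refl → n refl }) ∷ (λ ()) ∷ []) ∷ ((λ ()) ∷ (λ { refl → n refl }) ∷ []) ∷ ((λ ()) ∷ []) ∷ [] ∷ []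

  Pres-edge : ∀ t {x y} → x ≢ y → Pres (edgeSys (edge t x y)) (EdgeP t x y)
  Pres-edge t {x} {y} n = record
    { puniq = edge-unique t n ; ppm = prep _ (swap _ _ ↭-refl) ; ppα = ↭-refl ; in⁻ = i⁻ ; in⁺ = i⁺ ; m-mate = mm ; α-mate = αm }
    where
    i⁻ : ∀ {t' u v s} → (t' , u , v , s) ∈ Φ (edgeSys (edge t x y)) → EdgeP t x y t' u v
    i⁻ (here refl) = refl , inj₁ (refl , refl)
    i⁻ (there (here refl)) = refl , inj₁ (refl , refl)
    i⁻ (there (there (here refl))) = refl , inj₂ (refl , refl)
    i⁻ (there (there (there (here refl)))) = refl , inj₂ (refl , refl)
    i⁺ : ∀ {t' u v} s → EdgeP t x y t' u v → (t' , u , v , s) ∈ Φ (edgeSys (edge t x y))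
    i⁺ false (refl , inj₁ (refl , refl)) = here refl
    i⁺ true  (refl , inj₁ (refl , refl)) = there (here refl)
    i⁺ false (refl , inj₂ (refl , refl)) = there (there (here refl))
    i⁺ true  (refl , inj₂ (refl , refl)) = there (there (there (here refl)))
    mm : ∀ {t' u v s b} → InE (m (edgeSys (edge t x y))) (t' , u , v , s) b → b ≡ (t' , v , u , s)
    mm (inj₁ (here refl)) = refl
    mm (inj₁ (there (here refl))) = refl
    mm (inj₂ (here refl)) = refl
    mm (inj₂ (there (here refl))) = refl
    αm : ∀ {t' u v s b} → InE (α (edgeSys (edge t x y))) (t' , u , v , s) b → b ≡ (t' , u , v , not s)
    αm (inj₁ (here refl)) = refl
    αm (inj₁ (there (here refl))) = refl
    αm (inj₂ (here refl)) = refl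
    αm (inj₂ (there (here refl))) = refl

  InE-++⁻ : ∀ {A : Set} (es : List (A × A)) {fs u v} → InE (es ++ fs) u v → InE es u v ⊎ InE fs u v
  InE-++⁻ es (inj₁ i) with ∈-++⁻ es i
  ... | inj₁ j = inj₁ (inj₁ j)
  ... | inj₂ j = inj₂ (inj₁ j)
  InE-++⁻ es (inj₂ i) with ∈-++⁻ es i
  ... | inj₁ j = inj₁ (inj₂ j)
  ... | inj₂ j = inj₂ (inj₂ j)

  Pres-⊕ : ∀ {S T P Q} → Pres S P → Pres T Q → (∀ {t u v} → P t u v → Q t u v → ⊥) → Pres (S ⊕ T) (λ t u v → P t u v ⊎ Q t u v)
  Pres-⊕ {S} {T} {P} {Q} p q dj = record
    { puniq = Uniq.++⁺ (puniq p) (puniq q) (λ (i , j) → dj (in⁻ p i) (in⁻ q j))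
    ; ppm = ↭-trans (↭-reflexive (flat-++ (m S) (m T))) (++⁺ (ppm p) (ppm q))
    ; ppα = ↭-trans (↭-reflexive (flat-++ (α S) (α T))) (++⁺ (ppα p) (ppα q))
    ; in⁻ = λ i → i⁻ (∈-++⁻ (Φ S) i)
    ; in⁺ = λ { s (inj₁ h) → ∈-++⁺ˡ (in⁺ p s h) ; s (inj₂ h) → ∈-++⁺ʳ (Φ S) (in⁺ q s h) }
    ; m-mate = λ i → mm (InE-++⁻ (m S) i)
    ; α-mate = λ i → αm (InE-++⁻ (α S) i) }
    where
    i⁻ : ∀ {t u v s} → (t , u , v , s) ∈ Φ S ⊎ (t , u , v , s) ∈ Φ T → P t u v ⊎ Q t u v
    i⁻ (inj₁ i) = inj₁ (in⁻ p i)
    i⁻ (inj₂ i) = inj₂ (in⁻ q i)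
    mm : ∀ {t u v s b} → InE (m S) (t , u , v , s) b ⊎ InE (m T) (t , u , v , s) b → b ≡ (t , v , u , s)
    mm (inj₁ i) = m-mate p i
    mm (inj₂ i) = m-mate q i
    αm : ∀ {t u v s b} → InE (α S) (t , u , v , s) b ⊎ InE (α T) (t , u , v , s) b → b ≡ (t , u , v , not s)
    αm (inj₁ i) = α-mate p i
    αm (inj₂ i) = α-mate q i

  Pres-◂ : ∀ t {x y} → x ≢ y → ∀ {S P} → Pres S P → (∀ {t' u v} → EdgeP t x y t' u v → P t' u v → ⊥) →
    Pres (edge t x y ◂ S) (λ t' u v → EdgeP t x y t' u v ⊎ P t' u v)
  Pres-◂ t n p dj = Pres-⊕ (Pres-edge t n) p dj

  module _ {W : Set} (_≟W_ : DecidableEquality W) (γ : V → W) where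
    Pres-WF : ∀ {S P} → Pres S P → Surgery.WF _≟T_ _≟W_ (γ ∘ vert) S
    Pres-WF p = record { uniq = puniq p ; pm = ppm p ; pα = ppα p ; rα = λ i → cong (γ ∘ vert) (sym (α-mate p (inj₁ i))) }

    edge-OK : ∀ t {x y} → x ≢ y → Surgery.EdgeOK _≟T_ _≟W_ (γ ∘ vert) (edge t x y)
    edge-OK t n = record { uq = edge-unique t n ; χp = refl ; χq = refl }

-- Isomorphisms of tagged systems

module PresIso {V V' W W' : Set} (_≟V_ : DecidableEquality V) (_≟V'_ : DecidableEquality V')
               (_≟W_ : DecidableEquality W) (_≟W'_ : DecidableEquality W') (γ : V → W) (γ' : V' → W') where
  private
    module T  = Tagged _≟V_
    module T' = Tagged _≟V'_

  module _ {S : Sys T.TF} {S' : Sys T'.TF} {P : ℕ → V → V → Set} {P' : ℕ → V' → V' → Set} (p : T.Pres S P) (p' : T'.Pres S' P')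
           (θ : ℕ → ℕ) (g : V → V')
           (into : ∀ {t u v} → P t u v → P' (θ t) (g u) (g v))
           (inj : ∀ {t u v t' u' v'} → P t u v → P t' u' v' → θ t ≡ θ t' → g u ≡ g u' → g v ≡ g v' → (t , u , v) ≡ (t' , u' , v'))
           (onto : ∀ {t u v} → P' t u v → ∃ λ t₀ → ∃ λ u₀ → ∃ λ v₀ → P t₀ u₀ v₀ × t ≡ θ t₀ × u ≡ g u₀ × v ≡ g v₀) where
    private
      f : T.TF → T'.TF
      f (t , u , v , s) = θ t , g u , g v , s

      f-inj : ∀ {a b} → a ∈ Φ S → b ∈ Φ S → f a ≡ f b → a ≡ b
      f-inj {t , u , v , s} {t' , u' , v' , s'} i j e with inj (T.in⁻ p i) (T.in⁻ p j) (cong proj₁ e) (cong (λ z → proj₁ (proj₂ z)) e) (cong (λ z → proj₁ (proj₂ (proj₂ z))) e)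
      ... | refl = cong (λ s → t , u , v , s) (cong (λ z → proj₂ (proj₂ (proj₂ z))) e)

    iso-Φ : map f (Φ S) ↭ Φ S'
    iso-Φ = unique-set-↭ (map-unique f f-inj (T.puniq p)) (T'.puniq p') to′ from′
      where
      to′ : ∀ {z} → z ∈ map f (Φ S) → z ∈ Φ S'
      to′ i with ∈-map⁻ f i
      ... | (t , u , v , s) , j , refl = T'.in⁺ p' s (into (T.in⁻ p j))
      from′ : ∀ {z} → z ∈ Φ S' → z ∈ map f (Φ S)
      from′ {t , u , v , s} i with onto (T'.in⁻ p' i)
      ... | t₀ , u₀ , v₀ , h , refl , refl , refl = ∈-map⁺ f (T.in⁺ p s h)

    iso-length : length (Φ S) ≡ length (Φ S')
    iso-length = trans (sym (length-map f (Φ S))) (↭-length iso-Φ)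

    private
      hm : ∀ {a b} → (a , b) ∈ m S → InE (m S') (f a) (f b)
      hm {t , u , v , s} i with refl ← T.m-mate p (inj₁ i) = T'.mate-∈ p' (∈-resp-↭ iso-Φ (∈-map⁺ f (∈-resp-↭ (T.ppm p) (flat-∈ˡ i))))
      hα : ∀ {a b} → (a , b) ∈ α S → InE (α S') (f a) (f b)
      hα {t , u , v , s} i with refl ← T.α-mate p (inj₁ i) = T'.flip-∈ p' (∈-resp-↭ iso-Φ (∈-map⁺ f (∈-resp-↭ (T.ppα p) (flat-∈ˡ i))))

    iso-fwd : (∀ {t u v t' u' v'} → P t u v → P t' u' v' → γ u ≡ γ u' → γ' (g u) ≡ γ' (g u')) → ∀ {i j} → Surgery.Ach T._≟T_ _≟W_ (γ ∘ T.vert) S i j → Surgery.Ach T'._≟T_ _≟W'_ (γ' ∘ T'.vert) S' i j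
    iso-fwd hγ = Relabel.transport T._≟T_ T'._≟T_ f _≟W_ _≟W'_ (γ ∘ T.vert) (γ' ∘ T'.vert) (T.Pres-WF _≟W_ γ p) (T'.Pres-WF _≟W'_ γ' p') f-inj iso-Φ hm hα
      (λ {a} {b} i j e → hγ (T.in⁻ p i) (T.in⁻ p j) e)

    iso-bwd : V → (∀ {t u v t' u' v'} → P t u v → P t' u' v' → γ' (g u) ≡ γ' (g u') → γ u ≡ γ u') → ∀ {i j} → Surgery.Ach T'._≟T_ _≟W'_ (γ' ∘ T'.vert) S' i j → Surgery.Ach T._≟T_ _≟W_ (γ ∘ T.vert) S i j
    iso-bwd v₀ hγ = Relabel⁻.transport⁻ T._≟T_ T'._≟T_ f (0 , v₀ , v₀ , false) _≟W_ _≟W'_ (γ ∘ T.vert) (γ' ∘ T'.vert) (T.Pres-WF _≟W_ γ p) (T'.Pres-WF _≟W'_ γ' p') f-inj iso-Φ hm hα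
      (λ {a} {b} i j e → hγ (T.in⁻ p i) (T.in⁻ p j) e)

module TagGraph {n : ℕ} (adj : Adj n) (sm : ∀ u v → adj u v ≡ adj v u) (ir : ∀ v → adj v v ≡ false) where
  open GraphSys adj sm ir
  open Tagged {Fin n} Fin._≟_

  tagged : ℕ → Sys TF
  tagged t = sys (map (t ,_) (Φ GS)) (map² (t ,_) (m GS)) (map² (t ,_) (α GS))

  private
    wG : Surgery.WF _≟F_ Fin._≟_ proj₁ GS
    wG = WF-graph Fin._≟_ id edgeL-simple

  tagged-Pres : ∀ t → Pres (tagged t) (λ t' u v → t' ≡ t × adj u v ≡ true)
  tagged-Pres t = record
    { puniq = map-unique (t ,_) (λ { _ _ refl → refl }) (Φ-unique edgeL-simple)
    ; ppm = ↭-trans (↭-reflexive (flat-map² (t ,_) (m GS))) (map⁺ (t ,_) (Surgery.pm wG))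
    ; ppα = ↭-trans (↭-reflexive (flat-map² (t ,_) (α GS))) (map⁺ (t ,_) (Surgery.pα wG))
    ; in⁻ = i⁻
    ; in⁺ = λ { {t'} {u} {v} s (refl , e) → ∈-map⁺ (t ,_) (adj-Φ {u , v , s} e) }
    ; m-mate = mm ; α-mate = αm }
    where
    i⁻ : ∀ {t' u v s} → (t' , u , v , s) ∈ map (t ,_) (Φ GS) → t' ≡ t × adj u v ≡ true
    i⁻ i with ∈-map⁻ (t ,_) i
    ... | z , j , refl = refl , Φ-adj j
    mm : ∀ {t' u v s b} → InE (map² (t ,_) (m GS)) (t' , u , v , s) b → b ≡ (t' , v , u , s)
    mm (inj₁ i) with ∈-map²⁻ (t ,_) i
    ... | p , q , j , refl , refl with refl ← m-∈⁻ edgeL j = refl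
    mm (inj₂ i) with ∈-map²⁻ (t ,_) i
    ... | p , q , j , refl , refl with refl ← m-∈⁻ edgeL j = refl
    αm : ∀ {t' u v s b} → InE (map² (t ,_) (α GS)) (t' , u , v , s) b → b ≡ (t' , u , v , not s)
    αm (inj₁ i) with ∈-map²⁻ (t ,_) i
    ... | p , q , j , refl , refl with refl ← α-∈⁻ edgeL j = refl
    αm (inj₂ i) with ∈-map²⁻ (t ,_) i
    ... | (u , v , s) , q , j , refl , refl with refl ← α-∈⁻ edgeL j = cong (λ s → t , u , v , s) (sym (Bool.not-involutive s))

  Φ-length : ∀ t → length (Φ (tagged t)) ≡ 4 * length edgeL
  Φ-length t = trans (length-map (t ,_) (Φ GS)) (go edgeL)
    where
    go : ∀ L → length (Φ (graphSys L)) ≡ 4 * length L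
    go [] = refl
    go (_ ∷ L) = trans (cong (4 +_) (go L)) (eq (length L))
      where
      eq : ∀ l → 4 + 4 * l ≡ 4 * suc l
      eq = solve-∀

  D : ℕ → ℕ → Set
  D = Surgery.Ach _≟T_ Fin._≟_ vert (tagged 0)

  module _ (v₀ : Fin n) (nb : ∀ v → ∃ λ w → adj v w ≡ true) (cn : ∀ u w → Conn edgeL u w) where
    private
      tw : Surgery.WF _≟T_ Fin._≟_ vert (tagged 0)
      tw = Pres-WF Fin._≟_ id (tagged-Pres 0)

    D-up : D (2 + length edgeL) (Genus.genus adj + 2 * n)
    D-up = Relabel.transport _≟F_ _≟T_ (0 ,_) Fin._≟_ Fin._≟_ proj₁ vert wG tw (λ { _ _ refl → refl }) ↭-refl
      (λ i → inj₁ (∈-map⁺ _ i)) (λ i → inj₁ (∈-map⁺ _ i)) (λ _ _ e → e) (Char.charUp adj sm ir v₀ nb cn)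

    D-low : ∀ {i j} → D i j → Genus.genus adj + 2 * n + i ≤ 2 + length edgeL + j
    D-low d = Char.charLow adj sm ir v₀ nb cn (Relabel⁻.transport⁻ _≟F_ _≟T_ (0 ,_) (v₀ , v₀ , false) Fin._≟_ Fin._≟_ proj₁ vert wG tw (λ { _ _ refl → refl }) ↭-refl
      (λ i → inj₁ (∈-map⁺ _ i)) (λ i → inj₁ (∈-map⁺ _ i)) (λ _ _ e → e) d)

split-arith : ∀ A M {i j J I} → A + i ≤ M + j → M + J ≤ A + I → i + J ≤ j + I
split-arith A M {i} {j} {J} {I} h k = lin (A + M) (+-mono-≤ h k) (eq₁ i J A M) (eq₂ j I A M)
  where
  eq₁ : ∀ i J A M → i + J + (A + M) ≡ A + i + (M + J)
  eq₁ = solve-∀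
  eq₂ : ∀ j I A M → M + j + (A + I) ≡ j + I + (A + M)
  eq₂ = solve-∀

-- Added edges and sums as flag systems

record SA {n : ℕ} (a : Adj n) : Set where
  constructor sa
  field
    sm : ∀ u v → a u v ≡ a v u
    ir : ∀ v → a v v ≡ false
open SA public

module _ {n : ℕ} where
  open Tagged {Fin n} Fin._≟_ public
  module F = Split _≟T_ Fin._≟_ vert

  opaque

    tag : (a : Adj n) → SA a → ℕ → Sys TF
    tag a s = TagGraph.tagged a (sm s) (ir s)

    edgeCount : (a : Adj n) → SA a → ℕ
    edgeCount a s = length (GraphSys.edgeL a (sm s) (ir s))

    gen : Adj n → ℕ
    gen a = Genus.genus a

    gen≡ : ∀ a → gen a ≡ Genus.genus a
    gen≡ a = refl

    tag-Pres : (a : Adj n) (s : SA a) → ∀ t → Pres (tag a s t) (λ t' u v → t' ≡ t × a u v ≡ true)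
    tag-Pres a s = TagGraph.tagged-Pres a (sm s) (ir s)

    tag-length : (a : Adj n) (s : SA a) → ∀ t → length (Φ (tag a s t)) ≡ 4 * edgeCount a s
    tag-length a s = TagGraph.Φ-length a (sm s) (ir s)

  DD : (a : Adj n) → SA a → ℕ → ℕ → Set
  DD a s = F.Ach (tag a s 0)

  opaque
    unfolding tag edgeCount gen

    DD-up : ∀ (a : Adj n) s → Fin n → (∀ v → ∃ λ w → a v w ≡ true) → (∀ u w → Conn (GraphSys.edgeL a (sm s) (ir s)) u w) →
      DD a s (2 + edgeCount a s) (gen a + 2 * n)
    DD-up a s v₀ nb cn = TagGraph.D-up a (sm s) (ir s) v₀ nb cn

    DD-low : ∀ (a : Adj n) s → Fin n → (∀ v → ∃ λ w → a v w ≡ true) → (∀ u w → Conn (GraphSys.edgeL a (sm s) (ir s)) u w) →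
      ∀ {i j} → DD a s i j → gen a + 2 * n + i ≤ 2 + edgeCount a s + j
    DD-low a s v₀ nb cn = TagGraph.D-low a (sm s) (ir s) v₀ nb cn

  private module I = PresIso {Fin n} {Fin n} Fin._≟_ Fin._≟_ Fin._≟_ Fin._≟_ id id

  retag : ∀ (a : Adj n) s t t' {i j} → F.Ach (tag a s t) i j → F.Ach (tag a s t') i j
  retag a s t t' = I.iso-fwd (tag-Pres a s t) (tag-Pres a s t') (λ _ → t') id (λ (_ , e) → refl , e)
    (λ { (refl , _) (refl , _) _ refl refl → refl }) (λ { {u = u} {v} (refl , e) → t , u , v , (refl , e) , refl , refl , refl }) (λ _ _ e → e)

  WF-tag : ∀ (a : Adj n) s t → F.WF (tag a s t)
  WF-tag a s t = Pres-WF Fin._≟_ id (tag-Pres a s t)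

  module AddEdge (x y : Fin n) (x≢y : x ≢ y) where

    add : Adj n → Adj n
    add a u v = a u v ∨ (eqF u x ∧ eqF v y) ∨ (eqF u y ∧ eqF v x)

    add-⊆ : ∀ a {u v} → a u v ≡ true → add a u v ≡ true
    add-⊆ a = ∨-trueˡ

    add-xy : ∀ a {u v} → (u ≡ x × v ≡ y) ⊎ (u ≡ y × v ≡ x) → add a u v ≡ true
    add-xy a {u} {v} (inj₁ (refl , refl)) = ∨-trueʳ {a u v} (∨-trueˡ (∧-intro (eqF-refl u) (eqF-refl v)))
    add-xy a {u} {v} (inj₂ (refl , refl)) = ∨-trueʳ {a u v} (∨-trueʳ {eqF u x ∧ eqF v y} (∧-intro (eqF-refl u) (eqF-refl v)))

    add⁻ : ∀ a {u v} → add a u v ≡ true → a u v ≡ true ⊎ (u ≡ x × v ≡ y) ⊎ (u ≡ y × v ≡ x)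
    add⁻ a {u} {v} h with ∨-split {a u v} h
    ... | inj₁ e = inj₁ e
    ... | inj₂ h' with ∨-split {eqF u x ∧ eqF v y} h'
    ... | inj₁ e = inj₂ (inj₁ (eqF⁻ (proj₁ (∧-true {eqF u x} e)) , eqF⁻ (proj₂ (∧-true {eqF u x} e))))
    ... | inj₂ e = inj₂ (inj₂ (eqF⁻ (proj₁ (∧-true {eqF u y} e)) , eqF⁻ (proj₂ (∧-true {eqF u y} e))))

    iff : ∀ {b c : Bool} → (b ≡ true → c ≡ true) → (c ≡ true → b ≡ true) → b ≡ c
    iff {true} {c} f g = sym (f refl)
    iff {false} {true} f g = g refl
    iff {false} {false} f g = refl

    SA-add : ∀ {a} → SA a → SA (add a)
    SA-add {a} s = sa (λ u v → iff (sy u v) (sy v u)) ir′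
      where
      sy : ∀ u v → add a u v ≡ true → add a v u ≡ true
      sy u v h with add⁻ a h
      ... | inj₁ e = add-⊆ a (trans (sm s v u) e)
      ... | inj₂ (inj₁ (e , e')) = add-xy a (inj₂ (e' , e))
      ... | inj₂ (inj₂ (e , e')) = add-xy a (inj₁ (e' , e))
      ir′ : ∀ v → add a v v ≡ false
      ir′ v with add a v v in h
      ... | false = refl
      ... | true with add⁻ a h
      ... | inj₁ e = trans (sym e) (ir s v)
      ... | inj₂ (inj₁ (refl , refl)) = ⊥-elim (x≢y refl)
      ... | inj₂ (inj₂ (refl , refl)) = ⊥-elim (x≢y refl)

    module _ (a : Adj n) (s : SA a) (na : a x y ≡ false) (t t' : ℕ) where

      clash : ∀ {u v} → (u ≡ x × v ≡ y) ⊎ (u ≡ y × v ≡ x) → a u v ≡ true → ⊥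
      clash (inj₁ (refl , refl)) e = true≢false (trans (sym e) na)
      clash (inj₂ (refl , refl)) e = true≢false (trans (sym e) (trans (sm s y x) na))

      fresh : ∀ {t₁ u v} → EdgeP t x y t₁ u v → t₁ ≡ t' × a u v ≡ true → ⊥
      fresh (_ , h) (_ , e) = clash h e

      fresh-Disj : F.Disj (edgeSys (edge t x y)) (tag a s t')
      fresh-Disj {t₁ , u , v , b} i j = fresh (in⁻ (Pres-edge t x≢y) i) (in⁻ (tag-Pres a s t') j)

      private
        pe = Pres-◂ t x≢y (tag-Pres a s t') fresh
        pa = tag-Pres (add a) (SA-add s) 0
        into : ∀ {t₁ u v} → EdgeP t x y t₁ u v ⊎ (t₁ ≡ t' × a u v ≡ true) → 0 ≡ 0 × add a u v ≡ true
        into (inj₁ (_ , h)) = refl , add-xy a h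
        into (inj₂ (_ , e)) = refl , add-⊆ a e
        inj : ∀ {t₁ u v t₂ u' v'} → EdgeP t x y t₁ u v ⊎ (t₁ ≡ t' × a u v ≡ true) → EdgeP t x y t₂ u' v' ⊎ (t₂ ≡ t' × a u' v' ≡ true) →
          0 ≡ 0 → u ≡ u' → v ≡ v' → (t₁ , u , v) ≡ (t₂ , u' , v')
        inj (inj₁ (refl , _)) (inj₁ (refl , _)) _ refl refl = refl
        inj (inj₂ (refl , _)) (inj₂ (refl , _)) _ refl refl = refl
        inj (inj₁ (_ , h)) (inj₂ (_ , e)) _ refl refl = ⊥-elim (clash h e)
        inj (inj₂ (_ , e)) (inj₁ (_ , h)) _ refl refl = ⊥-elim (clash h e)
        onto : ∀ {t₁ u v} → t₁ ≡ 0 × add a u v ≡ true → ∃ λ t₀ → ∃ λ u₀ → ∃ λ v₀ → (EdgeP t x y t₀ u₀ v₀ ⊎ (t₀ ≡ t' × a u₀ v₀ ≡ true)) × t₁ ≡ 0 × u ≡ u₀ × v ≡ v₀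
        onto {t₁} {u} {v} (refl , e) with add⁻ a e
        ... | inj₁ e' = t' , u , v , inj₂ (refl , e') , refl , refl , refl
        ... | inj₂ h = t , u , v , inj₁ (refl , h) , refl , refl , refl

      ◂⇒add : ∀ {i j} → F.Ach (edge t x y ◂ tag a s t') i j → DD (add a) (SA-add s) i j
      ◂⇒add = I.iso-fwd pe pa (λ _ → 0) id into inj onto (λ _ _ e → e)

      add⇒◂ : ∀ {i j} → DD (add a) (SA-add s) i j → F.Ach (edge t x y ◂ tag a s t') i j
      add⇒◂ = I.iso-bwd pe pa (λ _ → 0) id into inj onto x (λ _ _ e → e)

      add-count : edgeCount (add a) (SA-add s) ≡ suc (edgeCount a s)
      add-count = quarter (edgeCount (add a) (SA-add s)) (suc (edgeCount a s)) (trans (sym (tag-length (add a) (SA-add s) 0))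
        (trans (sym (I.iso-length pe pa (λ _ → 0) id into inj onto)) (trans (cong (4 +_) (tag-length a s t')) (eq (edgeCount a s)))))
        where
        eq : ∀ l → 4 + 4 * l ≡ 4 * suc l
        eq = solve-∀
        quarter : ∀ a b → 4 * a ≡ 4 * b → a ≡ b
        quarter a b = *-cancelˡ-≡ a b 4

      add-≥ : ∀ {i j} → DD a s i j → DD (add a) (SA-add s) i (suc j)
      add-≥ d = ◂⇒add (F.Ach-⊕ (F.WF-edge ok) (WF-tag a s t') fresh-Disj {0} {1} (F.Ach-edge ok) (retag a s 0 t' d))
        where ok = edge-OK Fin._≟_ id t x≢y

      add-≤ : ∀ {i j} → DD (add a) (SA-add s) i j → DD a s i (suc j)
      add-≤ d = retag a s t' 0 (F.delete (edge-OK Fin._≟_ id t x≢y) (WF-tag a s t') fresh-Disj (add⇒◂ d))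

    -- A copy of an existing edge can be drawn next to it and adds a face. This comes from
    -- `parallel`, with the copy alone as second system: the gain of two minus the cost of one for a
    -- single edge.
    double : ∀ (a₁ : Adj n) s₁ → a₁ x y ≡ true → ∀ {i j} → DD a₁ s₁ i j → F.Ach (edge 2 x y ◂ tag a₁ s₁ 0) (suc i) j
    double a₁ s₁ xy {i} {j} d = F.Ach-≤ {i = 2 + (i + 0)} {j = j + 1} (≤-reflexive (eq i j))
        (I.iso-fwd q (Pres-◂ 2 x≢y (tag-Pres a₁ s₁ 0) fr₁) id id f (λ { _ _ refl refl refl → refl }) (λ {t} {u} {v} h → t , u , v , g h , refl , refl , refl) (λ _ _ e → e)
          (F.parallel {e = e₀} {e' = e₂} {T = sys [] [] []} ok₀ ok₂ (F.WF-◂ ok₀ (WF-tag a⁻ s⁻ 0) (fresh-Disj a⁻ s⁻ na⁻ 0 0)) (F.WF-edge ok₂) djq refl refl (x≢y ∘ sym) {i} {j} {0} {1}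
            (I.iso-bwd p₀ (tag-Pres a₁ s₁ 0) id id h₁ (λ { _ _ refl refl refl → refl }) (λ {t} {u} {v} h → t , u , v , h₂ h , refl , refl , refl) x (λ _ _ e → e) d)
            (F.Ach-edge ok₂)))
      where
      eq : ∀ i j → suc i + (j + 1) ≡ 2 + (i + 0) + j
      eq = solve-∀
      e₀ = edge 0 x y
      e₂ = edge 2 x y
      ok₂ = edge-OK Fin._≟_ id 2 x≢y
      fr₁ : ∀ {t u v} → EdgeP 2 x y t u v → t ≡ 0 × a₁ u v ≡ true → ⊥
      fr₁ (refl , _) (() , _)
      ok₀ = edge-OK Fin._≟_ id 0 x≢y
      isxy : Fin n → Fin n → Bool
      isxy u v = (eqF u x ∧ eqF v y) ∨ (eqF u y ∧ eqF v x)
      isxy⁻ : ∀ u v → isxy u v ≡ true → (u ≡ x × v ≡ y) ⊎ (u ≡ y × v ≡ x)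
      isxy⁻ u v e with add⁻ (λ _ _ → false) {u} {v} e
      ... | inj₂ h = h
      isxy⁺ : ∀ u v → (u ≡ x × v ≡ y) ⊎ (u ≡ y × v ≡ x) → isxy u v ≡ true
      isxy⁺ u v h = add-xy (λ _ _ → false) {u} {v} h
      a⁻ : Adj n
      a⁻ u v = a₁ u v ∧ not (isxy u v)
      a⁻⁻ : ∀ {u v} → a⁻ u v ≡ true → a₁ u v ≡ true × isxy u v ≡ false
      a⁻⁻ {u} {v} e with ∧-true {a₁ u v} e
      ... | e₁ , e₂ = e₁ , trans (sym (Bool.not-involutive _)) (cong not e₂)
      sx : ∀ u v → isxy u v ≡ true → isxy v u ≡ true
      sx u v e with isxy⁻ u v e
      ... | inj₁ (p , q) = isxy⁺ v u (inj₂ (q , p))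
      ... | inj₂ (p , q) = isxy⁺ v u (inj₁ (q , p))
      s⁻ : SA a⁻
      s⁻ = sa (λ u v → cong₂ _∧_ (sm s₁ u v) (cong not (iff (sx u v) (sx v u)))) (λ v → cong (_∧ not (isxy v v)) (ir s₁ v))
      na⁻ : a⁻ x y ≡ false
      na⁻ = trans (cong (λ b → a₁ x y ∧ not b) (isxy⁺ x y (inj₁ (refl , refl)))) (Bool.∧-zeroʳ (a₁ x y))
      p₀ = Pres-◂ 0 x≢y (tag-Pres a⁻ s⁻ 0) (fresh a⁻ s⁻ na⁻ 0 0)
      h₁ : ∀ {t u v} → EdgeP 0 x y t u v ⊎ (t ≡ 0 × a⁻ u v ≡ true) → t ≡ 0 × a₁ u v ≡ true
      h₁ (inj₁ (refl , inj₁ (refl , refl))) = refl , xy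
      h₁ (inj₁ (refl , inj₂ (refl , refl))) = refl , trans (sm s₁ y x) xy
      h₁ (inj₂ (refl , e)) = refl , proj₁ (a⁻⁻ e)
      h₂ : ∀ {t u v} → t ≡ 0 × a₁ u v ≡ true → EdgeP 0 x y t u v ⊎ (t ≡ 0 × a⁻ u v ≡ true)
      h₂ {t} {u} {v} (refl , e) with isxy u v in i
      ... | true = inj₁ (refl , isxy⁻ u v i)
      ... | false = inj₂ (refl , ∧-intro e refl)
      djq : F.Disj (e₀ ◂ tag a⁻ s⁻ 0) (edgeSys e₂)
      djq {t , u , v , b} i j with in⁻ p₀ i | in⁻ (Pres-edge 2 x≢y) j
      ... | inj₁ (refl , _) | () , _
      ... | inj₂ (refl , _) | () , _
      q : Pres ((e₀ ◂ tag a⁻ s⁻ 0) ⊕ edgeSys e₂) _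
      q = Pres-⊕ p₀ (Pres-edge 2 x≢y) (λ { (inj₁ (refl , _)) (() , _) ; (inj₂ (refl , _)) (() , _) })
      f : ∀ {t u v} → (EdgeP 0 x y t u v ⊎ (t ≡ 0 × a⁻ u v ≡ true)) ⊎ EdgeP 2 x y t u v → EdgeP 2 x y t u v ⊎ (t ≡ 0 × a₁ u v ≡ true)
      f (inj₁ h) = inj₂ (h₁ h)
      f (inj₂ h) = inj₁ h
      g : ∀ {t u v} → EdgeP 2 x y t u v ⊎ (t ≡ 0 × a₁ u v ≡ true) → (EdgeP 0 x y t u v ⊎ (t ≡ 0 × a⁻ u v ≡ true)) ⊎ EdgeP 2 x y t u v
      g (inj₁ h) = inj₂ h
      g (inj₂ h) = inj₁ (h₂ h)

  module Sum (x y : Fin n) (x≢y : x ≢ y) (a a₁ a₂ : Adj n) (s : SA a) (s₁ : SA a₁) (s₂ : SA a₂)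
             (cov : ∀ {u v} → a u v ≡ true → a₁ u v ≡ true ⊎ a₂ u v ≡ true)
             (sub₁ : ∀ {u v} → a₁ u v ≡ true → a u v ≡ true) (sub₂ : ∀ {u v} → a₂ u v ≡ true → a u v ≡ true)
             (shared : ∀ {u v w} → a₁ u v ≡ true → a₂ u w ≡ true → u ≡ x ⊎ u ≡ y) (na₂ : a₂ x y ≡ false) where
    open AddEdge x y x≢y

    dis : ∀ {u v} → a₁ u v ≡ true → a₂ u v ≡ true → ⊥
    dis {u} {v} e e' with shared e e' | shared (trans (sm s₁ v u) e) (trans (sm s₂ v u) e')
    ... | inj₁ refl | inj₁ refl = true≢false (trans (sym e) (ir s₁ u))
    ... | inj₂ refl | inj₂ refl = true≢false (trans (sym e) (ir s₁ u))
    ... | inj₁ refl | inj₂ refl = true≢false (trans (sym e') na₂)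
    ... | inj₂ refl | inj₁ refl = true≢false (trans (sym e') (trans (sm s₂ y x) na₂))

    private
      S₁ = tag a₁ s₁ 0
      S₂ = tag a₂ s₂ 1
      w₁ = WF-tag a₁ s₁ 0
      w₂ = WF-tag a₂ s₂ 1
      P : ℕ → Fin n → Fin n → Set
      P t u v = (t ≡ 0 × a₁ u v ≡ true) ⊎ (t ≡ 1 × a₂ u v ≡ true)
      pp : Pres (S₁ ⊕ S₂) P
      pp = Pres-⊕ (tag-Pres a₁ s₁ 0) (tag-Pres a₂ s₂ 1) (λ { (refl , _) (() , _) })
      dj : F.Disj S₁ S₂
      dj {t , u , v , b} i j with in⁻ (tag-Pres a₁ s₁ 0) i | in⁻ (tag-Pres a₂ s₂ 1) j
      ... | refl , _ | () , _
      into : ∀ {t u v} → P t u v → 0 ≡ 0 × a u v ≡ true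
      into (inj₁ (_ , e)) = refl , sub₁ e
      into (inj₂ (_ , e)) = refl , sub₂ e
      inj : ∀ {t u v t' u' v'} → P t u v → P t' u' v' → 0 ≡ 0 → u ≡ u' → v ≡ v' → (t , u , v) ≡ (t' , u' , v')
      inj (inj₁ (refl , _)) (inj₁ (refl , _)) _ refl refl = refl
      inj (inj₂ (refl , _)) (inj₂ (refl , _)) _ refl refl = refl
      inj (inj₁ (_ , e)) (inj₂ (_ , e')) _ refl refl = ⊥-elim (dis e e')
      inj (inj₂ (_ , e')) (inj₁ (_ , e)) _ refl refl = ⊥-elim (dis e e')
      onto : ∀ {t u v} → t ≡ 0 × a u v ≡ true → ∃ λ t₀ → ∃ λ u₀ → ∃ λ v₀ → P t₀ u₀ v₀ × t ≡ 0 × u ≡ u₀ × v ≡ v₀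
      onto {t} {u} {v} (refl , e) with cov e
      ... | inj₁ e' = 0 , u , v , inj₁ (refl , e') , refl , refl , refl
      ... | inj₂ e' = 1 , u , v , inj₂ (refl , e') , refl , refl , refl
      toG : ∀ {i j} → F.Ach (S₁ ⊕ S₂) i j → DD a s i j
      toG = I.iso-fwd pp (tag-Pres a s 0) (λ _ → 0) id into inj onto (λ _ _ e → e)
      ofG : ∀ {i j} → DD a s i j → F.Ach (S₁ ⊕ S₂) i j
      ofG = I.iso-bwd pp (tag-Pres a s 0) (λ _ → 0) id into inj onto x (λ _ _ e → e)

    sum-count : edgeCount a s ≡ edgeCount a₁ s₁ + edgeCount a₂ s₂
    sum-count = *-cancelˡ-≡ (edgeCount a s) (edgeCount a₁ s₁ + edgeCount a₂ s₂) 4 (trans (sym (tag-length a s 0))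
        (trans (sym (I.iso-length pp (tag-Pres a s 0) (λ _ → 0) id into inj onto))
        (trans (length-++ (Φ S₁)) (trans (cong₂ _+_ (tag-length a₁ s₁ 0) (tag-length a₂ s₂ 1)) (eq (edgeCount a₁ s₁) (edgeCount a₂ s₂))))))
      where
      eq : ∀ a b → 4 * a + 4 * b ≡ 4 * (a + b)
      eq = solve-∀

    sum-disjoint : ∀ {i j i' j'} → DD a₁ s₁ i j → DD a₂ s₂ i' j' → DD a s (i + i') (j + j')
    sum-disjoint d d' = toG (F.Ach-⊕ w₁ w₂ dj d (retag a₂ s₂ 0 1 d'))

    private
      e₂ = edge 2 x y
      e₃ = edge 3 x y
      ok₂ = edge-OK Fin._≟_ id 2 x≢y
      ok₃ = edge-OK Fin._≟_ id 3 x≢y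
      fr₁ : ∀ {t u v} → EdgeP 2 x y t u v → t ≡ 0 × a₁ u v ≡ true → ⊥
      fr₁ (refl , _) (() , _)
      d₁ : F.Disj (edgeSys e₂) S₁
      d₁ {t , u , v , b} i j = fr₁ (in⁻ (Pres-edge 2 x≢y) i) (in⁻ (tag-Pres a₁ s₁ 0) j)
      d₂ : ∀ k → F.Disj (edgeSys (edge k x y)) S₂
      d₂ k = fresh-Disj a₂ s₂ na₂ k 1
      we₁ : F.WF (e₂ ◂ S₁)
      we₁ = F.WF-◂ ok₂ w₁ d₁
      we₂ : F.WF (e₃ ◂ S₂)
      we₂ = F.WF-◂ ok₃ w₂ (d₂ 3)
      dje : F.Disj (e₂ ◂ S₁) (e₃ ◂ S₂)
      dje {t , u , v , b} i j with in⁻ (Pres-◂ 2 x≢y (tag-Pres a₁ s₁ 0) fr₁) i | in⁻ (Pres-◂ 3 x≢y (tag-Pres a₂ s₂ 1) (fresh a₂ s₂ na₂ 3 1)) j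
      ... | inj₁ (refl , _) | inj₁ (() , _)
      ... | inj₁ (refl , _) | inj₂ (() , _)
      ... | inj₂ (refl , _) | inj₁ (() , _)
      ... | inj₂ (refl , _) | inj₂ (() , _)

    -- The first summand comes with `e₂` as an edge of its own: it may already contain `xy`, and
    -- then `add` would change nothing.
    sum-join : ∀ {i j i' j'} → F.Ach (e₂ ◂ S₁) i j → DD (add a₂) (SA-add s₂) i' j' → DD a s (i + i') (j + j')
    sum-join d d' = toG (F.join ok₂ ok₃ we₁ we₂ dje refl refl (x≢y ∘ sym) w₁ w₂ d (add⇒◂ a₂ s₂ na₂ 3 1 d'))

    sum-plus : a₁ x y ≡ false → ∀ {i j i' j'} → DD (add a₁) (SA-add s₁) i j → DD (add a₂) (SA-add s₂) i' j' → DD a s (i + i') (j + j')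
    sum-plus na₁ d d' = sum-join (add⇒◂ a₁ s₁ na₁ 2 0 d) d'

    sum-plus-adj : a₁ x y ≡ true → ∀ {i j i' j'} → DD a₁ s₁ i j → DD (add a₂) (SA-add s₂) i' j' → DD a s (suc i + i') (j + j')
    sum-plus-adj xy d d' = sum-join (double a₁ s₁ xy d) d'

    SplitRes : ℕ → ℕ → Set
    SplitRes i j =
      (∃ λ i₁ → ∃ λ j₁ → ∃ λ i₂ → ∃ λ j₂ → DD a₁ s₁ i₁ j₁ × DD a₂ s₂ i₂ j₂ × i + (j₁ + j₂) ≤ j + (i₁ + i₂)) ⊎
      (∃ λ i₁ → ∃ λ j₁ → ∃ λ i₂ → ∃ λ j₂ → F.Ach (e₂ ◂ S₁) i₁ j₁ × DD (add a₂) (SA-add s₂) i₂ j₂ × i + (j₁ + j₂) ≤ j + (i₁ + i₂))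

    sum-split : ∀ {i j} → DD a s i j → SplitRes i j
    sum-split {i} {j} d = by (ofG d)
      where
      sh : ∀ {z z'} → z ∈ Φ S₁ → z' ∈ Φ S₂ → vert z ≡ vert z' → vert z ≡ x ⊎ vert z ≡ y
      sh {t , u , w , b} {t' , u' , w' , b'} k l refl = shared (proj₂ (in⁻ (tag-Pres a₁ s₁ 0) k)) (proj₂ (in⁻ (tag-Pres a₂ s₂ 1) l))
      by : F.Ach (S₁ ⊕ S₂) i j → SplitRes i j
      by (β , v , h) = pick (F.split (record { wS = w₁ ; wT = w₂ ; d = dj ; x≢y = x≢y ; shared = sh ; ok = ok₂ ; dS = d₁ ; dT = d₂ 2 ; ex = refl ; ey = refl }) v)
        where
        pick : _ → SplitRes i j
        pick (inj₁ (i₁ , j₁ , i₂ , j₂ , p , q , k)) = inj₁ (i₁ , j₁ , i₂ , j₂ , p , retag a₂ s₂ 1 0 q , split-arith (F.A (S₁ ⊕ S₂) β) (F.M (S₁ ⊕ S₂) β) h k)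
        pick (inj₂ (_ , i₁ , j₁ , i₂ , j₂ , p , q , k)) = inj₂ (i₁ , j₁ , i₂ , j₂ , p , ◂⇒add a₂ s₂ na₂ 2 1 q , split-arith (F.A (S₁ ⊕ S₂) β) (F.M (S₁ ⊕ S₂) β) h k)

    delete-e₂ : ∀ {i j} → F.Ach (e₂ ◂ S₁) i j → DD a₁ s₁ i (suc j)
    delete-e₂ = F.delete ok₂ w₁ d₁

    ◂-plus : a₁ x y ≡ false → ∀ {i j} → F.Ach (e₂ ◂ S₁) i j → DD (add a₁) (SA-add s₁) i j
    ◂-plus na₁ = ◂⇒add a₁ s₁ na₁ 2 0

-- Euler genus of xy-sums

γ γ⁺ : ∀ {n} → TGraph n → ℕ
γ G = gen (adj G)
γ⁺ G = γ (plus G)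

module _ {n : ℕ} {G : TGraph n} where

  Reach-trans : ∀ {u v w} → Reach G u v → Reach G v w → Reach G u w
  Reach-trans r here = r
  Reach-trans r (step r' e) = step (Reach-trans r r') e

  Reach-sym : (∀ u v → adj G u v ≡ adj G v u) → ∀ {u v} → Reach G u v → Reach G v u
  Reach-sym s here = here
  Reach-sym s (step {v} {w} r e) = Reach-trans (step here (trans (s w v) e)) (Reach-sym s r)

  Reach-last : ∀ {u v} → u ≢ v → Reach G u v → ∃ λ w → adj G w v ≡ true
  Reach-last n here = ⊥-elim (n refl)
  Reach-last n (step {w} r e) = w , e

SAG : ∀ {n} {G : TGraph n} → InGxy G → SA (adj G)
SAG (s , i , _) = sa s i

module _ {n : ℕ} (G : TGraph n) (h : InGxy G) (cn : Connected G) where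
  private
    s = SAG {G = G} h

    nb : ∀ v → ∃ λ w → adj G v w ≡ true
    nb v = let (w , e) = go (v Fin.≟ x G) in w , trans (sm s v w) e
      where
      go : Dec (v ≡ x G) → ∃ λ w → adj G w v ≡ true
      go (yes refl) = Reach-last (proj₂ (proj₂ h) ∘ sym) (cn (y G) v)
      go (no v≢x) = Reach-last (v≢x ∘ sym) (cn (x G) v)

    conn : ∀ u w → Conn (GraphSys.edgeL (adj G) (sm s) (ir s)) u w
    conn u w = go (cn u w)
      where
      L = GraphSys.edgeL (adj G) (sm s) (ir s)
      go : ∀ {w} → Reach G u w → Conn L u w
      go here = Conn-refl L
      go (step r e) = Conn-trans L (go r) (Conn-InE L (GraphSys.adj-InE (adj G) (sm s) (ir s) e))

  γ-up : DD (adj G) s (2 + edgeCount (adj G) s) (γ G + 2 * n)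
  γ-up = DD-up (adj G) s (x G) nb conn

  γ-low : ∀ {i j} → DD (adj G) s i j → γ G + 2 * n + i ≤ 2 + edgeCount (adj G) s + j
  γ-low = DD-low (adj G) s (x G) nb conn

module PlusGraph {n : ℕ} (G : TGraph n) (h : InGxy G) where
  open AddEdge (x G) (y G) (proj₂ (proj₂ h)) public

  plus-In : InGxy (plus G)
  plus-In = sm (SA-add (SAG {G = G} h)) , ir (SA-add (SAG {G = G} h)) , proj₂ (proj₂ h)

  plus-conn : Connected G → Connected (plus G)
  plus-conn cn u w = go (cn u w)
    where
    go : ∀ {w} → Reach G u w → Reach (plus G) u w
    go here = here
    go (step r e) = step (go r) (add-⊆ (adj G) e)

module Image {n n' : ℕ} (ι : Fin n → Fin n') (inj : ∀ a b → ι a ≡ ι b → a ≡ b) (v₀ : Fin n) (a : Adj n) (a' : Adj n') (s : SA a) (s' : SA a')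
             (into : ∀ {u v} → a u v ≡ true → a' (ι u) (ι v) ≡ true)
             (onto : ∀ {u v} → a' u v ≡ true → ∃ λ b → ∃ λ d → a b d ≡ true × u ≡ ι b × v ≡ ι d) where
  private
    h₁ : ∀ {t u v} → t ≡ 0 × a u v ≡ true → t ≡ 0 × a' (ι u) (ι v) ≡ true
    h₁ (e , e') = e , into e'
    h₂ : ∀ {t u v t' u' v'} → t ≡ 0 × a u v ≡ true → t' ≡ 0 × a u' v' ≡ true → t ≡ t' → ι u ≡ ι u' → ι v ≡ ι v' → (t , u , v) ≡ (t' , u' , v')
    h₂ {u = u} {v} {_} {u'} {v'} _ _ refl e e' with refl ← inj u u' e | refl ← inj v v' e' = refl
    h₃ : ∀ {t u v} → t ≡ 0 × a' u v ≡ true → ∃ λ t₀ → ∃ λ u₀ → ∃ λ v₀ → (t₀ ≡ 0 × a u₀ v₀ ≡ true) × t ≡ t₀ × u ≡ ι u₀ × v ≡ ι v₀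
    h₃ {t} (e , e') with onto e'
    ... | b , d , k , eb , ed = t , b , d , (e , k) , refl , eb , ed

  -- Vertices outside the image carry no flags, so `D` does not see them.
  img-fwd : ∀ {i j} → DD a s i j → DD a' s' i j
  img-fwd = PresIso.iso-fwd {Fin n} {Fin n'} Fin._≟_ Fin._≟_ Fin._≟_ Fin._≟_ id id (tag-Pres a s 0) (tag-Pres a' s' 0) id ι h₁ h₂ h₃ (λ _ _ e → cong ι e)

  img-bwd : ∀ {i j} → DD a' s' i j → DD a s i j
  img-bwd = PresIso.iso-bwd {Fin n} {Fin n'} Fin._≟_ Fin._≟_ Fin._≟_ Fin._≟_ id id (tag-Pres a s 0) (tag-Pres a' s' 0) id ι h₁ h₂ h₃ v₀ (λ {t} {u} {v} {t'} {u'} _ _ e → inj u u' e)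

  img-count : edgeCount a s ≡ edgeCount a' s'
  img-count = *-cancelˡ-≡ (edgeCount a s) (edgeCount a' s') 4 (trans (sym (tag-length a s 0))
    (trans (PresIso.iso-length {Fin n} {Fin n'} Fin._≟_ Fin._≟_ Fin._≟_ Fin._≟_ id id (tag-Pres a s 0) (tag-Pres a' s' 0) id ι h₁ h₂ h₃) (tag-length a' s' 0)))

ext-arith : ∀ {g g' E n} → g + 2 * n + (2 + E) ≤ 2 + E + (g' + 2 * n) → g ≤ g'
ext-arith {g} {g'} {E} {n} h = lin (2 * n + (2 + E)) h (eq₁ g n E) (eq₂ g' n E)
  where
  eq₁ : ∀ g n E → g + (2 * n + (2 + E)) ≡ g + 2 * n + (2 + E)
  eq₁ = solve-∀
  eq₂ : ∀ g n E → 2 + E + (g + 2 * n) ≡ g + (2 * n + (2 + E))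
  eq₂ = solve-∀

-- The genus is computed from the adjacency function, and pointwise agreement is all that is known
-- of two such functions; the comparison therefore goes through `D`.
γ-ext : ∀ {n} (G H : TGraph n) → InGxy G → InGxy H → Connected G → Connected H → (∀ {u v} → adj G u v ≡ true → adj H u v ≡ true) →
  (∀ {u v} → adj H u v ≡ true → adj G u v ≡ true) → γ G ≤ γ H
γ-ext {n} G H hG hH cG cH f g = ext-arith {γ G} {γ H} {edgeCount (adj H) (SAG {G = H} hH)} {n} (subst (λ E → γ G + 2 * n + (2 + E₁) ≤ 2 + E + (γ H + 2 * n)) (sym img-count) (γ-low G hG cG (img-fwd (γ-up H hH cH))))
  where
  open Image id (λ _ _ e → e) (x G) (adj H) (adj G) (SAG {G = H} hH) (SAG {G = G} hG) g (λ {u} {v} e → u , v , f e , refl , refl)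
  E₁ = edgeCount (adj H) (SAG {G = H} hH)

plus-arith₁ : ∀ {g g⁺ E n} → g⁺ + 2 * n + (2 + E) ≤ 2 + suc E + suc (g + 2 * n) → g⁺ ≤ g + 2
plus-arith₁ {g} {g⁺} {E} {n} h = lin (2 * n + (2 + E)) h (eq₁ g⁺ n E) (eq₂ g n E)
  where
  eq₁ : ∀ g n E → g + (2 * n + (2 + E)) ≡ g + 2 * n + (2 + E)
  eq₁ = solve-∀
  eq₂ : ∀ g n E → 2 + suc E + suc (g + 2 * n) ≡ g + 2 + (2 * n + (2 + E))
  eq₂ = solve-∀

plus-arith₂ : ∀ {g g⁺ E n} → g + 2 * n + (2 + suc E) ≤ 2 + E + suc (g⁺ + 2 * n) → g ≤ g⁺
plus-arith₂ {g} {g⁺} {E} {n} h = lin (2 * n + (3 + E)) h (eq₁ g n E) (eq₂ g⁺ n E)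
  where
  eq₁ : ∀ g n E → g + (2 * n + (3 + E)) ≡ g + 2 * n + (2 + suc E)
  eq₁ = solve-∀
  eq₂ : ∀ g n E → 2 + E + suc (g + 2 * n) ≡ g + (2 * n + (3 + E))
  eq₂ = solve-∀

module _ {n : ℕ} (G : TGraph n) (h : InGxy G) (cn : Connected G) where
  open PlusGraph G h
  private
    s = SAG {G = G} h
    E = edgeCount (adj G) s

  plus-adjacent : adj G (x G) (y G) ≡ true → γ⁺ G ≡ γ G
  plus-adjacent xy = ≤-antisym (γ-ext (plus G) G plus-In h (plus-conn cn) cn f (add-⊆ (adj G))) (γ-ext G (plus G) h plus-In cn (plus-conn cn) (add-⊆ (adj G)) f)
    where
    f : ∀ {u v} → adj (plus G) u v ≡ true → adj G u v ≡ true
    f e with add⁻ (adj G) e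
    ... | inj₁ e' = e'
    ... | inj₂ (inj₁ (refl , refl)) = xy
    ... | inj₂ (inj₂ (refl , refl)) = trans (sm s (y G) (x G)) xy

  private
    count : adj G (x G) (y G) ≡ false → edgeCount (adj (plus G)) (SA-add s) ≡ suc E
    count na = add-count (adj G) s na 0 0

  -- The new edge raises the number of edges by one and `D` by at most one.
  γ≤γ⁺ : γ G ≤ γ⁺ G
  γ≤γ⁺ = go (adj G (x G) (y G)) refl
    where
    go : ∀ b → adj G (x G) (y G) ≡ b → γ G ≤ γ⁺ G
    go true xy = ≤-reflexive (sym (plus-adjacent xy))
    go false na = plus-arith₂ {γ G} {γ⁺ G} {E} {n} (subst (λ k → γ G + 2 * n + (2 + k) ≤ 2 + E + suc (γ⁺ G + 2 * n)) (count na)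
      (γ-low G h cn (add-≤ (adj G) s na 0 0 (γ-up (plus G) plus-In (plus-conn cn)))))

  -- One from the additional edge, one from the possible fall of `D`.
  γ⁺≤γ+2 : γ⁺ G ≤ γ G + 2
  γ⁺≤γ+2 = go (adj G (x G) (y G)) refl
    where
    go : ∀ b → adj G (x G) (y G) ≡ b → γ⁺ G ≤ γ G + 2
    go true xy = ≤-trans (≤-reflexive (plus-adjacent xy)) (m≤m+n _ 2)
    go false na = plus-arith₁ {γ G} {γ⁺ G} {E} {n} (subst (λ k → γ⁺ G + 2 * n + (2 + E) ≤ 2 + k + suc (γ G + 2 * n)) (count na)
      (γ-low (plus G) plus-In (plus-conn cn) (add-≥ (adj G) s na 0 0 (γ-up G h cn))))

sum-arith₀ : ∀ {g n E₁ E₂ g₁ g₂ n₁ n₂} → n₁ + n₂ ≡ n + 2 → g + 2 * n + (2 + E₁ + (2 + E₂)) ≤ 2 + (E₁ + E₂) + (g₁ + 2 * n₁ + (g₂ + 2 * n₂)) → g ≤ g₁ + g₂ + 2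
sum-arith₀ {g} {n} {E₁} {E₂} {g₁} {g₂} {n₁} {n₂} e h = lin (2 * n + (4 + E₁ + E₂)) h (eq₁ g n E₁ E₂) (trans (eq₂ E₁ E₂ g₁ g₂ n₁ n₂) (trans (cong (λ k → 2 + E₁ + E₂ + g₁ + g₂ + 2 * k) e) (eq₃ n E₁ E₂ g₁ g₂)))
  where
  eq₁ : ∀ g n E₁ E₂ → g + (2 * n + (4 + E₁ + E₂)) ≡ g + 2 * n + (2 + E₁ + (2 + E₂))
  eq₁ = solve-∀
  eq₂ : ∀ E₁ E₂ g₁ g₂ n₁ n₂ → 2 + (E₁ + E₂) + (g₁ + 2 * n₁ + (g₂ + 2 * n₂)) ≡ 2 + E₁ + E₂ + g₁ + g₂ + 2 * (n₁ + n₂)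
  eq₂ = solve-∀
  eq₃ : ∀ n E₁ E₂ g₁ g₂ → 2 + E₁ + E₂ + g₁ + g₂ + 2 * (n + 2) ≡ g₁ + g₂ + 2 + (2 * n + (4 + E₁ + E₂))
  eq₃ = solve-∀

sum-arith₁ : ∀ {g n E₁ E₂ g₁ g₂ n₁ n₂} → n₁ + n₂ ≡ n + 2 → g + 2 * n + (2 + suc E₁ + (2 + suc E₂)) ≤ 2 + (E₁ + E₂) + (g₁ + 2 * n₁ + (g₂ + 2 * n₂)) → g ≤ g₁ + g₂
sum-arith₁ {g} {n} {E₁} {E₂} {g₁} {g₂} {n₁} {n₂} e h = lin (2 * n + (6 + E₁ + E₂)) h (eq₁ g n E₁ E₂) (trans (eq₂ E₁ E₂ g₁ g₂ n₁ n₂) (trans (cong (λ k → 2 + E₁ + E₂ + g₁ + g₂ + 2 * k) e) (eq₃ n E₁ E₂ g₁ g₂)))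
  where
  eq₁ : ∀ g n E₁ E₂ → g + (2 * n + (6 + E₁ + E₂)) ≡ g + 2 * n + (2 + suc E₁ + (2 + suc E₂))
  eq₁ = solve-∀
  eq₂ : ∀ E₁ E₂ g₁ g₂ n₁ n₂ → 2 + (E₁ + E₂) + (g₁ + 2 * n₁ + (g₂ + 2 * n₂)) ≡ 2 + E₁ + E₂ + g₁ + g₂ + 2 * (n₁ + n₂)
  eq₂ = solve-∀
  eq₃ : ∀ n E₁ E₂ g₁ g₂ → 2 + E₁ + E₂ + g₁ + g₂ + 2 * (n + 2) ≡ g₁ + g₂ + (2 * n + (6 + E₁ + E₂))
  eq₃ = solve-∀

-- k counts the extra edges of the two summands: 0 for the graphs themselves, 2 for both with xy added.
sum-arith₂ : ∀ k {g n E₁ E₂ g₁ g₂ n₁ n₂ i₁ i₂ j₁ j₂ E E₁' E₂'} → E ≡ E₁ + E₂ → E₁' + E₂' ≡ k + (E₁ + E₂) → n₁ + n₂ ≡ n + 2 → 2 + E + (j₁ + j₂) ≤ g + 2 * n + (i₁ + i₂) →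
  g₁ + 2 * n₁ + i₁ ≤ 2 + E₁' + j₁ → g₂ + 2 * n₂ + i₂ ≤ 2 + E₂' + j₂ → g₁ + g₂ + 2 ≤ g + k
sum-arith₂ k {g} {n} {E₁} {E₂} {g₁} {g₂} {n₁} {n₂} {i₁} {i₂} {j₁} {j₂} {_} {E₁'} {E₂'} refl e₂ e h h₁ h₂ =
  lin (2 * n + i₁ + i₂ + j₁ + j₂ + (4 + E₁ + E₂)) (+-mono-≤ h (+-mono-≤ h₁ h₂))
    (trans (trans (eq₁ n E₁ E₂ g₁ g₂ i₁ i₂ j₁ j₂) (cong (λ l → 2 + (E₁ + E₂) + (j₁ + j₂) + (g₁ + g₂ + i₁ + i₂ + 2 * l)) (sym e))) (eq₂ E₁ E₂ g₁ g₂ i₁ i₂ j₁ j₂ n₁ n₂))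
    (trans (eq₃ g n i₁ i₂ E₁' E₂' j₁ j₂) (trans (cong (λ l → g + 2 * n + (i₁ + i₂) + (4 + l + j₁ + j₂)) e₂) (eq₄ g n i₁ i₂ E₁ E₂ j₁ j₂ k)))
  where
  eq₁ : ∀ n E₁ E₂ g₁ g₂ i₁ i₂ j₁ j₂ → g₁ + g₂ + 2 + (2 * n + i₁ + i₂ + j₁ + j₂ + (4 + E₁ + E₂)) ≡ 2 + (E₁ + E₂) + (j₁ + j₂) + (g₁ + g₂ + i₁ + i₂ + 2 * (n + 2))
  eq₁ = solve-∀
  eq₂ : ∀ E₁ E₂ g₁ g₂ i₁ i₂ j₁ j₂ n₁ n₂ → 2 + (E₁ + E₂) + (j₁ + j₂) + (g₁ + g₂ + i₁ + i₂ + 2 * (n₁ + n₂)) ≡ 2 + (E₁ + E₂) + (j₁ + j₂) + (g₁ + 2 * n₁ + i₁ + (g₂ + 2 * n₂ + i₂))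
  eq₂ = solve-∀
  eq₃ : ∀ g n i₁ i₂ E₁' E₂' j₁ j₂ → g + 2 * n + (i₁ + i₂) + (2 + E₁' + j₁ + (2 + E₂' + j₂)) ≡ g + 2 * n + (i₁ + i₂) + (4 + (E₁' + E₂') + j₁ + j₂)
  eq₃ = solve-∀
  eq₄ : ∀ g n i₁ i₂ E₁ E₂ j₁ j₂ k → g + 2 * n + (i₁ + i₂) + (4 + (k + (E₁ + E₂)) + j₁ + j₂) ≡ g + k + (2 * n + i₁ + i₂ + j₁ + j₂ + (4 + E₁ + E₂))
  eq₄ = solve-∀

not-true : ∀ {b : Bool} → (b ≡ true → ⊥) → b ≡ false
not-true {true} f = ⊥-elim (f refl)
not-true {false} f = refl

bool-iff : ∀ {b c : Bool} → (b ≡ true → c ≡ true) → (c ≡ true → b ≡ true) → b ≡ c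
bool-iff {true} {c} f g = sym (f refl)
bool-iff {false} {true} f g = g refl
bool-iff {false} {false} f g = refl

module XYSum {n n₁ n₂ : ℕ} (G : TGraph n) (G₁ : TGraph n₁) (G₂ : TGraph n₂) (ι₁ : Fin n₁ → Fin n) (ι₂ : Fin n₂ → Fin n)
             (h₁ : InGxy G₁) (h₂ : InGxy G₂) (na₂ : adj G₂ (x G₂) (y G₂) ≡ false) (c₁ : Connected G₁) (c₂ : Connected G₂) (Σ₊ : IsXYSum G G₁ G₂ ι₁ ι₂) where
  open IsXYSum Σ₊ renaming (inj₁ to ι-inj₁; inj₂ to ι-inj₂)
  private
    s₁ = SAG {G = G₁} h₁
    s₂ = SAG {G = G₂} h₂
    X Y : Fin n
    X = x G
    Y = y G

  sum-sym : ∀ u v → adj G u v ≡ true → adj G v u ≡ true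
  sum-sym u v e with edges→ u v e
  ... | inj₁ (a , b , refl , refl , e') = edges₁ b a (trans (sm s₁ b a) e')
  ... | inj₂ (a , b , refl , refl , e') = edges₂ b a (trans (sm s₂ b a) e')

  sum-In : InGxy G
  sum-In = (λ u v → bool-iff (sum-sym u v) (sum-sym v u)) , (λ v → not-true (loop v)) , xy
    where
    loop : ∀ v → adj G v v ≡ true → ⊥
    loop v e with edges→ v v e
    ... | inj₁ (a , b , p , q , e') with refl ← ι-inj₁ a b (trans p (sym q)) = true≢false (trans (sym e') (ir s₁ a))
    ... | inj₂ (a , b , p , q , e') with refl ← ι-inj₂ a b (trans p (sym q)) = true≢false (trans (sym e') (ir s₂ a))
    xy : X ≢ Y
    xy e = proj₂ (proj₂ h₁) (ι-inj₁ (x G₁) (y G₁) (trans x₁ (trans e (sym y₁))))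

  sum-Connected : Connected G
  sum-Connected u w = Reach-trans (Reach-sym (proj₁ sum-In) (fromX u)) (fromX w)
    where
    map₁ : ∀ {a b} → Reach G₁ a b → Reach G (ι₁ a) (ι₁ b)
    map₁ here = here
    map₁ (step r e) = step (map₁ r) (edges₁ _ _ e)
    map₂ : ∀ {a b} → Reach G₂ a b → Reach G (ι₂ a) (ι₂ b)
    map₂ here = here
    map₂ (step r e) = step (map₂ r) (edges₂ _ _ e)
    fromX : ∀ w → Reach G X w
    fromX w with cover w
    ... | inj₁ (a , refl) = subst (λ z → Reach G z (ι₁ a)) x₁ (map₁ (c₁ (x G₁) a))
    ... | inj₂ (b , refl) = subst (λ z → Reach G z (ι₂ b)) x₂ (map₂ (c₂ (x G₂) b))

  vertex-count : n₁ + n₂ ≡ n + 2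
  vertex-count = trans (cong (n₁ +_) n₂≡) (trans (eq n₁ (length l)) (cong (_+ 2) (trans (sym len) (length-allFin n))))
    where
    eq : ∀ a b → a + suc (suc b) ≡ a + b + 2
    eq = solve-∀
    l₀ = ∈-↭ (∈-allFin (x G₂))
    y∈ : y G₂ ∈ proj₁ l₀
    y∈ with ∈-resp-↭ (proj₂ l₀) (∈-allFin (y G₂))
    ... | here e = ⊥-elim (proj₂ (proj₂ h₂) (sym e))
    ... | there i = i
    l₁ = ∈-↭ y∈
    l = proj₁ l₁
    π : allFin n₂ ↭ x G₂ ∷ y G₂ ∷ l
    π = ↭-trans (proj₂ l₀) (prep (x G₂) (proj₂ l₁))
    n₂≡ : n₂ ≡ suc (suc (length l))
    n₂≡ = trans (sym (length-allFin n₂)) (↭-length π)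
    u = Unique-resp-↭ π (Uniq.allFin⁺ n₂)
    πall : map ι₁ (allFin n₁) ++ map ι₂ l ↭ allFin n
    πall = unique-set-↭ (Uniq.++⁺ (map-unique ι₁ (λ {a} {b} _ _ → ι-inj₁ a b) (Uniq.allFin⁺ n₁)) (map-unique ι₂ (λ {a} {b} _ _ → ι-inj₂ a b) (unique-tail (unique-tail u))) dis)
        (Uniq.allFin⁺ n) (λ _ → ∈-allFin _) (λ {w} _ → cov w)
      where
      dis : ∀ {z} → z ∈ map ι₁ (allFin n₁) × z ∈ map ι₂ l → ⊥
      dis (i , j) with ∈-map⁻ ι₁ i | ∈-map⁻ ι₂ j
      ... | a , _ , refl | b , b∈ , e with meet a b e
      ... | inj₁ (_ , refl) = unique-head u (there b∈)
      ... | inj₂ (_ , refl) = unique-head (unique-tail u) b∈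
      cov : ∀ w → w ∈ map ι₁ (allFin n₁) ++ map ι₂ l
      cov w with cover w
      ... | inj₁ (a , refl) = ∈-++⁺ˡ (∈-map⁺ ι₁ (∈-allFin a))
      ... | inj₂ (b , refl) with ∈-resp-↭ π (∈-allFin b)
      ... | here refl = ∈-++⁺ˡ (subst (_∈ map ι₁ (allFin n₁)) (trans x₁ (sym x₂)) (∈-map⁺ ι₁ (∈-allFin (x G₁))))
      ... | there (here refl) = ∈-++⁺ˡ (subst (_∈ map ι₁ (allFin n₁)) (trans y₁ (sym y₂)) (∈-map⁺ ι₁ (∈-allFin (y G₁))))
      ... | there (there i) = ∈-++⁺ʳ (map ι₁ (allFin n₁)) (∈-map⁺ ι₂ i)
    len : length (allFin n) ≡ n₁ + length l
    len = trans (sym (↭-length πall)) (trans (length-++ (map ι₁ (allFin n₁))) (cong₂ _+_ (trans (length-map ι₁ (allFin n₁)) (length-allFin n₁)) (length-map ι₂ l)))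

  private
    -- Places a summand on the vertex set of the sum. There it need not be connected, so its genus
    -- is always read off from the original.
    img : ∀ {k} → (Fin k → Fin n) → Adj k → Adj n
    img ι a u w = anyF (λ b → anyF (λ d → eqF (ι b) u ∧ eqF (ι d) w ∧ a b d))

    img⁺ : ∀ {k} (ι : Fin k → Fin n) a {b d} → a b d ≡ true → img ι a (ι b) (ι d) ≡ true
    img⁺ ι a {b} {d} e = any⁺ _ (∈-allFin b) (any⁺ _ (∈-allFin d) (∧-intro (eqF-refl (ι b)) (∧-intro (eqF-refl (ι d)) e)))

    img⁻ : ∀ {k} (ι : Fin k → Fin n) a {u w} → img ι a u w ≡ true → ∃ λ b → ∃ λ d → a b d ≡ true × u ≡ ι b × w ≡ ι d
    img⁻ {k} ι a {u} {w} e with any⁻ _ {allFin k} e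
    ... | b , _ , e' with any⁻ _ {allFin k} e'
    ... | d , _ , e″ with ∧-true {eqF (ι b) u} e″
    ... | p , r with ∧-true {eqF (ι d) w} r
    ... | q , t = b , d , t , sym (eqF⁻ p) , sym (eqF⁻ q)

    SA-img : ∀ {k} (ι : Fin k → Fin n) (inj : ∀ a b → ι a ≡ ι b → a ≡ b) {a} → SA a → SA (img ι a)
    SA-img ι inj {a} s = sa (λ u v → bool-iff (sy u v) (sy v u)) (λ v → not-true (lp v))
      where
      sy : ∀ u v → img ι a u v ≡ true → img ι a v u ≡ true
      sy u v e with img⁻ ι a e
      ... | b , d , k , refl , refl = img⁺ ι a (trans (sm s d b) k)
      lp : ∀ v → img ι a v v ≡ true → ⊥
      lp v e with img⁻ ι a e
      ... | b , d , k , p , q with refl ← inj b d (trans (sym p) q) = true≢false (trans (sym k) (ir s b))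

    b₁ b₂ : Adj n
    b₁ = img ι₁ (adj G₁)
    b₂ = img ι₂ (adj G₂)
    t₁ : SA b₁
    t₁ = SA-img ι₁ ι-inj₁ s₁
    t₂ : SA b₂
    t₂ = SA-img ι₂ ι-inj₂ s₂

    X≢Y = proj₂ (proj₂ sum-In)
    s = SAG {G = G} sum-In

    cov : ∀ {u v} → adj G u v ≡ true → b₁ u v ≡ true ⊎ b₂ u v ≡ true
    cov {u} {v} e with edges→ u v e
    ... | inj₁ (a , b , refl , refl , e') = inj₁ (img⁺ ι₁ (adj G₁) e')
    ... | inj₂ (a , b , refl , refl , e') = inj₂ (img⁺ ι₂ (adj G₂) e')

    sub₁ : ∀ {u v} → b₁ u v ≡ true → adj G u v ≡ true
    sub₁ e with img⁻ ι₁ (adj G₁) e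
    ... | a , b , e' , refl , refl = edges₁ a b e'

    sub₂ : ∀ {u v} → b₂ u v ≡ true → adj G u v ≡ true
    sub₂ e with img⁻ ι₂ (adj G₂) e
    ... | a , b , e' , refl , refl = edges₂ a b e'

    shared : ∀ {u v w} → b₁ u v ≡ true → b₂ u w ≡ true → u ≡ X ⊎ u ≡ Y
    shared e e' with img⁻ ι₁ (adj G₁) e | img⁻ ι₂ (adj G₂) e'
    ... | a , _ , _ , refl , _ | b , _ , _ , q , _ with meet a b q
    ... | inj₁ (refl , _) = inj₁ x₁
    ... | inj₂ (refl , _) = inj₂ y₁

    na′ : ∀ {k} (ι : Fin k → Fin n) (inj : ∀ a b → ι a ≡ ι b → a ≡ b) (H : TGraph k) → ι (x H) ≡ X → ι (y H) ≡ Y → adj H (x H) (y H) ≡ false → img ι (adj H) X Y ≡ false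
    na′ ι inj H ex ey na = not-true λ e → go (img⁻ ι (adj H) e)
      where
      go : (∃ λ b → ∃ λ d → adj H b d ≡ true × X ≡ ι b × Y ≡ ι d) → ⊥
      go (b , d , k , p , q) with refl ← inj _ _ (trans ex p) | refl ← inj _ _ (trans ey q) = true≢false (trans (sym k) na)

    nb₂ : b₂ X Y ≡ false
    nb₂ = na′ ι₂ ι-inj₂ G₂ x₂ y₂ na₂

    module S = Sum X Y X≢Y (adj G) b₁ b₂ s t₁ t₂ cov sub₁ sub₂ shared nb₂
    module A = AddEdge X Y X≢Y
    module P₁ = PlusGraph G₁ h₁
    module P₂ = PlusGraph G₂ h₂
    module I₁ = Image ι₁ ι-inj₁ (x G₁) (adj G₁) b₁ s₁ t₁ (img⁺ ι₁ (adj G₁)) (img⁻ ι₁ (adj G₁))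
    module I₂ = Image ι₂ ι-inj₂ (x G₂) (adj G₂) b₂ s₂ t₂ (img⁺ ι₂ (adj G₂)) (img⁻ ι₂ (adj G₂))

    plus-into : ∀ {k} (ι : Fin k → Fin n) (H : TGraph k) (hH : InGxy H) → ι (x H) ≡ X → ι (y H) ≡ Y → ∀ {u v} → adj (plus H) u v ≡ true → A.add (img ι (adj H)) (ι u) (ι v) ≡ true
    plus-into ι H hH ex ey e with PlusGraph.add⁻ H hH (adj H) e
    ... | inj₁ e' = A.add-⊆ (img ι (adj H)) (img⁺ ι (adj H) e')
    ... | inj₂ (inj₁ (refl , refl)) = A.add-xy (img ι (adj H)) (inj₁ (ex , ey))
    ... | inj₂ (inj₂ (refl , refl)) = A.add-xy (img ι (adj H)) (inj₂ (ey , ex))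

    plus-onto : ∀ {k} (ι : Fin k → Fin n) (H : TGraph k) (hH : InGxy H) → ι (x H) ≡ X → ι (y H) ≡ Y → ∀ {u v} → A.add (img ι (adj H)) u v ≡ true → ∃ λ b → ∃ λ d → adj (plus H) b d ≡ true × u ≡ ι b × v ≡ ι d
    plus-onto ι H hH ex ey e with A.add⁻ (img ι (adj H)) e
    ... | inj₁ e' with img⁻ ι (adj H) e'
    ... | b , d , k , p , q = b , d , PlusGraph.add-⊆ H hH (adj H) k , p , q
    plus-onto ι H hH ex ey e | inj₂ (inj₁ (refl , refl)) = x H , y H , PlusGraph.add-xy H hH (adj H) (inj₁ (refl , refl)) , sym ex , sym ey
    plus-onto ι H hH ex ey e | inj₂ (inj₂ (refl , refl)) = y H , x H , PlusGraph.add-xy H hH (adj H) (inj₂ (refl , refl)) , sym ey , sym ex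

    module J₁ = Image ι₁ ι-inj₁ (x G₁) (adj (plus G₁)) (A.add b₁) (P₁.SA-add s₁) (A.SA-add t₁) (plus-into ι₁ G₁ h₁ x₁ y₁) (plus-onto ι₁ G₁ h₁ x₁ y₁)
    module J₂ = Image ι₂ ι-inj₂ (x G₂) (adj (plus G₂)) (A.add b₂) (P₂.SA-add s₂) (A.SA-add t₂) (plus-into ι₂ G₂ h₂ x₂ y₂) (plus-onto ι₂ G₂ h₂ x₂ y₂)

    E₁ = edgeCount (adj G₁) s₁
    E₂ = edgeCount (adj G₂) s₂
    E# = edgeCount (adj G) s

    count : E# ≡ E₁ + E₂
    count = trans S.sum-count (cong₂ _+_ (sym I₁.img-count) (sym I₂.img-count))

    up₁ = γ-up G₁ h₁ c₁
    up₂ = γ-up G₂ h₂ c₂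
    up₂⁺ = γ-up (plus G₂) P₂.plus-In (P₂.plus-conn c₂)
    low = γ-low G sum-In sum-Connected
    count₂⁺ : edgeCount (adj (plus G₂)) (P₂.SA-add s₂) ≡ suc E₂
    count₂⁺ = P₂.add-count (adj G₂) s₂ na₂ 0 0
    count₁⁺ : adj G₁ (x G₁) (y G₁) ≡ false → edgeCount (adj (plus G₁)) (P₁.SA-add s₁) ≡ suc E₁
    count₁⁺ na₁ = P₁.add-count (adj G₁) s₁ na₁ 0 0

  -- `D` is additive here. The constant is what remains of Euler's formula: two vertices counted
  -- twice contribute 4, and the constant 2 of one summand is spent.
  sum-≤₂ : γ G ≤ γ G₁ + γ G₂ + 2
  sum-≤₂ = sum-arith₀ {γ G} {n} {E₁} {E₂} {γ G₁} {γ G₂} {n₁} {n₂} vertex-count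
    (subst (λ k → γ G + 2 * n + (2 + E₁ + (2 + E₂)) ≤ 2 + k + (γ G₁ + 2 * n₁ + (γ G₂ + 2 * n₂))) count (low (S.sum-disjoint (I₁.img-fwd up₁) (I₂.img-fwd up₂))))

  sum-≤₁ : γ G ≤ γ⁺ G₁ + γ⁺ G₂
  sum-≤₁ = go (adj G₁ (x G₁) (y G₁)) refl
    where
    go : ∀ b → adj G₁ (x G₁) (y G₁) ≡ b → γ G ≤ γ⁺ G₁ + γ⁺ G₂
    go false na₁ = sum-arith₁ {γ G} {n} {E₁} {E₂} {γ⁺ G₁} {γ⁺ G₂} {n₁} {n₂} vertex-count
      (subst₂ (λ k l → γ G + 2 * n + (2 + k + (2 + l)) ≤ 2 + (E₁ + E₂) + (γ⁺ G₁ + 2 * n₁ + (γ⁺ G₂ + 2 * n₂))) (count₁⁺ na₁) count₂⁺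
        (subst (λ k → γ G + 2 * n + (2 + edgeCount (adj (plus G₁)) (P₁.SA-add s₁) + (2 + edgeCount (adj (plus G₂)) (P₂.SA-add s₂))) ≤ 2 + k + (γ⁺ G₁ + 2 * n₁ + (γ⁺ G₂ + 2 * n₂))) count
          (low (S.sum-plus (na′ ι₁ ι-inj₁ G₁ x₁ y₁ na₁) (J₁.img-fwd (γ-up (plus G₁) P₁.plus-In (P₁.plus-conn c₁))) (J₂.img-fwd up₂⁺)))))
    -- The edge `xy` of `G₁` stays, and a parallel copy of it serves for the joining. Its additional
    -- face makes up for the edge that `plus` does not add.
    go true xy = sum-arith₁ {γ G} {n} {E₁} {E₂} {γ⁺ G₁} {γ⁺ G₂} {n₁} {n₂} vertex-count
      (subst₂ (λ k l → γ G + 2 * n + (3 + E₁ + (2 + k)) ≤ 2 + (E₁ + E₂) + (l + 2 * n₁ + (γ⁺ G₂ + 2 * n₂))) count₂⁺ (sym (plus-adjacent G₁ h₁ c₁ xy))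
        (subst (λ k → γ G + 2 * n + (3 + E₁ + (2 + edgeCount (adj (plus G₂)) (P₂.SA-add s₂))) ≤ 2 + k + (γ G₁ + 2 * n₁ + (γ⁺ G₂ + 2 * n₂))) count
          (low (S.sum-plus-adj (subst₂ (λ u v → b₁ u v ≡ true) x₁ y₁ (img⁺ ι₁ (adj G₁) {x G₁} {y G₁} xy)) (I₁.img-fwd up₁) (J₂.img-fwd up₂⁺)))))

  -- The two outcomes of `sum-split` for an optimal matching of the sum are the two terms of the
  -- minimum.
  sum-≥ : γ⁺ G₁ + γ⁺ G₂ ≤ γ G ⊎ γ G₁ + γ G₂ + 2 ≤ γ G
  sum-≥ = cases (S.sum-split (γ-up G sum-In sum-Connected))
   where
   cases : S.SplitRes (2 + E#) (γ G + 2 * n) → γ⁺ G₁ + γ⁺ G₂ ≤ γ G ⊎ γ G₁ + γ G₂ + 2 ≤ γ G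
   cases (inj₁ (i₁ , j₁ , i₂ , j₂ , p , q , k)) = inj₂ (≤-trans (sum-arith₂ 0 {γ G} {n} {E₁} {E₂} {γ G₁} {γ G₂} {n₁} {n₂} {i₁} {i₂} {j₁} {j₂} {E#} {E₁} {E₂} count refl vertex-count k
        (γ-low G₁ h₁ c₁ (I₁.img-bwd p)) (γ-low G₂ h₂ c₂ (I₂.img-bwd q))) (≤-reflexive (+-identityʳ (γ G))))
   cases (inj₂ (i₁ , j₁ , i₂ , j₂ , p , q , k)) = inj₁ (go (adj G₁ (x G₁) (y G₁)) refl)
    where
    low₂ : γ⁺ G₂ + 2 * n₂ + i₂ ≤ 2 + suc E₂ + j₂
    low₂ = subst (λ k → γ⁺ G₂ + 2 * n₂ + i₂ ≤ 2 + k + j₂) count₂⁺ (γ-low (plus G₂) P₂.plus-In (P₂.plus-conn c₂) (J₂.img-bwd q))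
    cut : ∀ {a b} → a + 2 ≤ b + 2 → a ≤ b
    cut {a} {b} h = +-cancelʳ-≤ 2 a b h
    go : ∀ b → adj G₁ (x G₁) (y G₁) ≡ b → γ⁺ G₁ + γ⁺ G₂ ≤ γ G
    go false na₁ = cut (sum-arith₂ 2 {γ G} {n} {E₁} {E₂} {γ⁺ G₁} {γ⁺ G₂} {n₁} {n₂} {i₁} {i₂} {j₁} {j₂} {E#} {suc E₁} {suc E₂} count (cong suc (+-suc E₁ E₂)) vertex-count k
      (subst (λ k → γ⁺ G₁ + 2 * n₁ + i₁ ≤ 2 + k + j₁) (count₁⁺ na₁) (γ-low (plus G₁) P₁.plus-In (P₁.plus-conn c₁) (J₁.img-bwd (S.◂-plus (na′ ι₁ ι-inj₁ G₁ x₁ y₁ na₁) p)))) low₂)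
    -- The splitting returns `G₁` with a second edge between `x` and `y`. Deleting it costs one,
    -- which is exactly what `E₁` lacks against `suc E₁`.
    go true xy = cut (sum-arith₂ 2 {γ G} {n} {E₁} {E₂} {γ⁺ G₁} {γ⁺ G₂} {n₁} {n₂} {i₁} {i₂} {j₁} {j₂} {E#} {suc E₁} {suc E₂} count (cong suc (+-suc E₁ E₂)) vertex-count k
      (≤-trans (≤-reflexive (cong (λ g → g + 2 * n₁ + i₁) (plus-adjacent G₁ h₁ c₁ xy))) (≤-trans (γ-low G₁ h₁ c₁ (I₁.img-bwd (S.delete-e₂ p))) (≤-reflexive (+-suc (2 + E₁) j₁)))) low₂)

-- Contraction of a bridge

module Coarsen {X V V' : Set} (_≟_ : DecidableEquality X) (_≟V_ : DecidableEquality V) (_≟V'_ : DecidableEquality V') (χ : X → V) (χ' : X → V') where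
  private
    module E  = Surgery _≟_ _≟V_ χ
    module E' = Surgery _≟_ _≟V'_ χ'

  coarsen : ∀ {S i j} → (∀ {u v} → u ∈ Φ S → v ∈ Φ S → χ u ≡ χ v → χ' u ≡ χ' v) → E.Ach S i j → E'.Ach S i j
  coarsen h (β , v , k) = β , record { pβ = E.pβ v ; rβ = λ i → h (∈-resp-↭ (E.pβ v) (flat-∈ˡ i)) (∈-resp-↭ (E.pβ v) (flat-∈ʳ i)) (E.rβ v i) } , k

retagOne : ℕ → ℕ → ℕ → ℕ
retagOne k l t with t Data.Nat.≟ k
... | yes _ = l
... | no _  = t

module Bridge {n k : ℕ} (f : Fin n → Fin k) (a b : Fin n) (f-eq : ∀ u v → f u ≡ f v → u ≡ v ⊎ (u ≡ a × v ≡ b) ⊎ (u ≡ b × v ≡ a))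
              (inA : Fin n → Bool) (aA : inA a ≡ true) (bA : inA b ≡ false) where
  private
    module Ef = Split (_≟T_ {n}) Fin._≟_ (f ∘ vert)
    module I  = PresIso {Fin n} {Fin n} Fin._≟_ Fin._≟_ Fin._≟_ Fin._≟_ id id
    module If = PresIso {Fin n} {Fin n} Fin._≟_ Fin._≟_ Fin._≟_ Fin._≟_ f f

    TP : Set₁
    TP = ℕ → Fin n → Fin n → Set

    wf : ∀ {S P} → Pres {n} S P → Ef.WF S
    wf = Pres-WF Fin._≟_ f

    w : ∀ {S P} → Pres {n} S P → F.WF S
    w = Pres-WF Fin._≟_ id

    re : ∀ {S S'} {P P' : TP} → Pres S P → Pres S' P' → (∀ {t u v} → P t u v → P' t u v) → (∀ {t u v} → P' t u v → P t u v) → ∀ {i j} → F.Ach S i j → F.Ach S' i j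
    re p p' g h = I.iso-fwd p p' id id g (λ { _ _ refl refl refl → refl }) (λ {t} {u} {v} k → t , u , v , h k , refl , refl , refl) (λ _ _ e → e)

    re-f : ∀ {S S'} {P P' : TP} → Pres S P → Pres S' P' → (∀ {t u v} → P t u v → P' t u v) → (∀ {t u v} → P' t u v → P t u v) → ∀ {i j} → Ef.Ach S i j → Ef.Ach S' i j
    re-f p p' g h = If.iso-fwd p p' id id g (λ { _ _ refl refl refl → refl }) (λ {t} {u} {v} k → t , u , v , h k , refl , refl , refl) (λ _ _ e → e)

    disj : ∀ {S T} {P Q : TP} → Pres S P → Pres T Q → (∀ {t u v} → P t u v → Q t u v → ⊥) → ∀ {z} → z ∈ Φ S → z ∈ Φ T → ⊥
    disj p q h {t , u , v , s} i j = h (in⁻ p i) (in⁻ q j)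

    sep-inj : ∀ {u v} → inA u ≡ inA v → f u ≡ f v → u ≡ v
    sep-inj {u} {v} e h with f-eq u v h
    ... | inj₁ e' = e'
    ... | inj₂ (inj₁ (refl , refl)) = ⊥-elim (true≢false (trans (sym aA) (trans e bA)))
    ... | inj₂ (inj₂ (refl , refl)) = ⊥-elim (true≢false (trans (sym aA) (trans (sym e) bA)))

    not-a : ∀ {u v} → u ≢ a → v ≢ a → f u ≡ f v → u ≡ v
    not-a {u} {v} u≢ v≢ h with f-eq u v h
    ... | inj₁ e = e
    ... | inj₂ (inj₁ (e , _)) = ⊥-elim (u≢ e)
    ... | inj₂ (inj₂ (_ , e)) = ⊥-elim (v≢ e)

    meets-a : ∀ {u} → u ≢ a → f u ≡ f a → u ≡ b
    meets-a {u} u≢ h with f-eq u a h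
    ... | inj₁ e = ⊥-elim (u≢ e)
    ... | inj₂ (inj₁ (e , _)) = ⊥-elim (u≢ e)
    ... | inj₂ (inj₂ (e , _)) = e

    B≢a : ∀ {u} → inA u ≡ false → u ≢ a
    B≢a h refl = true≢false (trans (sym aA) h)

    a≢b : a ≢ b
    a≢b refl = true≢false (trans (sym aA) bA)

    -- If `f` separates the vertices that occur in `S`, a matching respecting the merged vertices
    -- already respects the original ones.
    refine : ∀ {S} {P : TP} (p : Pres S P) → (∀ {t u v t' u' v'} → P t u v → P t' u' v' → f u ≡ f u' → u ≡ u') → ∀ {i j} → Ef.Ach S i j → F.Ach S i j
    refine p h = Coarsen.coarsen (_≟T_ {n}) Fin._≟_ Fin._≟_ (f ∘ vert) vert (λ {z} {z'} i j e → h (in⁻ p i) (in⁻ p j) e)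

    e = edge 3 a b
    okE : F.EdgeOK e
    okE = edge-OK Fin._≟_ id 3 a≢b

    -- Since matchings need not be strict, the bridge can be laid down as a component of its own, at
    -- the cost of one.
    pendant : ∀ {S} {P : TP} (p : Pres S P) → (∀ {t u v} → P t u v → t ≢ 3) → ∀ {i j} → F.Ach S i j → F.Ach (e ◂ S) i (suc j)
    pendant {S} p h x = F.Ach-⊕ (F.WF-edge okE) (w p) (disj (Pres-edge 3 a≢b) p (λ { (refl , _) k → h k refl })) {0} {1} (F.Ach-edge okE) x

    -- S and T meet only in the merged vertex f a.
    one-sum : ∀ {S T} {P Q : TP} (p : Pres S P) (q : Pres T Q) → (∀ {t u v} → P t u v → Q t u v → ⊥) → (∀ {t u v} → P t u v → t ≢ 9) → (∀ {t u v} → Q t u v → t ≢ 9) →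
      (∀ {t u v t' u' v'} → P t u v → Q t' u' v' → f u ≡ f u' → f u ≡ f a) → ∀ c₀ → f a ≢ f c₀ → ∀ {i j} → Ef.Ach (S ⊕ T) i j →
      ∃ λ i₁ → ∃ λ j₁ → ∃ λ i₂ → ∃ λ j₂ → Ef.Ach S i₁ j₁ × Ef.Ach T i₂ j₂ × i + (j₁ + j₂) ≤ j + (i₁ + i₂)
    one-sum {S} {T} {P} {Q} p q dj p9 q9 meet c₀ fne (β , v , h) = cases (Ef.split σ v)
      where
      ne : a ≢ c₀
      ne refl = fne refl
      ok9 : Ef.EdgeOK (edge 9 a c₀)
      ok9 = edge-OK Fin._≟_ f 9 ne
      σ : Ef.Glued S T (f a) (f c₀) (edge 9 a c₀)
      σ = record { wS = wf p ; wT = wf q ; d = disj p q dj ; x≢y = fne ; shared = λ {z} {z'} i j e' → inj₁ (meet (in⁻ p i) (in⁻ q j) e') ; ok = ok9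
                 ; dS = disj (Pres-edge 9 ne) p (λ { (refl , _) k → p9 k refl }) ; dT = disj (Pres-edge 9 ne) q (λ { (refl , _) k → q9 k refl }) ; ex = refl ; ey = refl }
      cases : _ ⊎ _ → _
      cases (inj₁ (i₁ , j₁ , i₂ , j₂ , x , y , l)) = i₁ , j₁ , i₂ , j₂ , x , y , split-arith (Ef.A (S ⊕ T) β) (Ef.M (S ⊕ T) β) h l
      -- The splitting needs two vertices, so an arbitrary `f c₀` different from `f a` is supplied
      -- as the second one. This outcome would make it a common vertex.
      cases (inj₂ ((z , z' , i , j , e₁ , e₂) , _)) = ⊥-elim (fne (trans (sym (meet (in⁻ p i) (in⁻ q j) (trans e₁ (sym e₂)))) e₁))

  module _ (d : Adj n) (sd : SA d) (cl : ∀ {u v} → d u v ≡ true → inA u ≡ inA v) (c₀ : Fin n) (fac : f a ≢ f c₀) where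
    private
      dA dB : Adj n
      dA u v = d u v ∧ inA u
      dB u v = d u v ∧ not (inA u)

      ∧-cong-true : ∀ {p q r} → (p ≡ true → q ≡ r) → p ∧ q ≡ p ∧ r
      ∧-cong-true {false} h = refl
      ∧-cong-true {true} h = h refl

      sA : SA dA
      sA = sa (λ u v → trans (∧-cong-true {d u v} cl) (cong (_∧ inA v) (sm sd u v))) (λ v → cong (_∧ inA v) (ir sd v))
      sB : SA dB
      sB = sa (λ u v → trans (∧-cong-true {d u v} (cong not ∘ cl)) (cong (_∧ not (inA v)) (sm sd u v))) (λ v → cong (_∧ not (inA v)) (ir sd v))

      UA = tag dA sA 0
      UB = tag dB sB 0

      PA PB PD : TP
      PA t u v = t ≡ 0 × dA u v ≡ true
      PB t u v = t ≡ 0 × dB u v ≡ true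
      PD t u v = t ≡ 0 × d u v ≡ true

      pA : Pres UA PA
      pA = tag-Pres dA sA 0
      pB : Pres UB PB
      pB = tag-Pres dB sB 0
      pD : Pres (tag d sd 0) PD
      pD = tag-Pres d sd 0

      vA : ∀ {t u v} → PA t u v → inA u ≡ true
      vA {t} {u} {v} (_ , h) = proj₂ (∧-true {d u v} h)
      vB : ∀ {t u v} → PB t u v → inA u ≡ false
      vB {t} {u} {v} (_ , h) = trans (sym (Bool.not-involutive _)) (cong not (proj₂ (∧-true {d u v} h)))

      AB : ∀ {t u v} → PA t u v → PB t u v → ⊥
      AB h k = true≢false (trans (sym (vA h)) (vB k))

      toAB : ∀ {t u v} → PD t u v → PA t u v ⊎ PB t u v
      toAB {t} {u} {v} (e , h) with inA u in i
      ... | true  = inj₁ (e , ∧-intro h refl)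
      ... | false = inj₂ (e , ∧-intro h refl)

      ofAB : ∀ {t u v} → PA t u v ⊎ PB t u v → PD t u v
      ofAB {t} {u} {v} (inj₁ (e , h)) = e , proj₁ (∧-true {d u v} h)
      ofAB {t} {u} {v} (inj₂ (e , h)) = e , proj₁ (∧-true {d u v} h)

      noA : ∀ k {t u v} → k ≢ 0 → t ≡ 0 × dA u v ≡ true → t ≢ k
      noA k n (refl , _) refl = n refl
      noB : ∀ k {t u v} → k ≢ 0 → t ≡ 0 × dB u v ≡ true → t ≢ k
      noB k n (refl , _) refl = n refl

      pAB : Pres (UA ⊕ UB) (λ t u v → PA t u v ⊎ PB t u v)
      pAB = Pres-⊕ pA pB AB

      finish : ∀ {S T} {P Q : TP} (p : Pres S P) (q : Pres T Q) → (∀ {t u v} → P t u v → Q t u v → ⊥) → ∀ {i j i₁ j₁ i₂ j₂} → F.Ach S i₁ j₁ → F.Ach T i₂ j₂ →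
        i + (j₁ + j₂) ≤ j + (i₁ + i₂) → F.Ach (S ⊕ T) i j
      finish p q dj {i} {j} {i₁} {j₁} {i₂} {j₂} x y h = F.Ach-≤ {i = i₁ + i₂} {j = j₁ + j₂} (≤-trans h (≤-reflexive (+-comm j (i₁ + i₂)))) (F.Ach-⊕ (w p) (w q) (disj p q dj) x y)

    -- The bridge e = ab, contracted by f, may be put back as an edge on its own.
    uncontract₀ : ∀ {i j} → Ef.Ach (tag d sd 0) i j → F.Ach (e ◂ tag d sd 0) i (suc j)
    uncontract₀ x =
      case one-sum pA pB AB (noA 9 λ ()) (noB 9 λ ()) (λ k l e' → shared k l e') c₀ fac (re-f pD pAB toAB ofAB x) of λ { (i₁ , j₁ , i₂ , j₂ , y , z , h) →
        pendant pD (λ { (refl , _) () }) (re pAB pD ofAB toAB (finish pA pB AB (refine pA (λ k l → sep-inj (trans (vA k) (sym (vA l)))) y) (refine pB (λ k l → sep-inj (trans (vB k) (sym (vB l)))) z) h)) }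
      where
      shared : ∀ {t u v t' u' v'} → PA t u v → PB t' u' v' → f u ≡ f u' → f u ≡ f a
      shared {u = u} {u' = u'} k l h with f-eq u u' h
      ... | inj₁ refl = ⊥-elim (true≢false (trans (sym (vA k)) (vB l)))
      ... | inj₂ (inj₁ (refl , _)) = refl
      ... | inj₂ (inj₂ (_ , refl)) = h

    module _ {x y : Fin n} (fxy : f x ≢ f y) where
      private
        x≢y : x ≢ y
        x≢y refl = fxy refl

        EP : TP
        EP = EdgeP 2 x y

        PH : TP
        PH t u v = EP t u v ⊎ PD t u v

        pH : Pres (edge 2 x y ◂ tag d sd 0) PH
        pH = Pres-◂ 2 x≢y pD (λ { (refl , _) (() , _) })

        hA : Pres (edge 2 x y ◂ UA) (λ t u v → EP t u v ⊎ PA t u v)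
        hA = Pres-◂ 2 x≢y pA (λ { (refl , _) (() , _) })
        hB : Pres (edge 2 x y ◂ UB) (λ t u v → EP t u v ⊎ PB t u v)
        hB = Pres-◂ 2 x≢y pB (λ { (refl , _) (() , _) })

        EPv : ∀ {ℓ : Bool} {t u v} → inA x ≡ ℓ → inA y ≡ ℓ → EP t u v → inA u ≡ ℓ
        EPv hx hy (_ , inj₁ (refl , _)) = hx
        EPv hx hy (_ , inj₂ (refl , _)) = hy

        H≢3 : ∀ {t u v} → PH t u v → t ≢ 3
        H≢3 (inj₁ (refl , _)) ()
        H≢3 (inj₂ (refl , _)) ()

        meetAB : ∀ {u u'} → inA u ≡ true → inA u' ≡ false → f u ≡ f u' → f u ≡ f a
        meetAB {u} {u'} k l h with f-eq u u' h
        ... | inj₁ refl = ⊥-elim (true≢false (trans (sym k) l))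
        ... | inj₂ (inj₁ (refl , _)) = refl
        ... | inj₂ (inj₂ (_ , refl)) = h

      -- The new edge is counted with the side of `a`; the two sides still meet only in the merged
      -- vertex, as without it.
      same-side-A : inA x ≡ true → inA y ≡ true → ∀ {i j} → Ef.Ach (edge 2 x y ◂ tag d sd 0) i j → F.Ach (e ◂ edge 2 x y ◂ tag d sd 0) i (suc j)
      same-side-A hx hy z =
        case one-sum hA pB dj p9 (noB 9 λ ()) (λ k l → meetAB (vH k) (vB l)) c₀ fac (re-f pH q f₁ f₂ z) of λ { (i₁ , j₁ , i₂ , j₂ , z₁ , z₂ , h) →
          pendant pH H≢3 (re q pH f₂ f₁ (finish hA pB dj (refine hA (λ k l → sep-inj (trans (vH k) (sym (vH l)))) z₁) (refine pB (λ k l → sep-inj (trans (vB k) (sym (vB l)))) z₂) h)) }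
        where
        vH : ∀ {t u v} → EP t u v ⊎ PA t u v → inA u ≡ true
        vH (inj₁ k) = EPv hx hy k
        vH (inj₂ k) = vA k
        dj : ∀ {t u v} → EP t u v ⊎ PA t u v → PB t u v → ⊥
        dj k l = true≢false (trans (sym (vH k)) (vB l))
        p9 : ∀ {t u v} → EP t u v ⊎ PA t u v → t ≢ 9
        p9 (inj₁ (refl , _)) ()
        p9 (inj₂ (refl , _)) ()
        q : Pres ((edge 2 x y ◂ UA) ⊕ UB) (λ t u v → (EP t u v ⊎ PA t u v) ⊎ PB t u v)
        q = Pres-⊕ hA pB dj
        f₁ : ∀ {t u v} → PH t u v → (EP t u v ⊎ PA t u v) ⊎ PB t u v
        f₁ (inj₁ k) = inj₁ (inj₁ k)
        f₁ (inj₂ k) with toAB k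
        ... | inj₁ l = inj₁ (inj₂ l)
        ... | inj₂ l = inj₂ l
        f₂ : ∀ {t u v} → (EP t u v ⊎ PA t u v) ⊎ PB t u v → PH t u v
        f₂ (inj₁ (inj₁ k)) = inj₁ k
        f₂ (inj₁ (inj₂ k)) = inj₂ (ofAB (inj₁ k))
        f₂ (inj₂ k) = inj₂ (ofAB (inj₂ k))

      private
        r₁ : ∀ {t u v} → PH t u v → PA t u v ⊎ (EP t u v ⊎ PB t u v)
        r₁ (inj₁ k) = inj₂ (inj₁ k)
        r₁ (inj₂ k) with toAB k
        ... | inj₁ l = inj₁ l
        ... | inj₂ l = inj₂ (inj₂ l)
        r₂ : ∀ {t u v} → PA t u v ⊎ (EP t u v ⊎ PB t u v) → PH t u v
        r₂ (inj₁ k) = inj₂ (ofAB (inj₁ k))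
        r₂ (inj₂ (inj₁ k)) = inj₁ k
        r₂ (inj₂ (inj₂ k)) = inj₂ (ofAB (inj₂ k))
        djB : ∀ {t u v} → PA t u v → EP t u v ⊎ PB t u v → ⊥
        djB (refl , _) (inj₁ (() , _))
        djB k (inj₂ l) = AB k l
        qB : Pres (UA ⊕ (edge 2 x y ◂ UB)) (λ t u v → PA t u v ⊎ (EP t u v ⊎ PB t u v))
        qB = Pres-⊕ pA hB djB
        p9B : ∀ {t u v} → EP t u v ⊎ PB t u v → t ≢ 9
        p9B (inj₁ (refl , _)) ()
        p9B (inj₂ (refl , _)) ()

      same-side-B : inA x ≡ false → inA y ≡ false → ∀ {i j} → Ef.Ach (edge 2 x y ◂ tag d sd 0) i j → F.Ach (e ◂ edge 2 x y ◂ tag d sd 0) i (suc j)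
      same-side-B hx hy z =
        case one-sum pA hB djB (noA 9 λ ()) p9B (λ k l → meetAB (vA k) (vH l)) c₀ fac (re-f pH qB r₁ r₂ z) of λ { (i₁ , j₁ , i₂ , j₂ , z₁ , z₂ , h) →
          pendant pH H≢3 (re qB pH r₂ r₁ (finish pA hB djB (refine pA (λ k l → sep-inj (trans (vA k) (sym (vA l)))) z₁) (refine hB (λ k l → sep-inj (trans (vH k) (sym (vH l)))) z₂) h)) }
        where
        vH : ∀ {t u v} → EP t u v ⊎ PB t u v → inA u ≡ false
        vH (inj₁ k) = EPv hx hy k
        vH (inj₂ k) = vB k

      module _ (hx : inA x ≡ true) (hy : inA y ≡ false) where
        private
          vHB : ∀ {t u v} → EP t u v ⊎ PB t u v → u ≡ x ⊎ inA u ≡ false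
          vHB (inj₁ (_ , inj₁ (refl , _))) = inj₁ refl
          vHB (inj₁ (_ , inj₂ (refl , _))) = inj₂ hy
          vHB (inj₂ k) = inj₂ (vB k)

          refA : ∀ {i j} → Ef.Ach UA i j → F.Ach UA i j
          refA = refine pA (λ k l → sep-inj (trans (vA k) (sym (vA l))))

          pE : ∀ {S} {P : TP} → Pres S P → (∀ {t u v} → P t u v → t ≢ 3) → Pres (e ◂ S) (λ t u v → EdgeP 3 a b t u v ⊎ P t u v)
          pE p h = Pres-◂ 3 a≢b p (λ { (refl , _) k → h k refl })

          HB≢3 : ∀ {t u v} → EP t u v ⊎ PB t u v → t ≢ 3
          HB≢3 (inj₁ (refl , _)) ()
          HB≢3 (inj₂ (refl , _)) ()

          Final : TP
          Final t u v = EdgeP 3 a b t u v ⊎ PH t u v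
          pFinal : Pres (e ◂ edge 2 x y ◂ tag d sd 0) Final
          pFinal = pE pH H≢3

          eHB : Pres (e ◂ edge 2 x y ◂ UB) (λ t u v → EdgeP 3 a b t u v ⊎ (EP t u v ⊎ PB t u v))
          eHB = pE hB HB≢3
          djE : ∀ {t u v} → PA t u v → EdgeP 3 a b t u v ⊎ (EP t u v ⊎ PB t u v) → ⊥
          djE (refl , _) (inj₁ (() , _))
          djE k (inj₂ l) = djB k l
          qE : Pres (UA ⊕ (e ◂ edge 2 x y ◂ UB)) (λ t u v → PA t u v ⊎ (EdgeP 3 a b t u v ⊎ (EP t u v ⊎ PB t u v)))
          qE = Pres-⊕ pA eHB djE

          close : ∀ {i j} → F.Ach (UA ⊕ (e ◂ edge 2 x y ◂ UB)) i j → F.Ach (e ◂ edge 2 x y ◂ tag d sd 0) i j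
          close = re qE pFinal g₁ g₂
            where
            g₁ : ∀ {t u v} → PA t u v ⊎ (EdgeP 3 a b t u v ⊎ (EP t u v ⊎ PB t u v)) → Final t u v
            g₁ (inj₁ k) = inj₂ (r₂ (inj₁ k))
            g₁ (inj₂ (inj₁ k)) = inj₁ k
            g₁ (inj₂ (inj₂ k)) = inj₂ (r₂ (inj₂ k))
            g₂ : ∀ {t u v} → Final t u v → PA t u v ⊎ (EdgeP 3 a b t u v ⊎ (EP t u v ⊎ PB t u v))
            g₂ (inj₁ k) = inj₂ (inj₁ k)
            g₂ (inj₂ k) with r₁ k
            ... | inj₁ l = inj₁ l
            ... | inj₂ l = inj₂ (inj₂ l)

          suc-arith : ∀ {i j j₁ j₂ I} → i + (j₁ + j₂) ≤ j + I → i + (j₁ + suc j₂) ≤ suc j + I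
          suc-arith {i} {j} {j₁} {j₂} {I} h = ≤-trans (≤-reflexive (trans (cong (i +_) (+-suc j₁ j₂)) (+-suc i (j₁ + j₂)))) (s≤s h)

          -- subdividing, at its end a, an edge from c to a hanging on vertices other than a
          sub-at-a : ∀ k c → c ≢ a → k ≢ 3 → ∀ {S} {P : TP} (p : Pres S P) → (∀ {t u v} → P t u v → t ≢ 3) → (∀ {t u v} → P t u v → t ≢ k) → (∀ {t u v} → P t u v → u ≢ a) →
            ∀ {i j} → Ef.Ach (edge k c a ◂ S) i j → F.Ach (e ◂ edge k c a ◂ S) i (suc j)
          sub-at-a k c c≢a k≢3 {S} {P} p p3 pk pa = Subdivide.subdivide (_≟T_ {n}) Fin._≟_ Fin._≟_ vert (f ∘ vert) (Pres-WF Unit._≟_ (λ _ → tt) pk◂) okE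
              (disj (Pres-edge 3 a≢b) pk◂ (λ { (refl , _) (inj₁ (e' , _)) → k≢3 (sym e') ; (refl , _) (inj₂ h) → p3 h refl })) refl refl hχ ht
            where
            pk◂ : Pres (edge k c a ◂ S) (λ t u v → EdgeP k c a t u v ⊎ P t u v)
            pk◂ = Pres-◂ k c≢a p (λ { (refl , _) h → pk h refl })
            away : ∀ {z} → z ∈ Φ (edge k c a ◂ S) → z ≢ (k , a , c , false) → z ≢ (k , a , c , true) → vert z ≢ a
            away {t , u , v , s} i n₁ n₂ with in⁻ pk◂ i
            ... | inj₂ h = pa h
            ... | inj₁ (refl , inj₁ (refl , _)) = c≢a
            away {t , u , v , false} i n₁ n₂ | inj₁ (refl , inj₂ (refl , refl)) = ⊥-elim (n₁ refl)
            away {t , u , v , true}  i n₁ n₂ | inj₁ (refl , inj₂ (refl , refl)) = ⊥-elim (n₂ refl)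
            hχ : ∀ {z z'} → z ∈ Φ (edge k c a ◂ S) → z' ∈ Φ (edge k c a ◂ S) → z ≢ (k , a , c , false) → z ≢ (k , a , c , true) →
              z' ≢ (k , a , c , false) → z' ≢ (k , a , c , true) → f (vert z) ≡ f (vert z') → vert z ≡ vert z'
            hχ i j n₁ n₂ n₃ n₄ h = not-a (away i n₁ n₂) (away j n₃ n₄) h
            ht : ∀ {z} → z ∈ Φ (edge k c a ◂ S) → z ≢ (k , a , c , false) → z ≢ (k , a , c , true) → f (vert z) ≡ f a ⊎ f (vert z) ≡ f a → vert z ≡ b
            ht i n₁ n₂ (inj₁ h) = meets-a (away i n₁ n₂) h
            ht i n₁ n₂ (inj₂ h) = meets-a (away i n₁ n₂) h

          flip-P : ∀ {k x y} {t u v} → EdgeP {n} k x y t u v → EdgeP k y x t u v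
          flip-P (e , inj₁ h) = e , inj₂ h
          flip-P (e , inj₂ h) = e , inj₁ h

          map₁ : ∀ {A B C : Set} → (A → B) → A ⊎ C → B ⊎ C
          map₁ g (inj₁ k) = inj₁ (g k)
          map₁ g (inj₂ k) = inj₂ k

          map₂ : ∀ {A B C : Set} → (A → B) → C ⊎ A → C ⊎ B
          map₂ g (inj₁ k) = inj₁ k
          map₂ g (inj₂ k) = inj₂ (g k)

        -- Seen from the side of `b`, the edge `xy` hangs on the merged vertex. There the end at `a`
        -- is separated again and the bridge inserted between `a` and `b`, so the cost of one falls
        -- on the subdivision instead of `pendant`.
        across-at-a : x ≡ a → ∀ {i j} → Ef.Ach (edge 2 x y ◂ tag d sd 0) i j → F.Ach (e ◂ edge 2 x y ◂ tag d sd 0) i (suc j)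
        across-at-a refl {i} {j} z =
          case one-sum pA hB djB (noA 9 λ ()) p9B (λ {t} {u} k l → meet k (vHB l)) c₀ fac (re-f pH qB r₁ r₂ z) of λ { (i₁ , j₁ , i₂ , j₂ , z₁ , z₂ , h) →
            close (finish pA eHB djE {i = i} {j = suc j} {i₁ = i₁} {j₁ = j₁} {i₂ = i₂} {j₂ = suc j₂} (refA z₁) (re (pE hB' HB'≢3) eHB (map₂ (map₁ flip-P)) (map₂ (map₁ flip-P)) (sub-at-a 2 y (x≢y ∘ sym) (λ ()) pB (noB 3 λ ()) (noB 2 λ ()) (λ k → B≢a (vB k))
                      (re-f hB hB' (map₁ flip-P) (map₁ flip-P) z₂))) (suc-arith {i} {j} {j₁} {j₂} h)) }
          where
          hB' : Pres (edge 2 y x ◂ UB) (λ t u v → EdgeP 2 y x t u v ⊎ PB t u v)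
          hB' = Pres-◂ 2 (x≢y ∘ sym) pB (λ { (refl , _) (() , _) })
          HB'≢3 : ∀ {t u v} → EdgeP 2 y x t u v ⊎ PB t u v → t ≢ 3
          HB'≢3 (inj₁ (refl , _)) ()
          HB'≢3 (inj₂ (refl , _)) ()
          meet : ∀ {t u v u'} → PA t u v → u' ≡ x ⊎ inA u' ≡ false → f u ≡ f u' → f u ≡ f a
          meet k (inj₁ refl) h = h
          meet k (inj₂ l) h = meetAB (vA k) l h

        -- Now the sides share two merged vertices, `f a` and `f x`, so `split` applies with a
        -- virtual edge between them. In its first outcome the bridge is again laid down apart. In
        -- the second, the virtual edge on the side of `b` has its end at the merged vertex led over
        -- the bridge, at the cost of one; `join` then recombines the sides and deletes both virtual
        -- edges.
        across : x ≢ a → ∀ {i j} → Ef.Ach (edge 2 x y ◂ tag d sd 0) i j → F.Ach (e ◂ edge 2 x y ◂ tag d sd 0) i (suc j)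
        across x≢a {i} {j} z = go (re-f pH qB r₁ r₂ z)
          where
          a≢x : a ≢ x
          a≢x = x≢a ∘ sym
          fax : f a ≢ f x
          fax h = a≢x (sep-inj (trans aA (sym hx)) h)
          4A : ∀ {t u v} → EdgeP 4 a x t u v → PA t u v → ⊥
          4A (refl , _) (() , _)
          4B : ∀ {t u v} → EdgeP 4 a x t u v → EP t u v ⊎ PB t u v → ⊥
          4B (refl , _) (inj₁ (() , _))
          4B (refl , _) (inj₂ (() , _))
          gA : Pres (edge 4 a x ◂ UA) (λ t u v → EdgeP 4 a x t u v ⊎ PA t u v)
          gA = Pres-◂ 4 a≢x pA 4A
          gHB : Pres (edge 4 a x ◂ edge 2 x y ◂ UB) (λ t u v → EdgeP 4 a x t u v ⊎ (EP t u v ⊎ PB t u v))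
          gHB = Pres-◂ 4 a≢x hB 4B
          gHB' : Pres (edge 4 x a ◂ edge 2 x y ◂ UB) (λ t u v → EdgeP 4 x a t u v ⊎ (EP t u v ⊎ PB t u v))
          gHB' = Pres-◂ 4 x≢a hB (λ { (refl , _) (inj₁ (() , _)) ; (refl , _) (inj₂ (() , _)) })
          HB≢4 : ∀ {t u v} → EP t u v ⊎ PB t u v → t ≢ 4
          HB≢4 (inj₁ (refl , _)) ()
          HB≢4 (inj₂ (refl , _)) ()
          HB≢a : ∀ {t u v} → EP t u v ⊎ PB t u v → u ≢ a
          HB≢a k with vHB k
          ... | inj₁ refl = x≢a
          ... | inj₂ l = B≢a l
          meet : ∀ {t u v t' u' v'} → PA t u v → EP t' u' v' ⊎ PB t' u' v' → f u ≡ f u' → f u ≡ f a ⊎ f u ≡ f x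
          meet k l h with vHB l
          ... | inj₁ refl = inj₂ h
          ... | inj₂ l' = inj₁ (meetAB (vA k) l' h)
          gA-inA : ∀ {t u v} → EdgeP 4 a x t u v ⊎ PA t u v → inA u ≡ true
          gA-inA (inj₁ (_ , inj₁ (refl , _))) = aA
          gA-inA (inj₁ (_ , inj₂ (refl , _))) = hx
          gA-inA (inj₂ k) = vA k
          GHB'≢3 : ∀ {t u v} → EdgeP 4 x a t u v ⊎ (EP t u v ⊎ PB t u v) → t ≢ 3
          GHB'≢3 (inj₁ (refl , _)) ()
          GHB'≢3 (inj₂ k) = HB≢3 k
          g5 : Pres (edge 5 a x ◂ e ◂ edge 2 x y ◂ UB) (λ t u v → EdgeP 5 a x t u v ⊎ (EdgeP 3 a b t u v ⊎ (EP t u v ⊎ PB t u v)))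
          g5 = Pres-◂ 5 a≢x eHB 5E
            where
            5E : ∀ {t u v} → EdgeP 5 a x t u v → EdgeP 3 a b t u v ⊎ (EP t u v ⊎ PB t u v) → ⊥
            5E (refl , _) (inj₁ (() , _))
            5E (refl , _) (inj₂ (inj₁ (() , _)))
            5E (refl , _) (inj₂ (inj₂ (() , _)))
          to5 : ∀ {i j} → F.Ach (e ◂ edge 4 x a ◂ edge 2 x y ◂ UB) i j → F.Ach (edge 5 a x ◂ e ◂ edge 2 x y ◂ UB) i j
          to5 = I.iso-fwd (pE gHB' GHB'≢3) g5 (retagOne 4 5) id into inj onto (λ _ _ h → h)
            where
            into : ∀ {t u v} → EdgeP 3 a b t u v ⊎ (EdgeP 4 x a t u v ⊎ (EP t u v ⊎ PB t u v)) → EdgeP 5 a x (retagOne 4 5 t) u v ⊎ (EdgeP 3 a b (retagOne 4 5 t) u v ⊎ (EP (retagOne 4 5 t) u v ⊎ PB (retagOne 4 5 t) u v))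
            into (inj₁ (refl , h)) = inj₂ (inj₁ (refl , h))
            into (inj₂ (inj₁ (refl , h))) = inj₁ (flip-P (refl , h))
            into (inj₂ (inj₂ (inj₁ (refl , h)))) = inj₂ (inj₂ (inj₁ (refl , h)))
            into (inj₂ (inj₂ (inj₂ (refl , h)))) = inj₂ (inj₂ (inj₂ (refl , h)))
            small : ∀ {t u v} → EdgeP 3 a b t u v ⊎ (EdgeP 4 x a t u v ⊎ (EP t u v ⊎ PB t u v)) → t ≢ 5
            small (inj₁ (refl , _)) ()
            small (inj₂ (inj₁ (refl , _))) ()
            small (inj₂ (inj₂ (inj₁ (refl , _)))) ()
            small (inj₂ (inj₂ (inj₂ (refl , _)))) ()
            one : ∀ t t' → t ≢ 5 → t' ≢ 5 → retagOne 4 5 t ≡ retagOne 4 5 t' → t ≡ t'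
            one t t' n n' h with t Data.Nat.≟ 4 | t' Data.Nat.≟ 4
            ... | yes p | yes q = trans p (sym q)
            ... | yes p | no q = ⊥-elim (n' (sym h))
            ... | no p | yes q = ⊥-elim (n h)
            ... | no p | no q = h
            inj : ∀ {t u v t' u' v'} → EdgeP 3 a b t u v ⊎ (EdgeP 4 x a t u v ⊎ (EP t u v ⊎ PB t u v)) → EdgeP 3 a b t' u' v' ⊎ (EdgeP 4 x a t' u' v' ⊎ (EP t' u' v' ⊎ PB t' u' v')) →
              retagOne 4 5 t ≡ retagOne 4 5 t' → u ≡ u' → v ≡ v' → (t , u , v) ≡ (t' , u' , v')
            inj {t} {u} {v} {t'} k l h refl refl = cong (λ t → t , u , v) (one t t' (small k) (small l) h)
            onto : ∀ {t u v} → EdgeP 5 a x t u v ⊎ (EdgeP 3 a b t u v ⊎ (EP t u v ⊎ PB t u v)) →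
              ∃ λ t₀ → ∃ λ u₀ → ∃ λ v₀ → (EdgeP 3 a b t₀ u₀ v₀ ⊎ (EdgeP 4 x a t₀ u₀ v₀ ⊎ (EP t₀ u₀ v₀ ⊎ PB t₀ u₀ v₀))) × t ≡ retagOne 4 5 t₀ × u ≡ u₀ × v ≡ v₀
            onto {t} {u} {v} (inj₁ (refl , h)) = 4 , u , v , inj₂ (inj₁ (flip-P (refl , h))) , refl , refl , refl
            onto {t} {u} {v} (inj₂ (inj₁ (refl , h))) = 3 , u , v , inj₁ (refl , h) , refl , refl , refl
            onto {t} {u} {v} (inj₂ (inj₂ (inj₁ (refl , h)))) = 2 , u , v , inj₂ (inj₂ (inj₁ (refl , h))) , refl , refl , refl
            onto {t} {u} {v} (inj₂ (inj₂ (inj₂ (refl , h)))) = 0 , u , v , inj₂ (inj₂ (inj₂ (refl , h))) , refl , refl , refl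
          ok4f : Ef.EdgeOK (edge 4 a x)
          ok4f = edge-OK Fin._≟_ f 4 a≢x
          djJ : ∀ {t u v} → EdgeP 4 a x t u v ⊎ PA t u v → EdgeP 5 a x t u v ⊎ (EdgeP 3 a b t u v ⊎ (EP t u v ⊎ PB t u v)) → ⊥
          djJ (inj₁ (refl , _)) (inj₁ (() , _))
          djJ (inj₁ (refl , _)) (inj₂ (inj₁ (() , _)))
          djJ (inj₁ (refl , _)) (inj₂ (inj₂ (inj₁ (() , _))))
          djJ (inj₁ (refl , _)) (inj₂ (inj₂ (inj₂ (() , _))))
          djJ (inj₂ (refl , _)) (inj₁ (() , _))
          djJ (inj₂ k) (inj₂ l) = djE k l
          σ : Ef.Glued UA (edge 2 x y ◂ UB) (f a) (f x) (edge 4 a x)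
          σ = record { wS = wf pA ; wT = wf hB ; d = disj pA hB djB ; x≢y = fax ; shared = λ {z} {z'} k l h → meet (in⁻ pA k) (in⁻ hB l) h ; ok = ok4f
                     ; dS = disj (Pres-edge 4 a≢x) pA 4A ; dT = disj (Pres-edge 4 a≢x) hB 4B ; ex = refl ; ey = refl }
          cases : ∀ {A M} → Ef.Res σ A M →
            A + i ≤ M + j → F.Ach (e ◂ edge 2 x y ◂ tag d sd 0) i (suc j)
          cases {A} {M} (inj₁ (i₁ , j₁ , i₂ , j₂ , z₁ , z₂ , l)) h = pendant pH H≢3 (re qB pH r₂ r₁ (finish pA hB djB {i = i} {j = j} {i₁ = i₁} {j₁} {i₂} {j₂} (refA z₁) (refine hB (λ k l → not-a (HB≢a k) (HB≢a l)) z₂) (split-arith A M h l)))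
          cases {A} {M} (inj₂ (_ , i₁ , j₁ , i₂ , j₂ , z₁ , z₂ , l)) h = close (F.Ach-≤ {i = i₁ + i₂} {j = j₁ + suc j₂} (≤-trans (suc-arith {i} {j} {j₁} {j₂} (split-arith A M h l)) (≤-reflexive (+-comm (suc j) (i₁ + i₂))))
            (F.join (edge-OK Fin._≟_ id 4 a≢x) (edge-OK Fin._≟_ id 5 a≢x) (w gA) (w g5) (disj gA g5 djJ) refl refl x≢a (w pA) (w eHB)
              (refine gA (λ k l → sep-inj (trans (gA-inA k) (sym (gA-inA l)))) z₁)
              (to5 (sub-at-a 4 x x≢a (λ ()) hB HB≢3 HB≢4 HB≢a (re-f gHB gHB' (map₁ flip-P) (map₁ flip-P) z₂)))))
          go : Ef.Ach (UA ⊕ (edge 2 x y ◂ UB)) i j → F.Ach (e ◂ edge 2 x y ◂ tag d sd 0) i (suc j)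
          go (β , v , h) = cases (Ef.split σ v) h

    private
      from-A : ∀ {x y} → f x ≢ f y → inA x ≡ true → inA y ≡ false → ∀ {i j} → Ef.Ach (edge 2 x y ◂ tag d sd 0) i j → F.Ach (e ◂ edge 2 x y ◂ tag d sd 0) i (suc j)
      from-A {x} fxy hx hy with x Fin.≟ a
      ... | yes x≡a = across-at-a fxy hx hy x≡a
      ... | no x≢a  = across fxy hx hy x≢a

    uncontract : ∀ {x y} → f x ≢ f y → ∀ {i j} → Ef.Ach (edge 2 x y ◂ tag d sd 0) i j → F.Ach (e ◂ edge 2 x y ◂ tag d sd 0) i (suc j)
    uncontract {x} {y} fxy z with inA x in hx | inA y in hy
    ... | true  | true  = same-side-A fxy hx hy z
    ... | false | false = same-side-B fxy hx hy z
    ... | true  | false = from-A fxy hx hy z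
    ... | false | true  = re (pe y≢x) (pe x≢y) (map₂ (map₁ flip)) (map₂ (map₁ flip)) (from-A (fxy ∘ sym) hy hx (re-f (ph x≢y) (ph y≢x) (map₁ flip) (map₁ flip) z))
      where
      x≢y : x ≢ y
      x≢y refl = fxy refl
      y≢x = x≢y ∘ sym
      flip : ∀ {x y t u v} → EdgeP {n} 2 x y t u v → EdgeP 2 y x t u v
      flip (e , inj₁ h) = e , inj₂ h
      flip (e , inj₂ h) = e , inj₁ h
      map₁ : ∀ {A B C : Set} → (A → B) → A ⊎ C → B ⊎ C
      map₁ g (inj₁ k) = inj₁ (g k)
      map₁ g (inj₂ k) = inj₂ k
      map₂ : ∀ {A B C : Set} → (A → B) → C ⊎ A → C ⊎ B
      map₂ g (inj₁ k) = inj₁ k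
      map₂ g (inj₂ k) = inj₂ (g k)
      ph : ∀ {x y} → x ≢ y → Pres (edge 2 x y ◂ tag d sd 0) (λ t u v → EdgeP 2 x y t u v ⊎ PD t u v)
      ph x≢y = Pres-◂ 2 x≢y pD (λ { (refl , _) (() , _) })
      pe : ∀ {x y} → x ≢ y → Pres (e ◂ edge 2 x y ◂ tag d sd 0) (λ t u v → EdgeP 3 a b t u v ⊎ (EdgeP 2 x y t u v ⊎ PD t u v))
      pe x≢y = Pres-◂ 3 a≢b (ph x≢y) (λ { (refl , _) (inj₁ (() , _)) ; (refl , _) (inj₂ (() , _)) })

-- Contraction as a quotient map

-- Describes a contraction by the quotient map `f` alone, independently of the numbering of the
-- vertices. The section `sec` gives surjectivity.
record Contraction {k : ℕ} (G : TGraph (suc k)) (H : TGraph k) (a b : Fin (suc k)) (f : Fin (suc k) → Fin k) (sec : Fin k → Fin (suc k)) : Set where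
  field
    f-x  : x H ≡ f (x G)
    f-y  : y H ≡ f (y G)
    adj⁻ : ∀ {p q} → adj H p q ≡ true → p ≢ q × ∃ λ u → ∃ λ v → p ≡ f u × q ≡ f v × adj G u v ≡ true
    adj⁺ : ∀ {u v} → adj G u v ≡ true → f u ≢ f v → adj H (f u) (f v) ≡ true
    f-eq : ∀ u v → f u ≡ f v → u ≡ v ⊎ (u ≡ a × v ≡ b) ⊎ (u ≡ b × v ≡ a)
    f-ab : f a ≡ f b
    f-sec : ∀ p → f (sec p) ≡ p

module _ {k : ℕ} (u v : Fin (suc k)) (u≢v : u ≢ v) where

  merge : Fin (suc k) → Fin k
  merge w with w Fin.≟ v
  ... | yes _   = punchOut {i = v} {j = u} (λ e → u≢v (sym e))
  ... | no w≢v = punchOut {i = v} {j = w} (λ e → w≢v (sym e))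

  merge-eq : ∀ w w' → merge w ≡ merge w' → w ≡ w' ⊎ (w ≡ u × w' ≡ v) ⊎ (w ≡ v × w' ≡ u)
  merge-eq w w' e with w Fin.≟ v | w' Fin.≟ v
  ... | yes p | yes q = inj₁ (trans p (sym q))
  ... | yes p | no q  = inj₂ (inj₂ (p , sym (Fin.punchOut-injective {i = v} {u} {w'} (λ e → u≢v (sym e)) (λ e → q (sym e)) e)))
  ... | no p  | yes q = inj₂ (inj₁ (Fin.punchOut-injective {i = v} {w} {u} (λ e → p (sym e)) (λ e → u≢v (sym e)) e , q))
  ... | no p  | no q  = inj₁ (Fin.punchOut-injective {i = v} {w} {w'} (λ e → p (sym e)) (λ e → q (sym e)) e)

  merge-uv : merge u ≡ merge v
  merge-uv with u Fin.≟ v | v Fin.≟ v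
  ... | yes p | _ = ⊥-elim (u≢v p)
  ... | no _ | yes _ = Fin.punchOut-cong v refl
  ... | no _ | no n = ⊥-elim (n refl)

  merge-sec : ∀ p → merge (punchIn v p) ≡ p
  merge-sec p with punchIn v p Fin.≟ v
  ... | yes e = ⊥-elim (Fin.punchInᵢ≢i v p e)
  ... | no n = trans (Fin.punchOut-cong v refl) (Fin.punchOut-punchIn v)

  -- names the local merging function of contractEdge
  merging : (G : TGraph (suc k)) → Σ (Fin (suc k) → Fin k) λ f → adj (proj₂ (contractEdge G u v u≢v)) ≡
    (λ p q → not (eqF p q) ∧ anyF (λ c → anyF (λ d → eqF (f c) p ∧ eqF (f d) q ∧ adj G c d)))
  merging G = (λ w → x (proj₂ (contractEdge (record { adj = adj G ; x = w ; y = y G }) u v u≢v))) , refl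

  merging≡merge : ∀ G w → proj₁ (merging G) w ≡ merge w
  merging≡merge G w with w Fin.≟ v
  ... | yes _ = refl
  ... | no _  = refl

  contraction : (G : TGraph (suc k)) → Contraction G (proj₂ (contractEdge G u v u≢v)) u v merge (punchIn v)
  contraction G = record { f-x = fx ; f-y = fy ; adj⁻ = a⁻ ; adj⁺ = a⁺ ; f-eq = merge-eq ; f-ab = merge-uv ; f-sec = merge-sec }
    where
    H = proj₂ (contractEdge G u v u≢v)
    g = proj₁ (merging G)
    fx : x H ≡ merge (x G)
    fx with x G Fin.≟ v
    ... | yes _ = refl
    ... | no _ = refl
    fy : y H ≡ merge (y G)
    fy with y G Fin.≟ v
    ... | yes _ = refl
    ... | no _ = refl
    eqF-false : ∀ {p q : Fin k} → not (eqF p q) ≡ true → p ≢ q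
    eqF-false {p} {q} h e with () ← trans (sym h) (cong not (eqF⁺ e))
    a⁻ : ∀ {p q} → adj H p q ≡ true → p ≢ q × ∃ λ u' → ∃ λ v' → p ≡ merge u' × q ≡ merge v' × adj G u' v' ≡ true
    a⁻ {p} {q} h = let (n , h') = ∧-true {not (eqF p q)} h
                       (c , _ , h″) = any⁻ (λ c → anyF (λ d → eqF (g c) p ∧ eqF (g d) q ∧ adj G c d)) {allFin (suc k)} h'
                       (d , _ , h‴) = any⁻ (λ d → eqF (g c) p ∧ eqF (g d) q ∧ adj G c d) {allFin (suc k)} h″
                       (e₁ , r) = ∧-true {eqF (g c) p} h‴
                       (e₂ , e₃) = ∧-true {eqF (g d) q} r
                   in eqF-false n , c , d , trans (sym (eqF⁻ e₁)) (merging≡merge G c) , trans (sym (eqF⁻ e₂)) (merging≡merge G d) , e₃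
    neq : ∀ {p q : Fin k} → p ≢ q → not (eqF p q) ≡ true
    neq {p} {q} n with p Fin.≟ q
    ... | yes e = ⊥-elim (n e)
    ... | no _ = refl
    a⁺ : ∀ {u' v'} → adj G u' v' ≡ true → merge u' ≢ merge v' → adj H (merge u') (merge v') ≡ true
    a⁺ {c} {d} e n = ∧-intro (neq n) (any⁺ (λ c' → anyF (λ d' → eqF (g c') (merge c) ∧ eqF (g d') (merge d) ∧ adj G c' d')) (∈-allFin c)
      (any⁺ (λ d' → eqF (g c) (merge c) ∧ eqF (g d') (merge d) ∧ adj G c d') (∈-allFin d)
        (∧-intro (eqF⁺ (merging≡merge G c)) (∧-intro (eqF⁺ (merging≡merge G d)) e))))

module Contracted {k : ℕ} {G : TGraph (suc k)} {H : TGraph k} {a b : Fin (suc k)} {f : Fin (suc k) → Fin k} {sec : Fin k → Fin (suc k)}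
                  (ct : Contraction G H a b f sec) (h : InGxy G) (b≢x : b ≢ x G) (b≢y : b ≢ y G) where
  open Contraction ct
  private s = SAG {G = G} h

  fx≢fy : f (x G) ≢ f (y G)
  fx≢fy e with f-eq (x G) (y G) e
  ... | inj₁ e' = proj₂ (proj₂ h) e'
  ... | inj₂ (inj₁ (_ , e')) = b≢y (sym e')
  ... | inj₂ (inj₂ (e' , _)) = b≢x (sym e')

  contr-In : InGxy H
  contr-In = (λ p q → bool-iff (sy p q) (sy q p)) , (λ p → not-true λ e → proj₁ (adj⁻ e) refl) , λ e → fx≢fy (trans (sym f-x) (trans e f-y))
    where
    sy : ∀ p q → adj H p q ≡ true → adj H q p ≡ true
    sy p q e with adj⁻ e
    ... | n , u , v , refl , refl , e' = adj⁺ (trans (sm s v u) e') (n ∘ sym)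

  contr-conn : Connected G → Connected H
  contr-conn cn p q = subst₂ (Reach H) (f-sec p) (f-sec q) (go (cn (sec p) (sec q)))
    where
    go : ∀ {u w} → Reach G u w → Reach H (f u) (f w)
    go here = here
    go {u} (step {v} {w} r e) with f v Fin.≟ f w
    ... | yes e' = subst (Reach H (f u)) e' (go r)
    ... | no n = step (go r) (adj⁺ e n)

bridge-arith₀ : ∀ {g h k E} → g + 2 * suc k + (2 + E) ≤ 2 + suc E + suc (h + 2 * k) → g ≤ h
bridge-arith₀ {g} {h} {k} {E} l = lin (2 * k + (4 + E)) l (eq₁ g k E) (eq₂ h k E)
  where
  eq₁ : ∀ g k E → g + (2 * k + (4 + E)) ≡ g + 2 * suc k + (2 + E)
  eq₁ = solve-∀
  eq₂ : ∀ h k E → 2 + suc E + suc (h + 2 * k) ≡ h + (2 * k + (4 + E))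
  eq₂ = solve-∀

bridge-arith₁ : ∀ {g h k E} → g + 2 * suc k + (3 + E) ≤ 2 + suc (suc E) + suc (h + 2 * k) → g ≤ h
bridge-arith₁ {g} {h} {k} {E} l = lin (2 * k + (5 + E)) l (eq₁ g k E) (eq₂ h k E)
  where
  eq₁ : ∀ g k E → g + (2 * k + (5 + E)) ≡ g + 2 * suc k + (3 + E)
  eq₁ = solve-∀
  eq₂ : ∀ h k E → 2 + suc (suc E) + suc (h + 2 * k) ≡ h + (2 * k + (5 + E))
  eq₂ = solve-∀

module DeleteEdge {n : ℕ} (G : TGraph n) (h : InGxy G) (a b : Fin n) where
  private s = SAG {G = G} h

  isAB : Fin n → Fin n → Bool
  isAB u v = (eqF u a ∧ eqF v b) ∨ (eqF u b ∧ eqF v a)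

  isAB⁻ : ∀ u v → isAB u v ≡ true → (u ≡ a × v ≡ b) ⊎ (u ≡ b × v ≡ a)
  isAB⁻ u v e with ∨-split {eqF u a ∧ eqF v b} e
  ... | inj₁ k = inj₁ (eqF⁻ (proj₁ (∧-true {eqF u a} k)) , eqF⁻ (proj₂ (∧-true {eqF u a} k)))
  ... | inj₂ k = inj₂ (eqF⁻ (proj₁ (∧-true {eqF u b} k)) , eqF⁻ (proj₂ (∧-true {eqF u b} k)))

  isAB⁺ : ∀ u v → (u ≡ a × v ≡ b) ⊎ (u ≡ b × v ≡ a) → isAB u v ≡ true
  isAB⁺ u v (inj₁ (refl , refl)) = ∨-trueˡ (∧-intro (eqF-refl u) (eqF-refl v))
  isAB⁺ u v (inj₂ (refl , refl)) = ∨-trueʳ {eqF u a ∧ eqF v b} (∧-intro (eqF-refl u) (eqF-refl v))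

  del⁻ : ∀ {u v} → adj (deleteEdge G a b) u v ≡ true → adj G u v ≡ true × ¬ ((u ≡ a × v ≡ b) ⊎ (u ≡ b × v ≡ a))
  del⁻ {u} {v} e with ∧-true {adj G u v} e
  ... | e₁ , e₂ = e₁ , λ k → true≢false (trans (sym e₂) (cong not (isAB⁺ u v k)))

  del⁺ : ∀ {u v} → adj G u v ≡ true → ¬ ((u ≡ a × v ≡ b) ⊎ (u ≡ b × v ≡ a)) → adj (deleteEdge G a b) u v ≡ true
  del⁺ {u} {v} e n = ∧-intro e (cong not (not-true (n ∘ isAB⁻ u v)))

  del-In : InGxy (deleteEdge G a b)
  del-In = (λ u v → bool-iff (sy u v) (sy v u)) , (λ v → not-true λ e → true≢false (trans (sym (proj₁ (del⁻ e))) (ir s v))) , proj₂ (proj₂ h)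
    where
    sy : ∀ u v → adj (deleteEdge G a b) u v ≡ true → adj (deleteEdge G a b) v u ≡ true
    sy u v e with del⁻ e
    ... | e₁ , n = del⁺ (trans (sm s v u) e₁) λ { (inj₁ (p , q)) → n (inj₂ (q , p)) ; (inj₂ (p , q)) → n (inj₁ (q , p)) }

module BridgeContract {k : ℕ} {G : TGraph (suc k)} {H : TGraph k} {a b : Fin (suc k)} {f : Fin (suc k) → Fin k} {sec : Fin k → Fin (suc k)}
                      (ct : Contraction G H a b f sec) (h : InGxy G) (na : adj G (x G) (y G) ≡ false) (b≢x : b ≢ x G) (b≢y : b ≢ y G)
                      (cn : Connected G) (ab : adj G a b ≡ true) (bridge : ¬ Connected (deleteEdge G a b)) where
  open Contraction ct
  open Contracted ct h b≢x b≢y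
  private
    n = suc k
    s = SAG {G = G} h
    d : Adj n
    d = adj (deleteEdge G a b)
    open DeleteEdge G h a b
    sd : SA d
    sd = SAG {G = deleteEdge G a b} del-In
    L = GraphSys.edgeL d (sm sd) (ir sd)

    a≢b : a ≢ b
    a≢b e = true≢false (trans (sym ab) (trans (cong (λ z → adj G z b) e) (ir s b)))

    edge-conn : ∀ {u v} → d u v ≡ true → Conn L u v
    edge-conn e = Conn-InE L (GraphSys.adj-InE d (sm sd) (ir sd) e)

    ¬ab : ¬ Conn L a b
    ¬ab k = bridge λ u w → Conn-least {S = Reach (deleteEdge G a b)} (record { rfl = here ; sm = Reach-sym (sm sd) ; tr = Reach-trans }) L
        (λ i → step here (proj₂ (GraphSys.∈-edgeL⁻ d (sm sd) (ir sd) i))) (all-conn (cn u w))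
      where
      all-conn : ∀ {u w} → Reach G u w → Conn L u w
      all-conn here = Conn-refl L
      all-conn (step {v} {w} r e) = Conn-trans L (all-conn r) (one (isAB v w) refl)
        where
        one : ∀ t → isAB v w ≡ t → Conn L v w
        one false i = edge-conn (∧-intro e (cong not i))
        one true i with isAB⁻ v w i
        ... | inj₁ (refl , refl) = k
        ... | inj₂ (refl , refl) = Conn-sym L k

    inA : Fin n → Bool
    inA = Count.comp Fin._≟_ L a
    aA : inA a ≡ true
    aA = Count.comp-true Fin._≟_ L (Conn-refl L)
    bA : inA b ≡ false
    bA = Count.comp-false Fin._≟_ L ¬ab

    cl : ∀ {u v} → d u v ≡ true → inA u ≡ inA v
    cl e = Count.comp-closed Fin._≟_ L (edge-conn e)

    other : ∃ λ c → f a ≢ f c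
    other with f a Fin.≟ f (x G)
    ... | yes e = y G , λ e' → fx≢fy (trans (sym e) e')
    ... | no ne = x G , ne

    hH = contr-In
    sH = SAG {G = H} hH
    EH = edgeCount (adj H) sH

    noLoop : ∀ {u v} → d u v ≡ true → f u ≢ f v
    noLoop {u} {v} e e' with del⁻ e
    ... | e₁ , ne with f-eq u v e'
    ... | inj₁ refl = true≢false (trans (sym e₁) (ir s u))
    ... | inj₂ r = ne r

    common : ∀ {u} → d u a ≡ true → d u b ≡ true → ⊥
    common e e' = ¬ab (Conn-trans L (Conn-sym L (edge-conn e)) (edge-conn e'))

    common′ : ∀ {u} → d a u ≡ true → d b u ≡ true → ⊥
    common′ e e' = ¬ab (Conn-trans L (edge-conn e) (Conn-sym L (edge-conn e')))

    -- The ends of a bridge have no common neighbour, so its contraction creates no parallel edges: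
    -- the edges other than `ab` correspond bijectively to those of `H`.
    f-inj : ∀ {u v u' v'} → d u v ≡ true → d u' v' ≡ true → f u ≡ f u' → f v ≡ f v' → u ≡ u' × v ≡ v'
    f-inj {u} {v} {u'} {v'} e e' eu ev with f-eq u u' eu | f-eq v v' ev
    ... | inj₁ refl | inj₁ refl = refl , refl
    ... | inj₁ refl | inj₂ (inj₁ (refl , refl)) = ⊥-elim (common e e')
    ... | inj₁ refl | inj₂ (inj₂ (refl , refl)) = ⊥-elim (common e' e)
    ... | inj₂ (inj₁ (refl , refl)) | inj₁ refl = ⊥-elim (common′ e e')
    ... | inj₂ (inj₂ (refl , refl)) | inj₁ refl = ⊥-elim (common′ e' e)
    ... | inj₂ (inj₁ (refl , refl)) | inj₂ (inj₁ (refl , refl)) = ⊥-elim (noLoop e refl)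
    ... | inj₂ (inj₁ (refl , refl)) | inj₂ (inj₂ (refl , refl)) = ⊥-elim (proj₂ (del⁻ e) (inj₁ (refl , refl)))
    ... | inj₂ (inj₂ (refl , refl)) | inj₂ (inj₁ (refl , refl)) = ⊥-elim (proj₂ (del⁻ e) (inj₂ (refl , refl)))
    ... | inj₂ (inj₂ (refl , refl)) | inj₂ (inj₂ (refl , refl)) = ⊥-elim (noLoop e refl)

    d-onto : ∀ {p q} → adj H p q ≡ true → ∃ λ u → ∃ λ v → d u v ≡ true × p ≡ f u × q ≡ f v
    d-onto e with adj⁻ e
    ... | ne , u , v , refl , refl , e' = u , v , del⁺ e' (λ { (inj₁ (refl , refl)) → ne f-ab ; (inj₂ (refl , refl)) → ne (sym f-ab) }) , refl , refl

    module Q = PresIso {Fin n} {Fin k} Fin._≟_ Fin._≟_ Fin._≟_ Fin._≟_ f id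
    pd = tag-Pres d sd 0
    pH = tag-Pres (adj H) sH 0
    into₀ : ∀ {t u v} → t ≡ 0 × d u v ≡ true → t ≡ 0 × adj H (f u) (f v) ≡ true
    into₀ (e , e') = e , adj⁺ (proj₁ (del⁻ e')) (noLoop e')
    inj₀ : ∀ {t u v t' u' v'} → t ≡ 0 × d u v ≡ true → t' ≡ 0 × d u' v' ≡ true → t ≡ t' → f u ≡ f u' → f v ≡ f v' → (t , u , v) ≡ (t' , u' , v')
    inj₀ {t} (_ , e) (_ , e') refl eu ev with f-inj e e' eu ev
    ... | refl , refl = refl
    onto₀ : ∀ {t p q} → t ≡ 0 × adj H p q ≡ true → ∃ λ t₀ → ∃ λ u → ∃ λ v → (t₀ ≡ 0 × d u v ≡ true) × t ≡ t₀ × p ≡ f u × q ≡ f v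
    onto₀ {t} (e , e') with d-onto e'
    ... | u , v , k , p , q = t , u , v , (e , k) , refl , p , q

    EH≡ : edgeCount d sd ≡ EH
    EH≡ = *-cancelˡ-≡ (edgeCount d sd) EH 4 (trans (sym (tag-length d sd 0)) (trans (Q.iso-length pd pH id f into₀ inj₀ onto₀) (tag-length (adj H) sH 0)))

    module AB = AddEdge a b a≢b
    dab : d a b ≡ false
    dab = not-true λ e → proj₂ (del⁻ e) (inj₁ (refl , refl))

    G⁻ : ∀ {u v} → adj G u v ≡ true → AB.add d u v ≡ true
    G⁻ {u} {v} e = by (isAB u v) refl
      where
      by : ∀ t → isAB u v ≡ t → AB.add d u v ≡ true
      by true i = AB.add-xy d (isAB⁻ u v i)
      by false i = AB.add-⊆ d (∧-intro e (cong not i))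
    G⁺ : ∀ {u v} → AB.add d u v ≡ true → adj G u v ≡ true
    G⁺ e with AB.add⁻ d e
    ... | inj₁ e' = proj₁ (del⁻ e')
    ... | inj₂ (inj₁ (refl , refl)) = ab
    ... | inj₂ (inj₂ (refl , refl)) = trans (sm s b a) ab

    module Im = Image id (λ _ _ e → e) (x G) (AB.add d) (adj G) (AB.SA-add sd) s G⁺ (λ {u} {v} e → u , v , G⁻ e , refl , refl)
    EG≡ : edgeCount (adj G) s ≡ suc EH
    EG≡ = trans (sym Im.img-count) (trans (AB.add-count d sd dab 0 0) (cong suc EH≡))

  -- Passing from `H` to `G` adds a vertex and an edge, which lowers `2 + E - 2n` by one, and lowers
  -- `D` by at most one.
  γ-contract : γ G ≤ γ H
  γ-contract = bridge-arith₀ {γ G} {γ H} {k} {EH} (subst (λ E → γ G + 2 * n + (2 + EH) ≤ 2 + E + suc (γ H + 2 * k)) EG≡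
    (γ-low G h cn (Im.img-fwd (AB.◂⇒add d sd dab 3 0 (Bridge.uncontract₀ f a b f-eq inA aA bA d sd cl (proj₁ other) (proj₂ other)
      (Q.iso-bwd pd pH id f into₀ inj₀ onto₀ (x G) (λ _ _ e → e) (γ-up H hH (contr-conn cn))))))))

  private
    X Y : Fin n
    X = x G
    Y = y G
    X≢Y = proj₂ (proj₂ h)
    xH≢yH = proj₂ (proj₂ hH)
    module PH = PlusGraph H hH
    module PG = PlusGraph G h

    -- The edge `xy` is kept apart from `H`, in which the terminals may have become adjacent. With a
    -- parallel copy in that case the value has the same form in both.
    ext : Surgery.Ach (_≟T_ {k}) Fin._≟_ vert (edge 2 (x H) (y H) ◂ tag (adj H) sH 0) (3 + EH) (γ⁺ H + 2 * k)
    ext = by (adj H (x H) (y H)) refl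
      where
      by : ∀ t → adj H (x H) (y H) ≡ t → Surgery.Ach (_≟T_ {k}) Fin._≟_ vert (edge 2 (x H) (y H) ◂ tag (adj H) sH 0) (3 + EH) (γ⁺ H + 2 * k)
      by true xy = subst (λ g → Surgery.Ach (_≟T_ {k}) Fin._≟_ vert (edge 2 (x H) (y H) ◂ tag (adj H) sH 0) (3 + EH) (g + 2 * k)) (sym (plus-adjacent H hH (contr-conn cn) xy))
        (PH.double (adj H) sH xy (γ-up H hH (contr-conn cn)))
      by false nxy = subst (λ E → Surgery.Ach (_≟T_ {k}) Fin._≟_ vert (edge 2 (x H) (y H) ◂ tag (adj H) sH 0) (2 + E) (γ⁺ H + 2 * k)) (PH.add-count (adj H) sH nxy 2 0)
        (PH.add⇒◂ (adj H) sH nxy 2 0 (γ-up (plus H) PH.plus-In (PH.plus-conn (contr-conn cn))))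

    pd2 : Pres (edge 2 X Y ◂ tag d sd 0) (λ t u v → EdgeP 2 X Y t u v ⊎ (t ≡ 0 × d u v ≡ true))
    pd2 = Pres-◂ 2 X≢Y pd (λ { (refl , _) (() , _) })
    pH2 : Pres (edge 2 (x H) (y H) ◂ tag (adj H) sH 0) (λ t u v → EdgeP 2 (x H) (y H) t u v ⊎ (t ≡ 0 × adj H u v ≡ true))
    pH2 = Pres-◂ 2 xH≢yH pH (λ { (refl , _) (() , _) })

    into₂ : ∀ {t u v} → EdgeP 2 X Y t u v ⊎ (t ≡ 0 × d u v ≡ true) → EdgeP 2 (x H) (y H) t (f u) (f v) ⊎ (t ≡ 0 × adj H (f u) (f v) ≡ true)
    into₂ (inj₁ (e , inj₁ (refl , refl))) = inj₁ (e , inj₁ (sym f-x , sym f-y))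
    into₂ (inj₁ (e , inj₂ (refl , refl))) = inj₁ (e , inj₂ (sym f-y , sym f-x))
    into₂ (inj₂ k) = inj₂ (into₀ k)
    inj₂′ : ∀ {t u v t' u' v'} → EdgeP 2 X Y t u v ⊎ (t ≡ 0 × d u v ≡ true) → EdgeP 2 X Y t' u' v' ⊎ (t' ≡ 0 × d u' v' ≡ true) → t ≡ t' → f u ≡ f u' → f v ≡ f v' → (t , u , v) ≡ (t' , u' , v')
    inj₂′ (inj₁ (refl , inj₁ (refl , refl))) (inj₁ (refl , inj₁ (refl , refl))) _ _ _ = refl
    inj₂′ (inj₁ (refl , inj₂ (refl , refl))) (inj₁ (refl , inj₂ (refl , refl))) _ _ _ = refl
    inj₂′ (inj₁ (refl , inj₁ (refl , refl))) (inj₁ (refl , inj₂ (refl , refl))) _ e _ = ⊥-elim (fx≢fy e)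
    inj₂′ (inj₁ (refl , inj₂ (refl , refl))) (inj₁ (refl , inj₁ (refl , refl))) _ e _ = ⊥-elim (fx≢fy (sym e))
    inj₂′ (inj₁ (refl , _)) (inj₂ (() , _)) refl _ _
    inj₂′ (inj₂ (() , _)) (inj₁ (refl , _)) refl _ _
    inj₂′ (inj₂ k) (inj₂ l) e eu ev = inj₀ k l e eu ev
    onto₂ : ∀ {t p q} → EdgeP 2 (x H) (y H) t p q ⊎ (t ≡ 0 × adj H p q ≡ true) → ∃ λ t₀ → ∃ λ u → ∃ λ v → (EdgeP 2 X Y t₀ u v ⊎ (t₀ ≡ 0 × d u v ≡ true)) × t ≡ t₀ × p ≡ f u × q ≡ f v
    onto₂ {t} (inj₁ (e , inj₁ (refl , refl))) = t , X , Y , inj₁ (e , inj₁ (refl , refl)) , refl , f-x , f-y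
    onto₂ {t} (inj₁ (e , inj₂ (refl , refl))) = t , Y , X , inj₁ (e , inj₂ (refl , refl)) , refl , f-y , f-x
    onto₂ (inj₂ k) with onto₀ k
    ... | t , u , v , l , p , q , r = t , u , v , inj₂ l , p , q , r

    module I = PresIso {Fin n} {Fin n} Fin._≟_ Fin._≟_ Fin._≟_ Fin._≟_ id id
    P3 : ℕ → Fin n → Fin n → Set
    P3 t u v = EdgeP 3 a b t u v ⊎ (EdgeP 2 X Y t u v ⊎ (t ≡ 0 × d u v ≡ true))
    p3 : Pres (edge 3 a b ◂ edge 2 X Y ◂ tag d sd 0) P3
    p3 = Pres-◂ 3 a≢b pd2 (λ { (refl , _) (inj₁ (() , _)) ; (refl , _) (inj₂ (() , _)) })
    sG⁺ = PG.SA-add s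
    into₃ : ∀ {t u v} → P3 t u v → 0 ≡ 0 × adj (plus G) u v ≡ true
    into₃ (inj₁ (_ , inj₁ (refl , refl))) = refl , PG.add-⊆ (adj G) ab
    into₃ (inj₁ (_ , inj₂ (refl , refl))) = refl , PG.add-⊆ (adj G) (trans (sm s b a) ab)
    into₃ (inj₂ (inj₁ (_ , e))) = refl , PG.add-xy (adj G) e
    into₃ (inj₂ (inj₂ (_ , e))) = refl , PG.add-⊆ (adj G) (proj₁ (del⁻ e))
    Pair : Fin n → Fin n → Fin n → Fin n → Set
    Pair p q u v = (u ≡ p × v ≡ q) ⊎ (u ≡ q × v ≡ p)
    ab-xy : ∀ {u v} → Pair a b u v → Pair X Y u v → ⊥
    ab-xy (inj₁ (_ , refl)) (inj₁ (_ , e)) = b≢y e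
    ab-xy (inj₁ (_ , refl)) (inj₂ (_ , e)) = b≢x e
    ab-xy (inj₂ (refl , _)) (inj₁ (e , _)) = b≢x e
    ab-xy (inj₂ (refl , _)) (inj₂ (e , _)) = b≢y e
    xy-d : ∀ {u v} → Pair X Y u v → d u v ≡ true → ⊥
    xy-d (inj₁ (refl , refl)) e = true≢false (trans (sym (proj₁ (del⁻ e))) na)
    xy-d (inj₂ (refl , refl)) e = true≢false (trans (sym (proj₁ (del⁻ e))) (trans (sm s Y X) na))
    inj₃ : ∀ {t u v t' u' v'} → P3 t u v → P3 t' u' v' → 0 ≡ 0 → u ≡ u' → v ≡ v' → (t , u , v) ≡ (t' , u' , v')
    inj₃ (inj₁ (refl , _)) (inj₁ (refl , _)) _ refl refl = refl
    inj₃ (inj₂ (inj₁ (refl , _))) (inj₂ (inj₁ (refl , _))) _ refl refl = refl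
    inj₃ (inj₂ (inj₂ (refl , _))) (inj₂ (inj₂ (refl , _))) _ refl refl = refl
    inj₃ (inj₁ (_ , k)) (inj₂ (inj₁ (_ , l))) _ refl refl = ⊥-elim (ab-xy k l)
    inj₃ (inj₂ (inj₁ (_ , l))) (inj₁ (_ , k)) _ refl refl = ⊥-elim (ab-xy k l)
    inj₃ (inj₁ (_ , k)) (inj₂ (inj₂ (_ , l))) _ refl refl = ⊥-elim (proj₂ (del⁻ l) k)
    inj₃ (inj₂ (inj₂ (_ , l))) (inj₁ (_ , k)) _ refl refl = ⊥-elim (proj₂ (del⁻ l) k)
    inj₃ (inj₂ (inj₁ (_ , k))) (inj₂ (inj₂ (_ , l))) _ refl refl = ⊥-elim (xy-d k l)
    inj₃ (inj₂ (inj₂ (_ , l))) (inj₂ (inj₁ (_ , k))) _ refl refl = ⊥-elim (xy-d k l)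
    onto₃ : ∀ {t u v} → t ≡ 0 × adj (plus G) u v ≡ true → ∃ λ t₀ → ∃ λ u₀ → ∃ λ v₀ → P3 t₀ u₀ v₀ × t ≡ 0 × u ≡ u₀ × v ≡ v₀
    onto₃ {t} {u} {v} (refl , e) with PG.add⁻ (adj G) e
    ... | inj₂ k = 2 , u , v , inj₂ (inj₁ (refl , k)) , refl , refl , refl
    ... | inj₁ e' with AB.add⁻ d (G⁻ e')
    ... | inj₁ l = 0 , u , v , inj₂ (inj₂ (refl , l)) , refl , refl , refl
    ... | inj₂ l = 3 , u , v , inj₁ (refl , l) , refl , refl , refl

  γ⁺-contract : γ⁺ G ≤ γ⁺ H
  γ⁺-contract = bridge-arith₁ {γ⁺ G} {γ⁺ H} {k} {EH} (subst (λ E → γ⁺ G + 2 * n + (3 + EH) ≤ 2 + E + suc (γ⁺ H + 2 * k))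
      (trans (PG.add-count (adj G) s na 0 0) (cong suc EG≡))
    (γ-low (plus G) PG.plus-In (PG.plus-conn cn) (I.iso-fwd p3 (tag-Pres (adj (plus G)) sG⁺ 0) (λ _ → 0) id into₃ inj₃ onto₃ (λ _ _ e → e)
      (Bridge.uncontract f a b f-eq inA aA bA d sd cl (proj₁ other) (proj₂ other) fx≢fy
        (Q.iso-bwd pd2 pH2 id f into₂ inj₂′ onto₂ X (λ _ _ e → e) ext)))))

-- Minor-operations and drops of the genus

module _ {n n₁ n₂ : ℕ} {G : TGraph n} {G₁ : TGraph n₁} {G₂ : TGraph n₂} {ι₁ : Fin n₁ → Fin n} {ι₂ : Fin n₂ → Fin n}
         (h₁ : InGxy G₁) (na₁ : adj G₁ (x G₁) (y G₁) ≡ false) (Σ₊ : IsXYSum G G₁ G₂ ι₁ ι₂) where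
  open IsXYSum Σ₊ renaming (inj₁ to ι-inj₁; inj₂ to ι-inj₂)

  -- The edge would join x and y, or be a loop.
  private-edge : ∀ {a b c d} → adj G₁ a b ≡ true → ι₁ a ≡ ι₂ c → ι₁ b ≡ ι₂ d → ⊥
  private-edge {a} {b} {c} {d} e p q with meet a c p | meet b d q
  ... | inj₁ (refl , _) | inj₁ (refl , _) = true≢false (trans (sym e) (ir (SAG {G = G₁} h₁) a))
  ... | inj₂ (refl , _) | inj₂ (refl , _) = true≢false (trans (sym e) (ir (SAG {G = G₁} h₁) a))
  ... | inj₁ (refl , _) | inj₂ (refl , _) = true≢false (trans (sym e) na₁)
  ... | inj₂ (refl , _) | inj₁ (refl , _) = true≢false (trans (sym e) (trans (sm (SAG {G = G₁} h₁) a b) na₁))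

  delete-sum : InGxy G → ∀ {a b} → adj G₁ a b ≡ true → IsXYSum (deleteEdge G (ι₁ a) (ι₁ b)) (deleteEdge G₁ a b) G₂ ι₁ ι₂
  delete-sum hG {a} {b} e = record
    { inj₁ = ι-inj₁ ; inj₂ = ι-inj₂ ; x₁ = x₁ ; y₁ = y₁ ; x₂ = x₂ ; y₂ = y₂ ; meet = meet ; cover = cover
    ; edges→ = λ u w k → split u w (D.del⁻ k)
    ; edges₁ = λ c d k → let (k₁ , ne) = D₁.del⁻ k in D.del⁺ (edges₁ c d k₁) λ { (inj₁ (p , q)) → ne (inj₁ (ι-inj₁ _ _ p , ι-inj₁ _ _ q)) ; (inj₂ (p , q)) → ne (inj₂ (ι-inj₁ _ _ p , ι-inj₁ _ _ q)) }
    ; edges₂ = λ c d k → D.del⁺ (edges₂ c d k) λ { (inj₁ (p , q)) → private-edge e (sym p) (sym q) ; (inj₂ (p , q)) → private-edge e (sym q) (sym p) } }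
    where
    module D = DeleteEdge G hG (ι₁ a) (ι₁ b)
    module D₁ = DeleteEdge G₁ h₁ a b
    split : ∀ u w → adj G u w ≡ true × ¬ ((u ≡ ι₁ a × w ≡ ι₁ b) ⊎ (u ≡ ι₁ b × w ≡ ι₁ a)) →
      (∃ λ c → ∃ λ d → ι₁ c ≡ u × ι₁ d ≡ w × adj (deleteEdge G₁ a b) c d ≡ true) ⊎ (∃ λ c → ∃ λ d → ι₂ c ≡ u × ι₂ d ≡ w × adj G₂ c d ≡ true)
    split u w (k , ne) with edges→ u w k
    ... | inj₂ r = inj₂ r
    ... | inj₁ (c , d , refl , refl , k') = inj₁ (c , d , refl , refl , D₁.del⁺ k' λ { (inj₁ (refl , refl)) → ne (inj₁ (refl , refl)) ; (inj₂ (refl , refl)) → ne (inj₂ (refl , refl)) })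

module _ {k k₁ n₂ : ℕ} {G : TGraph (suc k)} {G₁ : TGraph (suc k₁)} {G₂ : TGraph n₂} {ι₁ : Fin (suc k₁) → Fin (suc k)} {ι₂ : Fin n₂ → Fin (suc k)}
         (Σ₊ : IsXYSum G G₁ G₂ ι₁ ι₂) (h₂ : InGxy G₂) {a b : Fin (suc k₁)} (b≢x : b ≢ x G₁) (b≢y : b ≢ y G₁)
         {H : TGraph k} {f sec} (ct : Contraction G H (ι₁ a) (ι₁ b) f sec)
         {H₁ : TGraph k₁} {f₁ sec₁} (ct₁ : Contraction G₁ H₁ a b f₁ sec₁) where
  open IsXYSum Σ₊ renaming (inj₁ to ι-inj₁; inj₂ to ι-inj₂)
  open Contraction ct
  open Contraction ct₁ using () renaming (f-x to f-x₁; f-y to f-y₁; adj⁻ to adj₁⁻; adj⁺ to adj₁⁺; f-eq to f-eq₁; f-ab to f-ab₁; f-sec to f-sec₁)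
  private
    -- The map induced by `ι₁` on the quotients; by `κ-f` the choice of the section does not matter.
    κ₁ : Fin k₁ → Fin k
    κ₁ p = f (ι₁ (sec₁ p))

    κ₂ : Fin n₂ → Fin k
    κ₂ = f ∘ ι₂

    b∉G₂ : ∀ {v} → ι₁ b ≢ ι₂ v
    b∉G₂ {v} e with meet b v e
    ... | inj₁ (e' , _) = b≢x e'
    ... | inj₂ (e' , _) = b≢y e'

    down : ∀ u v → f (ι₁ u) ≡ f (ι₁ v) → f₁ u ≡ f₁ v
    down u v e with f-eq (ι₁ u) (ι₁ v) e
    ... | inj₁ e' = cong f₁ (ι-inj₁ u v e')
    ... | inj₂ (inj₁ (p , q)) with refl ← ι-inj₁ _ _ p | refl ← ι-inj₁ _ _ q = f-ab₁
    ... | inj₂ (inj₂ (p , q)) with refl ← ι-inj₁ _ _ p | refl ← ι-inj₁ _ _ q = sym f-ab₁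

    up : ∀ u v → f₁ u ≡ f₁ v → f (ι₁ u) ≡ f (ι₁ v)
    up u v e with f-eq₁ u v e
    ... | inj₁ refl = refl
    ... | inj₂ (inj₁ (refl , refl)) = f-ab
    ... | inj₂ (inj₂ (refl , refl)) = sym f-ab

    κ-f : ∀ u → κ₁ (f₁ u) ≡ f (ι₁ u)
    κ-f u = up _ u (f-sec₁ (f₁ u))

    κ₂-inj : ∀ c d → κ₂ c ≡ κ₂ d → c ≡ d
    κ₂-inj c d e with f-eq (ι₂ c) (ι₂ d) e
    ... | inj₁ e' = ι-inj₂ c d e'
    ... | inj₂ (inj₁ (_ , q)) = ⊥-elim (b∉G₂ (sym q))
    ... | inj₂ (inj₂ (p , _)) = ⊥-elim (b∉G₂ (sym p))

    -- The merged vertex belongs to `G₂` only if `a` is a terminal, because `b` is none.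
    κ-meet : ∀ u v → f (ι₁ u) ≡ f (ι₂ v) → (f₁ u ≡ f₁ (x G₁) × v ≡ x G₂) ⊎ (f₁ u ≡ f₁ (y G₁) × v ≡ y G₂)
    κ-meet u v e with f-eq (ι₁ u) (ι₂ v) e
    ... | inj₂ (inj₁ (_ , q)) = ⊥-elim (b∉G₂ (sym q))
    ... | inj₁ e' with meet u v e'
    ... | inj₁ (refl , q) = inj₁ (refl , q)
    ... | inj₂ (refl , q) = inj₂ (refl , q)
    κ-meet u v e | inj₂ (inj₂ (p , q)) with refl ← ι-inj₁ _ _ p with meet a v (sym q)
    ... | inj₁ (refl , r) = inj₁ (sym f-ab₁ , r)
    ... | inj₂ (refl , r) = inj₂ (sym f-ab₁ , r)

  -- Since `b` is not a terminal, it lies outside `G₂`, so the quotient map is injective on `G₂`.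
  contract-sum : IsXYSum H H₁ G₂ κ₁ κ₂
  contract-sum = record
    { inj₁ = λ p q e → trans (sym (f-sec₁ p)) (trans (down _ _ e) (f-sec₁ q))
    ; inj₂ = κ₂-inj
    ; x₁ = trans (cong κ₁ f-x₁) (trans (κ-f (x G₁)) (trans (cong f x₁) (sym f-x)))
    ; y₁ = trans (cong κ₁ f-y₁) (trans (κ-f (y G₁)) (trans (cong f y₁) (sym f-y)))
    ; x₂ = trans (cong f x₂) (sym f-x)
    ; y₂ = trans (cong f y₂) (sym f-y)
    ; meet = mt
    ; cover = cv
    ; edges→ = ed
    ; edges₁ = ed₁
    ; edges₂ = λ c d e → adj⁺ (edges₂ c d e) λ e' → loop c d e (κ₂-inj c d e') }
    where
    loop : ∀ c d → adj G₂ c d ≡ true → c ≡ d → ⊥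
    loop c _ e refl = true≢false (trans (sym e) (ir (SAG {G = G₂} h₂) c))
    mt : ∀ p v → κ₁ p ≡ κ₂ v → (p ≡ x H₁ × v ≡ x G₂) ⊎ (p ≡ y H₁ × v ≡ y G₂)
    mt p v e with κ-meet (sec₁ p) v e
    ... | inj₁ (e' , q) = inj₁ (trans (sym (f-sec₁ p)) (trans e' (sym f-x₁)) , q)
    ... | inj₂ (e' , q) = inj₂ (trans (sym (f-sec₁ p)) (trans e' (sym f-y₁)) , q)
    cv : ∀ w → (∃ λ p → κ₁ p ≡ w) ⊎ (∃ λ v → κ₂ v ≡ w)
    cv w with cover (sec w)
    ... | inj₁ (u , e) = inj₁ (f₁ u , trans (κ-f u) (trans (cong f e) (f-sec w)))
    ... | inj₂ (v , e) = inj₂ (v , trans (cong f e) (f-sec w))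
    ed : ∀ u w → adj H u w ≡ true → (∃ λ p → ∃ λ q → κ₁ p ≡ u × κ₁ q ≡ w × adj H₁ p q ≡ true) ⊎ (∃ λ c → ∃ λ d → κ₂ c ≡ u × κ₂ d ≡ w × adj G₂ c d ≡ true)
    ed u w e with adj⁻ e
    ... | ne , u₀ , w₀ , refl , refl , e' with edges→ u₀ w₀ e'
    ... | inj₂ (c , d , refl , refl , e″) = inj₂ (c , d , refl , refl , e″)
    ... | inj₁ (c , d , refl , refl , e″) = inj₁ (f₁ c , f₁ d , κ-f c , κ-f d , adj₁⁺ e″ (ne ∘ up c d))
    ed₁ : ∀ p q → adj H₁ p q ≡ true → adj H (κ₁ p) (κ₁ q) ≡ true
    ed₁ p q e with adj₁⁻ e
    ... | ne , c , d , refl , refl , e' = subst₂ (λ u w → adj H u w ≡ true) (sym (κ-f c)) (sym (κ-f d)) (adj⁺ (edges₁ c d e') (ne ∘ down c d))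

-- g, a, b stand for the Euler genera of the sum and its two parts, a⁺, b⁺ for those of the parts with xy added.
record MinFacts (a a⁺ b b⁺ g : ℕ) : Set where
  field
    ub₁ : g ≤ a⁺ + b⁺
    ub₂ : g ≤ a + b + 2
    lb  : a⁺ + b⁺ ≤ g ⊎ a + b + 2 ≤ g
    lo  : a ≤ a⁺
    hi  : a⁺ ≤ a + 2
open MinFacts

-- Arithmetic of the minimum of two sums

module Arith {a a⁺ b b⁺ g η : ℕ} (F₀ : MinFacts a a⁺ b b⁺ g) (eη : a⁺ + b⁺ ≡ a + b + η) where

  -- The two terms of the minimum are `a + b + η` and `a + b + 2`, so `η` decides which one is
  -- attained; at `η = 2` both are.
  lb₁ : η ≤ 2 → a⁺ + b⁺ ≤ g
  lb₁ h with lb F₀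
  ... | inj₁ l = l
  ... | inj₂ l = ≤-trans (≤-reflexive eη) (≤-trans (+-monoʳ-≤ (a + b) h) l)

  lb₂ : 2 ≤ η → a + b + 2 ≤ g
  lb₂ h with lb F₀
  ... | inj₂ l = l
  ... | inj₁ l = ≤-trans (+-monoʳ-≤ (a + b) h) (≤-trans (≤-reflexive (sym eη)) l)

  module _ {a' a'⁺ g' : ℕ} (F′ : MinFacts a' a'⁺ b b⁺ g') where

    drop⁺ : η ≤ 2 → a'⁺ + 1 ≤ a⁺ → g' < g
    drop⁺ h k = ≤-trans (s≤s (ub₁ F′)) (≤-trans (≤-trans (≤-reflexive (eq a'⁺ b⁺)) (+-monoˡ-≤ b⁺ k)) (lb₁ h))
      where
      eq : ∀ a b → suc (a + b) ≡ a + 1 + b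
      eq = solve-∀

    drop : 2 ≤ η → a' + 1 ≤ a → g' < g
    drop h k = ≤-trans (s≤s (ub₂ F′)) (≤-trans (≤-trans (≤-reflexive (eq a' b)) (+-monoˡ-≤ (b + 2) k)) (≤-trans (≤-reflexive (sym (+-assoc a b 2))) (lb₂ h)))
      where
      eq : ∀ a b → suc (a + b + 2) ≡ a + 1 + (b + 2)
      eq = solve-∀

    drop₂ : η ≡ 1 → a' + 2 ≤ a → g' < g
    drop₂ refl k = ≤-trans (s≤s (ub₂ F′)) (≤-trans (≤-trans (≤-reflexive (eq a' b)) (+-monoˡ-≤ (b + 1) k)) (≤-trans (≤-reflexive (trans (sym (+-assoc a b 1)) (sym eη))) (lb₁ (s≤s z≤n))))
      where
      eq : ∀ a b → suc (a + b + 2) ≡ a + 2 + (b + 1)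
      eq = solve-∀

    drop₂⁺ : η ≡ 3 → a'⁺ + 2 ≤ a⁺ → g' < g
    drop₂⁺ refl k = ≤-trans (lin (a'⁺ + 1) (+-mono-≤ (ub₁ F′) k) (eq₁ g' a'⁺) (trans (eq₂ a'⁺ b⁺ a⁺) (trans (cong (a'⁺ +_) eη) (eq₃ a'⁺ a b)))) (lb₂ (s≤s (s≤s z≤n)))
      where
      eq₁ : ∀ g a → suc g + (a + 1) ≡ g + (a + 2)
      eq₁ = solve-∀
      eq₂ : ∀ a b c → a + b + c ≡ a + (c + b)
      eq₂ = solve-∀
      eq₃ : ∀ a' a b → a' + (a + b + 3) ≡ a + b + 2 + (a' + 1)
      eq₃ = solve-∀

    module _ (lt : g' < g) where

      above⁺ : a'⁺ + b⁺ ≤ g' → a'⁺ + 1 ≤ a⁺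
      above⁺ l = lin b⁺ (≤-trans (s≤s l) (≤-trans lt (ub₁ F₀))) (eq a'⁺ b⁺) refl
        where
        eq : ∀ a b → a + 1 + b ≡ suc (a + b)
        eq = solve-∀

      above : a' + b + 2 ≤ g' → a' + 1 ≤ a
      above l = lin (b + 2) (≤-trans (s≤s l) (≤-trans lt (ub₂ F₀))) (eq a' b) (+-assoc a b 2)
        where
        eq : ∀ a b → a + 1 + (b + 2) ≡ suc (a + b + 2)
        eq = solve-∀

      -- A comparison across: the minor attains one term of the minimum while the sum is bounded by
      -- the other. The distance `2 - η` of the two terms enters the result, as it does in `above₂`.
      above⁺₂ : a'⁺ + b⁺ ≤ g' → a'⁺ + suc η ≤ a⁺ + 2
      above⁺₂ l = lin b⁺ (+-monoˡ-≤ η (≤-trans (s≤s l) (≤-trans lt (ub₂ F₀)))) (eq₁ a'⁺ b⁺ η) (trans (eq₂ (a + b) η) (trans (cong (_+ 2) (sym eη)) (eq₃ a⁺ b⁺)))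
        where
        eq₁ : ∀ a b h → a + suc h + b ≡ suc (a + b) + h
        eq₁ = solve-∀
        eq₂ : ∀ c h → c + 2 + h ≡ c + h + 2
        eq₂ = solve-∀
        eq₃ : ∀ a b → a + b + 2 ≡ a + 2 + b
        eq₃ = solve-∀

      above₂ : a' + b + 2 ≤ g' → a' + 3 ≤ a + η
      above₂ l = lin b (≤-trans (s≤s l) (≤-trans lt (ub₁ F₀))) (eq₁ a' b) (trans eη (eq₂ a b η))
        where
        eq₁ : ∀ a b → a + 3 + b ≡ suc (a + b + 2)
        eq₁ = solve-∀
        eq₂ : ∀ a b h → a + b + h ≡ a + h + b
        eq₂ = solve-∀

-- The drop of (ĝ, ĝ⁺) from (a, a⁺) to (a', a'⁺) in G₁ that lowers the genus of a sum with η = k.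
Drops : (k a a⁺ a' a'⁺ : ℕ) → Set
Drops 0 a a⁺ a' a'⁺ = a'⁺ + 1 ≤ a⁺
Drops 1 a a⁺ a' a'⁺ = a'⁺ + 1 ≤ a⁺ ⊎ a' + 2 ≤ a
Drops 2 a a⁺ a' a'⁺ = a' + 1 ≤ a ⊎ a'⁺ + 1 ≤ a⁺
Drops 3 a a⁺ a' a'⁺ = a' + 1 ≤ a ⊎ a'⁺ + 2 ≤ a⁺
Drops 4 a a⁺ a' a'⁺ = a' + 1 ≤ a
Drops _ a a⁺ a' a'⁺ = ⊤

module _ {a a⁺ b b⁺ g a' a'⁺ g' : ℕ} (F₀ : MinFacts a a⁺ b b⁺ g) (F′ : MinFacts a' a'⁺ b b⁺ g') where

  drops⇒< : ∀ k → k ≤ 4 → a⁺ + b⁺ ≡ a + b + k → Drops k a a⁺ a' a'⁺ → g' < g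
  drops⇒< 0 _ e d = drop⁺ F′ z≤n d
    where open Arith F₀ e
  drops⇒< 1 _ e = λ { (inj₁ d) → drop⁺ F′ (s≤s z≤n) d ; (inj₂ d) → drop₂ F′ refl d }
    where open Arith F₀ e
  drops⇒< 2 _ e = λ { (inj₁ d) → drop F′ ≤-refl d ; (inj₂ d) → drop⁺ F′ ≤-refl d }
    where open Arith F₀ e
  drops⇒< 3 _ e = λ { (inj₁ d) → drop F′ (s≤s (s≤s z≤n)) d ; (inj₂ d) → drop₂⁺ F′ refl d }
    where open Arith F₀ e
  drops⇒< 4 _ e d = drop F′ (s≤s (s≤s z≤n)) d
    where open Arith F₀ e
  drops⇒< (suc (suc (suc (suc (suc _))))) (s≤s (s≤s (s≤s (s≤s ())))) _ _

  -- Which term the minor attains is unknown, but the genus of the sum is bounded by both, so the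
  -- better comparison can be chosen. For odd `η` the terms differ by one; this turns a fall of one
  -- into the fall of two that hoppers require.
  <⇒drops : ∀ k → a⁺ + b⁺ ≡ a + b + k → g' < g → Drops k a a⁺ a' a'⁺
  <⇒drops 0 e lt with lb F′
  ... | inj₁ l = Arith.above⁺ F₀ e F′ lt l
  -- Here ĝ falls by at least three, and since ĝ⁺ exceeds ĝ by at most two in the minor, ĝ⁺ falls by
  -- at least one.
  ... | inj₂ l = ≤-trans (+-monoˡ-≤ 1 (hi F′)) (≤-trans (≤-reflexive (+-assoc a' 2 1)) (≤-trans (Arith.above₂ F₀ e F′ lt l) (≤-trans (≤-reflexive (+-identityʳ a)) (lo F₀))))
  <⇒drops 1 e lt with lb F′
  ... | inj₁ l = inj₁ (Arith.above⁺ F₀ e F′ lt l)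
  ... | inj₂ l = inj₂ (lin 1 (Arith.above₂ F₀ e F′ lt l) (+-assoc a' 2 1) refl)
  <⇒drops 2 e lt with lb F′
  ... | inj₁ l = inj₂ (Arith.above⁺ F₀ e F′ lt l)
  ... | inj₂ l = inj₁ (Arith.above F₀ e F′ lt l)
  <⇒drops 3 e lt with lb F′
  ... | inj₁ l = inj₂ (lin 2 (Arith.above⁺₂ F₀ e F′ lt l) (+-assoc a'⁺ 2 2) refl)
  ... | inj₂ l = inj₁ (Arith.above F₀ e F′ lt l)
  <⇒drops 4 e lt with lb F′
  -- Here ĝ⁺ falls by at least three; ĝ is at least ĝ⁺ - 2 before and at most ĝ⁺ after, so it falls
  -- by at least one.
  ... | inj₁ l = lin 4 (≤-trans (+-monoˡ-≤ 5 (lo F′)) (≤-trans (Arith.above⁺₂ F₀ e F′ lt l) (+-monoˡ-≤ 2 (hi F₀)))) (+-assoc a' 1 4) (+-assoc a 2 2)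
  ... | inj₂ l = Arith.above F₀ e F′ lt l
  <⇒drops (suc (suc (suc (suc (suc _))))) _ _ = tt

-- Used for bridges: contracting one lowers neither parameter, and this is incompatible with every
-- kind of drop.
drops-≥ : ∀ k {a a⁺ a' a'⁺} → k ≤ 4 → a ≤ a' → a⁺ ≤ a'⁺ → ¬ Drops k a a⁺ a' a'⁺
drops-≥ 0 _ l l⁺ d = m+1+n≰m _ (≤-trans d l⁺)
drops-≥ 1 _ l l⁺ (inj₁ d) = m+1+n≰m _ (≤-trans d l⁺)
drops-≥ 1 _ l l⁺ (inj₂ d) = m+1+n≰m _ (≤-trans d l)
drops-≥ 2 _ l l⁺ (inj₁ d) = m+1+n≰m _ (≤-trans d l)
drops-≥ 2 _ l l⁺ (inj₂ d) = m+1+n≰m _ (≤-trans d l⁺)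
drops-≥ 3 _ l l⁺ (inj₁ d) = m+1+n≰m _ (≤-trans d l)
drops-≥ 3 _ l l⁺ (inj₂ d) = m+1+n≰m _ (≤-trans d l⁺)
drops-≥ 4 _ l l⁺ d = m+1+n≰m _ (≤-trans d l)
drops-≥ (suc (suc (suc (suc (suc _))))) (s≤s (s≤s (s≤s (s≤s ())))) _ _ _

-- Deciding connectedness and criticality

module _ {n : ℕ} (G : TGraph n) (h : InGxy G) where
  private
    s = SAG {G = G} h
    L = GraphSys.edgeL (adj G) (sm s) (ir s)

  connected? : Dec (Connected G)
  connected? = map′ (λ c u w → Conn-least {S = Reach G} (record { rfl = here ; sm = Reach-sym (sm s) ; tr = Reach-trans }) L (λ i → step here (proj₂ (GraphSys.∈-edgeL⁻ (adj G) (sm s) (ir s) i))) (c u w))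
                    (λ c u w → connL (c u w)) (Fin.all? λ u → Fin.all? λ w → Count.conn? Fin._≟_ L u w)
    where
    connL : ∀ {u w} → Reach G u w → Conn L u w
    connL here = Conn-refl L
    connL (step r e) = Conn-trans L (connL r) (Conn-InE L (GraphSys.adj-InE (adj G) (sm s) (ir s) e))

module _ {k : ℕ} {G : TGraph (suc k)} {H H' : TGraph k} {a b : Fin (suc k)} {f f' : Fin (suc k) → Fin k} {sec sec' : Fin k → Fin (suc k)}
         (ct : Contraction G H a b f sec) (ct' : Contraction G H' a b f' sec') (f≗f' : ∀ w → f w ≡ f' w)
         (h : InGxy G) (cn : Connected G) (b≢x : b ≢ x G) (b≢y : b ≢ y G) where
  private
    module C = Contraction ct
    module C′ = Contraction ct'
    module D = Contracted ct h b≢x b≢y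
    module D′ = Contracted ct' h b≢x b≢y
    module P = PlusGraph H D.contr-In
    module P′ = PlusGraph H' D′.contr-In

    x≡ : x H ≡ x H'
    x≡ = trans C.f-x (trans (f≗f' (x G)) (sym C′.f-x))
    y≡ : y H ≡ y H'
    y≡ = trans C.f-y (trans (f≗f' (y G)) (sym C′.f-y))

    fwd : ∀ {p q} → adj H p q ≡ true → adj H' p q ≡ true
    fwd e with C.adj⁻ e
    ... | ne , u , v , refl , refl , e' = subst₂ (λ p q → adj H' p q ≡ true) (sym (f≗f' u)) (sym (f≗f' v)) (C′.adj⁺ e' λ e″ → ne (trans (f≗f' u) (trans e″ (sym (f≗f' v)))))

    bwd : ∀ {p q} → adj H' p q ≡ true → adj H p q ≡ true
    bwd e with C′.adj⁻ e
    ... | ne , u , v , refl , refl , e' = subst₂ (λ p q → adj H p q ≡ true) (f≗f' u) (f≗f' v) (C.adj⁺ e' λ e″ → ne (trans (sym (f≗f' u)) (trans e″ (f≗f' v))))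

    fwd⁺ : ∀ {p q} → adj (plus H) p q ≡ true → adj (plus H') p q ≡ true
    fwd⁺ e with P.add⁻ (adj H) e
    ... | inj₁ e' = P′.add-⊆ (adj H') (fwd e')
    ... | inj₂ (inj₁ (p , q)) = P′.add-xy (adj H') (inj₁ (trans p x≡ , trans q y≡))
    ... | inj₂ (inj₂ (p , q)) = P′.add-xy (adj H') (inj₂ (trans p y≡ , trans q x≡))

    bwd⁺ : ∀ {p q} → adj (plus H') p q ≡ true → adj (plus H) p q ≡ true
    bwd⁺ e with P′.add⁻ (adj H') e
    ... | inj₁ e' = P.add-⊆ (adj H) (bwd e')
    ... | inj₂ (inj₁ (p , q)) = P.add-xy (adj H) (inj₁ (trans p (sym x≡) , trans q (sym y≡)))
    ... | inj₂ (inj₂ (p , q)) = P.add-xy (adj H) (inj₂ (trans p (sym y≡) , trans q (sym x≡)))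

  -- Contractions formed with different proofs of `u ≢ v` are known to agree only pointwise; their
  -- genera agree by `γ-ext`.
  contract-unique : γ H ≤ γ H'
  contract-unique = γ-ext H H' D.contr-In D′.contr-In (D.contr-conn cn) (D′.contr-conn cn) fwd bwd

  contract-unique⁺ : γ⁺ H ≤ γ⁺ H'
  contract-unique⁺ = γ-ext (plus H) (plus H') P.plus-In P′.plus-In (P.plus-conn (D.contr-conn cn)) (P′.plus-conn (D′.contr-conn cn)) fwd⁺ bwd⁺

merge-irrelevant : ∀ {k} (u v : Fin (suc k)) (p q : u ≢ v) w → merge u v p w ≡ merge u v q w
merge-irrelevant u v p q w with w Fin.≟ v
... | yes _ = Fin.punchOut-cong v refl
... | no _ = refl

module _ {n : ℕ} (G : TGraph n) (P : ∀ {k} → TGraph k → ℕ)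
         (irrelevant : ∀ u v (p q : u ≢ v) → v ≢ x G → v ≢ y G → P (proj₂ (contractEdge G u v p)) ≤ P (proj₂ (contractEdge G u v q))) where
  private
    Con : Fin n → Fin n → Set
    Con u v = (p : u ≢ v) → v ≢ x G → v ≢ y G → P (proj₂ (contractEdge G u v p)) + 1 ≤ P G

    con? : ∀ u v → Dec (u ≡ v) → Dec (v ≡ x G) → Dec (v ≡ y G) → Dec (Con u v)
    con? u v (yes e) _ _ = yes λ p _ _ → ⊥-elim (p e)
    con? u v (no p) (yes e) _ = yes λ _ q _ → ⊥-elim (q e)
    con? u v (no p) (no q) (yes e) = yes λ _ _ r → ⊥-elim (r e)
    con? u v (no p) (no q) (no r) = map′ (λ l p' _ _ → ≤-trans (+-monoˡ-≤ 1 (irrelevant u v p' p q r)) l) (λ c → c p q r)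
      (P (proj₂ (contractEdge G u v p)) + 1 ≤? P G)

  -- Hoppers and cascades are defined by non-criticality, so membership in one of the classes calls
  -- for a decision. A contraction carries a proof of `u ≢ v`, over which one cannot search;
  -- `irrelevant` reduces the test to one such proof.
  critical? : Dec (Critical P G)
  critical? = map′ (λ c → λ { (del u v e) → proj₁ (c u v e) ; (con u v e p q r) → proj₂ (c u v e) p q r })
                   (λ c u v e → c (del u v e) , λ p q r → c (con u v e p q r))
                   (Fin.all? λ u → Fin.all? λ v → (adj G u v Bool.≟ true) →-dec
                     ((P (deleteEdge G u v) + 1 ≤? P G) ×-dec con? u v (u Fin.≟ v) (v Fin.≟ x G) (v Fin.≟ y G)))

γ≡ĝ : ∀ {n} (G : TGraph n) → γ G ≡ ĝ G
γ≡ĝ G = gen≡ (adj G)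

γ⁺≡ĝ⁺ : ∀ {n} (G : TGraph n) → γ⁺ G ≡ ĝ⁺ G
γ⁺≡ĝ⁺ G = gen≡ (adj (plus G))

γ≤⇒ĝ≤ : ∀ {n m} (G : TGraph n) (H : TGraph m) → γ G ≤ γ H → ĝ G ≤ ĝ H
γ≤⇒ĝ≤ G H = subst₂ _≤_ (γ≡ĝ G) (γ≡ĝ H)

γ⁺≤⇒ĝ⁺≤ : ∀ {n m} (G : TGraph n) (H : TGraph m) → γ⁺ G ≤ γ⁺ H → ĝ⁺ G ≤ ĝ⁺ H
γ⁺≤⇒ĝ⁺≤ G H = subst₂ _≤_ (γ⁺≡ĝ⁺ G) (γ⁺≡ĝ⁺ H)

critical-ĝ? : ∀ {n} (G : TGraph n) → InGxy G → Connected G → Dec (Critical ĝ G)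
critical-ĝ? {zero} G _ _ with () ← x G
critical-ĝ? {suc k} G h cn = critical? G ĝ λ u v p q vx vy →
  γ≤⇒ĝ≤ (proj₂ (contractEdge G u v p)) (proj₂ (contractEdge G u v q)) (contract-unique (contraction u v p G) (contraction u v q G) (merge-irrelevant u v p q) h cn vx vy)

critical-ĝ⁺? : ∀ {n} (G : TGraph n) → InGxy G → Connected G → Dec (Critical ĝ⁺ G)
critical-ĝ⁺? {zero} G _ _ with () ← x G
critical-ĝ⁺? {suc k} G h cn = critical? G ĝ⁺ λ u v p q vx vy →
  γ⁺≤⇒ĝ⁺≤ (proj₂ (contractEdge G u v p)) (proj₂ (contractEdge G u v q)) (contract-unique⁺ (contraction u v p G) (contraction u v q G) (merge-irrelevant u v p q) h cn vx vy)

-- Tightness as a condition on `G₁` alone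

sum-facts : ∀ {n n₁ n₂} (G : TGraph n) (G₁ : TGraph n₁) (G₂ : TGraph n₂) {ι₁ ι₂} → InGxy G₁ → InGxy° G₂ → Connected G₁ → Connected G₂ →
  IsXYSum G G₁ G₂ ι₁ ι₂ → MinFacts (ĝ G₁) (ĝ⁺ G₁) (ĝ G₂) (ĝ⁺ G₂) (ĝ G)
sum-facts G G₁ G₂ {ι₁} {ι₂} h₁ (h₂ , na₂) c₁ c₂ Σ₊ =
  cast (γ≡ĝ G₁) (γ⁺≡ĝ⁺ G₁) (γ≡ĝ G₂) (γ⁺≡ĝ⁺ G₂) (γ≡ĝ G)
    record { ub₁ = XYSum.sum-≤₁ G G₁ G₂ ι₁ ι₂ h₁ h₂ na₂ c₁ c₂ Σ₊ ; ub₂ = XYSum.sum-≤₂ G G₁ G₂ ι₁ ι₂ h₁ h₂ na₂ c₁ c₂ Σ₊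
           ; lb = XYSum.sum-≥ G G₁ G₂ ι₁ ι₂ h₁ h₂ na₂ c₁ c₂ Σ₊ ; lo = γ≤γ⁺ G₁ h₁ c₁ ; hi = γ⁺≤γ+2 G₁ h₁ c₁ }
  where
  cast : ∀ {a a₀ a⁺ a⁺₀ b b₀ b⁺ b⁺₀ g g₀} → a ≡ a₀ → a⁺ ≡ a⁺₀ → b ≡ b₀ → b⁺ ≡ b⁺₀ → g ≡ g₀ → MinFacts a a⁺ b b⁺ g → MinFacts a₀ a⁺₀ b₀ b⁺₀ g₀
  cast refl refl refl refl refl F = F

-- A contraction that lowers neither parameter; its existence refutes tightness as well as all five
-- conditions.
record Stuck {n : ℕ} (G : TGraph n) : Set where
  field
    {u v}    : Fin n
    uv       : adj G u v ≡ true
    u≢v      : u ≢ v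
    v≢x      : v ≢ x G
    v≢y      : v ≢ y G
    stays-ĝ  : ĝ G ≤ ĝ (proj₂ (contractEdge G u v u≢v))
    stays-ĝ⁺ : ĝ⁺ G ≤ ĝ⁺ (proj₂ (contractEdge G u v u≢v))

-- The end that a contraction removes must not be a terminal. As `x` and `y` are not adjacent, some
-- end of the bridge is no terminal, and the edge may be reversed.
bridge-stuck : ∀ {n} (G : TGraph n) → InGxy° G → Connected G → ∀ {a b} → adj G a b ≡ true → ¬ Connected (deleteEdge G a b) → Stuck G
bridge-stuck {zero} G _ _ {()}
bridge-stuck {suc k} G (h , na) cn {a} {b} ab br = orient (b Fin.≟ x G) (b Fin.≟ y G)
  where
  s = SAG {G = G} h
  loop : ∀ {a b} → adj G a b ≡ true → a ≢ b
  loop e refl = true≢false (trans (sym e) (ir s _))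
  stuck : ∀ {a b} → adj G a b ≡ true → ¬ Connected (deleteEdge G a b) → b ≢ x G → b ≢ y G → Stuck G
  stuck {a} {b} e br bx by = record { uv = e ; u≢v = loop e ; v≢x = bx ; v≢y = by
    ; stays-ĝ = γ≤⇒ĝ≤ G (proj₂ (contractEdge G a b (loop e))) (BridgeContract.γ-contract (contraction a b (loop e) G) h na bx by cn e br)
    ; stays-ĝ⁺ = γ⁺≤⇒ĝ⁺≤ G (proj₂ (contractEdge G a b (loop e))) (BridgeContract.γ⁺-contract (contraction a b (loop e) G) h na bx by cn e br) }
  ba : adj G b a ≡ true
  ba = trans (sm s b a) ab
  rb : ¬ Connected (deleteEdge G b a)
  rb c = br λ u w → go (c u w)
    where
    module A = DeleteEdge G h a b
    module B = DeleteEdge G h b a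
    go : ∀ {u w} → Reach (deleteEdge G b a) u w → Reach (deleteEdge G a b) u w
    go here = here
    go (step r e) = step (go r) (A.del⁺ (proj₁ (B.del⁻ e)) λ { (inj₁ k) → proj₂ (B.del⁻ e) (inj₂ k) ; (inj₂ k) → proj₂ (B.del⁻ e) (inj₁ k) })
  orient : Dec (b ≡ x G) → Dec (b ≡ y G) → Stuck G
  orient (no bx) (no by) = stuck ab br bx by
  orient (yes refl) _ = stuck ba rb (loop ab) λ { refl → true≢false (trans (sym ba) na) }
  orient (no _) (yes refl) = stuck ba rb (λ { refl → true≢false (trans (sym ab) na) }) (loop ab)

module _ {n₁ n₂ : ℕ} (G₁ : TGraph n₁) (G₂ : TGraph n₂) (h₁ : InGxy° G₁) (h₂ : InGxy° G₂) (c₁ : Connected G₁) (c₂ : Connected G₂) where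
  private
    Facts : ∀ {n k} → TGraph n → TGraph k → Set
    Facts H H₁ = MinFacts (ĝ H₁) (ĝ⁺ H₁) (ĝ G₂) (ĝ⁺ G₂) (ĝ H)

  con-facts : ∀ {n} {G : TGraph n} {ι₁ ι₂} → IsXYSum G G₁ G₂ ι₁ ι₂ → ∀ {a b} (p : a ≢ b) (q : ι₁ a ≢ ι₁ b) → b ≢ x G₁ → b ≢ y G₁ →
    Facts (proj₂ (contractEdge G (ι₁ a) (ι₁ b) q)) (proj₂ (contractEdge G₁ a b p))
  con-facts = go c₁ (proj₁ h₁)
    where
    go : ∀ {n n₁} {G : TGraph n} {G₁ : TGraph n₁} {ι₁ ι₂} → Connected G₁ → InGxy G₁ → IsXYSum G G₁ G₂ ι₁ ι₂ → ∀ {a b} (p : a ≢ b) (q : ι₁ a ≢ ι₁ b) → b ≢ x G₁ → b ≢ y G₁ →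
      Facts (proj₂ (contractEdge G (ι₁ a) (ι₁ b) q)) (proj₂ (contractEdge G₁ a b p))
    go {zero} {suc _} {ι₁ = ι₁} c h Σ₊ {a} with () ← ι₁ a
    go {suc _} {zero} c h Σ₊ {()}
    go {suc k} {suc k₁} {G} {G₁} {ι₁} c h Σ₊ {a} {b} p q bx by =
      sum-facts (proj₂ (contractEdge G (ι₁ a) (ι₁ b) q)) (proj₂ (contractEdge G₁ a b p)) G₂ contr-In h₂ (contr-conn c) c₂
        (contract-sum Σ₊ (proj₁ h₂) bx by (contraction (ι₁ a) (ι₁ b) q G) (contraction a b p G₁))
      where open Contracted (contraction a b p G₁) h bx by

  -- The formula for sums needs connected summands. A deletion leaves `G₁` connected unless the edge
  -- is a bridge, and then the contraction of that edge settles the matter.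
  del-facts : ∀ {n} {G : TGraph n} {ι₁ ι₂} → IsXYSum G G₁ G₂ ι₁ ι₂ → ∀ {a b} → adj G₁ a b ≡ true →
    Facts (deleteEdge G (ι₁ a) (ι₁ b)) (deleteEdge G₁ a b) ⊎ Stuck G₁
  del-facts {G = G} {ι₁} {ι₂} Σ₊ {a} {b} e with connected? (deleteEdge G₁ a b) (DeleteEdge.del-In G₁ (proj₁ h₁) a b)
  ... | no br = inj₂ (bridge-stuck G₁ h₁ c₁ e br)
  ... | yes c = inj₁ (sum-facts _ _ G₂ (DeleteEdge.del-In G₁ (proj₁ h₁) a b) h₂ c c₂ (delete-sum (proj₁ h₁) (proj₂ h₁) Σ₊ (XYSum.sum-In G G₁ G₂ ι₁ ι₂ (proj₁ h₁) (proj₁ h₂) (proj₂ h₂) c₁ c₂ Σ₊) e))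

module _ {n n₁ n₂ : ℕ} {G : TGraph n} {G₁ : TGraph n₁} {G₂ : TGraph n₂} {ι₁ : Fin n₁ → Fin n} {ι₂ : Fin n₂ → Fin n}
         (h₁ : InGxy° G₁) (h₂ : InGxy° G₂) (c₁ : Connected G₁) (c₂ : Connected G₂) (Σ₊ : IsXYSum G G₁ G₂ ι₁ ι₂) where
  open IsXYSum Σ₊ renaming (inj₁ to ι-inj₁; inj₂ to ι-inj₂)
  private
    F₀ : MinFacts (ĝ G₁) (ĝ⁺ G₁) (ĝ G₂) (ĝ⁺ G₂) (ĝ G)
    F₀ = sum-facts G G₁ G₂ (proj₁ h₁) h₂ c₁ c₂ Σ₊

    ĝ₂≤ĝ₂⁺ : ĝ G₂ ≤ ĝ⁺ G₂
    ĝ₂≤ĝ₂⁺ = subst₂ _≤_ (γ≡ĝ G₂) (γ⁺≡ĝ⁺ G₂) (γ≤γ⁺ G₂ (proj₁ h₂) c₂)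

    ĝ₂⁺≤ĝ₂+2 : ĝ⁺ G₂ ≤ ĝ G₂ + 2
    ĝ₂⁺≤ĝ₂+2 = subst₂ (λ p q → p ≤ q + 2) (γ⁺≡ĝ⁺ G₂) (γ≡ĝ G₂) (γ⁺≤γ+2 G₂ (proj₁ h₂) c₂)

    -- Since ĝ ≤ ĝ⁺ for both summands, the truncated differences in `η` are exact.
    η-sum : ĝ⁺ G₁ + ĝ⁺ G₂ ≡ ĝ G₁ + ĝ G₂ + η G₁ G₂
    η-sum = eq (MinFacts.lo F₀) ĝ₂≤ĝ₂⁺
      where
      eq′ : ∀ a b s t → (a + s) + (b + t) ≡ a + b + (s + t)
      eq′ = solve-∀
      eq : ∀ {a a⁺ b b⁺} → a ≤ a⁺ → b ≤ b⁺ → a⁺ + b⁺ ≡ a + b + ((a⁺ ∸ a) + (b⁺ ∸ b))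
      eq {a} {a⁺} {b} {b⁺} l l' = trans (sym (cong₂ _+_ (m+[n∸m]≡n l) (m+[n∸m]≡n l'))) (eq′ a b (a⁺ ∸ a) (b⁺ ∸ b))

  η≤4 : η G₁ G₂ ≤ 4
  η≤4 = +-mono-≤ (m≤n+o⇒m∸n≤o (ĝ⁺ G₁) (ĝ G₁) (MinFacts.hi F₀)) (m≤n+o⇒m∸n≤o (ĝ⁺ G₂) (ĝ G₂) ĝ₂⁺≤ĝ₂+2)

  Drop : MinorOp G₁ → Set
  Drop μ = Drops (η G₁ G₂) (ĝ G₁) (ĝ⁺ G₁) (ĝ (proj₂ (apply μ))) (ĝ⁺ (proj₂ (apply μ)))

  private
    not-stuck : (∀ {a b} e p q r → Drop (con a b e p q r)) → ¬ Stuck G₁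
    not-stuck d st = drops-≥ (η G₁ G₂) η≤4 stays-ĝ stays-ĝ⁺ (d uv u≢v v≢x v≢y)
      where open Stuck st

    lift-≢ : ∀ {a b} → a ≢ b → ι₁ a ≢ ι₁ b
    lift-≢ p e = p (ι-inj₁ _ _ e)

  tight⇒drop : Tight ĝ G G₁ ι₁ → ∀ μ → Drop μ
  tight⇒drop t = op
    where
    op-con : ∀ {a b} e p q r → Drop (con a b e p q r)
    op-con {a} {b} e p q r = <⇒drops F₀ (con-facts G₁ G₂ h₁ h₂ c₁ c₂ Σ₊ p (lift-≢ p) q r) (η G₁ G₂) η-sum
      (t (con (ι₁ a) (ι₁ b) (edges₁ a b e) (lift-≢ p) (λ k → lift-≢ q (trans k (sym x₁))) (λ k → lift-≢ r (trans k (sym y₁)))) (a , b , refl , refl , e))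
    op : ∀ μ → Drop μ
    op (con a b e p q r) = op-con e p q r
    op (del a b e) = by (del-facts G₁ G₂ h₁ h₂ c₁ c₂ Σ₊ e)
      where
      by : _ → Drop (del a b e)
      by (inj₁ F) = <⇒drops F₀ F (η G₁ G₂) η-sum (t (del (ι₁ a) (ι₁ b) (edges₁ a b e)) (a , b , refl , refl , e))
      -- The deletion of a bridge is out of reach of the sum formula, but the drop already derived
      -- for contractions fails for that of the bridge.
      by (inj₂ st) = ⊥-elim (not-stuck op-con st)

  drop⇒tight : (∀ μ → Drop μ) → Tight ĝ G G₁ ι₁
  drop⇒tight d (con _ _ e p q r) (a , b , refl , refl , e₁) =
    drops⇒< F₀ (con-facts G₁ G₂ h₁ h₂ c₁ c₂ Σ₊ p₁ p q₁ r₁) (η G₁ G₂) η≤4 η-sum (d (con a b e₁ p₁ q₁ r₁))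
    where
    p₁ : a ≢ b
    p₁ k = p (cong ι₁ k)
    q₁ : b ≢ x G₁
    q₁ k = q (trans (cong ι₁ k) x₁)
    r₁ : b ≢ y G₁
    r₁ k = r (trans (cong ι₁ k) y₁)
  drop⇒tight d (del _ _ e) (a , b , refl , refl , e₁) = by (del-facts G₁ G₂ h₁ h₂ c₁ c₂ Σ₊ e₁)
    where
    by : _ → ĝ (deleteEdge G (ι₁ a) (ι₁ b)) < ĝ G
    by (inj₁ F) = drops⇒< F₀ F (η G₁ G₂) η≤4 η-sum (d (del a b e₁))
    by (inj₂ st) = ⊥-elim (not-stuck (λ e p q r → d (con _ _ e p q r)) st)

-- Drops for each value of `η` and the corresponding classes

module _ {n : ℕ} (G : TGraph n) (h : InGxy° G) (cn : Connected G) where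
  private
    Drops-on : ℕ → Set
    Drops-on k = (μ : MinorOp G) → Drops k (ĝ G) (ĝ⁺ G) (ĝ (proj₂ (apply μ))) (ĝ⁺ (proj₂ (apply μ)))

  Class : ℕ → Set
  Class k = (k ≡ 0 → C° ĝ⁺ G)
    × (k ≡ 1 → C° ĝ⁺ G ⊎ Hw-ĝ G)
    × (k ≡ 2 → C° ĝ⁺ G ⊎ C° ĝ G ⊎ Cascade G)
    × (k ≡ 3 → C° ĝ G ⊎ Hw-ĝ⁺ G)
    × (k ≡ 4 → C° ĝ G)

  class⇒drops : ∀ k → k ≤ 4 → Class k → Drops-on k
  class⇒drops 0 _ (c , _) = proj₂ (c refl)
  class⇒drops 1 _ (_ , c , _) = by (c refl)
    where
    by : C° ĝ⁺ G ⊎ Hw-ĝ G → Drops-on 1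
    by (inj₁ (_ , d)) μ = inj₁ (d μ)
    by (inj₂ (_ , _ , d)) = d
  class⇒drops 2 _ (_ , _ , c , _) = by (c refl)
    where
    by : C° ĝ⁺ G ⊎ C° ĝ G ⊎ Cascade G → Drops-on 2
    by (inj₁ (_ , d)) μ = inj₂ (d μ)
    by (inj₂ (inj₁ (_ , d))) μ = inj₁ (d μ)
    by (inj₂ (inj₂ (_ , d , _))) = d
  class⇒drops 3 _ (_ , _ , _ , c , _) = by (c refl)
    where
    by : C° ĝ G ⊎ Hw-ĝ⁺ G → Drops-on 3
    by (inj₁ (_ , d)) μ = inj₁ (d μ)
    by (inj₂ (_ , _ , d)) = d
  class⇒drops 4 _ (_ , _ , _ , _ , c) = proj₂ (c refl)
  class⇒drops (suc (suc (suc (suc (suc _))))) (s≤s (s≤s (s≤s (s≤s ()))))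

  drops⇒class : ∀ k → Drops-on k → Class k
  drops⇒class k d = (λ { refl → h , d })
    , (λ { refl → one (critical-ĝ⁺? G (proj₁ h) cn) d })
    , (λ { refl → two (critical-ĝ⁺? G (proj₁ h) cn) (critical-ĝ? G (proj₁ h) cn) d })
    , (λ { refl → three (critical-ĝ? G (proj₁ h) cn) d })
    , (λ { refl → h , d })
    where
    one : Dec (Critical ĝ⁺ G) → Drops-on 1 → C° ĝ⁺ G ⊎ Hw-ĝ G
    one (yes c) d = inj₁ (h , c)
    one (no ¬c) d = inj₂ (h , (λ (_ , c) → ¬c c) , d)
    two : Dec (Critical ĝ⁺ G) → Dec (Critical ĝ G) → Drops-on 2 → C° ĝ⁺ G ⊎ C° ĝ G ⊎ Cascade G
    two (yes c) _ d = inj₁ (h , c)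
    two (no _) (yes c) d = inj₂ (inj₁ (h , c))
    two (no ¬c) (no ¬c′) d = inj₂ (inj₂ (h , d , (λ (_ , c) → ¬c′ c) , (λ (_ , c) → ¬c c)))
    three : Dec (Critical ĝ G) → Drops-on 3 → C° ĝ G ⊎ Hw-ĝ⁺ G
    three (yes c) d = inj₁ (h , c)
    three (no ¬c) d = inj₂ (h , (λ (_ , c) → ¬c c) , d)

theorem4p8 : ∀ {n n₁ n₂} (G : TGraph n) (G₁ : TGraph n₁) (G₂ : TGraph n₂)
    (ι₁ : Fin n₁ → Fin n) (ι₂ : Fin n₂ → Fin n) →
    InGxy° G₁ → InGxy° G₂ → Connected G₁ → Connected G₂ →
    IsXYSum G G₁ G₂ ι₁ ι₂ →
    Tight ĝ G G₁ ι₁ ⇔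
    ((η G₁ G₂ ≡ 0 → C° ĝ⁺ G₁)
    × (η G₁ G₂ ≡ 1 → C° ĝ⁺ G₁ ⊎ Hw-ĝ G₁)
    × (η G₁ G₂ ≡ 2 → C° ĝ⁺ G₁ ⊎ C° ĝ G₁ ⊎ Cascade G₁)
    × (η G₁ G₂ ≡ 3 → C° ĝ G₁ ⊎ Hw-ĝ⁺ G₁)
    × (η G₁ G₂ ≡ 4 → C° ĝ G₁))
theorem4p8 G G₁ G₂ ι₁ ι₂ h₁ h₂ c₁ c₂ Σ₊ = mk⇔
  (λ t → drops⇒class G₁ h₁ c₁ (η G₁ G₂) (tight⇒drop h₁ h₂ c₁ c₂ Σ₊ t))
  (λ c → drop⇒tight h₁ h₂ c₁ c₂ Σ₊ (class⇒drops G₁ h₁ c₁ (η G₁ G₂) (η≤4 h₁ h₂ c₁ c₂ Σ₊) c))
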